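{- Let $p<q<r$ be primes. Let $\alpha=\min\{q_p^*,\,p-q_p^*,\,r_p^*,\,p-r_p^*\}$ and let $\beta$ be the unique integer with $0<\beta\le p-1$ and $\alpha\beta qr\equiv1\pmod p$. Then for every integer $i$, $a_{pqr}(i)\le\min\{2\alpha+\beta,\ p-\beta,\ 2p/3\}$ and $-a_{pqr}(i)\le\min\{p+2\alpha-\beta,\ \beta,\ 2p/3\}$.
   Context: For a positive integer $n$, the $n$-th cyclotomic polynomial is written $\Phi_n(x)=\sum_{k=0}^{\varphi(n)}a_n(k)x^k$, and $a_n(k)=0$ for $k<0$ or $k>\varphi(n)$. For a prime $p$ and a prime $s\ne p$, $s_p^*$ denotes the unique integer in $[1,p-1]$ with $s\,s_p^*\equiv1\pmod p$. -}

module Defs where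

open import Data.Nat as ℕ using (ℕ; zero; suc; _∸_)
open import Data.Nat.Divisibility using (_∣?_)
open import Data.Integer as ℤ using (ℤ; +_; -[1+_]; 0ℤ; 1ℤ; -1ℤ; _+_; _-_; _*_)
open import Data.List using (List; []; _∷_; _++_; reverse; length; replicate)
open import Data.Bool using (if_then_else_)
open import Relation.Nullary.Decidable using (⌊_⌋)

-- Integer polynomials as coefficient lists, lowest degree first.
Poly : Set
Poly = List ℤ

addP : Poly → Poly → Poly
addP [] q = q
addP (a ∷ p) [] = a ∷ p
addP (a ∷ p) (b ∷ q) = (a + b) ∷ addP p q

scaleP : ℤ → Poly → Poly
scaleP c [] = []
scaleP c (a ∷ p) = (c * a) ∷ scaleP c p

mulP : Poly → Poly → Poly
mulP [] q = []
mulP (a ∷ p) q = addP (scaleP a q) (0ℤ ∷ mulP p q)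

dot : List ℤ → List ℤ → ℤ
dot (a ∷ as) (b ∷ bs) = a * b + dot as bs
dot _ _ = 0ℤ

-- Long division of A by a monic polynomial D (exact in our use).
-- Works on reversed lists (highest degree first); dt = the non-leading
-- coefficients of D, highest first.  Quotient coefficients are produced
-- from the top down and accumulated, so the result is lowest-degree first.
private
  divGo : List ℤ → ℕ → List ℤ → List ℤ → List ℤ
  divGo dt zero a qs = qs
  divGo dt (suc m) [] qs = divGo dt m [] ((0ℤ - dot dt qs) ∷ qs)
  divGo dt (suc m) (ak ∷ a) qs = divGo dt m a ((ak - dot dt qs) ∷ qs)

  tailL : List ℤ → List ℤ
  tailL [] = []
  tailL (_ ∷ xs) = xs

divMonic : Poly → Poly → Poly
divMonic A D = divGo (tailL (reverse D)) (suc (length A ∸ length D)) (reverse A) []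

-- x^n - 1 for n ≥ 1
xn-1 : ℕ → Poly
xn-1 n = -1ℤ ∷ (replicate (n ∸ 1) 0ℤ ++ (1ℤ ∷ []))

private
  prodDiv : ℕ → ℕ → List Poly → Poly
  prodDiv m d [] = 1ℤ ∷ []
  prodDiv m d (φ ∷ ps) =
    if ⌊ d ∣? m ⌋ then mulP φ (prodDiv m (suc d) ps) else prodDiv m (suc d) ps

-- phis n = [Φ_1, …, Φ_n], via  x^n - 1 = ∏_{d ∣ n} Φ_d(x)
phis : ℕ → List Poly
phis zero = []
phis (suc n) = phis n ++ (divMonic (xn-1 (suc n)) (prodDiv (suc n) 1 (phis n)) ∷ [])

private
  lastOr : Poly → List Poly → Poly
  lastOr d [] = d
  lastOr d (x ∷ xs) = lastOr x xs

-- The n-th cyclotomic polynomial (n ≥ 1; Φ 0 is a dummy value).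
Φ : ℕ → Poly
Φ n = lastOr (1ℤ ∷ []) (phis n)

coeffList : Poly → ℕ → ℤ
coeffList [] k = 0ℤ
coeffList (c ∷ cs) zero = c
coeffList (c ∷ cs) (suc k) = coeffList cs k

a : ℕ → ℤ → ℤ
a n (+ k) = coeffList (Φ n) k
a n -[1+ k ] = 0ℤ

{-# OPTIONS --safe #-}
module Submission where

-- Write k = a qr + b pr + c pq - F pqr with digits a < p, b < q, c < r, and let χ k = [F = 0].  Below degree pqr the
-- coefficient of Φ_pqr is the sum over p consecutive k of χ k - χ (k - q) - χ (k - r) + χ (k - q - r), because
-- (1 - x^{qr}) (1 - x^{pr}) (1 - x^{pq}) ∑ χ k x^k = 1 there.  Each summand depends only on F and on the comparisons of a
-- with r⁻¹, q⁻¹ and r⁻¹ + q⁻¹ modulo p, of b with p⁻¹ modulo q and of c with p⁻¹ modulo r; shifting the base point by q or r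
-- replaces r⁻¹ by p - r⁻¹ or q⁻¹ by p - q⁻¹ at the cost of a sign.  So one may assume u = min, v = max and u + v ≤ p for the
-- two inverses u, v, where v = β for upper and v = p - β for lower bounds, and an upper bound for the sum is wanted.
-- The p points have distinct a, called columns; the columns fall into [0, u), [u, v), [v, u + v), [u + v, p), and the sum is
-- at most τ + g₁ + t₁ + g₃ + h₃ - u for counts of points of five kinds.  The trivial bounds on these counts give p - v; the
-- points of the kind τ lie in a window of u + v columns, which gives 2u + v.
-- For 2p/3, suppose 3 A > 2p.  Then 3v < p, and points of the kind τ are so frequent that two of them are at distance 1 or 2.
-- Hence consecutive points differ by a small step (d, θ, η) with d M + θ + η = ±1: distance 1 gives it at once, and at
-- distance 2 a parity argument shows that the difference can be halved.  Reversing the order makes d positive.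
-- If θ, η ≤ 0, then F cannot fall or rise as the counts require.  If θ > 0, the number J of steps that fit into the range of
-- the third coordinate bounds how many points of the kinds τ, t₁, h₃ occur on one turn of the columns, and excludes
-- transitions from g₁ to g₃; counting turns contradicts 3 A > 2p.  The case η > 0 is symmetric.

open import Defs
open import Data.Nat as ℕ using (ℕ; _⊓_; _∸_)
open import Data.Nat.Primality using (Prime)
open import Data.Integer as ℤ using (ℤ; +_; 1ℤ; -_; _-_)
open import Data.Integer.Divisibility using (_∣_)
open import Data.Product using (_×_)
open import Data.Nat as ℕ using (zero; suc; s≤s; z≤n)
import Data.Nat.Properties as ℕ
open import Data.Integer as ℤ using (-[1+_]; 0ℤ; -1ℤ; _+_; _*_; _≤_; _<_; +≤+; +<+)
open import Data.Integer.Properties as ℤ using (≤-antisym; ≤-trans; ≤-refl; ≤-reflexive)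
open import Data.Bool using (Bool; true; false; _∧_; if_then_else_)
open import Data.List using (List; []; _∷_)
open import Data.Product using (_,_; proj₁; proj₂; ∃)
open import Data.Sum using (_⊎_; inj₁; inj₂; [_,_]′)
open import Data.Unit using (⊤; tt)
open import Data.Empty using (⊥; ⊥-elim)
open import Function using (_∘_; case_of_)
open import Relation.Nullary using (¬_; Dec; yes; no)
open import Relation.Nullary.Decidable using (_×-dec_; _⊎-dec_; ⌊_⌋)
open import Relation.Binary.PropositionalEquality using (_≡_; _≢_; refl; sym; trans; cong; cong₂; subst; subst₂; module ≡-Reasoning)

-- The constant 2/3 comes from balancing three facts: τ is at least A - u, all points of the kinds
-- τ, t₁ and h₃ fit into one window of u + v columns, and g₁ and g₃ are at most u each. Against 3 A
-- > 2p the resulting inequalities have almost no slack, so the counting stops just short of a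
-- contradiction in a few extremal cases: u = v with p = 3u + 1, and p = 6D + 4 for a steep step,
-- where D is the number of columns passed in J steps. These are excluded by arithmetic: p is odd,
-- and the column step is ± uv, so that nine times it is ± 1 modulo p when 3u = 3v = p - 1. This is
-- why a chain records the parity of p and the class of its column step. The coefficient formula
-- rests on the direction of long division: it runs from the top, so its output is determined by any
-- sequence that satisfies the recursion of the divisor, and polynomials become commuting operators
-- on sequences that can be regrouped at will.

-- Integer arithmetic by normal forms and certificates.

module Lin where
  open import Data.Bool.Properties using (T-≡)
  open import Function.Bundles using (Equivalence)

  ≰⇒1+≤ : ∀ {x y} → ¬ (x ≤ y) → 1ℤ + y ≤ x
  ≰⇒1+≤ h = ℤ.i<j⇒suc[i]≤j (ℤ.≰⇒> h)

  module Identities where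
    open import Data.Integer.Solver using (module +-*-Solver)
    open +-*-Solver using (solve; con; _:+_; _:*_; :-_; _:-_; _:=_)
    l1 : ∀ i j m → i * (j * m) ≡ j * (i * m)
    l1 = solve 3 (λ i j m → i :* (j :* m) := j :* (i :* m)) refl
    l2 : ∀ c d k P → (c + d) * k + P ≡ c * k + (d * k + P)
    l2 = solve 4 (λ c d k P → (c :+ d) :* k :+ P := c :* k :+ (d :* k :+ P)) refl
    l3 : ∀ d k c P → d * k + (c + P) ≡ c + (d * k + P)
    l3 = solve 4 (λ d k c P → d :* k :+ (c :+ P) := c :+ (d :* k :+ P)) refl
    l4 : ∀ c m P Q → c * m + (P + Q) ≡ (c * m + P) + Q
    l4 = solve 4 (λ c m P Q → c :* m :+ (P :+ Q) := (c :* m :+ P) :+ Q) refl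
    l5 : ∀ c d m k P → (c * d) * (m * k) + (c * m) * P ≡ (c * m) * (d * k + P)
    l5 = solve 5 (λ c d m k P → (c :* d) :* (m :* k) :+ (c :* m) :* P := (c :* m) :* (d :* k :+ P)) refl
    l6 : ∀ c m Q P → (c * m) * Q + P * Q ≡ (c * m + P) * Q
    l6 = solve 4 (λ c m Q P → (c :* m) :* Q :+ P :* Q := (c :* m :+ P) :* Q) refl
    l7 : ∀ x → x * 1ℤ ≡ x
    l7 = solve 1 (λ x → x :* con (1ℤ) := x) refl
    l8 : ∀ x → 1ℤ * (x * 1ℤ) + 0ℤ ≡ x
    l8 = solve 1 (λ x → con (1ℤ) :* (x :* con (1ℤ)) :+ con (0ℤ) := x) refl
    l9 : ∀ x → x * 1ℤ + 0ℤ ≡ x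
    l9 = solve 1 (λ x → x :* con (1ℤ) :+ con (0ℤ) := x) refl
    l10 : ∀ x → (- 1ℤ * 1ℤ) * x ≡ - x
    l10 = solve 1 (λ x → (con (- 1ℤ) :* con (1ℤ)) :* x := :- x) refl
    l11 : ∀ c a P → c + a + P ≡ a + (c * 1ℤ + P)
    l11 = solve 3 (λ c a P → c :+ a :+ P := a :+ (c :* con (1ℤ) :+ P)) refl
    l12 : ∀ a m P → a + P ≡ a + (0ℤ * m + P)
    l12 = solve 3 (λ a m P → a :+ P := a :+ (con (0ℤ) :* m :+ P)) refl

  open Identities

  infix 9 #_
  infixl 6 _:+_ _:-_
  infixl 7 _:*_
  infix 8 :-_
  infix 5.5 _<=_by_ _==_by_ _=~_by_

  data Ex : Set where
    #_ num : ℕ → Ex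
    :-_ : Ex → Ex
    _:+_ _:-_ _:*_ : Ex → Ex → Ex

  #0 = # 0
  #1 = # 1
  #2 = # 2
  #3 = # 3
  #4 = # 4
  #5 = # 5
  #6 = # 6
  #7 = # 7
  #8 = # 8
  #9 = # 9
  #10 = # 10
  #11 = # 11
  #12 = # 12
  #13 = # 13
  #14 = # 14
  #15 = # 15
  #16 = # 16
  #17 = # 17
  #18 = # 18
  #19 = # 19
  #20 = # 20
  $0 = num 0
  $1 = num 1
  $2 = num 2
  $3 = num 3
  $4 = num 4
  $7 = num 7
  $9 = num 9

  private
    variable ρ : List ℤ

  look : List ℤ → ℕ → ℤ
  look [] _ = 0ℤ
  look (x ∷ _) zero = x
  look (_ ∷ xs) (suc i) = look xs i

  ⟦_⟧ : Ex → List ℤ → ℤ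
  ⟦ # i ⟧ ρ = look ρ i
  ⟦ num n ⟧ ρ = + n
  ⟦ :- x ⟧ ρ = - ⟦ x ⟧ ρ
  ⟦ x :+ y ⟧ ρ = ⟦ x ⟧ ρ + ⟦ y ⟧ ρ
  ⟦ x :- y ⟧ ρ = ⟦ x ⟧ ρ - ⟦ y ⟧ ρ
  ⟦ x :* y ⟧ ρ = ⟦ x ⟧ ρ * ⟦ y ⟧ ρ

  -- A polynomial is a list of (coefficient , monomial), a monomial a sorted list of variables.
  Mono NF : Set
  Mono = List ℕ
  NF = List (ℤ × Mono)

  ⟦_⟧ᵐ : Mono → List ℤ → ℤ
  ⟦ [] ⟧ᵐ ρ = 1ℤ
  ⟦ i ∷ m ⟧ᵐ ρ = look ρ i * ⟦ m ⟧ᵐ ρ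

  ⟦_⟧ⁿ : NF → List ℤ → ℤ
  ⟦ [] ⟧ⁿ ρ = 0ℤ
  ⟦ (c , m) ∷ P ⟧ⁿ ρ = c * ⟦ m ⟧ᵐ ρ + ⟦ P ⟧ⁿ ρ

  insert : ℕ → Mono → Mono
  insert i [] = i ∷ []
  insert i (j ∷ m) with i ℕ.≤ᵇ j
  ... | true = i ∷ j ∷ m
  ... | false = j ∷ insert i m

  mulᵐ : Mono → Mono → Mono
  mulᵐ [] m = m
  mulᵐ (i ∷ k) m = insert i (mulᵐ k m)

  sameᵐ : (m k : Mono) → Bool
  sameᵐ [] [] = true
  sameᵐ (i ∷ m) (j ∷ k) = (i ℕ.≡ᵇ j) ∧ sameᵐ m k
  sameᵐ _ _ = false

  -- A monomial that cancels stays in the list with coefficient 0, which is why `negative` and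
  -- `isZero` skip zero coefficients.
  add₁ : ℤ → Mono → NF → NF
  add₁ c m [] = (c , m) ∷ []
  add₁ c m ((d , k) ∷ P) with sameᵐ m k
  ... | true = (c + d , k) ∷ P
  ... | false = (d , k) ∷ add₁ c m P

  addⁿ : NF → NF → NF
  addⁿ [] Q = Q
  addⁿ ((c , m) ∷ P) Q = add₁ c m (addⁿ P Q)

  mul₁ : ℤ → Mono → NF → NF
  mul₁ c m [] = []
  mul₁ c m ((d , k) ∷ P) = add₁ (c * d) (mulᵐ m k) (mul₁ c m P)

  mulⁿ : NF → NF → NF
  mulⁿ [] Q = []
  mulⁿ ((c , m) ∷ P) Q = addⁿ (mul₁ c m Q) (mulⁿ P Q)

  nf : Ex → NF
  nf (# i) = (1ℤ , i ∷ []) ∷ []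
  nf (num n) = (+ n , []) ∷ []
  nf (:- x) = mul₁ (- 1ℤ) [] (nf x)
  nf (x :+ y) = addⁿ (nf x) (nf y)
  nf (x :- y) = addⁿ (nf x) (mul₁ (- 1ℤ) [] (nf y))
  nf (x :* y) = mulⁿ (nf x) (nf y)

  -- The accumulator collects the constant terms. A surviving nonconstant monomial makes the test
  -- fail, so success means that the polynomial is a negative constant.
  negative : ℤ → NF → Bool
  negative -[1+ _ ] [] = true
  negative (+ _) [] = false
  negative acc ((c , []) ∷ P) = negative (c + acc) P
  negative acc ((+ 0 , _ ∷ _) ∷ P) = negative acc P
  negative acc ((_ , _ ∷ _) ∷ P) = false

  scaled : List Ex → List ℕ → NF
  scaled [] _ = []
  scaled (x ∷ es) [] = addⁿ (nf x) (scaled es [])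
  scaled (x ∷ es) (c ∷ cs) = addⁿ (mul₁ (+ c) [] (nf x)) (scaled es cs)

  nth : List Ex → ℕ → Ex
  nth [] _ = num 0
  nth (x ∷ _) zero = x
  nth (_ ∷ es) (suc i) = nth es i

  products : List Ex → List (ℕ × ℕ) → NF
  products es [] = []
  products es ((i , j) ∷ ps) = addⁿ (mulⁿ (nf (nth es i)) (nf (nth es j))) (products es ps)

  -- A certificate: the expressions es with coefficients cs (1 where the list has ended), plus products of pairs of them.
  certificate : List Ex → List ℕ → List (ℕ × ℕ) → NF
  certificate es cs ps = addⁿ (scaled es cs) (products es ps)

  isZero : NF → Bool
  isZero [] = true
  isZero ((+ 0 , _) ∷ P) = isZero P
  isZero (_ ∷ P) = false

  -- Certificates have natural coefficients, so an equation needs a direction: `==` contributes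
  -- `y - x`, and `=~` contributes `x - y`.
  data Fact (ρ : List ℤ) : Set where
    _<=_by_ : ∀ x y → ⟦ x ⟧ ρ ≤ ⟦ y ⟧ ρ → Fact ρ
    _==_by_ _=~_by_ : ∀ x y → ⟦ x ⟧ ρ ≡ ⟦ y ⟧ ρ → Fact ρ

  data Equation (ρ : List ℤ) : Set where
    _==_by_ _=~_by_ : ∀ x y → ⟦ x ⟧ ρ ≡ ⟦ y ⟧ ρ → Equation ρ

  exprs : List (Fact ρ) → List Ex
  exprs [] = []
  exprs ((x <= y by _) ∷ fs) = (y :- x) ∷ exprs fs
  exprs ((x == y by _) ∷ fs) = (y :- x) ∷ exprs fs
  exprs ((x =~ y by _) ∷ fs) = (x :- y) ∷ exprs fs

  sides : List (Equation ρ) → List Ex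
  sides [] = []
  sides ((x == y by _) ∷ fs) = (y :- x) ∷ sides fs
  sides ((x =~ y by _) ∷ fs) = (x :- y) ∷ sides fs

  insert-sound : ∀ i m → ⟦ insert i m ⟧ᵐ ρ ≡ look ρ i * ⟦ m ⟧ᵐ ρ
  insert-sound i [] = refl
  insert-sound {ρ} i (j ∷ m) with i ℕ.≤ᵇ j
  ... | true = refl
  ... | false = trans (cong (look ρ j *_) (insert-sound i m)) (l1 (look ρ j) (look ρ i) (⟦ m ⟧ᵐ ρ))

  mulᵐ-sound : ∀ k m → ⟦ mulᵐ k m ⟧ᵐ ρ ≡ ⟦ k ⟧ᵐ ρ * ⟦ m ⟧ᵐ ρ
  mulᵐ-sound [] m = sym (ℤ.*-identityˡ _)
  mulᵐ-sound {ρ} (i ∷ k) m = trans (insert-sound i (mulᵐ k m))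
    (trans (cong (look ρ i *_) (mulᵐ-sound k m)) (sym (ℤ.*-assoc (look ρ i) _ _)))

  sameᵐ-sound : ∀ m k → sameᵐ m k ≡ true → m ≡ k
  sameᵐ-sound [] [] _ = refl
  sameᵐ-sound (i ∷ m) (j ∷ k) e with i ℕ.≡ᵇ j in eq
  ... | true = cong₂ _∷_ (ℕ.≡ᵇ⇒≡ i j (Equivalence.from T-≡ eq)) (sameᵐ-sound m k e)

  add₁-sound : ∀ c m P → ⟦ add₁ c m P ⟧ⁿ ρ ≡ c * ⟦ m ⟧ᵐ ρ + ⟦ P ⟧ⁿ ρ
  add₁-sound c m [] = refl
  add₁-sound {ρ} c m ((d , k) ∷ P) with sameᵐ m k in eq
  ... | true rewrite sameᵐ-sound m k eq = l2 c d (⟦ k ⟧ᵐ ρ) (⟦ P ⟧ⁿ ρ)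
  ... | false = trans (cong (λ z → d * ⟦ k ⟧ᵐ ρ + z) (add₁-sound c m P)) (l3 d (⟦ k ⟧ᵐ ρ) (c * ⟦ m ⟧ᵐ ρ) (⟦ P ⟧ⁿ ρ))

  addⁿ-sound : ∀ P Q → ⟦ addⁿ P Q ⟧ⁿ ρ ≡ ⟦ P ⟧ⁿ ρ + ⟦ Q ⟧ⁿ ρ
  addⁿ-sound [] Q = sym (ℤ.+-identityˡ _)
  addⁿ-sound {ρ} ((c , m) ∷ P) Q = trans (add₁-sound c m (addⁿ P Q))
    (trans (cong (λ z → c * ⟦ m ⟧ᵐ ρ + z) (addⁿ-sound P Q)) (l4 c (⟦ m ⟧ᵐ ρ) _ _))

  mul₁-sound : ∀ c m P → ⟦ mul₁ c m P ⟧ⁿ ρ ≡ (c * ⟦ m ⟧ᵐ ρ) * ⟦ P ⟧ⁿ ρ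
  mul₁-sound {ρ} c m [] = sym (ℤ.*-zeroʳ (c * ⟦ m ⟧ᵐ ρ))
  mul₁-sound {ρ} c m ((d , k) ∷ P) = trans (add₁-sound (c * d) (mulᵐ m k) (mul₁ c m P))
    (trans (cong₂ _+_ (cong (λ z → c * d * z) (mulᵐ-sound m k)) (mul₁-sound c m P)) (l5 c d (⟦ m ⟧ᵐ ρ) (⟦ k ⟧ᵐ ρ) _))

  mulⁿ-sound : ∀ P Q → ⟦ mulⁿ P Q ⟧ⁿ ρ ≡ ⟦ P ⟧ⁿ ρ * ⟦ Q ⟧ⁿ ρ
  mulⁿ-sound {ρ} [] Q = sym (ℤ.*-zeroˡ (⟦ Q ⟧ⁿ ρ))
  mulⁿ-sound {ρ} ((c , m) ∷ P) Q = trans (addⁿ-sound (mul₁ c m Q) (mulⁿ P Q))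
    (trans (cong₂ _+_ (mul₁-sound c m Q) (mulⁿ-sound P Q)) (l6 c (⟦ m ⟧ᵐ ρ) _ _))

  nf-neg : ∀ P → ⟦ mul₁ (- 1ℤ) [] P ⟧ⁿ ρ ≡ - ⟦ P ⟧ⁿ ρ
  nf-neg {ρ} P = trans (mul₁-sound (- 1ℤ) [] P) (l10 (⟦ P ⟧ⁿ ρ))

  nf-sound : ∀ x → ⟦ nf x ⟧ⁿ ρ ≡ ⟦ x ⟧ ρ
  nf-sound {ρ} (# i) = l8 (look ρ i)
  nf-sound (num n) = l9 (+ n)
  nf-sound (:- x) = trans (nf-neg (nf x)) (cong -_ (nf-sound x))
  nf-sound (x :+ y) = trans (addⁿ-sound (nf x) (nf y)) (cong₂ _+_ (nf-sound x) (nf-sound y))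
  nf-sound (x :- y) = trans (addⁿ-sound (nf x) _) (cong₂ _+_ (nf-sound x) (trans (nf-neg (nf y)) (cong -_ (nf-sound y))))
  nf-sound (x :* y) = trans (mulⁿ-sound (nf x) (nf y)) (cong₂ _*_ (nf-sound x) (nf-sound y))

  negative-sound : ∀ acc P → negative acc P ≡ true → acc + ⟦ P ⟧ⁿ ρ < 0ℤ
  negative-sound {ρ} -[1+ n ] [] e = ℤ.-<+
  negative-sound {ρ} acc ((c , []) ∷ P) e =
    subst (_< 0ℤ) (l11 c acc (⟦ P ⟧ⁿ ρ)) (negative-sound {ρ} (c + acc) P (lem acc e))
    where lem : ∀ acc → negative acc ((c , []) ∷ P) ≡ true → negative (c + acc) P ≡ true
          lem (+ _) e = e
          lem -[1+ _ ] e = e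
  negative-sound {ρ} (+ n) ((+ 0 , i ∷ m) ∷ P) e = subst (_< 0ℤ) (l12 (+ n) (look ρ i * ⟦ m ⟧ᵐ ρ) (⟦ P ⟧ⁿ ρ)) (negative-sound {ρ} (+ n) P e)
  negative-sound {ρ} -[1+ n ] ((+ 0 , i ∷ m) ∷ P) e = subst (_< 0ℤ) (l12 -[1+ n ] (look ρ i * ⟦ m ⟧ᵐ ρ) (⟦ P ⟧ⁿ ρ)) (negative-sound {ρ} -[1+ n ] P e)
  negative-sound (+ n) ((ℤ.+[1+ _ ] , i ∷ m) ∷ P) ()
  negative-sound (+ n) ((-[1+ _ ] , i ∷ m) ∷ P) ()
  negative-sound -[1+ n ] ((ℤ.+[1+ _ ] , i ∷ m) ∷ P) ()
  negative-sound -[1+ n ] ((-[1+ _ ] , i ∷ m) ∷ P) ()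

  *-nonneg : ∀ {x y} → 0ℤ ≤ x → 0ℤ ≤ y → 0ℤ ≤ x * y
  *-nonneg {+ m} {+ n} _ _ = subst (0ℤ ≤_) (ℤ.pos-* m n) (+≤+ ℕ.z≤n)

  Nonneg Zero : List ℤ → List Ex → Set
  Nonneg ρ [] = ⊤
  Nonneg ρ (x ∷ es) = 0ℤ ≤ ⟦ x ⟧ ρ × Nonneg ρ es
  Zero ρ [] = ⊤
  Zero ρ (x ∷ es) = ⟦ x ⟧ ρ ≡ 0ℤ × Zero ρ es

  exprs-nonneg : (fs : List (Fact ρ)) → Nonneg ρ (exprs fs)
  exprs-nonneg [] = tt
  exprs-nonneg ((x <= y by h) ∷ fs) = ℤ.i≤j⇒0≤j-i h , exprs-nonneg fs
  exprs-nonneg ((x == y by h) ∷ fs) = ℤ.i≤j⇒0≤j-i (≤-reflexive h) , exprs-nonneg fs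
  exprs-nonneg ((x =~ y by h) ∷ fs) = ℤ.i≤j⇒0≤j-i (≤-reflexive (sym h)) , exprs-nonneg fs

  sides-zero : (fs : List (Equation ρ)) → Zero ρ (sides fs)
  sides-zero [] = tt
  sides-zero ((x == y by h) ∷ fs) = ℤ.i≡j⇒i-j≡0 (sym h) , sides-zero fs
  sides-zero ((x =~ y by h) ∷ fs) = ℤ.i≡j⇒i-j≡0 h , sides-zero fs

  scale-sound : ∀ c x → ⟦ mul₁ c [] (nf x) ⟧ⁿ ρ ≡ c * ⟦ x ⟧ ρ
  scale-sound {ρ} c x = trans (mul₁-sound c [] (nf x)) (cong₂ _*_ (l7 c) (nf-sound x))

  add-nonneg : ∀ P Q → 0ℤ ≤ ⟦ P ⟧ⁿ ρ → 0ℤ ≤ ⟦ Q ⟧ⁿ ρ → 0ℤ ≤ ⟦ addⁿ P Q ⟧ⁿ ρ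
  add-nonneg P Q h k = subst (0ℤ ≤_) (sym (addⁿ-sound P Q)) (ℤ.+-mono-≤ h k)

  scaled-nonneg : ∀ es cs → Nonneg ρ es → 0ℤ ≤ ⟦ scaled es cs ⟧ⁿ ρ
  scaled-nonneg [] _ _ = ≤-refl
  scaled-nonneg (x ∷ es) [] (h , H) = add-nonneg (nf x) _ (subst (0ℤ ≤_) (sym (nf-sound x)) h) (scaled-nonneg es [] H)
  scaled-nonneg (x ∷ es) (c ∷ cs) (h , H) = add-nonneg (mul₁ (+ c) [] (nf x)) _ (subst (0ℤ ≤_) (sym (scale-sound (+ c) x)) (*-nonneg {+ c} (+≤+ ℕ.z≤n) h)) (scaled-nonneg es cs H)

  nth-nonneg : ∀ es i → Nonneg ρ es → 0ℤ ≤ ⟦ nth es i ⟧ ρ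
  nth-nonneg [] _ _ = ≤-refl
  nth-nonneg (x ∷ _) zero (h , _) = h
  nth-nonneg (_ ∷ es) (suc i) (_ , H) = nth-nonneg es i H

  products-nonneg : ∀ es ps → Nonneg ρ es → 0ℤ ≤ ⟦ products es ps ⟧ⁿ ρ
  products-nonneg es [] H = ≤-refl
  products-nonneg es ((i , j) ∷ ps) H = add-nonneg (mulⁿ (nf (nth es i)) (nf (nth es j))) _
    (subst (0ℤ ≤_) (sym (trans (mulⁿ-sound (nf (nth es i)) (nf (nth es j))) (cong₂ _*_ (nf-sound (nth es i)) (nf-sound (nth es j)))))
      (*-nonneg (nth-nonneg es i H) (nth-nonneg es j H)))
    (products-nonneg es ps H)

  scaled-zero : ∀ es cs → Zero ρ es → ⟦ scaled es cs ⟧ⁿ ρ ≡ 0ℤ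
  scaled-zero [] _ _ = refl
  scaled-zero (x ∷ es) [] (h , H) = trans (addⁿ-sound (nf x) _) (cong₂ _+_ (trans (nf-sound x) h) (scaled-zero es [] H))
  scaled-zero (x ∷ es) (c ∷ cs) (h , H) = trans (addⁿ-sound (mul₁ (+ c) [] (nf x)) _)
    (cong₂ _+_ (trans (scale-sound (+ c) x) (trans (cong (+ c *_) h) (ℤ.*-zeroʳ (+ c)))) (scaled-zero es cs H))

  isZero-sound : ∀ P → isZero P ≡ true → ⟦ P ⟧ⁿ ρ ≡ 0ℤ
  isZero-sound [] _ = refl
  isZero-sound {ρ} ((+ 0 , m) ∷ P) e = trans (cong₂ _+_ (ℤ.*-zeroˡ (⟦ m ⟧ᵐ ρ)) (isZero-sound P e)) refl

  refute : ∀ es cs ps → negative 0ℤ (certificate es cs ps) ≡ true → Nonneg ρ es → ⊥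
  refute {ρ} es cs ps e H = ℤ.<⇒≱ (negative-sound {ρ} 0ℤ (certificate es cs ps) e)
    (subst (0ℤ ≤_) (sym (ℤ.+-identityˡ _)) (add-nonneg (scaled es cs) _ (scaled-nonneg es cs H) (products-nonneg es ps H)))

  -- Abstract, because with-abstraction would otherwise normalise the proofs.
  abstract
    lin⊥ : ∀ ρ (fs : List (Fact ρ)) cs ps → negative 0ℤ (certificate (exprs fs) cs ps) ≡ true → ⊥
    lin⊥ ρ fs cs ps e = refute (exprs fs) cs ps e (exprs-nonneg fs)

    -- Over the integers the negated goal is `r + 1 ≤ l`. It becomes the expression with index 0, so
    -- the coefficients and product indices of the facts start one place later than in `lin⊥`.
    lin≤ : ∀ ρ l r (fs : List (Fact ρ)) cs ps → negative 0ℤ (certificate ((l :- (r :+ num 1)) ∷ exprs fs) cs ps) ≡ true → ⟦ l ⟧ ρ ≤ ⟦ r ⟧ ρ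
    lin≤ ρ l r fs cs ps e with ⟦ l ⟧ ρ ℤ.≤? ⟦ r ⟧ ρ
    ... | yes h = h
    ... | no h = ⊥-elim (refute ((l :- (r :+ num 1)) ∷ exprs fs) cs ps e
      (ℤ.i≤j⇒0≤j-i (subst (_≤ ⟦ l ⟧ ρ) (ℤ.+-comm 1ℤ (⟦ r ⟧ ρ)) (≰⇒1+≤ h)) , exprs-nonneg fs))

    lin≡ : ∀ ρ l r (fs : List (Equation ρ)) cs → isZero (addⁿ (nf (l :- r)) (scaled (sides fs) cs)) ≡ true → ⟦ l ⟧ ρ ≡ ⟦ r ⟧ ρ
    lin≡ ρ l r fs cs e = ℤ.i-j≡0⇒i≡j _ _ (trans (sym (nf-sound (l :- r))) (trans (sym (ℤ.+-identityʳ _))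
      (trans (cong (λ z → ⟦ nf (l :- r) ⟧ⁿ ρ + z) (sym (scaled-zero (sides fs) cs (sides-zero fs))))
      (trans (sym (addⁿ-sound (nf (l :- r)) (scaled (sides fs) cs))) (isZero-sound (addⁿ (nf (l :- r)) (scaled (sides fs) cs)) e)))))

-- Finite sums, indicators and counting.

module Sums where
  open Lin

  ∑ : ℕ → (ℕ → ℤ) → ℤ
  ∑ zero f = 0ℤ
  ∑ (suc n) f = ∑ n f + f n

  private
    variable
      n : ℕ
      f g : ℕ → ℤ

  ∑-cong : ∀ n → (∀ i → i ℕ.< n → f i ≡ g i) → ∑ n f ≡ ∑ n g
  ∑-cong zero h = refl
  ∑-cong (suc n) h = cong₂ _+_ (∑-cong n (λ i l → h i (ℕ.m<n⇒m<1+n l))) (h n ℕ.≤-refl)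

  ∑-mono : ∀ n → (∀ i → i ℕ.< n → f i ≤ g i) → ∑ n f ≤ ∑ n g
  ∑-mono zero h = ≤-refl
  ∑-mono (suc n) h = ℤ.+-mono-≤ (∑-mono n (λ i l → h i (ℕ.m<n⇒m<1+n l))) (h n ℕ.≤-refl)

  ∑-+ : ∀ n → ∑ n (λ i → f i + g i) ≡ ∑ n f + ∑ n g
  ∑-+ zero = refl
  ∑-+ {f} {g} (suc n) = let e = ∑-+ {f} {g} n in
    (lin≡ (∑ n (λ i → f i + g i) ∷ f n ∷ g n ∷ ∑ n f ∷ ∑ n g ∷ []) (#0 :+ (#1 :+ #2)) (#3 :+ #1 :+ (#4 :+ #2)) (#0 == #3 :+ #4 by e ∷ []) [] refl)

  ∑-neg : ∀ n → ∑ n (λ i → - f i) ≡ - ∑ n f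
  ∑-neg zero = refl
  ∑-neg {f} (suc n) = let e = ∑-neg {f} n in
    (lin≡ (∑ n (λ i → - f i) ∷ f n ∷ ∑ n f ∷ []) (#0 :+ :- #1) (:- (#2 :+ #1)) (#0 == :- #2 by e ∷ []) [] refl)

  ∑-const : ∀ c n → ∑ n (λ _ → c) ≡ + n * c
  ∑-const c zero = sym (ℤ.*-zeroˡ c)
  ∑-const c (suc n) = let e = ∑-const c n in
    (lin≡ (∑ n (λ _ → c) ∷ c ∷ + n ∷ []) (#0 :+ #1) (($1 :+ #2) :* #1) (#0 == #2 :* #1 by e ∷ []) [] refl)

  ∑-split : ∀ m n → ∑ (m ℕ.+ n) f ≡ ∑ m f + ∑ n (λ i → f (m ℕ.+ i))
  ∑-split {f} m zero = trans (cong (λ z → ∑ z f) (ℕ.+-identityʳ m)) (sym (ℤ.+-identityʳ _))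
  ∑-split {f} m (suc n) = trans (cong (λ z → ∑ z f) (ℕ.+-suc m n))
    (trans (cong (_+ f (m ℕ.+ n)) (∑-split {f} m n)) (ℤ.+-assoc (∑ m f) _ _))

  ∑-zero : ∀ n → (∀ i → i ℕ.< n → f i ≡ 0ℤ) → ∑ n f ≡ 0ℤ
  ∑-zero zero h = refl
  ∑-zero (suc n) h = cong₂ _+_ (∑-zero n (λ i l → h i (ℕ.m<n⇒m<1+n l))) (h n ℕ.≤-refl)

  ∑-nonneg : ∀ n → (∀ i → i ℕ.< n → 0ℤ ≤ f i) → 0ℤ ≤ ∑ n f
  ∑-nonneg zero h = ≤-refl
  ∑-nonneg (suc n) h = ℤ.+-mono-≤ (∑-nonneg n (λ i l → h i (ℕ.m<n⇒m<1+n l))) (h n ℕ.≤-refl)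

  ∑-swap : ∀ (F : ℕ → ℕ → ℤ) m n → ∑ m (λ i → ∑ n (F i)) ≡ ∑ n (λ j → ∑ m (λ i → F i j))
  ∑-swap F zero n = sym (∑-zero n (λ _ _ → refl))
  ∑-swap F (suc m) n = trans (cong (_+ ∑ n (F m)) (∑-swap F m n)) (sym (∑-+ n))

  ∑-single : ∀ n k → k ℕ.< n → (∀ i → i ℕ.< n → i ≢ k → f i ≡ 0ℤ) → ∑ n f ≡ f k
  ∑-single {f} (suc n) k l h with k ℕ.≟ n
  ... | yes refl = trans (cong (_+ f n) (∑-zero n λ i i<n → h i (ℕ.m<n⇒m<1+n i<n) (ℕ.<⇒≢ i<n))) (ℤ.+-identityˡ _)
  ... | no k≢n = trans (cong₂ _+_ (∑-single n k (ℕ.≤∧≢⇒< (ℕ.s≤s⁻¹ l) k≢n) (λ i i<n → h i (ℕ.m<n⇒m<1+n i<n)))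
                                 (h n ℕ.≤-refl (k≢n ∘ sym))) (ℤ.+-identityʳ _)

  ⟨_⟩ : ∀ {P : Set} → Dec P → ℤ
  ⟨ yes _ ⟩ = 1ℤ
  ⟨ no _ ⟩ = 0ℤ

  ⟨⟩≥0 : ∀ {P : Set} (d : Dec P) → 0ℤ ≤ ⟨ d ⟩
  ⟨⟩≥0 (yes _) = +≤+ z≤n
  ⟨⟩≥0 (no _) = +≤+ z≤n

  ⟨⟩≤1 : ∀ {P : Set} (d : Dec P) → ⟨ d ⟩ ≤ 1ℤ
  ⟨⟩≤1 (yes _) = +≤+ (s≤s z≤n)
  ⟨⟩≤1 (no _) = +≤+ z≤n

  ⟨⟩-yes : ∀ {P : Set} (d : Dec P) → P → ⟨ d ⟩ ≡ 1ℤ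
  ⟨⟩-yes (yes _) _ = refl
  ⟨⟩-yes (no ¬p) p = ⊥-elim (¬p p)

  ⟨⟩-no : ∀ {P : Set} (d : Dec P) → ¬ P → ⟨ d ⟩ ≡ 0ℤ
  ⟨⟩-no (yes p) ¬p = ⊥-elim (¬p p)
  ⟨⟩-no (no _) _ = refl

  ⟨⟩-mono : ∀ {P Q : Set} (d : Dec P) (e : Dec Q) → (P → Q) → ⟨ d ⟩ ≤ ⟨ e ⟩
  ⟨⟩-mono (yes p) e h = ≤-reflexive (sym (⟨⟩-yes e (h p)))
  ⟨⟩-mono (no _) e h = ⟨⟩≥0 e

  ⟨⟩-cong : ∀ {P Q : Set} (d : Dec P) (e : Dec Q) → (P → Q) → (Q → P) → ⟨ d ⟩ ≡ ⟨ e ⟩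
  ⟨⟩-cong d e h k = ≤-antisym (⟨⟩-mono d e h) (⟨⟩-mono e d k)

  count≤ : ∀ {P : ℕ → Set} (P? : ∀ i → Dec (P i)) n → ∑ n (λ i → ⟨ P? i ⟩) ≤ + n
  count≤ P? zero = ≤-refl
  count≤ P? (suc n) = let h = count≤ P? n ; k = ⟨⟩≤1 (P? n) in
    (lin≤ (∑ n (λ i → ⟨ P? i ⟩) ∷ ⟨ P? n ⟩ ∷ + n ∷ []) (#0 :+ #1) ($1 :+ #2) (#0 <= #2 by h ∷ #1 <= $1 by k ∷ []) [] [] refl)

  ⟨⟩-pair : ∀ {P Q R : Set} (d : Dec P) (e : Dec Q) (c : Dec R) → (P → Q → R) → ⟨ d ⟩ + ⟨ e ⟩ ≤ 1ℤ + ⟨ c ⟩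
  ⟨⟩-pair (yes p) (yes q) c h = ≤-reflexive (cong (λ z → 1ℤ + z) (sym (⟨⟩-yes c (h p q))))
  ⟨⟩-pair (yes p) (no _) c h = let k = ⟨⟩≥0 c in (lin≤ (⟨ c ⟩ ∷ []) ($1 :+ $0) ($1 :+ #0) ($0 <= #0 by k ∷ []) [] [] refl)
  ⟨⟩-pair (no _) e c h = let k = ⟨⟩≥0 c ; l = ⟨⟩≤1 e in (lin≤ (⟨ e ⟩ ∷ ⟨ c ⟩ ∷ []) ($0 :+ #0) ($1 :+ #1) ($0 <= #1 by k ∷ #0 <= $1 by l ∷ []) [] [] refl)

  -- Meant for two labels at the ends of a fixed jump that exclude each other: `R` marks the
  -- exceptional positions where the exclusion fails.
  pairs≤ : ∀ {P Q R : ℕ → Set} (P? : ∀ i → Dec (P i)) (Q? : ∀ i → Dec (Q i)) (R? : ∀ i → Dec (R i)) n →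
    (∀ i → i ℕ.< n → P i → Q i → R i) →
    ∑ n (λ i → ⟨ P? i ⟩) + ∑ n (λ i → ⟨ Q? i ⟩) ≤ + n + ∑ n (λ i → ⟨ R? i ⟩)
  pairs≤ P? Q? R? zero h = ≤-refl
  pairs≤ P? Q? R? (suc n) h =
    let ih = pairs≤ P? Q? R? n (λ i l → h i (ℕ.m<n⇒m<1+n l)) ; k = ⟨⟩-pair (P? n) (Q? n) (R? n) (h n ℕ.≤-refl) in
    (lin≤ (∑ n (λ i → ⟨ P? i ⟩) ∷ ⟨ P? n ⟩ ∷ ∑ n (λ i → ⟨ Q? i ⟩) ∷ ⟨ Q? n ⟩ ∷ + n ∷ ∑ n (λ i → ⟨ R? i ⟩) ∷ ⟨ R? n ⟩ ∷ []) (#0 :+ #1 :+ (#2 :+ #3)) ($1 :+ #4 :+ (#5 :+ #6)) (#0 :+ #2 <= #4 :+ #5 by ih ∷ #1 :+ #3 <= $1 :+ #6 by k ∷ []) [] [] refl)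

  ∑-sub : ∀ lo n p → lo ℕ.+ n ℕ.≤ p → (∀ i → i ℕ.< p → 0ℤ ≤ f i) → ∑ n (λ i → f (lo ℕ.+ i)) ≤ ∑ p f
  ∑-sub {f} lo n p l h =
    let r = p ℕ.∸ (lo ℕ.+ n) ; e = ℕ.m+[n∸m]≡n l
        s₁ = trans (cong (λ z → ∑ z f) (sym e)) (∑-split {f} (lo ℕ.+ n) r) ; s₂ = ∑-split {f} lo n
        k₁ = ∑-nonneg {f} lo (λ i q → h i (ℕ.<-≤-trans q (ℕ.≤-trans (ℕ.m≤m+n lo n) l)))
        k₂ = ∑-nonneg {λ i → f (lo ℕ.+ n ℕ.+ i)} r (λ i q → h _ (ℕ.<-≤-trans (ℕ.+-monoʳ-< (lo ℕ.+ n) q) (ℕ.≤-reflexive e)))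
    in (lin≤ (∑ n (λ i → f (lo ℕ.+ i)) ∷ ∑ p f ∷ ∑ (lo ℕ.+ n) f ∷ ∑ r (λ i → f (lo ℕ.+ n ℕ.+ i)) ∷ ∑ lo f ∷ []) #0 #1 (#1 =~ #2 :+ #3 by s₁ ∷ #2 =~ #4 :+ #0 by s₂ ∷ $0 <= #4 by k₁ ∷ $0 <= #3 by k₂ ∷ []) [] [] refl)

  -- Both sides are the double sum of `f i` times the indicator of `τ x = i`, taken in the two
  -- orders.
  ∑-reindex : ∀ p (σ τ : ℕ → ℕ) → (∀ i → i ℕ.< p → σ i ℕ.< p) → (∀ x → x ℕ.< p → τ x ℕ.< p) →
    (∀ i → i ℕ.< p → τ (σ i) ≡ i) → (∀ x → x ℕ.< p → σ (τ x) ≡ x) → ∑ p f ≡ ∑ p (λ x → f (τ x))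
  ∑-reindex {f} p σ τ σ< τ< τσ στ = trans (∑-cong p (λ i l → sym (trans
      (∑-single p (σ i) (σ< i l) (λ x l′ ne → trans (cong (λ z → f i * z) (⟨⟩-no (τ x ℕ.≟ i) (λ e → ne (trans (sym (στ x l′)) (cong σ e))))) (ℤ.*-zeroʳ (f i))))
      (trans (cong (λ z → f i * z) (⟨⟩-yes (τ (σ i) ℕ.≟ i) (τσ i l))) (ℤ.*-identityʳ (f i))))))
    (trans (∑-swap (λ i x → f i * ⟨ τ x ℕ.≟ i ⟩) p p)
    (∑-cong p (λ x l → trans (∑-single p (τ x) (τ< x l) (λ i _ ne → trans (cong (λ z → f i * z) (⟨⟩-no (τ x ℕ.≟ i) (ne ∘ sym))) (ℤ.*-zeroʳ (f i))))
      (trans (cong (λ z → f (τ x) * z) (⟨⟩-yes (τ x ℕ.≟ τ x) refl)) (ℤ.*-identityʳ _)))))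

  -- Drop positions from the end until one satisfies `P`; all other solutions then lie among the `J`
  -- positions before it.
  span≤ : ∀ {P : ℕ → Set} (P? : ∀ i → Dec (P i)) J n →
    (∀ i k → i ℕ.< k → k ℕ.< n → P i → P k → k ℕ.≤ i ℕ.+ J) → ∑ n (λ i → ⟨ P? i ⟩) ≤ + suc J
  span≤ P? J zero h = +≤+ z≤n
  span≤ {P} P? J (suc n) h with P? n
  ... | no _ = ≤-trans (≤-reflexive (ℤ.+-identityʳ _)) (span≤ P? J n (λ i k l l′ → h i k l (ℕ.m<n⇒m<1+n l′)))
  ... | yes pn with J ℕ.≤? n
  ...   | no J>n = let k = count≤ P? n ; q = +≤+ (ℕ.≰⇒> J>n) in
    (lin≤ (∑ n (λ i → ⟨ P? i ⟩) ∷ + J ∷ + n ∷ []) (#0 :+ $1) ($1 :+ #1) (#0 <= #2 by k ∷ $1 :+ #2 <= #1 by q ∷ []) [] [] refl)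
  ...   | yes J≤n = let r = n ℕ.∸ J ; e = ℕ.m∸n+n≡m J≤n
                        s₁ = trans (cong (λ z → ∑ z (λ i → ⟨ P? i ⟩)) (sym e)) (∑-split {λ i → ⟨ P? i ⟩} r J)
                        z = ∑-zero r (λ i l → ⟨⟩-no (P? i) (λ pi → ℕ.<⇒≱ (ℕ.<-≤-trans (ℕ.+-monoˡ-< J l) (ℕ.≤-reflexive e)) (h i n (ℕ.<-≤-trans l (ℕ.m∸n≤m n J)) ℕ.≤-refl pi pn)))
                        k = count≤ (λ i → P? (r ℕ.+ i)) J in
    (lin≤ (∑ n (λ i → ⟨ P? i ⟩) ∷ + J ∷ ∑ r (λ i → ⟨ P? i ⟩) ∷ ∑ J (λ i → ⟨ P? (r ℕ.+ i) ⟩) ∷ []) (#0 :+ $1) ($1 :+ #1) (#0 == #2 :+ #3 by s₁ ∷ #2 == $0 by z ∷ #3 <= #1 by k ∷ []) [] [] refl)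

  tail≤ : ∀ p j → ∑ p (λ i → ⟨ p ℕ.≤? i ℕ.+ j ⟩) ≤ + j
  tail≤ p j with j ℕ.≤? p
  ... | no j>p = ≤-trans (count≤ (λ i → p ℕ.≤? i ℕ.+ j) p) (+≤+ (ℕ.<⇒≤ (ℕ.≰⇒> j>p)))
  ... | yes j≤p = let r = p ℕ.∸ j ; e = ℕ.m∸n+n≡m j≤p
                      s₁ = trans (cong (λ z → ∑ z (λ i → ⟨ p ℕ.≤? i ℕ.+ j ⟩)) (sym e)) (∑-split {λ i → ⟨ p ℕ.≤? i ℕ.+ j ⟩} r j)
                      z = ∑-zero r (λ i l → ⟨⟩-no (p ℕ.≤? i ℕ.+ j) (ℕ.<⇒≱ (ℕ.<-≤-trans (ℕ.+-monoˡ-< j l) (ℕ.≤-reflexive e))))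
                      k = count≤ (λ i → p ℕ.≤? (r ℕ.+ i) ℕ.+ j) j in
    (lin≤ (∑ p (λ i → ⟨ p ℕ.≤? i ℕ.+ j ⟩) ∷ + j ∷ ∑ r (λ i → ⟨ p ℕ.≤? i ℕ.+ j ⟩) ∷ ∑ j (λ i → ⟨ p ℕ.≤? r ℕ.+ i ℕ.+ j ⟩) ∷ []) #0 #1 (#0 == #2 :+ #3 by s₁ ∷ #2 == $0 by z ∷ #3 <= #1 by k ∷ []) [] [] refl)

  find : ∀ {P : ℕ → Set} (P? : ∀ i → Dec (P i)) n → (∃ λ i → i ℕ.< n × P i) ⊎ (∑ n (λ i → ⟨ P? i ⟩) ≡ 0ℤ)
  find P? n with ℕ.anyUpTo? P? n
  ... | yes h = inj₁ h
  ... | no ¬h = inj₂ (∑-zero n (λ i l → ⟨⟩-no (P? i) (λ pi → ¬h (i , l , pi))))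

  disjoint≤ : ∀ {P Q : ℕ → Set} (P? : ∀ i → Dec (P i)) (Q? : ∀ i → Dec (Q i)) n → (∀ i → i ℕ.< n → P i → Q i → ⊥) →
    ∑ n (λ i → ⟨ P? i ⟩) + ∑ n (λ i → ⟨ Q? i ⟩) ≤ + n
  disjoint≤ P? Q? n h = ≤-trans (pairs≤ {R = λ _ → ⊥} P? Q? (λ _ → no (λ ())) n h)
    (≤-reflexive (trans (cong (λ z → + n + z) (∑-zero n (λ _ _ → refl))) (ℤ.+-identityʳ _)))

-- Chains of p points: data, labels and the window bound.

module ChainM where
  open Lin
  open Sums

  -- The digits of the p consecutive integers n₀ + δ i: col = a, Y = b pr, Z = c pq, M = qr and N = pqr.  The thresholds
  -- N - V and N - U stand for b ≥ p⁻¹ and c ≥ p⁻¹ (after a shift of base point, for the complementary residues); hy and hz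
  -- are the granularities pr and pq; e = v - u and m = p - u - v.  The class is closed under reversing the order of the
  -- points and under exchanging Y and Z, which is why δ = ±1 and why {ey , ez} = {u , v} in either order.
  record Data : Set where
    field
      u e m : ℕ
    v : ℕ
    v = u ℕ.+ e
    s : ℕ
    s = v ℕ.+ u
    p : ℕ
    p = s ℕ.+ m
    field
      M hy hz V U n₀ δ ω υ ζ : ℤ
      ey ez : ℕ
      col pos : ℕ → ℕ
      Y Z F : ℕ → ℤ
    N : ℤ
    N = + p * M
    field
      col< : ∀ i → i ℕ.< p → col i ℕ.< p
      pos< : ∀ x → x ℕ.< p → pos x ℕ.< p
      pos-col : ∀ i → i ℕ.< p → pos (col i) ≡ i
      col-pos : ∀ x → x ℕ.< p → col (pos x) ≡ x
      M≥1 : 1ℤ ≤ M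
      hy≥1 : 1ℤ ≤ hy
      hz≥1 : 1ℤ ≤ hz
      0≤Y : ∀ i → 0ℤ ≤ Y i
      0≤Z : ∀ i → 0ℤ ≤ Z i
      Y≤ : ∀ i → Y i + hy ≤ N
      Z≤ : ∀ i → Z i + hz ≤ N
      -- Two top values of `Y` differ by at most `V - hy`; the summand `p` leaves room for the drift
      -- of the base point along the chain.
      V≤ : V - hy + + p ≤ + ey * M
      U≤ : U - hz + + p ≤ + ez * M
      u≤ey : + u ≤ + ey
      ey≤v : + ey ≤ + v
      u≤ez : + u ≤ + ez
      ez≤v : + ez ≤ + v
      ey+ez : + ey + + ez ≡ + s
      δ≡ : (δ ≡ 1ℤ) ⊎ (δ ≡ - 1ℤ)
      eqn : ∀ i → i ℕ.< p → + col i * M + Y i + Z i ≡ n₀ + δ * + i + F i * N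
      col-step : ∀ i → suc i ℕ.< p → ∃ λ γ → + col (suc i) ≡ + col i + ω + γ * + p
      Y-step : ∀ i → suc i ℕ.< p → ∃ λ α → Y (suc i) ≡ Y i + υ + α * N
      Z-step : ∀ i → suc i ℕ.< p → ∃ λ β → Z (suc i) ≡ Z i + ζ + β * N
      -- The column step is the inverse of `q r` modulo `p` up to the direction of the chain, and
      -- `u v` is up to sign the product of the inverses of `q` and `r`.
      ω≡ : (∃ λ κ → ω ≡ + (u ℕ.* v) + κ * + p) ⊎ (∃ λ κ → ω ≡ - + (u ℕ.* v) + κ * + p)

  -- T, T₁, G₁, G₃, H are the points that contribute to the sum; T′ collects T, T₁ and H on one turn.
  module Labels (D : Data) where
    open Data D

    TopY TopZ Top T G₁ T₁ G₃ H T₄ T′ : ℕ → Set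
    TopY i = N - V ≤ Y i
    TopZ i = N - U ≤ Z i
    Top i = TopY i × TopZ i
    T i = F i ≡ + 2 × Top i
    G₁ i = F i ≡ 0ℤ
    T₁ i = F i ≡ 1ℤ × Top i
    G₃ i = F i ≡ 1ℤ × 1ℤ + Y i ≤ N - V × 1ℤ + Z i ≤ N - U
    H i = F i ≡ + 2
    T₄ i = s ℕ.≤ col i × T i
    T′ i = Top i × ((F i ≡ + 2 × v ℕ.≤ col i) ⊎ (F i ≡ 1ℤ × col i ℕ.< u))

    Top? : ∀ i → Dec (Top i)
    Top? i = (N - V ℤ.≤? Y i) ×-dec (N - U ℤ.≤? Z i)
    T? : ∀ i → Dec (T i)
    T? i = (F i ℤ.≟ + 2) ×-dec Top? i
    G₁? : ∀ i → Dec (G₁ i)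
    G₁? i = F i ℤ.≟ 0ℤ
    T₁? : ∀ i → Dec (T₁ i)
    T₁? i = (F i ℤ.≟ 1ℤ) ×-dec Top? i
    G₃? : ∀ i → Dec (G₃ i)
    G₃? i = (F i ℤ.≟ 1ℤ) ×-dec ((1ℤ + Y i ℤ.≤? N - V) ×-dec (1ℤ + Z i ℤ.≤? N - U))
    H? : ∀ i → Dec (H i)
    H? i = F i ℤ.≟ + 2
    T₄? : ∀ i → Dec (T₄ i)
    T₄? i = (s ℕ.≤? col i) ×-dec T? i
    T′? : ∀ i → Dec (T′ i)
    T′? i = Top? i ×-dec (((F i ℤ.≟ + 2) ×-dec (v ℕ.≤? col i)) ⊎-dec ((F i ℤ.≟ 1ℤ) ×-dec (col i ℕ.<? u)))

    τ g₁ t₁ g₃ h₃ : ℤ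
    τ = ∑ m (λ o → ⟨ T? (pos (s ℕ.+ o)) ⟩)
    g₁ = ∑ u (λ o → ⟨ G₁? (pos o) ⟩)
    t₁ = ∑ u (λ o → ⟨ T₁? (pos o) ⟩)
    g₃ = ∑ u (λ o → ⟨ G₃? (pos (v ℕ.+ o)) ⟩)
    h₃ = ∑ u (λ o → ⟨ H? (pos (v ℕ.+ o)) ⟩)

  module DataFacts (D : Data) where
    open Data D
    open Labels D

    col-split : ∀ (f : ℕ → ℤ) → ∑ p f ≡ ∑ u f + ∑ e (λ o → f (u ℕ.+ o)) + ∑ u (λ o → f (v ℕ.+ o)) + ∑ m (λ o → f (s ℕ.+ o))
    col-split f = trans (∑-split {f} s m) (cong (_+ ∑ m (λ o → f (s ℕ.+ o)))
      (trans (∑-split {f} v u) (cong (_+ ∑ u (λ o → f (v ℕ.+ o))) (∑-split {f} u e))))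

    reindex : ∀ (f : ℕ → ℤ) → ∑ p f ≡ ∑ p (λ x → f (pos x))
    reindex f = ∑-reindex {f} p col pos col< pos< pos-col col-pos

    u≤p : u ℕ.≤ p
    u≤p = ℕ.≤-trans (ℕ.m≤m+n u e) (ℕ.≤-trans (ℕ.m≤m+n v u) (ℕ.m≤m+n s m))
    v+<p : ∀ {o} → o ℕ.< u → v ℕ.+ o ℕ.< p
    v+<p l = ℕ.<-≤-trans (ℕ.+-monoʳ-< v l) (ℕ.m≤m+n s m)
    s+<p : ∀ {o} → o ℕ.< m → s ℕ.+ o ℕ.< p
    s+<p l = ℕ.+-monoʳ-< s l

    τ≤m : τ ≤ + m
    τ≤m = count≤ (λ o → T? (pos (s ℕ.+ o))) m
    g₁+t₁≤u : g₁ + t₁ ≤ + u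
    g₁+t₁≤u = disjoint≤ (λ o → G₁? (pos o)) (λ o → T₁? (pos o)) u (λ o _ g t → case trans (sym g) (proj₁ t) of λ ())
    g₃+h₃≤u : g₃ + h₃ ≤ + u
    g₃+h₃≤u = disjoint≤ (λ o → G₃? (pos (v ℕ.+ o))) (λ o → H? (pos (v ℕ.+ o))) u (λ o _ g t → case trans (sym (proj₁ g)) t of λ ())
    u≥0 : 0ℤ ≤ + u
    u≥0 = +≤+ z≤n
    e≥0 : 0ℤ ≤ + e
    e≥0 = +≤+ z≤n
    m≥0 : 0ℤ ≤ + m
    m≥0 = +≤+ z≤n
    -- The base point moves by less than p over the chain.
    drift : ∀ i k → i ℕ.< p → k ℕ.< p → δ * + k + 1ℤ ≤ δ * + i + + p
    drift i k l l′ with δ≡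
    ... | inj₁ refl = let a = +≤+ l′ ; b : 0ℤ ≤ + i
                          b = +≤+ z≤n in
      (lin≤ (+ k ∷ + i ∷ + p ∷ []) ($1 :* #0 :+ $1) ($1 :* #1 :+ #2) ($1 :+ #0 <= #2 by a ∷ $0 <= #1 by b ∷ []) [] [] refl)
    ... | inj₂ refl = let a = +≤+ l ; b : 0ℤ ≤ + k
                          b = +≤+ z≤n in
      (lin≤ (+ k ∷ + i ∷ + p ∷ []) (:- $1 :* #0 :+ $1) (:- $1 :* #1 :+ #2) ($1 :+ #1 <= #2 by a ∷ $0 <= #0 by b ∷ []) [] [] refl)

    -- T₁-points are regarded as lying one turn further, so that F = 2 for every T′-point.
    lift : ℕ → ℕ
    lift i with v ℕ.≤? col i
    ... | yes _ = col i
    ... | no _ = col i ℕ.+ p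

    lift-eqn : ∀ i → i ℕ.< p → T′ i → + lift i * M + Y i + Z i ≡ n₀ + δ * + i + + 2 * N
    lift-eqn i l (_ , inj₁ (f , le)) with v ℕ.≤? col i
    ... | yes _ = trans (eqn i l) (cong (λ z → n₀ + δ * + i + z * N) f)
    ... | no ¬le = ⊥-elim (¬le le)
    lift-eqn i l (_ , inj₂ (f , lt)) with v ℕ.≤? col i
    ... | yes le = ⊥-elim (ℕ.<⇒≱ lt (ℕ.≤-trans (ℕ.m≤m+n u e) le))
    ... | no _ = let h = eqn i l in
      (lin≡ (+ col i ∷ + p ∷ M ∷ Y i ∷ Z i ∷ n₀ ∷ δ ∷ + i ∷ N ∷ F i ∷ []) ((#0 :+ #1) :* #2 :+ #3 :+ #4) (#5 :+ #6 :* #7 :+ $2 :* #8) (#0 :* #2 :+ #3 :+ #4 == #5 :+ #6 :* #7 :+ #9 :* #8 by h ∷ #9 :* #8 == #8 by f′ ∷ #8 =~ #1 :* #2 by N≡ ∷ []) [] refl)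
      where N≡ : N ≡ + p * M
            N≡ = refl
            f′ : F i * N ≡ N
            f′ = trans (cong (_* N) f) (ℤ.*-identityˡ N)

    -- After lifting both points have F = 2, so `M` times the difference of the columns is balanced
    -- by the differences of `Y` and `Z` and by the drift. Top values differ by at most `V - hy` and
    -- `U - hz`; with the drift this is less than `(ey + ez) M = s M`.
    lift-near : ∀ i k → i ℕ.< p → k ℕ.< p → T′ i → T′ k → + lift i + 1ℤ ≤ + lift k + + s
    lift-near i k l l′ t t′ = let a = lift-eqn i l t ; b = lift-eqn k l′ t′ ; d = drift k i l′ l
                                  y = proj₁ (proj₁ t) ; z = proj₂ (proj₁ t) ; y′ = Y≤ k ; z′ = Z≤ k in
      case + lift k + + s ℤ.≤? + lift i of λ where
        (no q) → ℤ.≤-trans (≤-reflexive (ℤ.+-comm (+ lift i) 1ℤ)) (≰⇒1+≤ q)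
        (yes q) → ⊥-elim (let p≥1 = ≤-trans (+≤+ (s≤s (z≤n {i}))) (+≤+ l) in (lin⊥ (M ∷ + lift i ∷ Y i ∷ Z i ∷ n₀ ∷ δ ∷ + i ∷ N ∷ + lift k ∷ Y k ∷ Z k ∷ + k ∷ + p ∷ V ∷ U ∷ hy ∷ hz ∷ + ey ∷ + ez ∷ + u ∷ + e ∷ []) ($1 <= #0 by M≥1 ∷ #1 :* #0 :+ #2 :+ #3 == #4 :+ #5 :* #6 :+ $2 :* #7 by a ∷ #8 :* #0 :+ #9 :+ #10 =~ #4 :+ #5 :* #11 :+ $2 :* #7 by b ∷ #5 :* #6 :+ $1 <= #5 :* #11 :+ #12 by d ∷ #7 :- #13 <= #2 by y ∷ #7 :- #14 <= #3 by z ∷ #9 :+ #15 <= #7 by y′ ∷ #10 :+ #16 <= #7 by z′ ∷ #13 :- #15 :+ #12 <= #17 :* #0 by V≤ ∷ #14 :- #16 :+ #12 <= #18 :* #0 by U≤ ∷ #8 :+ (#19 :+ #20 :+ #19) <= #1 by q ∷ $1 <= #12 by p≥1 ∷ (#17 :+ #18) :* #0 == (#19 :+ #20 :+ #19) :* #0 by es ∷ []) (0 ∷ []) ((10 , 0) ∷ []) refl))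
      where es : (+ ey + + ez) * M ≡ (+ u + + e + + u) * M
            es = cong (_* M) ey+ez

    T-near : ∀ i k → i ℕ.< p → k ℕ.< p → s ℕ.≤ col i → s ℕ.≤ col k → T i → T k → col i ℕ.< col k ℕ.+ s
    T-near i k l l′ a b (f , t) (f′ , t′) = let h = lift-near i k l l′ (t , inj₁ (f , a′)) (t′ , inj₁ (f′ , b′)) in
      ℤ.drop‿+≤+ (≤-trans (≤-reflexive (ℤ.+-comm 1ℤ (+ col i))) (subst₂ (λ x y → + x + 1ℤ ≤ + y + + s) (at i a′) (at k b′) h))
      where
      a′ = ℕ.≤-trans (ℕ.m≤m+n v u) a
      b′ = ℕ.≤-trans (ℕ.m≤m+n v u) b
      at : ∀ i → v ℕ.≤ col i → lift i ≡ col i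
      at i h with v ℕ.≤? col i
      ... | yes _ = refl
      ... | no ¬h = ⊥-elim (¬h h)

    τ≤s : τ ≤ + s
    τ≤s with find (λ o → T? (pos (s ℕ.+ o))) m
    ... | inj₂ z = ≤-trans (≤-reflexive z) (+≤+ z≤n)
    ... | inj₁ (o , l , t) = ≤-trans (span≤ (λ o → T? (pos (s ℕ.+ o))) (ℕ.pred s) m near) (≤-reflexive (cong +_ (ℕ.suc-pred s {{s≢0}})))
      where
      near′ : ∀ a b → a ℕ.< m → b ℕ.< m → T (pos (s ℕ.+ a)) → T (pos (s ℕ.+ b)) → b ℕ.< a ℕ.+ s
      near′ a b l l′ t t′ = ℕ.+-cancelˡ-< s _ _ (subst (s ℕ.+ b ℕ.<_) (ℕ.+-assoc s a s) (subst₂ (λ x y → x ℕ.< y ℕ.+ s) (col-pos _ (s+<p l′)) (col-pos _ (s+<p l))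
        (T-near _ _ (pos< _ (s+<p l′)) (pos< _ (s+<p l)) (subst (s ℕ.≤_) (sym (col-pos _ (s+<p l′))) (ℕ.m≤m+n s b)) (subst (s ℕ.≤_) (sym (col-pos _ (s+<p l))) (ℕ.m≤m+n s a)) t′ t)))
      -- A single point of the kind T forces `s > 0`, because it is near itself.
      s≢0 : ℕ.NonZero s
      s≢0 = ℕ.>-nonZero (ℕ.+-cancelˡ-< o 0 s (subst (ℕ._< o ℕ.+ s) (sym (ℕ.+-identityʳ o)) (near′ o o l l t t)))
      near : ∀ a b → a ℕ.< b → b ℕ.< m → T (pos (s ℕ.+ a)) → T (pos (s ℕ.+ b)) → b ℕ.≤ a ℕ.+ ℕ.pred s
      near a b a<b b<m t t′ = ℕ.s≤s⁻¹ (subst (b ℕ.<_) (trans (cong (a ℕ.+_) (sym (ℕ.suc-pred s {{s≢0}}))) (ℕ.+-suc a (ℕ.pred s))) (near′ a b (ℕ.<-trans a<b b<m) b<m t t′))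

  record Chain : Set where
    field
      datum : Data
    open Data datum public
    open Labels datum public
    field
      -- `V` may exceed `ey M` when the base point has been shifted, but by less than `M / 3`;
      -- together with `3 v < p` this gives `3 V < N`.
      3V≤ : + 3 * V + 1ℤ ≤ + 3 * (+ ey * M) + M
      3U≤ : + 3 * U + 1ℤ ≤ + 3 * (+ ez * M) + M
      odd : ∃ λ h → + p ≡ 1ℤ + + 2 * + h
      A : ℤ
      large : + 2 * + p + 1ℤ ≤ + 3 * A
      good : A + + u ≤ τ + g₁ + t₁ + g₃ + h₃

  module Facts (C : Chain) where
    open Chain C
    open DataFacts datum public

    t₁≥0 : 0ℤ ≤ t₁
    t₁≥0 = ∑-nonneg u (λ _ _ → ⟨⟩≥0 (T₁? _))
    h₃≥0 : 0ℤ ≤ h₃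
    h₃≥0 = ∑-nonneg u (λ _ _ → ⟨⟩≥0 (H? _))

    -- The trivial bounds turn `good` into `A ≤ m + u`, and `3 A > 2 p` then gives `m > u + 2 e`,
    -- which is `p > 3 v`.
    3v<p : + u + + 2 * + e + 1ℤ ≤ + m
    3v<p = (lin≤ (+ u ∷ + e ∷ + m ∷ A ∷ τ ∷ g₁ ∷ t₁ ∷ g₃ ∷ h₃ ∷ []) (#0 :+ $2 :* #1 :+ $1) #2 (#3 :+ #0 <= #4 :+ #5 :+ #6 :+ #7 :+ #8 by good ∷ #4 <= #2 by τ≤m ∷ #5 :+ #6 <= #0 by g₁+t₁≤u ∷ #7 :+ #8 <= #0 by g₃+h₃≤u ∷ $2 :* (#0 :+ #1 :+ #0 :+ #2) :+ $1 <= $3 :* #3 by large ∷ []) (1 ∷ 3 ∷ 3 ∷ 3 ∷ 3 ∷ []) [] refl)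

    τ≥ : A ≤ τ + + u
    τ≥ = (lin≤ (A ∷ τ ∷ + u ∷ g₁ ∷ t₁ ∷ g₃ ∷ h₃ ∷ []) #0 (#1 :+ #2) (#0 :+ #2 <= #1 :+ #3 :+ #4 :+ #5 :+ #6 by good ∷ #3 :+ #4 <= #2 by g₁+t₁≤u ∷ #5 :+ #6 <= #2 by g₃+h₃≤u ∷ []) [] [] refl)

    p≥1 : 1ℤ ≤ + p
    p≥1 = (lin≤ (+ u ∷ + e ∷ + m ∷ []) $1 (#0 :+ #1 :+ #0 :+ #2) ($0 <= #0 by u≥0 ∷ $0 <= #1 by e≥0 ∷ #0 :+ $2 :* #1 :+ $1 <= #2 by 3v<p ∷ []) (1 ∷ 3 ∷ 3 ∷ []) [] refl)
    N≡ : N ≡ + p * M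
    N≡ = refl
    N≥1 : 1ℤ ≤ N
    N≥1 = (lin≤ (N ∷ + p ∷ M ∷ []) $1 #0 (#0 =~ #1 :* #2 by N≡ ∷ $1 <= #1 by p≥1 ∷ $1 <= #2 by M≥1 ∷ []) [] ((2 , 3) ∷ []) refl)
    N≡′ : N ≡ (+ u + + e + + u + + m) * M
    N≡′ = refl
    3V<N : + 3 * V + 1ℤ ≤ N
    3V<N = let q : + 3 * + ey + 1ℤ ≤ + u + + e + + u + + m
               q = (lin≤ (+ ey ∷ + u ∷ + e ∷ + m ∷ []) ($3 :* #0 :+ $1) (#1 :+ #2 :+ #1 :+ #3) (#0 <= #1 :+ #2 by ey≤v ∷ #1 :+ $2 :* #2 :+ $1 <= #3 by 3v<p ∷ []) (1 ∷ 3 ∷ []) [] refl) in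
      (lin≤ (V ∷ N ∷ M ∷ + ey ∷ + u ∷ + e ∷ + m ∷ []) ($3 :* #0 :+ $1) #1 ($1 <= #2 by M≥1 ∷ $3 :* #0 :+ $1 <= $3 :* (#3 :* #2) :+ #2 by 3V≤ ∷ #1 =~ (#4 :+ #5 :+ #4 :+ #6) :* #2 by N≡′ ∷ $3 :* #3 :+ $1 <= #4 :+ #5 :+ #4 :+ #6 by q ∷ []) (1 ∷ 0 ∷ []) ((4 , 1) ∷ []) refl)
    3U<N : + 3 * U + 1ℤ ≤ N
    3U<N = let q : + 3 * + ez + 1ℤ ≤ + u + + e + + u + + m
               q = (lin≤ (+ ez ∷ + u ∷ + e ∷ + m ∷ []) ($3 :* #0 :+ $1) (#1 :+ #2 :+ #1 :+ #3) (#0 <= #1 :+ #2 by ez≤v ∷ #1 :+ $2 :* #2 :+ $1 <= #3 by 3v<p ∷ []) (1 ∷ 3 ∷ []) [] refl) in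
      (lin≤ (U ∷ N ∷ M ∷ + ez ∷ + u ∷ + e ∷ + m ∷ []) ($3 :* #0 :+ $1) #1 ($1 <= #2 by M≥1 ∷ $3 :* #0 :+ $1 <= $3 :* (#3 :* #2) :+ #2 by 3U≤ ∷ #1 =~ (#4 :+ #5 :+ #4 :+ #6) :* #2 by N≡′ ∷ $3 :* #3 :+ $1 <= #4 :+ #5 :+ #4 :+ #6 by q ∷ []) (1 ∷ 0 ∷ []) ((4 , 1) ∷ []) refl)

-- Counting along one turn of the columns.

module Count where
  open import Data.Nat.DivMod using (_%_; m%n<n; m<n⇒m%n≡m; %-distribˡ-+; m%n%n≡m%n; [m+n]%n≡m%n)
  open Lin
  open Sums
  open ChainM

  module Counts (C : Chain) where
    open Chain C
    open Facts C

    instance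
      p-nonZero : ℕ.NonZero p
      p-nonZero = ℕ.>-nonZero (ℤ.drop‿+≤+ p≥1)

    -- `off` is `x - v` modulo `p`, since `u + m = p - v`. Starting the turn at `v` puts the columns
    -- of the kinds H and T before the columns `[0 , u)` of the kind T₁, in accordance with `lift`.
    off cof : ℕ → ℕ
    off x = (x ℕ.+ (u ℕ.+ m)) % p
    cof o = (o ℕ.+ v) % p

    private
      shift : ∀ x k l → k ℕ.+ l ≡ p → x ℕ.< p → ((x ℕ.+ k) % p ℕ.+ l) % p ≡ x
      shift x k l e x<p = begin
        ((x ℕ.+ k) % p ℕ.+ l) % p ≡⟨ %-distribˡ-+ ((x ℕ.+ k) % p) l p ⟩
        ((x ℕ.+ k) % p % p ℕ.+ l % p) % p ≡⟨ cong (λ z → (z ℕ.+ l % p) % p) (m%n%n≡m%n (x ℕ.+ k) p) ⟩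
        ((x ℕ.+ k) % p ℕ.+ l % p) % p ≡⟨ %-distribˡ-+ (x ℕ.+ k) l p ⟨
        (x ℕ.+ k ℕ.+ l) % p ≡⟨ cong (_% p) (trans (ℕ.+-assoc x k l) (cong (x ℕ.+_) e)) ⟩
        (x ℕ.+ p) % p ≡⟨ [m+n]%n≡m%n x p ⟩
        x % p ≡⟨ m<n⇒m%n≡m x<p ⟩
        x ∎ where open ≡-Reasoning
      v+[u+m] : v ℕ.+ (u ℕ.+ m) ≡ p
      v+[u+m] = sym (ℕ.+-assoc v u m)

    off< : ∀ x → off x ℕ.< p
    off< x = m%n<n _ p
    cof< : ∀ x → cof x ℕ.< p
    cof< x = m%n<n _ p
    off-cof : ∀ o → o ℕ.< p → off (cof o) ≡ o
    off-cof o = shift o v (u ℕ.+ m) v+[u+m]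
    cof-off : ∀ x → x ℕ.< p → cof (off x) ≡ x
    cof-off x = shift x (u ℕ.+ m) v (trans (ℕ.+-comm (u ℕ.+ m) v) v+[u+m])

    reindex-off : ∀ (f : ℕ → ℤ) → ∑ p f ≡ ∑ p (λ o → f (pos (cof o)))
    reindex-off f = ∑-reindex {f} p (λ i → off (col i)) (λ o → pos (cof o)) (λ i _ → off< (col i)) (λ o _ → pos< (cof o) (cof< o))
      (λ i l → trans (cong pos (cof-off (col i) (col< i l))) (pos-col i l))
      (λ o l → trans (cong off (col-pos (cof o) (cof< o))) (off-cof o l))

    lift≡ : ∀ i → i ℕ.< p → lift i ≡ v ℕ.+ off (col i)
    lift≡ i l with v ℕ.≤? col i
    ... | yes le = sym (begin
        v ℕ.+ (col i ℕ.+ (u ℕ.+ m)) % p ≡⟨ cong (λ z → v ℕ.+ z % p) (trans (cong (ℕ._+ (u ℕ.+ m)) (sym e′)) (trans (ℕ.+-assoc r v (u ℕ.+ m)) (cong (r ℕ.+_) v+[u+m]))) ⟩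
        v ℕ.+ (r ℕ.+ p) % p ≡⟨ cong (v ℕ.+_) (trans ([m+n]%n≡m%n r p) (m<n⇒m%n≡m (ℕ.≤-<-trans (ℕ.m∸n≤m (col i) v) (col< i l)))) ⟩
        v ℕ.+ r ≡⟨ ℕ.+-comm v r ⟩
        r ℕ.+ v ≡⟨ e′ ⟩
        col i ∎)
      where open ≡-Reasoning
            r : ℕ
            r = col i ℕ.∸ v
            e′ : r ℕ.+ v ≡ col i
            e′ = ℕ.m∸n+n≡m le
    ... | no ¬le = sym (begin
        v ℕ.+ (col i ℕ.+ (u ℕ.+ m)) % p ≡⟨ cong (v ℕ.+_) (m<n⇒m%n≡m (ℕ.<-≤-trans (ℕ.+-monoˡ-< (u ℕ.+ m) (ℕ.≰⇒> ¬le)) (ℕ.≤-reflexive v+[u+m]))) ⟩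
        v ℕ.+ (col i ℕ.+ (u ℕ.+ m)) ≡⟨ ℕ.+-comm v _ ⟩
        col i ℕ.+ (u ℕ.+ m) ℕ.+ v ≡⟨ ℕ.+-assoc (col i) (u ℕ.+ m) v ⟩
        col i ℕ.+ (u ℕ.+ m ℕ.+ v) ≡⟨ cong (col i ℕ.+_) (trans (ℕ.+-comm (u ℕ.+ m) v) v+[u+m]) ⟩
        col i ℕ.+ p ∎)
      where open ≡-Reasoning

    off-near : ∀ i k → i ℕ.< p → k ℕ.< p → T′ i → T′ k → off (col i) ℕ.< off (col k) ℕ.+ s
    off-near i k l l′ t t′ = let h = lift-near i k l l′ t t′ ; a = cong +_ (lift≡ i l) ; b = cong +_ (lift≡ k l′) in
      ℤ.drop‿+≤+ (lin≤ (+ off (col i) ∷ + off (col k) ∷ + s ∷ + lift i ∷ + lift k ∷ + v ∷ []) ($1 :+ #0) (#1 :+ #2) (#3 :+ $1 <= #4 :+ #2 by h ∷ #3 =~ #5 :+ #0 by a ∷ #4 == #5 :+ #1 by b ∷ []) [] [] refl)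

    τ′ : ℤ
    τ′ = ∑ p (λ i → ⟨ T′? i ⟩)

    τ′≤s : τ′ ≤ + s
    τ′≤s with find T′? p
    ... | inj₂ z = ≤-trans (≤-reflexive z) (+≤+ z≤n)
    ... | inj₁ (i , l , t) = subst₂ _≤_ (sym (reindex-off (λ i → ⟨ T′? i ⟩))) (cong +_ (ℕ.suc-pred s {{s≢0}}))
        (span≤ (λ o → T′? (pos (cof o))) (ℕ.pred s) p near)
      where
      s≢0 : ℕ.NonZero s
      s≢0 = ℕ.>-nonZero (ℕ.+-cancelˡ-< (off (col i)) 0 s (subst (ℕ._< off (col i) ℕ.+ s) (sym (ℕ.+-identityʳ _)) (off-near i i l l t t)))
      near : ∀ a b → a ℕ.< b → b ℕ.< p → T′ (pos (cof a)) → T′ (pos (cof b)) → b ℕ.≤ a ℕ.+ ℕ.pred s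
      near a b a<b b<p ta tb = ℕ.s≤s⁻¹ (subst (b ℕ.<_) (trans (cong (a ℕ.+_) (sym (ℕ.suc-pred s {{s≢0}}))) (ℕ.+-suc a (ℕ.pred s)))
        (subst₂ (λ x y → x ℕ.< y ℕ.+ s) (oc b b<p) (oc a (ℕ.<-trans a<b b<p))
          (off-near (pos (cof b)) (pos (cof a)) (pos< _ (cof< b)) (pos< _ (cof< a)) tb ta)))
        where oc : ∀ o → o ℕ.< p → off (col (pos (cof o))) ≡ o
              oc o l = trans (cong off (col-pos (cof o) (cof< o))) (off-cof o l)

    τ>v : + v + 1ℤ ≤ τ
    τ>v = (lin≤ (+ u ∷ + e ∷ τ ∷ A ∷ + m ∷ []) (#0 :+ #1 :+ $1) #2 (#3 <= #2 :+ #0 by τ≥ ∷ #0 :+ $2 :* #1 :+ $1 <= #4 by 3v<p ∷ $0 <= #1 by e≥0 ∷ $2 :* (#0 :+ #1 :+ #0 :+ #4) :+ $1 <= $3 :* #3 by large ∷ []) (3 ∷ 3 ∷ 2 ∷ 3 ∷ []) [] refl)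

    private
      -- The columns `[s , s + v)` can hold only `v` of the more than `v` points of the kind T.
      far : ∃ λ k → v ℕ.+ k ℕ.< m × T (pos (s ℕ.+ (v ℕ.+ k)))
      far with ℕ.≤-total v m
      ... | inj₂ m≤v = let a = +≤+ m≤v in ⊥-elim (lin⊥ (+ m ∷ + v ∷ τ ∷ []) (#0 <= #1 by a ∷ #2 <= #0 by τ≤m ∷ #1 :+ $1 <= #2 by t ∷ []) [] [] refl)
        where t = τ>v
      ... | inj₁ v≤m with find (λ k → T? (pos (s ℕ.+ (v ℕ.+ k)))) (m ℕ.∸ v)
      ...   | inj₁ (k , l , t) = k , ℕ.<-≤-trans (ℕ.+-monoʳ-< v l) (ℕ.≤-reflexive (ℕ.m+[n∸m]≡n v≤m)) , t
      ...   | inj₂ z = let t = τ>v ; c = count≤ (λ o → T? (pos (s ℕ.+ o))) v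
                           d = trans (cong (λ z → ∑ z (λ o → ⟨ T? (pos (s ℕ.+ o)) ⟩)) (sym (ℕ.m+[n∸m]≡n v≤m))) (∑-split {λ o → ⟨ T? (pos (s ℕ.+ o)) ⟩} v (m ℕ.∸ v)) in
        ⊥-elim (lin⊥ (+ v ∷ τ ∷ ∑ v (λ o → ⟨ T? (pos (s ℕ.+ o)) ⟩) ∷ ∑ (m ℕ.∸ v) (λ k → ⟨ T? (pos (s ℕ.+ (v ℕ.+ k))) ⟩) ∷ []) (#0 :+ $1 <= #1 by t ∷ #2 <= #0 by c ∷ #3 == $0 by z ∷ #1 == #2 :+ #3 by d ∷ []) [] [] refl)

    -- Compare with the T from `far`: it has the same F and its column is larger by more than `v`.
    -- This surplus outweighs the drift and all that one of `Y`, `Z` can gain over its value at the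
    -- far point, so the other one must be at least as large at `i` as there.
    H-top : ∀ i → i ℕ.< p → col i ℕ.< s → H i → Top i
    H-top i l c<s h = let k , k<m , (f , y , z) = far ; x = s ℕ.+ (v ℕ.+ k) ; j = pos x ; x<p = s+<p k<m ; j<p = pos< x x<p
                          c = col-pos x x<p ; d = drift i j l j<p ; y≤ = Y≤ i ; z≤ = Z≤ i ; q = +≤+ c<s ; k≥0 = +≤+ (z≤n {k})
                          a : + col i * M + Y i + Z i ≡ n₀ + δ * + i + + 2 * N
                          a = trans (eqn i l) (cong (λ z → n₀ + δ * + i + z * N) h)
                          b : (+ s + (+ v + + k)) * M + Y j + Z j ≡ n₀ + δ * + j + + 2 * N
                          b = trans (cong (λ z → + z * M + Y j + Z j) (sym c)) (trans (eqn j j<p) (cong (λ z → n₀ + δ * + j + z * N) f))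
                      in
      (lin≤ (N ∷ V ∷ Y i ∷ + col i ∷ M ∷ Z i ∷ n₀ ∷ δ ∷ + i ∷ + s ∷ + u ∷ + e ∷ + k ∷ Y j ∷ Z j ∷ + j ∷ U ∷ + p ∷ hz ∷ + ez ∷ []) (#0 :- #1) #2 (#3 :* #4 :+ #2 :+ #5 =~ #6 :+ #7 :* #8 :+ $2 :* #0 by a ∷ (#9 :+ (#10 :+ #11 :+ #12)) :* #4 :+ #13 :+ #14 == #6 :+ #7 :* #15 :+ $2 :* #0 by b ∷ #0 :- #1 <= #13 by y ∷ #0 :- #16 <= #14 by z ∷ #7 :* #15 :+ $1 <= #7 :* #8 :+ #17 by d ∷ #5 :+ #18 <= #0 by z≤ ∷ #16 :- #18 :+ #17 <= #19 :* #4 by U≤ ∷ $1 <= #4 by M≥1 ∷ $1 :+ #3 <= #9 by q ∷ #19 <= #10 :+ #11 by ez≤v ∷ $0 <= #12 by k≥0 ∷ []) [] ((9 , 8) ∷ (10 , 8) ∷ (11 , 8) ∷ []) refl) ,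
      (lin≤ (N ∷ U ∷ Z i ∷ + col i ∷ M ∷ Y i ∷ n₀ ∷ δ ∷ + i ∷ + s ∷ + u ∷ + e ∷ + k ∷ Y j ∷ Z j ∷ + j ∷ V ∷ + p ∷ hy ∷ + ey ∷ []) (#0 :- #1) #2 (#3 :* #4 :+ #5 :+ #2 =~ #6 :+ #7 :* #8 :+ $2 :* #0 by a ∷ (#9 :+ (#10 :+ #11 :+ #12)) :* #4 :+ #13 :+ #14 == #6 :+ #7 :* #15 :+ $2 :* #0 by b ∷ #0 :- #16 <= #13 by y ∷ #0 :- #1 <= #14 by z ∷ #7 :* #15 :+ $1 <= #7 :* #8 :+ #17 by d ∷ #5 :+ #18 <= #0 by y≤ ∷ #16 :- #18 :+ #17 <= #19 :* #4 by V≤ ∷ $1 <= #4 by M≥1 ∷ $1 :+ #3 <= #9 by q ∷ #19 <= #10 :+ #11 by ey≤v ∷ $0 <= #12 by k≥0 ∷ []) [] ((9 , 8) ∷ (10 , 8) ∷ (11 , 8) ∷ []) refl)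

    -- By `H-top` the points counted by h₃ are top, so τ, t₁ and h₃ merge into one count that the
    -- window bounds by `s`.
    good′ : A + + u ≤ τ′ + g₁ + g₃
    good′ = let r = trans (reindex (λ i → ⟨ T′? i ⟩)) (col-split (λ x → ⟨ T′? (pos x) ⟩))
                a = ∑-mono u (λ o l → ⟨⟩-mono (T₁? (pos o)) (T′? (pos o)) (λ (f , t) → t , inj₂ (f , subst (ℕ._< u) (sym (col-pos o (ℕ.<-≤-trans l u≤p))) l)))
                b = ∑-nonneg {λ o → ⟨ T′? (pos (u ℕ.+ o)) ⟩} e (λ _ _ → ⟨⟩≥0 (T′? _))
                c = ∑-mono u (λ o l → ⟨⟩-mono (H? (pos (v ℕ.+ o))) (T′? (pos (v ℕ.+ o))) (λ h → let w = col-pos (v ℕ.+ o) (v+<p l) in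
                      H-top _ (pos< _ (v+<p l)) (subst (ℕ._< s) (sym w) (ℕ.+-monoʳ-< v l)) h , inj₁ (h , subst (v ℕ.≤_) (sym w) (ℕ.m≤m+n v o))))
                d = ∑-mono m (λ o l → ⟨⟩-mono (T? (pos (s ℕ.+ o))) (T′? (pos (s ℕ.+ o))) (λ (f , t) →
                      t , inj₁ (f , subst (v ℕ.≤_) (sym (col-pos (s ℕ.+ o) (s+<p l))) (ℕ.≤-trans (ℕ.m≤m+n v u) (ℕ.m≤m+n s o)))))
            in (lin≤ (A ∷ + u ∷ τ′ ∷ g₁ ∷ g₃ ∷ τ ∷ t₁ ∷ h₃ ∷ ∑ u (λ o → ⟨ T′? (pos o) ⟩) ∷ ∑ e (λ o → ⟨ T′? (pos (u ℕ.+ o)) ⟩) ∷ ∑ u (λ o → ⟨ T′? (pos (v ℕ.+ o)) ⟩) ∷ ∑ m (λ o → ⟨ T′? (pos (s ℕ.+ o)) ⟩) ∷ []) (#0 :+ #1) (#2 :+ #3 :+ #4) (#0 :+ #1 <= #5 :+ #3 :+ #6 :+ #4 :+ #7 by good ∷ #2 =~ #8 :+ #9 :+ #10 :+ #11 by r ∷ #6 <= #8 by a ∷ $0 <= #9 by b ∷ #7 <= #10 by c ∷ #5 <= #11 by d ∷ []) [] [] refl)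

    u>e : + e + 1ℤ ≤ + u
    u>e = (lin≤ (+ e ∷ + u ∷ A ∷ τ′ ∷ g₁ ∷ g₃ ∷ t₁ ∷ h₃ ∷ + m ∷ []) (#0 :+ $1) #1 (#2 :+ #1 <= #3 :+ #4 :+ #5 by good′ ∷ #3 <= #1 :+ #0 :+ #1 by τ′≤s ∷ #4 :+ #6 <= #1 by g₁+t₁≤u ∷ $0 <= #6 by t₁≥0 ∷ #5 :+ #7 <= #1 by g₃+h₃≤u ∷ $0 <= #7 by h₃≥0 ∷ #1 :+ $2 :* #0 :+ $1 <= #8 by 3v<p ∷ $2 :* (#1 :+ #0 :+ #1 :+ #8) :+ $1 <= $3 :* #2 by large ∷ []) (3 ∷ 3 ∷ 3 ∷ 3 ∷ 3 ∷ 3 ∷ 3 ∷ 2 ∷ []) [] refl)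

    -- Since `u > e`, only `u = 1`, `e = 0` is to be excluded. There `A ≤ 3`, hence `p ≤ 4`, whereas
    -- `3 v < p` and parity require `p ≥ 5`.
    u≥2 : + 2 ≤ + u
    u≥2 with + 2 ℤ.≤? + u | odd
    ... | yes h | _ = h
    ... | no h | k , o = ⊥-elim (case k ℕ.≤? 1 of λ where
            (yes k≤1) → let q = +≤+ k≤1 in (lin⊥ (+ k ∷ + e ∷ + u ∷ + m ∷ []) (#0 <= $1 by q ∷ #1 :+ $1 <= #2 by u>e′ ∷ $0 <= #1 by e≥0 ∷ #2 :+ #1 :+ #2 :+ #3 == $1 :+ $2 :* #0 by o ∷ #2 :+ $2 :* #1 :+ $1 <= #3 by 3v<p ∷ []) (2 ∷ 3 ∷ 6 ∷ []) [] refl)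
            (no k>1) → let q = +≤+ (ℕ.≰⇒> k>1) in (lin⊥ (+ u ∷ + e ∷ + m ∷ + k ∷ A ∷ τ′ ∷ g₁ ∷ g₃ ∷ t₁ ∷ h₃ ∷ []) (#0 :+ #1 :+ #0 :+ #2 =~ $1 :+ $2 :* #3 by o ∷ $2 <= #3 by q ∷ $1 :+ #0 <= $2 by w ∷ #1 :+ $1 <= #0 by u>e′ ∷ #4 :+ #0 <= #5 :+ #6 :+ #7 by good′ ∷ #5 <= #0 :+ #1 :+ #0 by τ′≤s ∷ #6 :+ #8 <= #0 by g₁+t₁≤u ∷ $0 <= #8 by t₁≥0 ∷ #7 :+ #9 <= #0 by g₃+h₃≤u ∷ $0 <= #9 by h₃≥0 ∷ $2 :* (#0 :+ #1 :+ #0 :+ #2) :+ $1 <= $3 :* #4 by large ∷ []) (2 ∷ 4 ∷ 12 ∷ 3 ∷ 3 ∷ 3 ∷ 3 ∷ 3 ∷ 3 ∷ 3 ∷ []) [] refl))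
      where
      w = ≰⇒1+≤ h
      u>e′ = u>e

-- Steps between consecutive points and their iterates.

module Steps where
  open Lin
  open Sums
  open ChainM
  open Count

  small-multiple : ∀ K {P} → 1ℤ ≤ P → K * P + 1ℤ ≤ P → - P + 1ℤ ≤ K * P → K ≡ 0ℤ
  small-multiple K {P} h a b =
    case K ℤ.≤? 0ℤ of λ where
      (no q) → let q = ≰⇒1+≤ q in ⊥-elim (lin⊥ (P ∷ K ∷ []) ($1 <= #0 by h ∷ #1 :* #0 :+ $1 <= #0 by a ∷ $1 :+ $0 <= #1 by q ∷ []) (0 ∷ []) ((2 , 0) ∷ []) refl)
      (yes q) → case 0ℤ ℤ.≤? K of λ where
        (yes q′) → ≤-antisym q q′
        (no q′) → let q′ = ≰⇒1+≤ q′ in ⊥-elim (lin⊥ (P ∷ K ∷ []) ($1 <= #0 by h ∷ :- #0 :+ $1 <= #1 :* #0 by b ∷ $1 :+ #1 <= $0 by q′ ∷ []) (0 ∷ []) ((2 , 0) ∷ []) refl)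

  -- The changes of the coordinates are determined only modulo `p` and `N`; a step fixes integer
  -- representatives whose weighted sum is exactly the motion `δ` of the base point.
  record Step (C : Chain) : Set where
    open Chain C
    field
      d θ η : ℤ
      step-sum : d * M + θ + η ≡ δ
      col-d : ∀ i → suc i ℕ.< p → ∃ λ γ → + col (suc i) ≡ + col i + d + γ * + p
      Y-θ : ∀ i → suc i ℕ.< p → ∃ λ α → Y (suc i) ≡ Y i + θ + α * N
      Z-η : ∀ i → suc i ℕ.< p → ∃ λ β → Z (suc i) ≡ Z i + η + β * N

  -- `γ`, `α`, `β` are the wraps of the three coordinates. F changes by their sum alone, because `j`
  -- times the step accounts for the motion of the base point.
  record Jump {C : Chain} (S : Step C) (i j : ℕ) : Set where
    open Chain C
    open Step S
    field
      γ α β : ℤ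
      colJ : + col (j ℕ.+ i) ≡ + col i + + j * d + γ * + p
      YJ : Y (j ℕ.+ i) ≡ Y i + + j * θ + α * N
      ZJ : Z (j ℕ.+ i) ≡ Z i + + j * η + β * N
      FJ : F (j ℕ.+ i) ≡ F i + γ + α + β

  module Jumps {C : Chain} (S : Step C) where
    open Chain C
    open Facts C
    open Counts C
    open Step S

    F-jump : ∀ i j γ α β → i ℕ.< p → j ℕ.+ i ℕ.< p → + col (j ℕ.+ i) ≡ + col i + + j * d + γ * + p →
      Y (j ℕ.+ i) ≡ Y i + + j * θ + α * N → Z (j ℕ.+ i) ≡ Z i + + j * η + β * N → F (j ℕ.+ i) ≡ F i + γ + α + β
    F-jump i j γ α β l l′ c y z = ℤ.*-cancelʳ-≡ _ _ N {{ℤ.>-nonZero (ℤ.suc[i]≤j⇒i<j N≥1)}} (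
      let a = eqn i l ; b = eqn (j ℕ.+ i) l′ ; k = j ℕ.+ i
          c′ : + col k * M ≡ (+ col i + + j * d) * M + γ * N
          c′ = trans (cong (_* M) c) (lin≡ (+ col i ∷ + j ∷ d ∷ γ ∷ + p ∷ M ∷ N ∷ []) ((#0 :+ #1 :* #2 :+ #3 :* #4) :* #5) ((#0 :+ #1 :* #2) :* #5 :+ #3 :* #6) (#3 :* #6 =~ #3 :* (#4 :* #5) by (np γ) ∷ []) [] refl)
          s′ : + j * (d * M + θ + η) ≡ + j * δ
          s′ = cong (+ j *_) step-sum in
      (lin≡ (F k ∷ N ∷ F i ∷ γ ∷ α ∷ β ∷ + col i ∷ M ∷ Y i ∷ Z i ∷ n₀ ∷ δ ∷ + i ∷ + col k ∷ Y k ∷ Z k ∷ + j ∷ d ∷ θ ∷ η ∷ []) (#0 :* #1) ((#2 :+ #3 :+ #4 :+ #5) :* #1) (#6 :* #7 :+ #8 :+ #9 == #10 :+ #11 :* #12 :+ #2 :* #1 by a ∷ #13 :* #7 :+ #14 :+ #15 =~ #10 :+ #11 :* (#16 :+ #12) :+ #0 :* #1 by b ∷ #13 :* #7 == (#6 :+ #16 :* #17) :* #7 :+ #3 :* #1 by c′ ∷ #14 == #8 :+ #16 :* #18 :+ #4 :* #1 by y ∷ #15 == #9 :+ #16 :* #19 :+ #5 :* #1 by z ∷ #16 :* (#17 :* #7 :+ #18 :+ #19) == #16 :* #11 by s′ ∷ []) [] refl))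
      where np : ∀ γ → γ * N ≡ γ * (+ p * M)
            np _ = refl

    jump : ∀ i j → j ℕ.+ i ℕ.< p → Jump S i j
    jump i zero l = record { γ = 0ℤ ; α = 0ℤ ; β = 0ℤ
      ; colJ = (lin≡ (+ col i ∷ d ∷ + p ∷ []) #0 (#0 :+ $0 :* #1 :+ $0 :* #2) [] [] refl) ; YJ = (lin≡ (Y i ∷ θ ∷ N ∷ []) #0 (#0 :+ $0 :* #1 :+ $0 :* #2) [] [] refl)
      ; ZJ = (lin≡ (Z i ∷ η ∷ N ∷ []) #0 (#0 :+ $0 :* #1 :+ $0 :* #2) [] [] refl) ; FJ = (lin≡ (F i ∷ []) #0 (#0 :+ $0 :+ $0 :+ $0) [] [] refl) }
    jump i (suc j) l = let
        k = j ℕ.+ i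
        open Jump (jump i j (ℕ.<-trans (ℕ.n<1+n k) l))
        γ₁ , c = col-d k l ; α₁ , y = Y-θ k l ; β₁ , z = Z-η k l
        c₁ : + col (suc k) ≡ + col i + + suc j * d + (γ + γ₁) * + p
        c₁ = (lin≡ (+ col (suc k) ∷ + col i ∷ + j ∷ d ∷ γ ∷ γ₁ ∷ + p ∷ + col k ∷ []) #0 (#1 :+ ($1 :+ #2) :* #3 :+ (#4 :+ #5) :* #6) (#0 == #7 :+ #3 :+ #5 :* #6 by c ∷ #7 == #1 :+ #2 :* #3 :+ #4 :* #6 by colJ ∷ []) [] refl)
        y₁ : Y (suc k) ≡ Y i + + suc j * θ + (α + α₁) * N
        y₁ = (lin≡ (Y (suc k) ∷ Y i ∷ + j ∷ θ ∷ α ∷ α₁ ∷ N ∷ Y k ∷ []) #0 (#1 :+ ($1 :+ #2) :* #3 :+ (#4 :+ #5) :* #6) (#0 == #7 :+ #3 :+ #5 :* #6 by y ∷ #7 == #1 :+ #2 :* #3 :+ #4 :* #6 by YJ ∷ []) [] refl)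
        z₁ : Z (suc k) ≡ Z i + + suc j * η + (β + β₁) * N
        z₁ = (lin≡ (Z (suc k) ∷ Z i ∷ + j ∷ η ∷ β ∷ β₁ ∷ N ∷ Z k ∷ []) #0 (#1 :+ ($1 :+ #2) :* #3 :+ (#4 :+ #5) :* #6) (#0 == #7 :+ #3 :+ #5 :* #6 by z ∷ #7 == #1 :+ #2 :* #3 :+ #4 :* #6 by ZJ ∷ []) [] refl)
      in record { γ = γ + γ₁ ; α = α + α₁ ; β = β + β₁ ; colJ = c₁ ; YJ = y₁ ; ZJ = z₁
                ; FJ = F-jump i (suc j) (γ + γ₁) (α + α₁) (β + β₁) (ℕ.≤-<-trans (ℕ.m≤n+m i (suc j)) l) l c₁ y₁ z₁ }

  module StepFacts (C : Chain) where
    open Chain C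
    open Facts C
    open Counts C

    p≥7 : + 7 ≤ + p
    p≥7 = (lin≤ (+ u ∷ + e ∷ + m ∷ []) $7 (#0 :+ #1 :+ #0 :+ #2) ($2 <= #0 by u≥2 ∷ $0 <= #1 by e≥0 ∷ #0 :+ $2 :* #1 :+ $1 <= #2 by 3v<p ∷ []) (1 ∷ 3 ∷ 3 ∷ []) [] refl)
    1<p : 1 ℕ.< p
    1<p = ℕ.<-≤-trans (s≤s (s≤s z≤n)) (ℤ.drop‿+≤+ p≥7)

    -- Representatives of the steps may be changed by multiples of p and N, as long as their sum is right.
    mkStep : (d θ η : ℤ) → d * M + θ + η ≡ δ → ∃ (λ γ → d ≡ ω + γ * + p) → ∃ (λ α → θ ≡ υ + α * N) → Step C
    mkStep d θ η sm (γ₀ , dω) (α₀ , θυ) = record { d = d ; θ = θ ; η = η ; step-sum = sm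
      ; col-d = λ i l → let γ , h = col-step i l in γ - γ₀ , (lin≡ (+ col (suc i) ∷ + col i ∷ d ∷ γ ∷ γ₀ ∷ + p ∷ ω ∷ []) #0 (#1 :+ #2 :+ (#3 :- #4) :* #5) (#0 == #1 :+ #6 :+ #3 :* #5 by h ∷ #2 =~ #6 :+ #4 :* #5 by dω ∷ []) [] refl)
      ; Y-θ = λ i l → let α , h = Y-step i l in α - α₀ , (lin≡ (Y (suc i) ∷ Y i ∷ θ ∷ α ∷ α₀ ∷ N ∷ υ ∷ []) #0 (#1 :+ #2 :+ (#3 :- #4) :* #5) (#0 == #1 :+ #6 :+ #3 :* #5 by h ∷ #2 =~ #6 :+ #4 :* #5 by θυ ∷ []) [] refl)
      ; Z-η = λ i l → let γ , c = col-step i l ; α , y = Y-step i l ; a = eqn i (ℕ.<-trans (ℕ.n<1+n i) l) ; b = eqn (suc i) l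
                          B = F (suc i) - F i - (γ - γ₀) - (α - α₀)
                          c′ : + col (suc i) * M ≡ (+ col i + d) * M + (γ - γ₀) * N
                          c′ = trans (cong (_* M) (trans c (cong (λ z → + col i + z + γ * + p) (ω′)))) (ex (+ col i) d γ γ₀ (+ p) M)
                      in B , (lin≡ (Z (suc i) ∷ Z i ∷ η ∷ F (suc i) ∷ F i ∷ γ ∷ γ₀ ∷ α ∷ α₀ ∷ N ∷ + col i ∷ M ∷ Y i ∷ n₀ ∷ δ ∷ + i ∷ + col (suc i) ∷ Y (suc i) ∷ d ∷ υ ∷ θ ∷ []) #0 (#1 :+ #2 :+ (#3 :- #4 :- (#5 :- #6) :- (#7 :- #8)) :* #9) (#10 :* #11 :+ #12 :+ #1 =~ #13 :+ #14 :* #15 :+ #4 :* #9 by a ∷ #16 :* #11 :+ #17 :+ #0 == #13 :+ #14 :* ($1 :+ #15) :+ #3 :* #9 by b ∷ #16 :* #11 =~ (#10 :+ #18) :* #11 :+ (#5 :- #6) :* #9 by c′ ∷ #17 =~ #12 :+ #19 :+ #7 :* #9 by y ∷ #20 == #19 :+ #8 :* #9 by θυ ∷ #18 :* #11 :+ #20 :+ #2 =~ #14 by sm ∷ []) [] refl) }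
      where
      ω′ : ω ≡ d - γ₀ * + p
      ω′ = (lin≡ (ω ∷ d ∷ γ₀ ∷ + p ∷ []) #0 (#1 :- #2 :* #3) (#1 =~ #0 :+ #2 :* #3 by dω ∷ []) [] refl)
      ex : ∀ c d γ γ₀ P M → (c + (d - γ₀ * P) + γ * P) * M ≡ (c + d) * M + (γ - γ₀) * (P * M)
      ex c d γ γ₀ P M = (lin≡ (c ∷ d ∷ γ₀ ∷ P ∷ γ ∷ M ∷ []) ((#0 :+ (#1 :- #2 :* #3) :+ #4 :* #3) :* #5) ((#0 :+ #1) :* #5 :+ (#4 :- #2) :* (#3 :* #5)) [] [] refl)

    base : Step C
    base = mkStep ω υ (δ - ω * M - υ) (lin≡ (ω ∷ M ∷ υ ∷ δ ∷ []) (#0 :* #1 :+ #2 :+ (#3 :- #0 :* #1 :- #2)) #3 [] [] refl) (0ℤ , (lin≡ (ω ∷ + p ∷ []) #0 (#0 :+ $0 :* #1) [] [] refl)) (0ℤ , (lin≡ (υ ∷ N ∷ []) #0 (#0 :+ $0 :* #1) [] [] refl))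

    col-≡ω : (S : Step C) → ∃ λ κ → Step.d S ≡ ω + κ * + p
    col-≡ω S = let open Step S ; γ , h = col-d 0 1<p ; γ′ , h′ = col-step 0 1<p in
      γ′ - γ , (lin≡ (d ∷ ω ∷ γ′ ∷ γ ∷ + p ∷ + col 1 ∷ + col 0 ∷ []) #0 (#1 :+ (#2 :- #3) :* #4) (#5 =~ #6 :+ #0 :+ #3 :* #4 by h ∷ #5 == #6 :+ #1 :+ #2 :* #4 by h′ ∷ []) [] refl)

    -- If 3u = 3v = p - 1 then ω ≡ ± uv and 9uv = (p - 1)².
    nine : (S : Step C) → + e ≡ 0ℤ → + p ≡ + 3 * + u + 1ℤ → (∃ λ K → + 9 * Step.d S ≡ 1ℤ + K * + p) ⊎ (∃ λ K → + 9 * Step.d S ≡ - 1ℤ + K * + p)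
    nine S e0 pe with col-≡ω S | ω≡
    ... | κ , dω | inj₁ (κ′ , h) = inj₁ (+ 9 * (κ + κ′) + (+ 3 * + u - 1ℤ) , trans (cong (+ 9 *_) (trans dω (cong (_+ κ * + p) h)))
          (trans (cong₂ (λ a b → + 9 * (a + κ′ * b + κ * b)) uv pe) (trans (ex (+ u) κ κ′) (cong (λ z → 1ℤ + (+ 9 * (κ + κ′) + (+ 3 * + u - 1ℤ)) * z) (sym pe)))))
      where uv : + (u ℕ.* v) ≡ + u * + u
            uv = trans (ℤ.pos-* u v) (cong (λ z → + u * z) (trans (cong (λ z → + u + z) e0) (ℤ.+-identityʳ (+ u))))
            ex : ∀ u κ κ′ → + 9 * (u * u + κ′ * (+ 3 * u + 1ℤ) + κ * (+ 3 * u + 1ℤ)) ≡ 1ℤ + (+ 9 * (κ + κ′) + (+ 3 * u - 1ℤ)) * (+ 3 * u + 1ℤ)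
            ex u κ κ′ = (lin≡ (u ∷ κ′ ∷ κ ∷ []) ($9 :* (#0 :* #0 :+ #1 :* ($3 :* #0 :+ $1) :+ #2 :* ($3 :* #0 :+ $1))) ($1 :+ ($9 :* (#2 :+ #1) :+ ($3 :* #0 :- $1)) :* ($3 :* #0 :+ $1)) [] [] refl)
    ... | κ , dω | inj₂ (κ′ , h) = inj₂ (+ 9 * (κ + κ′) - (+ 3 * + u - 1ℤ) , trans (cong (+ 9 *_) (trans dω (cong (_+ κ * + p) h)))
          (trans (cong₂ (λ a b → + 9 * (- a + κ′ * b + κ * b)) uv pe) (trans (ex (+ u) κ κ′) (cong (λ z → - 1ℤ + (+ 9 * (κ + κ′) - (+ 3 * + u - 1ℤ)) * z) (sym pe)))))
      where uv : + (u ℕ.* v) ≡ + u * + u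
            uv = trans (ℤ.pos-* u v) (cong (λ z → + u * z) (trans (cong (λ z → + u + z) e0) (ℤ.+-identityʳ (+ u))))
            ex : ∀ u κ κ′ → + 9 * (- (u * u) + κ′ * (+ 3 * u + 1ℤ) + κ * (+ 3 * u + 1ℤ)) ≡ - 1ℤ + (+ 9 * (κ + κ′) - (+ 3 * u - 1ℤ)) * (+ 3 * u + 1ℤ)
            ex u κ κ′ = (lin≡ (u ∷ κ′ ∷ κ ∷ []) ($9 :* (:- (#0 :* #0) :+ #1 :* ($3 :* #0 :+ $1) :+ #2 :* ($3 :* #0 :+ $1))) (:- $1 :+ ($9 :* (#2 :+ #1) :- ($3 :* #0 :- $1)) :* ($3 :* #0 :+ $1)) [] [] refl)

    τ₄ : ℤ
    τ₄ = ∑ p (λ i → ⟨ T₄? i ⟩)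

    τ≤τ₄ : τ ≤ τ₄
    τ≤τ₄ = let r = trans (reindex (λ i → ⟨ T₄? i ⟩)) (∑-split {λ x → ⟨ T₄? (pos x) ⟩} s m)
               a = ∑-mono m (λ o l → ⟨⟩-mono (T? (pos (s ℕ.+ o))) (T₄? (pos (s ℕ.+ o))) (λ t → subst (s ℕ.≤_) (sym (col-pos (s ℕ.+ o) (s+<p l))) (ℕ.m≤m+n s o) , t))
               b = ∑-nonneg {λ o → ⟨ T₄? (pos o) ⟩} s (λ _ _ → ⟨⟩≥0 (T₄? _))
           in (lin≤ (τ ∷ τ₄ ∷ ∑ s (λ o → ⟨ T₄? (pos o) ⟩) ∷ ∑ m (λ o → ⟨ T₄? (pos (s ℕ.+ o)) ⟩) ∷ []) #0 #1 (#1 =~ #2 :+ #3 by r ∷ #0 <= #3 by a ∷ $0 <= #2 by b ∷ []) [] [] refl)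

-- Exchange of Y and Z, and reversal of the order.

module Sym where
  open Lin
  open Sums
  open ChainM
  open Count

  -- The labels only depend on Y, Z, F and on the position, so any relabelling that respects them preserves the counts.
  transport-good : (C : Chain) (D : Data) → let open Chain C
                                                module L = Labels D
                                                module D = Data D in
    + 3 * D.V + 1ℤ ≤ + 3 * (+ D.ey * D.M) + D.M → + 3 * D.U + 1ℤ ≤ + 3 * (+ D.ez * D.M) + D.M →
    D.u ≡ u → D.e ≡ e → D.m ≡ m →
    (∀ x → x ℕ.< p → (L.T (D.pos x) → T (pos x)) × (T (pos x) → L.T (D.pos x))) →
    (∀ x → x ℕ.< p → D.F (D.pos x) ≡ F (pos x)) →
    (∀ x → x ℕ.< p → T₁ (pos x) → L.T₁ (D.pos x)) →
    (∀ x → x ℕ.< p → G₃ (pos x) → L.G₃ (D.pos x)) → Chain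
  transport-good C D 3V 3U refl refl refl hT hF hT₁ hG₃ = record
    { datum = D ; 3V≤ = 3V ; 3U≤ = 3U ; odd = odd ; A = A ; large = large
    ; good = ≤-trans good (ℤ.+-mono-≤ (ℤ.+-mono-≤ (ℤ.+-mono-≤ (ℤ.+-mono-≤
        (∑-mono m (λ o l → ⟨⟩-mono (T? _) (L.T? _) (proj₂ (hT _ (s+<p l)))))
        (∑-mono u (λ o l → ⟨⟩-mono (G₁? _) (L.G₁? _) (λ g → trans (hF _ (ℕ.<-≤-trans l u≤p)) g))))
        (∑-mono u (λ o l → ⟨⟩-mono (T₁? _) (L.T₁? _) (hT₁ _ (ℕ.<-≤-trans l u≤p)))))
        (∑-mono u (λ o l → ⟨⟩-mono (G₃? _) (L.G₃? _) (hG₃ _ (v+<p l)))))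
        (∑-mono u (λ o l → ⟨⟩-mono (H? _) (L.H? _) (λ g → trans (hF _ (v+<p l)) g)))) }
    where open Chain C
          open Facts C
          module L = Labels D

  swap : Chain → Chain
  swap C = transport-good C D 3U≤ 3V≤ refl refl refl
    (λ _ _ → (λ (f , y , z) → f , z , y) , (λ (f , y , z) → f , z , y)) (λ _ _ → refl)
    (λ _ _ (f , y , z) → f , z , y) (λ _ _ (f , y , z) → f , z , y)
    where
    open Chain C
    D : Data
    D = record { u = u ; e = e ; m = m ; M = M ; hy = hz ; hz = hy ; V = U ; U = V ; n₀ = n₀ ; δ = δ ; ω = ω ; υ = ζ ; ζ = υ ; ey = ez ; ez = ey
      ; col = col ; pos = pos ; Y = Z ; Z = Y ; F = F ; col< = col< ; pos< = pos< ; pos-col = pos-col ; col-pos = col-pos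
      ; M≥1 = M≥1 ; hy≥1 = hz≥1 ; hz≥1 = hy≥1 ; 0≤Y = 0≤Z ; 0≤Z = 0≤Y ; Y≤ = Z≤ ; Z≤ = Y≤ ; V≤ = U≤ ; U≤ = V≤
      ; u≤ey = u≤ez ; ey≤v = ez≤v ; u≤ez = u≤ey ; ez≤v = ey≤v ; ey+ez = trans (ℤ.+-comm (+ ez) (+ ey)) ey+ez ; δ≡ = δ≡
      ; eqn = λ i l → trans (lem (+ col i * M) (Z i) (Y i)) (eqn i l)
      ; col-step = col-step ; Y-step = Z-step ; Z-step = Y-step ; ω≡ = ω≡ }
      where lem : ∀ a b c → a + b + c ≡ a + c + b
            lem a b c = (lin≡ (a ∷ b ∷ c ∷ []) (#0 :+ #1 :+ #2) (#0 :+ #2 :+ #1) [] [] refl)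

  module Reversal (C : Chain) where
    open Chain C
    open Facts C
    ρ : ℕ → ℕ
    ρ i = p ℕ.∸ suc i
    ρ< : ∀ {i} → i ℕ.< p → ρ i ℕ.< p
    ρ< {i} l = ℕ.∸-monoʳ-< {p} {suc i} {0} (s≤s z≤n) l
    ρ+ : ∀ {i} → i ℕ.< p → + ρ i + + i + 1ℤ ≡ + p
    ρ+ {i} l = trans (trans (ℤ.+-assoc (+ ρ i) (+ i) 1ℤ) (cong (λ z → + (ρ i ℕ.+ z)) (ℕ.+-comm i 1))) (cong +_ (ℕ.m∸n+n≡m l))
    ρρ : ∀ {i} → i ℕ.< p → ρ (ρ i) ≡ i
    ρρ {i} l = let a = ρ+ l ; b = ρ+ (ρ< l) in ℤ.+-injective (lin≡ (+ ρ (ρ i) ∷ + i ∷ + ρ i ∷ + p ∷ []) #0 #1 (#2 :+ #1 :+ $1 =~ #3 by a ∷ #0 :+ #2 :+ $1 == #3 by b ∷ []) [] refl)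
    ρ-suc : ∀ {i} → suc i ℕ.< p → suc (ρ (suc i)) ≡ ρ i
    ρ-suc {i} l = let a = ρ+ l ; b = ρ+ (ℕ.<-trans (ℕ.n<1+n i) l) in
      ℤ.+-injective (lin≡ (+ ρ (suc i) ∷ + ρ i ∷ + i ∷ + p ∷ []) ($1 :+ #0) #1 (#0 :+ ($1 :+ #2) :+ $1 == #3 by a ∷ #1 :+ #2 :+ $1 =~ #3 by b ∷ []) [] refl)
    back : ∀ {f : ℕ → ℤ} {c k} i → suc i ℕ.< p → (∀ j → suc j ℕ.< p → ∃ λ γ → f (suc j) ≡ f j + c + γ * k) → ∃ λ γ → f (ρ (suc i)) ≡ f (ρ i) + - c + γ * k
    back {f} {c} {k} i l h = let γ , q = h (ρ (suc i)) (ℕ.≤-<-trans (ℕ.≤-reflexive (ρ-suc l)) (ρ< (ℕ.<-trans (ℕ.n<1+n i) l))) ; q′ = trans (cong f (sym (ρ-suc l))) q in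
      - γ , (lin≡ (f (ρ (suc i)) ∷ f (ρ i) ∷ c ∷ γ ∷ k ∷ []) #0 (#1 :+ :- #2 :+ :- #3 :* #4) (#1 =~ #0 :+ #2 :+ #3 :* #4 by q′ ∷ []) [] refl)
    ω′ : (∃ λ κ → ω ≡ + (u ℕ.* v) + κ * + p) ⊎ (∃ λ κ → ω ≡ - + (u ℕ.* v) + κ * + p) → (∃ λ κ → - ω ≡ + (u ℕ.* v) + κ * + p) ⊎ (∃ λ κ → - ω ≡ - + (u ℕ.* v) + κ * + p)
    ω′ (inj₁ (κ , h)) = inj₂ (- κ , (lin≡ (ω ∷ + (u ℕ.* v) ∷ κ ∷ + p ∷ []) (:- #0) (:- #1 :+ :- #2 :* #3) (#0 =~ #1 :+ #2 :* #3 by h ∷ []) [] refl))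
    ω′ (inj₂ (κ , h)) = inj₁ (- κ , (lin≡ (ω ∷ + (u ℕ.* v) ∷ κ ∷ + p ∷ []) (:- #0) (#1 :+ :- #2 :* #3) (#0 =~ :- #1 :+ #2 :* #3 by h ∷ []) [] refl))
    δ′ : (δ ≡ 1ℤ) ⊎ (δ ≡ - 1ℤ) → (- δ ≡ 1ℤ) ⊎ (- δ ≡ - 1ℤ)
    δ′ (inj₁ refl) = inj₂ refl
    δ′ (inj₂ refl) = inj₁ refl
    D : Data
    D = record { u = u ; e = e ; m = m ; M = M ; hy = hy ; hz = hz ; V = V ; U = U ; n₀ = n₀ + δ * (+ p - 1ℤ) ; δ = - δ ; ω = - ω ; υ = - υ ; ζ = - ζ ; ey = ey ; ez = ez
      ; col = λ i → col (ρ i) ; pos = λ x → ρ (pos x) ; Y = λ i → Y (ρ i) ; Z = λ i → Z (ρ i) ; F = λ i → F (ρ i)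
      ; col< = λ i l → col< (ρ i) (ρ< l) ; pos< = λ x l → ρ< (pos< x l)
      ; pos-col = λ i l → trans (cong ρ (pos-col (ρ i) (ρ< l))) (ρρ l) ; col-pos = λ x l → trans (cong col (ρρ (pos< x l))) (col-pos x l)
      ; M≥1 = M≥1 ; hy≥1 = hy≥1 ; hz≥1 = hz≥1 ; 0≤Y = λ i → 0≤Y (ρ i) ; 0≤Z = λ i → 0≤Z (ρ i) ; Y≤ = λ i → Y≤ (ρ i) ; Z≤ = λ i → Z≤ (ρ i)
      ; V≤ = V≤ ; U≤ = U≤ ; u≤ey = u≤ey ; ey≤v = ey≤v ; u≤ez = u≤ez ; ez≤v = ez≤v ; ey+ez = ey+ez ; δ≡ = δ′ δ≡
      ; eqn = λ i l → let a = eqn (ρ i) (ρ< l) ; b = cong (δ *_) (ρ+ l) in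
          (lin≡ (+ col (ρ i) ∷ M ∷ Y (ρ i) ∷ Z (ρ i) ∷ n₀ ∷ δ ∷ + p ∷ + i ∷ F (ρ i) ∷ N ∷ + ρ i ∷ []) (#0 :* #1 :+ #2 :+ #3) (#4 :+ #5 :* (#6 :- $1) :+ :- #5 :* #7 :+ #8 :* #9) (#0 :* #1 :+ #2 :+ #3 == #4 :+ #5 :* #10 :+ #8 :* #9 by a ∷ #5 :* (#10 :+ #7 :+ $1) == #5 :* #6 by b ∷ []) [] refl)
      ; col-step = λ i l → back {λ k → + col k} {ω} {+ p} i l col-step ; Y-step = λ i l → back {Y} {υ} {N} i l Y-step ; Z-step = λ i l → back {Z} {ζ} {N} i l Z-step
      ; ω≡ = ω′ ω≡ }

    reverse : Chain
    reverse = transport-good C D 3V≤ 3U≤ refl refl refl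
      (λ x l → let r = ρρ (pos< x l) in
       (λ (f , y , z) → subst T r (f , y , z)) , (λ t → subst T (sym r) t))
      (λ x l → cong F (ρρ (pos< x l)))
      (λ x l t → subst T₁ (sym (ρρ (pos< x l))) t)
      (λ x l t → subst G₃ (sym (ρρ (pos< x l))) t)

  open Reversal public using (reverse)

-- Two points of the kind T at distance 1 or 2.

module Gap where
  open Lin
  open Sums
  open ChainM
  open Count
  open Steps

  -- The bound is attained by 0, 3, 6, ... when `n` is 1 modulo 3; this pattern is the extremal case
  -- below.
  sparse≤ : ∀ {P : ℕ → Set} (P? : ∀ i → Dec (P i)) n → (∀ i → suc i ℕ.< n → P i → P (suc i) → ⊥) → (∀ i → suc (suc i) ℕ.< n → P i → P (suc (suc i)) → ⊥) →
    + 3 * ∑ n (λ i → ⟨ P? i ⟩) ≤ + n + + 2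
  sparse≤ P? 0 _ _ = +≤+ z≤n
  sparse≤ P? 1 _ _ = let a = ⟨⟩≤1 (P? 0) in (lin≤ (⟨ P? 0 ⟩ ∷ []) ($3 :* ($0 :+ #0)) ($1 :+ $2) (#0 <= $1 by a ∷ []) (1 ∷ 3 ∷ []) [] refl)
  sparse≤ P? 2 h _ = let a = ⟨⟩-pair {R = ⊥} (P? 0) (P? 1) (no λ ()) (h 0 ℕ.≤-refl) in (lin≤ (⟨ P? 0 ⟩ ∷ ⟨ P? 1 ⟩ ∷ []) ($3 :* ($0 :+ #0 :+ #1)) ($2 :+ $2) (#0 :+ #1 <= $1 :+ $0 by a ∷ []) (1 ∷ 3 ∷ []) [] refl)
  sparse≤ P? (suc (suc (suc n))) h k =
    let ih = sparse≤ P? n (λ i l → h i (ℕ.≤-trans l (ℕ.m≤n+m n 3))) (λ i l → k i (ℕ.≤-trans l (ℕ.m≤n+m n 3)))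
        t = triple (P? n) (P? (1 ℕ.+ n)) (P? (2 ℕ.+ n)) (h n (s≤s (s≤s (ℕ.n≤1+n n)))) (h (suc n) ℕ.≤-refl) (k n ℕ.≤-refl)
    in (lin≤ (∑ n (λ i → ⟨ P? i ⟩) ∷ ⟨ P? n ⟩ ∷ ⟨ P? (1 ℕ.+ n) ⟩ ∷ ⟨ P? (2 ℕ.+ n) ⟩ ∷ + n ∷ []) ($3 :* (#0 :+ #1 :+ #2 :+ #3)) ($3 :+ #4 :+ $2) (#1 :+ #2 :+ #3 <= $1 by t ∷ $3 :* #0 <= #4 :+ $2 by ih ∷ []) (1 ∷ 3 ∷ []) [] refl)
    where
    triple : ∀ {A B C : Set} (a : Dec A) (b : Dec B) (c : Dec C) → (A → B → ⊥) → (B → C → ⊥) → (A → C → ⊥) → ⟨ a ⟩ + ⟨ b ⟩ + ⟨ c ⟩ ≤ 1ℤ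
    triple (yes a) (yes b) _ h _ _ = ⊥-elim (h a b)
    triple (yes a) (no _) (yes c) _ _ k = ⊥-elim (k a c)
    triple (yes a) (no _) (no _) _ _ _ = ≤-refl
    triple (no _) (yes b) (yes c) _ h _ = ⊥-elim (h b c)
    triple (no _) (yes b) (no _) _ _ _ = ≤-refl
    triple (no _) (no _) (yes c) _ _ _ = ≤-refl
    triple (no _) (no _) (no _) _ _ _ = +≤+ z≤n

  module Gaps (C : Chain) where
    open Chain C
    open Facts C
    open Counts C
    open StepFacts C

    Gap : ℕ → Set
    Gap k = ∃ λ i → k ℕ.+ i ℕ.< p × T₄ i × T₄ (k ℕ.+ i)

    private
      gap? : ∀ k → Dec (Gap k)
      gap? k with ℕ.anyUpTo? (λ i → (k ℕ.+ i ℕ.<? p) ×-dec (T₄? i ×-dec T₄? (k ℕ.+ i))) p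
      ... | yes (i , _ , h) = yes (i , h)
      ... | no ¬h = no (λ (i , l , h) → ¬h (i , ℕ.≤-<-trans (ℕ.m≤n+m i k) l , l , h))

      module _ (¬1 : ¬ Gap 1) (¬2 : ¬ Gap 2) where
        from : ∀ k → k ℕ.≤ p → + 3 * ∑ (p ℕ.∸ k) (λ i → ⟨ T₄? (k ℕ.+ i) ⟩) + + k ≤ + p + + 2
        from k k≤p = let e = ℕ.m+[n∸m]≡n k≤p ; e′ = cong +_ e
                         b = sparse≤ (λ i → T₄? (k ℕ.+ i)) (p ℕ.∸ k)
                               (λ i l t t′ → ¬1 (k ℕ.+ i , in-p {i = suc i} e l (ℕ.+-suc k i) , t , subst T₄ (ℕ.+-suc k i) t′))
                               (λ i l t t′ → let r = trans (ℕ.+-suc k (suc i)) (cong suc (ℕ.+-suc k i)) in ¬2 (k ℕ.+ i , in-p {i = suc (suc i)} e l r , t , subst T₄ r t′))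
          in (lin≤ (∑ (p ℕ.∸ k) (λ i → ⟨ T₄? (k ℕ.+ i) ⟩) ∷ + k ∷ + p ∷ + (p ℕ.∸ k) ∷ []) ($3 :* #0 :+ #1) (#2 :+ $2) ($3 :* #0 <= #3 :+ $2 by b ∷ #1 :+ #3 == #2 by e′ ∷ []) [] [] refl)
          where in-p : ∀ {i r} → k ℕ.+ (p ℕ.∸ k) ≡ p → i ℕ.< p ℕ.∸ k → k ℕ.+ i ≡ r → r ℕ.< p
                in-p e l refl = ℕ.<-≤-trans (ℕ.+-monoʳ-< k l) (ℕ.≤-reflexive e)
        cut : ∀ k → k ℕ.≤ p → τ₄ ≡ ∑ k (λ i → ⟨ T₄? i ⟩) + ∑ (p ℕ.∸ k) (λ i → ⟨ T₄? (k ℕ.+ i) ⟩)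
        cut k k≤p = trans (cong (λ z → ∑ z (λ i → ⟨ T₄? i ⟩)) (sym (ℕ.m+[n∸m]≡n k≤p))) (∑-split {λ i → ⟨ T₄? i ⟩} k (p ℕ.∸ k))
        P : + p ≡ + u + + e + + u + + m
        P = refl
        7≤p : 7 ℕ.≤ p
        7≤p = ℤ.drop‿+≤+ p≥7
        -- Without gaps `3 τ ≤ p + 2`, whereas `τ ≥ A - u` gives `3 τ ≥ 2 p + 1 - 3 u`. Hence
        -- `p ≤ 3 u + 1`, and `3 v < p` leaves only `e = 0` and `p = 3 u + 1`.
        e0 : + e ≡ 0ℤ
        e0 = let b = from 0 z≤n ; c = cut 0 z≤n in
          ≤-antisym (lin≤ (+ e ∷ τ₄ ∷ ∑ p (λ i → ⟨ T₄? i ⟩) ∷ τ ∷ A ∷ + u ∷ + p ∷ + m ∷ []) #0 $0 (#1 == $0 :+ #2 by c ∷ #3 <= #1 by τ≤τ₄ ∷ #4 <= #3 :+ #5 by τ≥ ∷ $3 :* #2 :+ $0 <= #6 :+ $2 by b ∷ $2 :* (#5 :+ #0 :+ #5 :+ #7) :+ $1 <= $3 :* #4 by large ∷ #5 :+ $2 :* #0 :+ $1 <= #7 by 3v<p ∷ #6 == #5 :+ #0 :+ #5 :+ #7 by P ∷ []) (3 ∷ 3 ∷ 3 ∷ 3 ∷ []) [] refl) e≥0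
        p≡ : + p ≡ + 3 * + u + 1ℤ
        p≡ = let b = from 0 z≤n ; c = cut 0 z≤n in
          (≤-antisym (lin≤ (+ p ∷ + u ∷ τ₄ ∷ ∑ p (λ i → ⟨ T₄? i ⟩) ∷ τ ∷ A ∷ + e ∷ + m ∷ []) #0 ($3 :* #1 :+ $1) (#2 == $0 :+ #3 by c ∷ #4 <= #2 by τ≤τ₄ ∷ #5 <= #4 :+ #1 by τ≥ ∷ #0 == #1 :+ #6 :+ #1 :+ #7 by P ∷ $3 :* #3 :+ $0 <= #0 :+ $2 by b ∷ $2 :* (#1 :+ #6 :+ #1 :+ #7) :+ $1 <= $3 :* #5 by large ∷ []) (1 ∷ 3 ∷ 3 ∷ 3 ∷ 2 ∷ []) [] refl) (lin≤ (+ u ∷ + p ∷ τ₄ ∷ ∑ p (λ i → ⟨ T₄? i ⟩) ∷ τ ∷ A ∷ + e ∷ + m ∷ []) ($3 :* #0 :+ $1) #1 (#2 == $0 :+ #3 by c ∷ #4 <= #2 by τ≤τ₄ ∷ #5 <= #4 :+ #0 by τ≥ ∷ #0 :+ $2 :* #6 :+ $1 <= #7 by 3v<p ∷ $0 <= #6 by e≥0 ∷ $3 :* #3 :+ $0 <= #1 :+ $2 by b ∷ $2 :* (#0 :+ #6 :+ #0 :+ #7) :+ $1 <= $3 :* #5 by large ∷ []) (1 ∷ 3 ∷ 3 ∷ 3 ∷ 2 ∷ 6 ∷ []) [] refl))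
        -- The total has to attain the bound of `sparse≤`. If the first `k` positions hold at most
        -- `k / 3` points, leaving out position `k` would already lose the equality.
        at : ∀ k → suc k ℕ.≤ p → ∑ k (λ i → ⟨ T₄? i ⟩) * + 3 ≤ + k → T₄ k
        at k l h with T₄? k in eq
        ... | yes t = t
        ... | no _ = let b = from (suc k) l ; c = cut (suc k) l ; z = cong ⟨_⟩ eq in
          ⊥-elim (lin⊥ (τ₄ ∷ ∑ k (λ i → ⟨ T₄? i ⟩) ∷ ⟨ T₄? k ⟩ ∷ ∑ (p ℕ.∸ suc k) (λ i → ⟨ T₄? (suc k ℕ.+ i) ⟩) ∷ τ ∷ A ∷ + u ∷ + p ∷ + e ∷ + m ∷ + k ∷ []) (#0 == #1 :+ #2 :+ #3 by c ∷ #2 == $0 by z ∷ #4 <= #0 by τ≤τ₄ ∷ #5 <= #4 :+ #6 by τ≥ ∷ #7 == #6 :+ #8 :+ #6 :+ #9 by P ∷ $3 :* #3 :+ ($1 :+ #10) <= #7 :+ $2 by b ∷ $2 :* (#6 :+ #8 :+ #6 :+ #9) :+ $1 <= $3 :* #5 by large ∷ #7 =~ $3 :* #6 :+ $1 by p≡ ∷ #1 :* $3 <= #10 by h ∷ []) (3 ∷ 3 ∷ 3 ∷ 3 ∷ 2 ∷ []) [] refl)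
        after : ∀ k → T₄ k → ∑ k (λ i → ⟨ T₄? i ⟩) * + 3 ≤ + k → 3 ℕ.+ k ℕ.< p → ∑ (3 ℕ.+ k) (λ i → ⟨ T₄? i ⟩) * + 3 ≤ + (3 ℕ.+ k)
        after k t h l = let a = ⟨⟩≤1 (T₄? k) ; b = ⟨⟩-no (T₄? (suc k)) (λ t′ → ¬1 (k , ℕ.<-trans (s≤s (ℕ.m≤n+m (suc k) 1)) l , t , t′))
                            c = ⟨⟩-no (T₄? (2 ℕ.+ k)) (λ t′ → ¬2 (k , ℕ.<-trans (ℕ.n<1+n _) l , t , t′)) in
          (lin≤ (∑ k (λ i → ⟨ T₄? i ⟩) ∷ ⟨ T₄? k ⟩ ∷ ⟨ T₄? (1 ℕ.+ k) ⟩ ∷ ⟨ T₄? (2 ℕ.+ k) ⟩ ∷ + k ∷ []) ((#0 :+ #1 :+ #2 :+ #3) :* $3) ($3 :+ #4) (#1 <= $1 by a ∷ #2 == $0 by b ∷ #3 == $0 by c ∷ #0 :* $3 <= #4 by h ∷ []) (1 ∷ 3 ∷ 3 ∷ 3 ∷ []) [] refl)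
        -- With gaps of exactly 3 the positions 0, 3, 6 carry T, so their columns are in arithmetic progression modulo p = 3u + 1.
        T0 : T₄ 0
        T0 = at 0 (ℕ.≤-trans (s≤s z≤n) 7≤p) ≤-refl
        c3 = after 0 T0 ≤-refl (ℕ.≤-trans (s≤s (s≤s (s≤s (s≤s z≤n)))) 7≤p)
        T3 : T₄ 3
        T3 = at 3 (ℕ.≤-trans (s≤s (s≤s (s≤s (s≤s z≤n)))) 7≤p) c3
        T6 : T₄ 6
        T6 = at 6 7≤p (after 3 T3 c3 7≤p)
        impossible : ⊥
        impossible = let
            open Step base using (d)
            open Jumps base using (jump)
            j₁ = jump 0 3 (ℕ.≤-trans (s≤s (s≤s (s≤s (s≤s z≤n)))) 7≤p) ; j₂ = jump 3 3 7≤p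
            open Jump j₁ using () renaming (γ to γ₁; colJ to ca)
            open Jump j₂ using () renaming (γ to γ₂; colJ to cb)
            l0 = +≤+ (proj₁ T0) ; l3 = +≤+ (proj₁ T3) ; l6 = +≤+ (proj₁ T6)
            r0 = +≤+ (col< 0 (ℕ.≤-trans (s≤s z≤n) 7≤p)) ; r3 = +≤+ (col< 3 (ℕ.≤-trans (s≤s (s≤s (s≤s (s≤s z≤n)))) 7≤p)) ; r6 = +≤+ (col< 6 7≤p)
            -- The columns at 0, 3 and 6 lie in `[2 u , 3 u]`, so their second difference is smaller
            -- than `p` and both triple steps wrap equally often.
            g : (γ₁ - γ₂) ≡ 0ℤ
            g = small-multiple (γ₁ - γ₂) p≥1
              (lin≤ (γ₁ ∷ γ₂ ∷ + p ∷ + col 3 ∷ + e ∷ + col 0 ∷ d ∷ + col 6 ∷ + u ∷ []) ((#0 :- #1) :* #2 :+ $1) #2 ($1 :+ #3 <= #2 by r3 ∷ #4 =~ $0 by e0 ∷ #3 =~ #5 :+ $3 :* #6 :+ #0 :* #2 by ca ∷ #7 == #3 :+ $3 :* #6 :+ #1 :* #2 by cb ∷ #8 :+ #4 :+ #8 <= #5 by l0 ∷ #8 :+ #4 :+ #8 <= #7 by l6 ∷ #2 == $3 :* #8 :+ $1 by p≡ ∷ $2 <= #8 by u≥2 ∷ []) (1 ∷ 2 ∷ 2 ∷ []) [] refl)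
              (lin≤ (+ p ∷ γ₁ ∷ γ₂ ∷ + u ∷ + e ∷ + col 3 ∷ + col 0 ∷ d ∷ + col 6 ∷ []) (:- #0 :+ $1) ((#1 :- #2) :* #0) (#3 :+ #4 :+ #3 <= #5 by l3 ∷ #4 =~ $0 by e0 ∷ #5 == #6 :+ $3 :* #7 :+ #1 :* #0 by ca ∷ #8 =~ #5 :+ $3 :* #7 :+ #2 :* #0 by cb ∷ $1 :+ #6 <= #0 by r0 ∷ $1 :+ #8 <= #0 by r6 ∷ #0 == $3 :* #3 :+ $1 by p≡ ∷ $2 <= #3 by u≥2 ∷ []) (1 ∷ 2 ∷ 2 ∷ []) [] refl)
            g′ : (γ₁ - γ₂) * + p ≡ 0ℤ
            g′ = cong (_* + p) g
            fin : ∀ K c → (c ≡ 1ℤ) ⊎ (c ≡ - 1ℤ) → + 9 * d ≡ c + K * + p → ⊥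
            fin K c hc h = let
                c₁ : c ≤ 1ℤ
                c₁ = [ ≤-reflexive , (λ q → ≤-trans (≤-reflexive q) ℤ.-≤+) ]′ hc
                c₂ : - 1ℤ ≤ c
                c₂ = [ (λ q → ≤-trans ℤ.-≤+ (≤-reflexive (sym q))) , (λ q → ≤-reflexive (sym q)) ]′ hc
                -- Three times the common difference of the columns is `c` plus a multiple of `p`,
                -- and too small for a nonzero multiple; but it cannot be ± 1.
                z : (K + + 3 * γ₁) ≡ 0ℤ
                z = small-multiple (K + + 3 * γ₁) p≥1
                  (lin≤ (K ∷ γ₁ ∷ + p ∷ d ∷ c ∷ + col 3 ∷ + col 0 ∷ + col 6 ∷ γ₂ ∷ + u ∷ + e ∷ []) ((#0 :+ $3 :* #1) :* #2 :+ $1) #2 ($9 :* #3 =~ #4 :+ #0 :* #2 by h ∷ :- $1 <= #4 by c₂ ∷ #5 =~ #6 :+ $3 :* #3 :+ #1 :* #2 by ca ∷ #7 =~ #5 :+ $3 :* #3 :+ #8 :* #2 by cb ∷ (#1 :- #8) :* #2 == $0 by g′ ∷ #9 :+ #10 :+ #9 <= #6 by l0 ∷ $1 :+ #7 <= #2 by r6 ∷ $2 <= #9 by u≥2 ∷ #10 =~ $0 by e0 ∷ #2 == $3 :* #9 :+ $1 by p≡ ∷ []) (2 ∷ 2 ∷ 2 ∷ 3 ∷ 3 ∷ 3 ∷ 3 ∷ 3 ∷ 3 ∷ 3 ∷ []) [] refl)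
                  (lin≤ (+ p ∷ K ∷ γ₁ ∷ d ∷ c ∷ + col 3 ∷ + col 0 ∷ + col 6 ∷ γ₂ ∷ + u ∷ + e ∷ []) (:- #0 :+ $1) ((#1 :+ $3 :* #2) :* #0) ($9 :* #3 == #4 :+ #1 :* #0 by h ∷ #4 <= $1 by c₁ ∷ #5 == #6 :+ $3 :* #3 :+ #2 :* #0 by ca ∷ #7 == #5 :+ $3 :* #3 :+ #8 :* #0 by cb ∷ (#2 :- #8) :* #0 =~ $0 by g′ ∷ #9 :+ #10 :+ #9 <= #7 by l6 ∷ $1 :+ #6 <= #0 by r0 ∷ $2 <= #9 by u≥2 ∷ #10 =~ $0 by e0 ∷ #0 == $3 :* #9 :+ $1 by p≡ ∷ []) (2 ∷ 2 ∷ 2 ∷ 3 ∷ 3 ∷ 3 ∷ 3 ∷ 3 ∷ 3 ∷ 3 ∷ []) [] refl)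
                z′ = cong (_* + p) z
                three : + 3 * (+ col 3 - + col 0) ≡ c
                three = (lin≡ (+ col 3 ∷ + col 0 ∷ c ∷ d ∷ γ₁ ∷ + p ∷ K ∷ []) ($3 :* (#0 :- #1)) #2 (#0 == #1 :+ $3 :* #3 :+ #4 :* #5 by ca ∷ (#6 :+ $3 :* #4) :* #5 == $0 by z′ ∷ $9 :* #3 == #2 :+ #6 :* #5 by h ∷ []) (3 ∷ []) refl)
              in no3 _ c hc three
            in [ (λ (K , h) → fin K 1ℤ (inj₁ refl) h) , (λ (K , h) → fin K (- 1ℤ) (inj₂ refl) h) ]′ (nine base e0 p≡)
          where
          no3 : ∀ x c → (c ≡ 1ℤ) ⊎ (c ≡ - 1ℤ) → + 3 * x ≡ c → ⊥
          no3 x c (inj₁ refl) h = case x ℤ.≤? 0ℤ of λ where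
            (yes q) → (lin⊥ (x ∷ []) (#0 <= $0 by q ∷ $3 :* #0 =~ $1 by h ∷ []) (3 ∷ []) [] refl)
            (no q) → let q = ≰⇒1+≤ q in (lin⊥ (x ∷ []) ($1 :+ $0 <= #0 by q ∷ $3 :* #0 == $1 by h ∷ []) (3 ∷ []) [] refl)
          no3 x c (inj₂ refl) h = case 0ℤ ℤ.≤? x of λ where
            (yes q) → (lin⊥ (x ∷ []) ($0 <= #0 by q ∷ $3 :* #0 == :- $1 by h ∷ []) (3 ∷ []) [] refl)
            (no q) → let q = ≰⇒1+≤ q in (lin⊥ (x ∷ []) ($1 :+ #0 <= $0 by q ∷ $3 :* #0 =~ :- $1 by h ∷ []) (3 ∷ []) [] refl)

    gap : Gap 1 ⊎ Gap 2
    gap with gap? 1 | gap? 2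
    ... | yes h | _ = inj₁ h
    ... | no _ | yes h = inj₂ h
    ... | no ¬1 | no ¬2 = ⊥-elim (impossible ¬1 ¬2)

-- The parity obstruction next to a point of the kind T.

module Parity where
  open import Data.Integer.DivMod using (_%ℕ_; _/ℕ_; a≡a%ℕn+[a/ℕn]*n; n%ℕd<d)
  open Lin
  open Sums
  open ChainM
  open Count
  open Steps
  open Gap
  open Sym

  -- A step no larger in any coordinate than the difference of two points of the kind T may be.
  record Unit (C : Chain) : Set where
    open Chain C
    field
      step : Step C
    open Step step public
    field
      θ≤ : θ ≤ V - hy
      -θ≤ : - θ ≤ V - hy
      η≤ : η ≤ U - hz
      -η≤ : - η ≤ U - hz
      d< : d + 1ℤ ≤ + m
      -d< : - d + 1ℤ ≤ + m

  halve : ∀ n → ∃ λ k → (n ≡ + 2 * k) ⊎ (n ≡ + 2 * k + 1ℤ)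
  halve n with n %ℕ 2 in eq | n%ℕd<d n 2 | a≡a%ℕn+[a/ℕn]*n n 2
  ... | 0 | _ | h = n /ℕ 2 , inj₁ (lin≡ (n ∷ n /ℕ 2 ∷ []) #0 ($2 :* #1) (#0 == $0 :+ #1 :* $2 by h ∷ []) [] refl)
  ... | 1 | _ | h = n /ℕ 2 , inj₂ (lin≡ (n ∷ n /ℕ 2 ∷ []) #0 ($2 :* #1 :+ $1) (#0 == $1 :+ #1 :* $2 by h ∷ []) [] refl)
  ... | suc (suc _) | s≤s (s≤s ()) | _

  ≡-1 : ∀ q → (0ℤ ≤ q → ⊥) → (q ≤ - + 2 → ⊥) → q ≡ - 1ℤ
  ≡-1 q a b = ≤-antisym
    (case 0ℤ ℤ.≤? q of λ where (yes h) → ⊥-elim (a h)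
                               (no h) → let h = ≰⇒1+≤ h in (lin≤ (q ∷ []) #0 (:- $1) ($1 :+ #0 <= $0 by h ∷ []) [] [] refl))
    (case q ℤ.≤? - + 2 of λ where (yes h) → ⊥-elim (b h)
                                  (no h) → let h = ≰⇒1+≤ h in (lin≤ (q ∷ []) (:- $1) #0 ($1 :+ :- $2 <= #0 by h ∷ []) [] [] refl))

  ≡0∨-1 : ∀ q → (1ℤ ≤ q → ⊥) → (q ≤ - + 2 → ⊥) → (q ≡ 0ℤ) ⊎ (q ≡ - 1ℤ)
  ≡0∨-1 q a b with 0ℤ ℤ.≤? q
  ... | yes h = inj₁ (≤-antisym (case 1ℤ ℤ.≤? q of λ where
            (yes k) → ⊥-elim (a k)
            (no k) → let k = ≰⇒1+≤ k in (lin≤ (q ∷ []) #0 $0 ($1 :+ #0 <= $1 by k ∷ []) [] [] refl)) h)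
  ... | no h = inj₂ (≡-1 q (λ k → h k) b)

  module Parities (C : Chain) where
    open Chain C
    open Facts C
    open Counts C
    open StepFacts C
    open Gaps C

    -- The positions registered by one of the five counts, with the condition on the column
    -- included.
    OK : ℕ → Set
    OK i = (col i ℕ.< u × (G₁ i ⊎ T₁ i)) ⊎ (((v ℕ.≤ col i) × col i ℕ.< s) × (G₃ i ⊎ H i)) ⊎ T₄ i
    OK? : ∀ i → Dec (OK i)
    OK? i = ((col i ℕ.<? u) ×-dec (G₁? i ⊎-dec T₁? i)) ⊎-dec ((((v ℕ.≤? col i) ×-dec (col i ℕ.<? s)) ×-dec (G₃? i ⊎-dec H? i)) ⊎-dec T₄? i)

    or≤ : ∀ {P Q R : Set} (a : Dec P) (b : Dec Q) (c : Dec R) → (P → Q → ⊥) → (P → R) → (Q → R) → ⟨ a ⟩ + ⟨ b ⟩ ≤ ⟨ c ⟩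
    or≤ (yes p) (yes q) c h _ _ = ⊥-elim (h p q)
    or≤ (yes p) (no _) c _ k _ = ≤-reflexive (sym (⟨⟩-yes c (k p)))
    or≤ (no _) b c _ _ l = ≤-trans (≤-reflexive (ℤ.+-identityˡ _)) (⟨⟩-mono b c l)

    OK≥ : A + + u ≤ ∑ p (λ i → ⟨ OK? i ⟩)
    OK≥ = let
        r = trans (reindex (λ i → ⟨ OK? i ⟩)) (col-split (λ x → ⟨ OK? (pos x) ⟩))
        a = ≤-trans (≤-reflexive (sym (∑-+ {λ o → ⟨ G₁? (pos o) ⟩} {λ o → ⟨ T₁? (pos o) ⟩} u))) (∑-mono u (λ o l →
              let c = subst (ℕ._< u) (sym (col-pos o (ℕ.<-≤-trans l u≤p))) l in
              or≤ (G₁? (pos o)) (T₁? (pos o)) (OK? (pos o)) (λ g t → case trans (sym g) (proj₁ t) of λ ()) (λ g → inj₁ (c , inj₁ g)) (λ t → inj₁ (c , inj₂ t))))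
        b = ∑-nonneg {λ o → ⟨ OK? (pos (u ℕ.+ o)) ⟩} e (λ _ _ → ⟨⟩≥0 (OK? _))
        c = ≤-trans (≤-reflexive (sym (∑-+ {λ o → ⟨ G₃? (pos (v ℕ.+ o)) ⟩} {λ o → ⟨ H? (pos (v ℕ.+ o)) ⟩} u))) (∑-mono u (λ o l →
              let w = sym (col-pos (v ℕ.+ o) (v+<p l)) ; c = subst (v ℕ.≤_) w (ℕ.m≤m+n v o) , subst (ℕ._< s) w (ℕ.+-monoʳ-< v l) in
              or≤ (G₃? (pos (v ℕ.+ o))) (H? (pos (v ℕ.+ o))) (OK? (pos (v ℕ.+ o))) (λ g t → case trans (sym (proj₁ g)) t of λ ())
                (λ g → inj₂ (inj₁ (c , inj₁ g))) (λ t → inj₂ (inj₁ (c , inj₂ t)))))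
        d = ∑-mono m (λ o l → ⟨⟩-mono (T? (pos (s ℕ.+ o))) (OK? (pos (s ℕ.+ o))) (λ t → inj₂ (inj₂ (subst (s ℕ.≤_) (sym (col-pos (s ℕ.+ o) (s+<p l))) (ℕ.m≤m+n s o) , t))))
      in (lin≤ (A ∷ + u ∷ ∑ p (λ i → ⟨ OK? i ⟩) ∷ τ ∷ g₁ ∷ t₁ ∷ g₃ ∷ h₃ ∷ ∑ u (λ o → ⟨ OK? (pos o) ⟩) ∷ ∑ e (λ o → ⟨ OK? (pos (u ℕ.+ o)) ⟩) ∷ ∑ u (λ o → ⟨ OK? (pos (v ℕ.+ o)) ⟩) ∷ ∑ m (λ o → ⟨ OK? (pos (s ℕ.+ o)) ⟩) ∷ []) (#0 :+ #1) #2 (#0 :+ #1 <= #3 :+ #4 :+ #5 :+ #6 :+ #7 by good ∷ #2 =~ #8 :+ #9 :+ #10 :+ #11 by r ∷ #4 :+ #5 <= #8 by a ∷ $0 <= #9 by b ∷ #6 :+ #7 <= #10 by c ∷ #3 <= #11 by d ∷ []) [] [] refl)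

    -- If no T has two good neighbours, then good positions are too scarce.
    no-isolation : (∀ i → 2 ℕ.+ i ℕ.< p → T₄ (suc i) → OK i → OK (2 ℕ.+ i) → ⊥) → ⊥
    no-isolation h = let
        q = p ℕ.∸ 2 ; E = ℕ.m+[n∸m]≡n {2} {p} (ℤ.drop‿+≤+ (≤-trans (+≤+ (s≤s (s≤s z≤n))) p≥7)) ; E′ = cong +_ E
        E₁ : 1 ℕ.+ (q ℕ.+ 1) ≡ p
        E₁ = trans (cong suc (ℕ.+-comm q 1)) E
        t = trans (cong (λ z → ∑ z (λ i → ⟨ T₄? i ⟩)) (sym E₁)) (∑-split {λ i → ⟨ T₄? i ⟩} 1 (q ℕ.+ 1))
        t′ = ∑-split {λ i → ⟨ T₄? (suc i) ⟩} q 1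
        x = ⟨⟩≤1 (T₄? 0) ; y = ⟨⟩≤1 (T₄? (suc (q ℕ.+ 0)))
        -- Each inner T costs at least one of its neighbours. With `τ₄ ≥ A - u` and at least `A + u`
        -- good positions, this yields `3 A + u ≤ 2 p + 2`, against `u ≥ 2`.
        a = ≤-trans (∑-mono q (λ i l → one (T₄? (suc i)) (OK? i) (OK? (2 ℕ.+ i)) (h i (ℕ.<-≤-trans (ℕ.+-monoʳ-< 2 l) (ℕ.≤-reflexive E)))))
              (≤-reflexive (trans (∑-+ {λ i → + 2 + - ⟨ OK? i ⟩} {λ i → - ⟨ OK? (2 ℕ.+ i) ⟩} q) (cong₂ _+_ (trans (∑-+ {λ i → + 2} {λ i → - ⟨ OK? i ⟩} q) (cong₂ _+_ (∑-const (+ 2) q) (∑-neg {λ i → ⟨ OK? i ⟩} q))) (∑-neg {λ i → ⟨ OK? (2 ℕ.+ i) ⟩} q))))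
        b = trans (cong (λ z → ∑ z (λ i → ⟨ OK? i ⟩)) (sym (trans (ℕ.+-comm q 2) E))) (∑-split {λ i → ⟨ OK? i ⟩} q 2)
        c = trans (cong (λ z → ∑ z (λ i → ⟨ OK? i ⟩)) (sym E)) (∑-split {λ i → ⟨ OK? i ⟩} 2 q)
        b₁ = count≤ (λ i → OK? (q ℕ.+ i)) 2 ; c₁ = count≤ OK? 2
      in (lin⊥ (+ q ∷ + u ∷ + e ∷ + m ∷ A ∷ ∑ p (λ i → ⟨ OK? i ⟩) ∷ τ₄ ∷ ⟨ T₄? 0 ⟩ ∷ ∑ (q ℕ.+ 1) (λ i → ⟨ T₄? (suc i) ⟩) ∷ ∑ q (λ i → ⟨ T₄? (suc i) ⟩) ∷ ⟨ T₄? (suc (q ℕ.+ 0)) ⟩ ∷ ∑ q (λ i → ⟨ OK? i ⟩) ∷ ∑ q (λ i → ⟨ OK? (2 ℕ.+ i) ⟩) ∷ ∑ 2 (λ i → ⟨ OK? (q ℕ.+ i) ⟩) ∷ ∑ 2 (λ i → ⟨ OK? i ⟩) ∷ τ ∷ []) ($2 :+ #0 == #1 :+ #2 :+ #1 :+ #3 by E′ ∷ #4 :+ #1 <= #5 by OK≥ ∷ #6 == $0 :+ #7 :+ #8 by t ∷ #8 == #9 :+ ($0 :+ #10) by t′ ∷ #7 <= $1 by x ∷ #10 <= $1 by y ∷ #9 <= #0 :* $2 :+ :- #11 :+ :- #12 by a ∷ #5 == #11 :+ #13 by b ∷ #5 == #14 :+ #12 by c ∷ #13 <= $2 by b₁ ∷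 #14 <= $2 by c₁ ∷ #15 <= #6 by τ≤τ₄ ∷ #4 <= #15 :+ #1 by τ≥ ∷ $2 :* (#1 :+ #2 :+ #1 :+ #3) :+ $1 <= $3 :* #4 by large ∷ $2 <= #1 by u≥2 ∷ []) (2 ∷ 2 ∷ []) [] refl)
      where
      one : ∀ {P Q R : Set} (a : Dec P) (b : Dec Q) (c : Dec R) → (P → Q → R → ⊥) → ⟨ a ⟩ ≤ + 2 + - ⟨ b ⟩ + - ⟨ c ⟩
      one (yes p) (yes q) (yes r) h = ⊥-elim (h p q r)
      one (yes p) (yes q) (no r) h = ≤-refl
      one (yes p) (no q) (yes r) h = ≤-refl
      one (yes p) (no q) (no r) h = +≤+ (s≤s z≤n)
      one (no p) (yes q) (yes r) h = ≤-refl
      one (no p) (yes q) (no r) h = +≤+ z≤n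
      one (no p) (no q) (yes r) h = +≤+ z≤n
      one (no p) (no q) (no r) h = +≤+ z≤n

    m<2s : + m ≤ + 2 * + s
    m<2s = (lin≤ (+ m ∷ + u ∷ + e ∷ A ∷ τ′ ∷ g₁ ∷ g₃ ∷ t₁ ∷ h₃ ∷ []) #0 ($2 :* (#1 :+ #2 :+ #1)) (#3 :+ #1 <= #4 :+ #5 :+ #6 by good′ ∷ #4 <= #1 :+ #2 :+ #1 by τ′≤s ∷ #5 :+ #7 <= #1 by g₁+t₁≤u ∷ $0 <= #7 by t₁≥0 ∷ #6 :+ #8 <= #1 by g₃+h₃≤u ∷ $0 <= #8 by h₃≥0 ∷ $0 <= #1 by u≥0 ∷ $0 <= #2 by e≥0 ∷ $2 :* (#1 :+ #2 :+ #1 :+ #0) :+ $1 <= $3 :* #3 by large ∷ []) (2 ∷ 3 ∷ 3 ∷ 3 ∷ 3 ∷ 3 ∷ 3 ∷ 3 ∷ 3 ∷ []) [] refl)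

    -- Twice a neighbouring point, compared with the point at i; (a , b , c) are the carries.
    record Near (i k : ℕ) (x y z a b c : ℤ) : Set where
      field
        2col : + 2 * + col k ≡ + 2 * + col i + x + a * + p
        2Y : + 2 * Y k ≡ + 2 * Y i + y + b * N
        2Z : + 2 * Z k ≡ + 2 * Z i + z + c * N
        2F : + 2 * F k ≡ + 2 * F i + a + b + c

    module _ {i k x y z a b c} (nb : Near i k x y z a b c) (k<p : k ℕ.< p) (i<p : i ℕ.< p) (t : T₄ i) (ok : OK k)
             (x< : x + 1ℤ ≤ + m) (-x< : - x + 1ℤ ≤ + m) (y≤ : y ≤ V - hy) (-y≤ : - y ≤ V - hy) (z≤ : z ≤ U - hz) (-z≤ : - z ≤ U - hz) where
      open Near nb
      private
        ty = proj₁ (proj₂ (proj₂ t))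
        tz = proj₂ (proj₂ (proj₂ t))
        Yi = Y≤ i
        Zi = Z≤ i
        Yk = Y≤ k
        Zk = Z≤ k
        Yk0 = 0≤Y k
        Zk0 = 0≤Z k
        s≤ = +≤+ (proj₁ t)
        i< = +≤+ (col< i i<p)
        k< = +≤+ (col< k k<p)
        k0 : 0ℤ ≤ + col k
        k0 = +≤+ z≤n
        fi : F i ≡ + 2
        fi = proj₁ (proj₂ t)
        P : + p ≡ + u + + e + + u + + m
        P = refl

        -- An odd carry moves `Y` away from the top by half of `N` or more. Because `3 V < N`, only
        -- the carry -1 keeps it in `[0 , N)`, and the new value lies near `N / 2`, which is not
        -- top.
        Y-low : ∀ q → b ≡ + 2 * q + 1ℤ → b ≡ - 1ℤ
        Y-low q h = trans h (cong (λ q → + 2 * q + 1ℤ) (≡-1 q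
          (λ l → let r = trans (cong (λ z → + 2 * Y i + y + z * N) h) refl in (lin⊥ (N ∷ V ∷ Y i ∷ Y k ∷ hy ∷ q ∷ y ∷ []) (#0 :- #1 <= #2 by ty ∷ #3 :+ #4 <= #0 by Yk ∷ $0 <= #5 by l ∷ $1 <= #4 by hy≥1 ∷ $1 <= #0 by N≥1 ∷ $2 :* #3 =~ $2 :* #2 :+ #6 :+ ($2 :* #5 :+ $1) :* #0 by 2Y′ ∷ :- #6 <= #1 :- #4 by -y≤ ∷ $3 :* #1 :+ $1 <= #0 by 3V<N ∷ []) (2 ∷ 2 ∷ 2 ∷ 3 ∷ 0 ∷ []) ((2 , 4) ∷ (2 , 4) ∷ []) refl))
          (λ l → (lin⊥ (Y k ∷ Y i ∷ y ∷ q ∷ N ∷ hy ∷ V ∷ []) ($2 :* #0 == $2 :* #1 :+ #2 :+ ($2 :* #3 :+ $1) :* #4 by 2Y′ ∷ #1 :+ #5 <= #4 by Yi ∷ $0 <= #0 by Yk0 ∷ #2 <= #6 :- #5 by y≤ ∷ #3 <= :- $2 by l ∷ $1 <= #5 by hy≥1 ∷ $1 <= #4 by N≥1 ∷ $3 :* #6 :+ $1 <= #4 by 3V<N ∷ []) (3 ∷ 6 ∷ 6 ∷ 3 ∷ 6 ∷ 9 ∷ 2 ∷ []) ((4 , 6) ∷ (4 , 6) ∷ (4 , 6) ∷ (4 , 6) ∷ (4 , 6) ∷ (4 , 6) ∷ []) refl))))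
          where 2Y′ = trans 2Y (cong (λ z → + 2 * Y i + y + z * N) h)
        Z-low : ∀ q → c ≡ + 2 * q + 1ℤ → c ≡ - 1ℤ
        Z-low q h = trans h (cong (λ q → + 2 * q + 1ℤ) (≡-1 q
          (λ l → (lin⊥ (N ∷ U ∷ Z i ∷ Z k ∷ hz ∷ q ∷ z ∷ []) (#0 :- #1 <= #2 by tz ∷ #3 :+ #4 <= #0 by Zk ∷ $0 <= #5 by l ∷ $1 <= #4 by hz≥1 ∷ $1 <= #0 by N≥1 ∷ $2 :* #3 =~ $2 :* #2 :+ #6 :+ ($2 :* #5 :+ $1) :* #0 by 2Z′ ∷ :- #6 <= #1 :- #4 by -z≤ ∷ $3 :* #1 :+ $1 <= #0 by 3U<N ∷ []) (2 ∷ 2 ∷ 2 ∷ 3 ∷ 0 ∷ []) ((2 , 4) ∷ (2 , 4) ∷ []) refl))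
          (λ l → (lin⊥ (Z k ∷ Z i ∷ z ∷ q ∷ N ∷ hz ∷ U ∷ []) ($2 :* #0 == $2 :* #1 :+ #2 :+ ($2 :* #3 :+ $1) :* #4 by 2Z′ ∷ #1 :+ #5 <= #4 by Zi ∷ $0 <= #0 by Zk0 ∷ #2 <= #6 :- #5 by z≤ ∷ #3 <= :- $2 by l ∷ $1 <= #5 by hz≥1 ∷ $1 <= #4 by N≥1 ∷ $3 :* #6 :+ $1 <= #4 by 3U<N ∷ []) (3 ∷ 6 ∷ 6 ∷ 3 ∷ 6 ∷ 9 ∷ 2 ∷ []) ((4 , 6) ∷ (4 , 6) ∷ (4 , 6) ∷ (4 , 6) ∷ (4 , 6) ∷ (4 , 6) ∷ []) refl))))
          where 2Z′ = trans 2Z (cong (λ y → + 2 * Z i + z + y * N) h)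
        ¬TopY : b ≡ - 1ℤ → TopY k → ⊥
        ¬TopY h t = let 2Y′ = trans 2Y (cong (λ z → + 2 * Y i + y + z * N) h) in
          (lin⊥ (N ∷ V ∷ Y k ∷ Y i ∷ hy ∷ y ∷ []) (#0 :- #1 <= #2 by t ∷ #3 :+ #4 <= #0 by Yi ∷ $1 <= #4 by hy≥1 ∷ $2 :* #2 == $2 :* #3 :+ #5 :+ :- $1 :* #0 by 2Y′ ∷ #5 <= #1 :- #4 by y≤ ∷ $3 :* #1 :+ $1 <= #0 by 3V<N ∷ []) (2 ∷ 2 ∷ 3 ∷ []) [] refl)

      -- As `Y k` is not top, a column wrap of +1/2 is impossible: it would leave only the kind T.
      -- Otherwise `k` is a G₃, and then `Z` lies below its top, or F = 0, and then `Z` has wrapped.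
      -- Either way the halfway value `Z i + z / 2` has left the top window.
      near-xy′ : ∀ q w → a ≡ + 2 * q + 1ℤ → b ≡ - 1ℤ → c ≡ + 2 * w → (q ≡ 0ℤ) ⊎ (q ≡ - 1ℤ) → (w ≡ 0ℤ) ⊎ (w ≡ - 1ℤ) →
        (+ 2 * N ≤ + 2 * Z i + z) ⊎ (+ 2 * Z i + z + + 2 ≤ + 2 * N - + 2 * U)
      near-xy′ q w ha b≡ hc (inj₁ refl) _ = let 2col′ = trans 2col (cong (λ z → + 2 * + col i + x + z * + p) ha) in ⊥-elim (case ok of λ where
                (inj₁ (l , _)) → let l = +≤+ l in (lin⊥ (+ u ∷ + e ∷ + col i ∷ + col k ∷ x ∷ + p ∷ + m ∷ []) (#0 :+ #1 :+ #0 <= #2 by s≤ ∷ $1 :+ #3 <= #0 by l ∷ $0 <= #0 by u≥0 ∷ $0 <= #1 by e≥0 ∷ $2 :* #3 =~ $2 :* #2 :+ #4 :+ $1 :* #5 by 2col′ ∷ :- #4 :+ $1 <= #6 by -x< ∷ #5 =~ #0 :+ #1 :+ #0 :+ #6 by P ∷ []) (2 ∷ 2 ∷ 4 ∷ 3 ∷ []) [] refl)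
                (inj₂ (inj₁ ((_ , l) , _))) → let l = +≤+ l in (lin⊥ (+ u ∷ + e ∷ + col i ∷ + col k ∷ x ∷ + p ∷ + m ∷ []) (#0 :+ #1 :+ #0 <= #2 by s≤ ∷ $1 :+ #3 <= #0 :+ #1 :+ #0 by l ∷ $0 <= #0 by u≥0 ∷ $2 :* #3 =~ $2 :* #2 :+ #4 :+ $1 :* #5 by 2col′ ∷ :- #4 :+ $1 <= #6 by -x< ∷ #5 =~ #0 :+ #1 :+ #0 :+ #6 by P ∷ $0 <= #1 by e≥0 ∷ []) (2 ∷ 2 ∷ 2 ∷ []) [] refl)
                (inj₂ (inj₂ (_ , _ , ty′ , _))) → ¬TopY b≡ ty′)
      near-xy′ q w ha b≡ hc (inj₂ refl) (inj₁ refl) = let 2Z′ = trans 2Z (cong (λ y → + 2 * Z i + z + y * N) hc) in case ok of λ where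
                (inj₁ (_ , inj₁ f)) → ⊥-elim (lin⊥ (F i ∷ F k ∷ a ∷ b ∷ c ∷ []) (#0 =~ $2 by fi ∷ #1 == $0 by f ∷ $2 :* #1 =~ $2 :* #0 :+ #2 :+ #3 :+ #4 by 2F ∷ #2 =~ $2 :* :- $1 :+ $1 by ha ∷ #3 =~ :- $1 by b≡ ∷ #4 =~ $0 by hc ∷ []) (2 ∷ 2 ∷ []) [] refl)
                (inj₁ (_ , inj₂ (_ , ty′ , _))) → ⊥-elim (¬TopY b≡ ty′)
                (inj₂ (inj₁ (_ , inj₁ (_ , _ , nz)))) → inj₂ (lin≤ (Z i ∷ z ∷ N ∷ U ∷ Z k ∷ []) ($2 :* #0 :+ #1 :+ $2) ($2 :* #2 :- $2 :* #3) ($1 :+ #4 <= #2 :- #3 by nz ∷ $2 :* #4 =~ $2 :* #0 :+ #1 :+ $0 :* #2 by 2Z′ ∷ []) (1 ∷ 2 ∷ []) [] refl)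
                (inj₂ (inj₁ (_ , inj₂ f))) → ⊥-elim (lin⊥ (F i ∷ F k ∷ a ∷ b ∷ c ∷ []) (#0 == $2 by fi ∷ #1 =~ $2 by f ∷ $2 :* #1 == $2 :* #0 :+ #2 :+ #3 :+ #4 by 2F ∷ #2 == $2 :* :- $1 :+ $1 by ha ∷ #3 == :- $1 by b≡ ∷ #4 == $0 by hc ∷ []) (2 ∷ 2 ∷ []) [] refl)
                (inj₂ (inj₂ (_ , _ , ty′ , _))) → ⊥-elim (¬TopY b≡ ty′)
      near-xy′ q w ha b≡ hc (inj₂ refl) (inj₂ refl) = let 2Z′ = trans 2Z (cong (λ y → + 2 * Z i + z + y * N) hc) in case ok of λ where
                (inj₁ (_ , inj₁ f)) → inj₁ (lin≤ (N ∷ Z i ∷ z ∷ Z k ∷ []) ($2 :* #0) ($2 :* #1 :+ #2) ($0 <= #3 by Zk0 ∷ $2 :* #3 == $2 :* #1 :+ #2 :+ :- $2 :* #0 by 2Z′ ∷ []) (1 ∷ 2 ∷ []) [] refl)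
                (inj₁ (_ , inj₂ (_ , ty′ , _))) → ⊥-elim (¬TopY b≡ ty′)
                (inj₂ (inj₁ (_ , inj₁ (f , _ , _)))) → ⊥-elim (lin⊥ (F i ∷ F k ∷ a ∷ b ∷ c ∷ []) (#0 == $2 by fi ∷ #1 =~ $1 by f ∷ $2 :* #1 == $2 :* #0 :+ #2 :+ #3 :+ #4 by 2F ∷ #2 == $2 :* :- $1 :+ $1 by ha ∷ #3 == :- $1 by b≡ ∷ #4 == :- $2 by hc ∷ []) (2 ∷ 2 ∷ []) [] refl)
                (inj₂ (inj₁ (_ , inj₂ f))) → ⊥-elim (lin⊥ (F i ∷ F k ∷ a ∷ b ∷ c ∷ []) (#0 == $2 by fi ∷ #1 =~ $2 by f ∷ $2 :* #1 == $2 :* #0 :+ #2 :+ #3 :+ #4 by 2F ∷ #2 == $2 :* :- $1 :+ $1 by ha ∷ #3 == :- $1 by b≡ ∷ #4 == :- $2 by hc ∷ []) (2 ∷ 2 ∷ []) [] refl)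
                (inj₂ (inj₂ (_ , _ , ty′ , _))) → ⊥-elim (¬TopY b≡ ty′)

      near-xy : ∀ q r w → a ≡ + 2 * q + 1ℤ → b ≡ + 2 * r + 1ℤ → c ≡ + 2 * w → (+ 2 * N ≤ + 2 * Z i + z) ⊎ (+ 2 * Z i + z + + 2 ≤ + 2 * N - + 2 * U)
      near-xy q r w ha hb hc = near-xy′ q w ha (Y-low r hb) hc
          (≡0∨-1 q
            (λ l → let 2col′ = trans 2col (cong (λ z → + 2 * + col i + x + z * + p) ha) in
               (lin⊥ (+ u ∷ + e ∷ + col i ∷ + col k ∷ + p ∷ q ∷ x ∷ + m ∷ []) (#0 :+ #1 :+ #0 <= #2 by s≤ ∷ $1 :+ #3 <= #4 by k< ∷ $1 <= #5 by l ∷ $0 <= #0 by u≥0 ∷ $0 <= #1 by e≥0 ∷ $1 <= #4 by p≥1 ∷ $2 :* #3 =~ $2 :* #2 :+ #6 :+ ($2 :* #5 :+ $1) :* #4 by 2col′ ∷ :- #6 :+ $1 <= #7 by -x< ∷ #4 =~ #0 :+ #1 :+ #0 :+ #7 by P ∷ []) (2 ∷ 2 ∷ 2 ∷ 6 ∷ 3 ∷ 0 ∷ []) ((2 , 5) ∷ (2 , 5) ∷ []) refl))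
            (λ l → let 2col′ = trans 2col (cong (λ z → + 2 * + col i + x + z * + p) ha) in
               (lin⊥ (+ col i ∷ + p ∷ + col k ∷ q ∷ + u ∷ x ∷ + m ∷ + e ∷ []) ($1 :+ #0 <= #1 by i< ∷ $0 <= #2 by k0 ∷ #3 <= :- $2 by l ∷ $0 <= #4 by u≥0 ∷ $1 <= #1 by p≥1 ∷ $2 :* #2 == $2 :* #0 :+ #5 :+ ($2 :* #3 :+ $1) :* #1 by 2col′ ∷ #5 :+ $1 <= #6 by x< ∷ #1 =~ #4 :+ #7 :+ #4 :+ #6 by P ∷ $0 <= #7 by e≥0 ∷ []) (2 ∷ 2 ∷ 2 ∷ 2 ∷ 0 ∷ []) ((2 , 4) ∷ (2 , 4) ∷ []) refl)))
          (≡0∨-1 w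
            (λ l → let 2Z′ = trans 2Z (cong (λ y → + 2 * Z i + z + y * N) hc) in
               (lin⊥ (N ∷ U ∷ Z i ∷ Z k ∷ hz ∷ w ∷ z ∷ []) (#0 :- #1 <= #2 by tz ∷ #3 :+ #4 <= #0 by Zk ∷ $1 <= #4 by hz≥1 ∷ $1 <= #5 by l ∷ $2 :* #3 =~ $2 :* #2 :+ #6 :+ $2 :* #5 :* #0 by 2Z′ ∷ :- #6 <= #1 :- #4 by -z≤ ∷ $3 :* #1 :+ $1 <= #0 by 3U<N ∷ $1 <= #0 by N≥1 ∷ []) (2 ∷ 2 ∷ 3 ∷ 2 ∷ []) ((3 , 7) ∷ (3 , 7) ∷ []) refl))
            (λ l → let 2Z′ = trans 2Z (cong (λ y → + 2 * Z i + z + y * N) hc) in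
               (lin⊥ (Z i ∷ hz ∷ N ∷ U ∷ Z k ∷ w ∷ z ∷ []) (#0 :+ #1 <= #2 by Zi ∷ #2 :- #3 <= #0 by tz ∷ $0 <= #4 by Zk0 ∷ $3 :* #3 :+ $1 <= #2 by 3U<N ∷ $1 <= #1 by hz≥1 ∷ #5 <= :- $2 by l ∷ $1 <= #2 by N≥1 ∷ $2 :* #4 == $2 :* #0 :+ #6 :+ $2 :* #5 :* #2 by 2Z′ ∷ #6 <= #3 :- #1 by z≤ ∷ []) (7 ∷ 5 ∷ 2 ∷ 2 ∷ 8 ∷ 2 ∷ 0 ∷ []) ((5 , 6) ∷ (5 , 6) ∷ []) refl)))

      -- Here the column plays the part of `Z`: the halfway column `col i + x / 2` has left the
      -- interval `[s , p)`.
      near-yz′ : ∀ q → a ≡ + 2 * q → b ≡ - 1ℤ → c ≡ - 1ℤ → (q ≡ 0ℤ) ⊎ (q ≡ - 1ℤ) →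
        (+ 2 * + p ≤ + 2 * + col i + x) ⊎ (+ 2 * + col i + x + + 2 ≤ + 2 * + s)
      near-yz′ q ha b≡ c≡ (inj₁ refl) = let 2col′ = trans 2col (cong (λ z → + 2 * + col i + x + z * + p) ha) in case ok of λ where
                (inj₁ (_ , inj₁ f)) → ⊥-elim (lin⊥ (F i ∷ F k ∷ a ∷ b ∷ c ∷ []) (#0 =~ $2 by fi ∷ #1 == $0 by f ∷ $2 :* #1 =~ $2 :* #0 :+ #2 :+ #3 :+ #4 by 2F ∷ #2 =~ $0 by ha ∷ #3 =~ :- $1 by b≡ ∷ #4 =~ :- $1 by c≡ ∷ []) (2 ∷ 2 ∷ []) [] refl)
                (inj₁ (_ , inj₂ (_ , ty′ , _))) → ⊥-elim (¬TopY b≡ ty′)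
                (inj₂ (inj₁ ((_ , l) , _))) → let l = +≤+ l in inj₂ (lin≤ (+ col i ∷ x ∷ + s ∷ + col k ∷ + p ∷ []) ($2 :* #0 :+ #1 :+ $2) ($2 :* #2) ($1 :+ #3 <= #2 by l ∷ $2 :* #3 =~ $2 :* #0 :+ #1 :+ $0 :* #4 by 2col′ ∷ []) (1 ∷ 2 ∷ []) [] refl)
                (inj₂ (inj₂ (_ , _ , ty′ , _))) → ⊥-elim (¬TopY b≡ ty′)
      near-yz′ q ha b≡ c≡ (inj₂ refl) = let 2col′ = trans 2col (cong (λ z → + 2 * + col i + x + z * + p) ha) in
                inj₁ (lin≤ (+ p ∷ + col i ∷ x ∷ + col k ∷ []) ($2 :* #0) ($2 :* #1 :+ #2) ($0 <= #3 by k0 ∷ $2 :* #3 == $2 :* #1 :+ #2 :+ :- $2 :* #0 by 2col′ ∷ []) (1 ∷ 2 ∷ []) [] refl)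

      near-yz : ∀ q r w → a ≡ + 2 * q → b ≡ + 2 * r + 1ℤ → c ≡ + 2 * w + 1ℤ → (+ 2 * + p ≤ + 2 * + col i + x) ⊎ (+ 2 * + col i + x + + 2 ≤ + 2 * + s)
      near-yz q r w ha hb hc = near-yz′ q ha (Y-low r hb) (Z-low w hc)
          (≡0∨-1 q
            (λ l → let 2col′ = trans 2col (cong (λ z → + 2 * + col i + x + z * + p) ha) in
               (lin⊥ (+ u ∷ + e ∷ + col i ∷ + col k ∷ + p ∷ q ∷ x ∷ + m ∷ []) (#0 :+ #1 :+ #0 <= #2 by s≤ ∷ $1 :+ #3 <= #4 by k< ∷ $1 <= #5 by l ∷ $1 <= #4 by p≥1 ∷ $2 :* #3 =~ $2 :* #2 :+ #6 :+ $2 :* #5 :* #4 by 2col′ ∷ :- #6 :+ $1 <= #7 by -x< ∷ #7 <= $2 :* (#0 :+ #1 :+ #0) by m<2s ∷ []) (2 ∷ 2 ∷ 2 ∷ 0 ∷ []) ((2 , 3) ∷ (2 , 3) ∷ []) refl))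
            (λ l → let 2col′ = trans 2col (cong (λ z → + 2 * + col i + x + z * + p) ha) in
               (lin⊥ (+ col i ∷ + p ∷ + col k ∷ q ∷ + u ∷ x ∷ + m ∷ + e ∷ []) ($1 :+ #0 <= #1 by i< ∷ $0 <= #2 by k0 ∷ #3 <= :- $2 by l ∷ $0 <= #4 by u≥0 ∷ $2 :* #2 == $2 :* #0 :+ #5 :+ $2 :* #3 :* #1 by 2col′ ∷ #5 :+ $1 <= #6 by x< ∷ #1 =~ #4 :+ #7 :+ #4 :+ #6 by P ∷ $0 <= #7 by e≥0 ∷ $1 <= #1 by p≥1 ∷ []) (2 ∷ 2 ∷ 2 ∷ 2 ∷ []) ((2 , 8) ∷ (2 , 8) ∷ []) refl)))

    -- The two points next to a T at distance (x , y , z)/2 cannot both be good.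
    module _ {i k l x y z a b c a′ b′ c′} (li : i ℕ.< p) (lk : k ℕ.< p) (ll : l ℕ.< p) (t : T₄ i) (ok : OK k) (ok′ : OK l)
             (nb : Near i k x y z a b c) (nb′ : Near i l (- x) (- y) (- z) a′ b′ c′)
             (x< : x + 1ℤ ≤ + m) (-x< : - x + 1ℤ ≤ + m) (y≤ : y ≤ V - hy) (-y≤ : - y ≤ V - hy) (z≤ : z ≤ U - hz) (-z≤ : - z ≤ U - hz) where
      private
        n-x< : - - x + 1ℤ ≤ + m
        n-x< = (lin≤ (x ∷ + m ∷ []) (:- (:- #0) :+ $1) #1 (#0 :+ $1 <= #1 by x< ∷ []) [] [] refl)
        n-y≤ : - - y ≤ V - hy
        n-y≤ = (lin≤ (y ∷ V ∷ hy ∷ []) (:- (:- #0)) (#1 :- #2) (#0 <= #1 :- #2 by y≤ ∷ []) [] [] refl)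
        n-z≤ : - - z ≤ U - hz
        n-z≤ = (lin≤ (z ∷ U ∷ hz ∷ []) (:- (:- #0)) (#1 :- #2) (#0 <= #1 :- #2 by z≤ ∷ []) [] [] refl)
        tz : N - U ≤ Z i
        tz = proj₂ (proj₂ (proj₂ t))
        zi : Z i + hz ≤ N
        zi = Z≤ i
        s≤ : + s ≤ + col i
        s≤ = +≤+ (proj₁ t)
        i< : 1ℤ + + col i ≤ + p
        i< = +≤+ (col< i li)
        sm : + p ≡ + s + + m
        sm = refl
        -- `Z i + z / 2` and `Z i - z / 2` have the top value `Z i` as their mean and are closer
        -- than the width of the window, so they cannot both have left it.
        xy-contra : (+ 2 * N ≤ + 2 * Z i + z) ⊎ (+ 2 * Z i + z + + 2 ≤ + 2 * N - + 2 * U) → (+ 2 * N ≤ + 2 * Z i + - z) ⊎ (+ 2 * Z i + - z + + 2 ≤ + 2 * N - + 2 * U) → ⊥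
        xy-contra (inj₁ f) (inj₁ g) = (lin⊥ (Z i ∷ hz ∷ N ∷ z ∷ []) (#0 :+ #1 <= #2 by zi ∷ $1 <= #1 by hz≥1 ∷ $2 :* #2 <= $2 :* #0 :+ #3 by f ∷ $2 :* #2 <= $2 :* #0 :+ :- #3 by g ∷ []) (4 ∷ 4 ∷ []) [] refl)
        xy-contra (inj₁ f) (inj₂ g) = (lin⊥ (z ∷ U ∷ hz ∷ N ∷ Z i ∷ []) (#0 <= #1 :- #2 by z≤ ∷ $1 <= #2 by hz≥1 ∷ $2 :* #3 <= $2 :* #4 :+ #0 by f ∷ $2 :* #4 :+ :- #0 :+ $2 <= $2 :* #3 :- $2 :* #1 by g ∷ []) (2 ∷ 2 ∷ []) [] refl)
        xy-contra (inj₂ f) (inj₁ g) = (lin⊥ (z ∷ U ∷ hz ∷ N ∷ Z i ∷ []) (:- #0 <= #1 :- #2 by -z≤ ∷ $1 <= #2 by hz≥1 ∷ $2 :* #3 <= $2 :* #4 :+ :- #0 by g ∷ $2 :* #4 :+ #0 :+ $2 <= $2 :* #3 :- $2 :* #1 by f ∷ []) (2 ∷ 2 ∷ []) [] refl)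
        xy-contra (inj₂ f) (inj₂ g) = (lin⊥ (N ∷ U ∷ Z i ∷ z ∷ []) (#0 :- #1 <= #2 by tz ∷ $2 :* #2 :+ #3 :+ $2 <= $2 :* #0 :- $2 :* #1 by f ∷ $2 :* #2 :+ :- #3 :+ $2 <= $2 :* #0 :- $2 :* #1 by g ∷ []) (4 ∷ []) [] refl)
        yz-contra : (+ 2 * + p ≤ + 2 * + col i + x) ⊎ (+ 2 * + col i + x + + 2 ≤ + 2 * + s) → (+ 2 * + p ≤ + 2 * + col i + - x) ⊎ (+ 2 * + col i + - x + + 2 ≤ + 2 * + s) → ⊥
        yz-contra (inj₁ f) (inj₁ g) = (lin⊥ (+ col i ∷ + p ∷ x ∷ []) ($1 :+ #0 <= #1 by i< ∷ $2 :* #1 <= $2 :* #0 :+ #2 by f ∷ $2 :* #1 <= $2 :* #0 :+ :- #2 by g ∷ []) (4 ∷ []) [] refl)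
        yz-contra (inj₁ f) (inj₂ g) = (lin⊥ (x ∷ + m ∷ + p ∷ + s ∷ + col i ∷ []) (#0 :+ $1 <= #1 by x< ∷ #2 =~ #3 :+ #1 by sm ∷ $2 :* #2 <= $2 :* #4 :+ #0 by f ∷ $2 :* #4 :+ :- #0 :+ $2 <= $2 :* #3 by g ∷ []) (2 ∷ 2 ∷ []) [] refl)
        yz-contra (inj₂ f) (inj₁ g) = (lin⊥ (x ∷ + m ∷ + p ∷ + s ∷ + col i ∷ []) (:- #0 :+ $1 <= #1 by -x< ∷ #2 =~ #3 :+ #1 by sm ∷ $2 :* #2 <= $2 :* #4 :+ :- #0 by g ∷ $2 :* #4 :+ #0 :+ $2 <= $2 :* #3 by f ∷ []) (2 ∷ 2 ∷ []) [] refl)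
        yz-contra (inj₂ f) (inj₂ g) = (lin⊥ (+ s ∷ + col i ∷ x ∷ []) (#0 <= #1 by s≤ ∷ $2 :* #1 :+ #2 :+ $2 <= $2 :* #0 by f ∷ $2 :* #1 :+ :- #2 :+ $2 <= $2 :* #0 by g ∷ []) (4 ∷ []) [] refl)

      xy⊥ : ∀ q r w q′ r′ w′ → a ≡ + 2 * q + 1ℤ → b ≡ + 2 * r + 1ℤ → c ≡ + 2 * w → a′ ≡ + 2 * q′ + 1ℤ → b′ ≡ + 2 * r′ + 1ℤ → c′ ≡ + 2 * w′ → ⊥
      xy⊥ q r w q′ r′ w′ ha hb hc ha′ hb′ hc′ = xy-contra (near-xy nb lk li t ok x< -x< y≤ -y≤ z≤ -z≤ q r w ha hb hc)
        (near-xy nb′ ll li t ok′ -x< n-x< -y≤ n-y≤ -z≤ n-z≤ q′ r′ w′ ha′ hb′ hc′)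

      yz⊥ : ∀ q r w q′ r′ w′ → a ≡ + 2 * q → b ≡ + 2 * r + 1ℤ → c ≡ + 2 * w + 1ℤ → a′ ≡ + 2 * q′ → b′ ≡ + 2 * r′ + 1ℤ → c′ ≡ + 2 * w′ + 1ℤ → ⊥
      yz⊥ q r w q′ r′ w′ ha hb hc ha′ hb′ hc′ = yz-contra (near-yz nb lk li t ok x< -x< y≤ -y≤ z≤ -z≤ q r w ha hb hc)
        (near-yz nb′ ll li t ok′ -x< n-x< -y≤ n-y≤ -z≤ n-z≤ q′ r′ w′ ha′ hb′ hc′)

-- From a gap to a small step.

module Units where
  open Lin
  open Sums
  open ChainM
  open Count
  open Steps
  open Gap
  open Sym
  open Parity

  swapStep : ∀ {C} → Step C → Step (swap C)
  swapStep {C} S = record { d = d ; θ = η ; η = θ ; step-sum = trans (lin≡ (d * M ∷ η ∷ θ ∷ []) (#0 :+ #1 :+ #2) (#0 :+ #2 :+ #1) [] [] refl) step-sum ; col-d = col-d ; Y-θ = Z-η ; Z-η = Y-θ }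
    where open Chain C
          open Step S

  reverseStep : ∀ {C} → Step C → Step (reverse C)
  reverseStep {C} S = record { d = - d ; θ = - θ ; η = - η ; step-sum = (lin≡ (d ∷ M ∷ θ ∷ η ∷ δ ∷ []) (:- #0 :* #1 :+ :- #2 :+ :- #3) (:- #4) (#0 :* #1 :+ #2 :+ #3 =~ #4 by step-sum ∷ []) [] refl)
      ; col-d = λ i l → back {λ k → + col k} {d} {+ p} i l col-d ; Y-θ = λ i l → back {Y} {θ} {N} i l Y-θ ; Z-η = λ i l → back {Z} {η} {N} i l Z-η }
    where open Chain C
          open Step S
          open Reversal C using (back)

  -- The vector (x , y , z) is twice a step, up to the torsion (εx p , εy N , εz N).
  record Half (C : Chain) : Set where
    open Chain C
    field
      step : Step C
    open Step step public
    field
      x y z εx εy εz : ℤ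
      2d : + 2 * d ≡ x + εx * + p
      2θ : + 2 * θ ≡ y + εy * N
      2η : + 2 * η ≡ z + εz * N
      ε-sum : εx + εy + εz ≡ 0ℤ
      x< : x + 1ℤ ≤ + m
      -x< : - x + 1ℤ ≤ + m
      y≤ : y ≤ V - hy
      -y≤ : - y ≤ V - hy
      z≤ : z ≤ U - hz
      -z≤ : - z ≤ U - hz

  swapHalf : ∀ {C} → Half C → Half (swap C)
  swapHalf {C} h = record { step = swapStep step ; x = x ; y = z ; z = y ; εx = εx ; εy = εz ; εz = εy ; 2d = 2d ; 2θ = 2η ; 2η = 2θ
    ; ε-sum = trans (lin≡ (εx ∷ εz ∷ εy ∷ []) (#0 :+ #1 :+ #2) (#0 :+ #2 :+ #1) [] [] refl) ε-sum ; x< = x< ; -x< = -x< ; y≤ = z≤ ; -y≤ = -z≤ ; z≤ = y≤ ; -z≤ = -y≤ }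
    where open Half h

  module Torsion (C : Chain) (h : Half C) where
    open Chain C
    open Parities C
    open Half h
    open Jumps step

    forth : ∀ i → suc i ℕ.< p → ∃ λ γ → ∃ λ α → ∃ λ β → Near i (suc i) x y z (εx + + 2 * γ) (εy + + 2 * α) (εz + + 2 * β)
      × Near (suc i) i (- x) (- y) (- z) (- (εx + + 2 * γ)) (- (εy + + 2 * α)) (- (εz + + 2 * β))
    forth i l = let
        γ , c = col-d i l ; α , b = Y-θ i l ; β , a = Z-η i l
        c₁ : + col (suc i) ≡ + col i + + 1 * d + γ * + p
        c₁ = trans c (cong (λ z → + col i + z + γ * + p) (sym (ℤ.*-identityˡ d)))
        b₁ : Y (suc i) ≡ Y i + + 1 * θ + α * N
        b₁ = trans b (cong (λ z → Y i + z + α * N) (sym (ℤ.*-identityˡ θ)))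
        a₁ : Z (suc i) ≡ Z i + + 1 * η + β * N
        a₁ = trans a (cong (λ z → Z i + z + β * N) (sym (ℤ.*-identityˡ η)))
        f = F-jump i 1 γ α β (ℕ.<-trans (ℕ.n<1+n i) l) l c₁ b₁ a₁
      in γ , α , β ,
        record { 2col = (lin≡ (+ col (suc i) ∷ + col i ∷ x ∷ εx ∷ γ ∷ + p ∷ d ∷ []) ($2 :* #0) ($2 :* #1 :+ #2 :+ (#3 :+ $2 :* #4) :* #5) (#0 == #1 :+ #6 :+ #4 :* #5 by c ∷ $2 :* #6 == #2 :+ #3 :* #5 by 2d ∷ []) (2 ∷ []) refl) ; 2Y = (lin≡ (Y (suc i) ∷ Y i ∷ y ∷ εy ∷ α ∷ N ∷ θ ∷ []) ($2 :* #0) ($2 :* #1 :+ #2 :+ (#3 :+ $2 :* #4) :* #5) (#0 == #1 :+ #6 :+ #4 :* #5 by b ∷ $2 :* #6 == #2 :+ #3 :* #5 by 2θ ∷ []) (2 ∷ []) refl)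
               ; 2Z = (lin≡ (Z (suc i) ∷ Z i ∷ z ∷ εz ∷ β ∷ N ∷ η ∷ []) ($2 :* #0) ($2 :* #1 :+ #2 :+ (#3 :+ $2 :* #4) :* #5) (#0 == #1 :+ #6 :+ #4 :* #5 by a ∷ $2 :* #6 == #2 :+ #3 :* #5 by 2η ∷ []) (2 ∷ []) refl) ; 2F = (lin≡ (F (suc i) ∷ F i ∷ εx ∷ γ ∷ εy ∷ α ∷ εz ∷ β ∷ []) ($2 :* #0) ($2 :* #1 :+ (#2 :+ $2 :* #3) :+ (#4 :+ $2 :* #5) :+ (#6 :+ $2 :* #7)) (#0 == #1 :+ #3 :+ #5 :+ #7 by f ∷ #2 :+ #4 :+ #6 =~ $0 by ε-sum ∷ []) (2 ∷ []) refl) } ,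
        record { 2col = (lin≡ (+ col i ∷ + col (suc i) ∷ x ∷ εx ∷ γ ∷ + p ∷ d ∷ []) ($2 :* #0) ($2 :* #1 :+ :- #2 :+ :- (#3 :+ $2 :* #4) :* #5) (#1 =~ #0 :+ #6 :+ #4 :* #5 by c ∷ $2 :* #6 =~ #2 :+ #3 :* #5 by 2d ∷ []) (2 ∷ []) refl) ; 2Y = (lin≡ (Y i ∷ Y (suc i) ∷ y ∷ εy ∷ α ∷ N ∷ θ ∷ []) ($2 :* #0) ($2 :* #1 :+ :- #2 :+ :- (#3 :+ $2 :* #4) :* #5) (#1 =~ #0 :+ #6 :+ #4 :* #5 by b ∷ $2 :* #6 =~ #2 :+ #3 :* #5 by 2θ ∷ []) (2 ∷ []) refl)
               ; 2Z = (lin≡ (Z i ∷ Z (suc i) ∷ z ∷ εz ∷ β ∷ N ∷ η ∷ []) ($2 :* #0) ($2 :* #1 :+ :- #2 :+ :- (#3 :+ $2 :* #4) :* #5) (#1 =~ #0 :+ #6 :+ #4 :* #5 by a ∷ $2 :* #6 =~ #2 :+ #3 :* #5 by 2η ∷ []) (2 ∷ []) refl) ; 2F = (lin≡ (F i ∷ F (suc i) ∷ εx ∷ γ ∷ εy ∷ α ∷ εz ∷ β ∷ []) ($2 :* #0) ($2 :* #1 :+ :- (#2 :+ $2 :* #3) :+ :- (#4 :+ $2 :* #5) :+ :- (#6 :+ $2 :* #7)) (#1 =~ #0 :+ #3 :+ #5 :+ #7 by f ∷ #2 :+ #4 :+ #6 == $0 by ε-sum ∷ []) (2 ∷ []) refl)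 }

    private
      odd⁺ : ∀ {ε} γ → ε ≡ 1ℤ → (ε + + 2 * γ ≡ + 2 * γ + 1ℤ) × (- (ε + + 2 * γ) ≡ + 2 * (- γ - 1ℤ) + 1ℤ)
      odd⁺ γ refl = (lin≡ (γ ∷ []) ($1 :+ $2 :* #0) ($2 :* #0 :+ $1) [] [] refl) , (lin≡ (γ ∷ []) (:- ($1 :+ $2 :* #0)) ($2 :* (:- #0 :- $1) :+ $1) [] [] refl)
      odd⁻ : ∀ {ε} γ → ε ≡ - 1ℤ → (ε + + 2 * γ ≡ + 2 * (γ - 1ℤ) + 1ℤ) × (- (ε + + 2 * γ) ≡ + 2 * (- γ) + 1ℤ)
      odd⁻ γ refl = (lin≡ (γ ∷ []) (:- $1 :+ $2 :* #0) ($2 :* (#0 :- $1) :+ $1) [] [] refl) , (lin≡ (γ ∷ []) (:- (:- $1 :+ $2 :* #0)) ($2 :* :- #0 :+ $1) [] [] refl)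
      even : ∀ {ε} γ → ε ≡ 0ℤ → (ε + + 2 * γ ≡ + 2 * γ) × (- (ε + + 2 * γ) ≡ + 2 * (- γ))
      even γ refl = (lin≡ (γ ∷ []) ($0 :+ $2 :* #0) ($2 :* #0) [] [] refl) , (lin≡ (γ ∷ []) (:- ($0 :+ $2 :* #0)) ($2 :* :- #0) [] [] refl)

    -- `no-isolation` supplies a T between two good points. These lie at plus and minus half of
    -- `(x , y , z)`, each with carries of the same parities, so `xy⊥` applies.
    torsion-xy : εx ≡ 1ℤ → εy ≡ - 1ℤ → εz ≡ 0ℤ → ⊥
    torsion-xy ex ey ez = no-isolation λ i l t o o′ → let
        l′ = ℕ.<-trans (ℕ.n<1+n _) l ; γ , α , β , _ , nb′ = forth i l′ ; γ₁ , α₁ , β₁ , nb , _ = forth (suc i) l in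
      xy⊥ l′ l (ℕ.<-trans (ℕ.n<1+n _) l′) t o′ o nb nb′ x< -x< y≤ -y≤ z≤ -z≤ γ₁ (α₁ - 1ℤ) β₁ (- γ - 1ℤ) (- α) (- β)
        (proj₁ (odd⁺ γ₁ ex)) (proj₁ (odd⁻ α₁ ey)) (proj₁ (even β₁ ez)) (proj₂ (odd⁺ γ ex)) (proj₂ (odd⁻ α ey)) (proj₂ (even β ez))

    torsion-yz : εx ≡ 0ℤ → εy ≡ - 1ℤ → εz ≡ 1ℤ → ⊥
    torsion-yz ex ey ez = no-isolation λ i l t o o′ → let
        l′ = ℕ.<-trans (ℕ.n<1+n _) l ; γ , α , β , _ , nb′ = forth i l′ ; γ₁ , α₁ , β₁ , nb , _ = forth (suc i) l in
      yz⊥ l′ l (ℕ.<-trans (ℕ.n<1+n _) l′) t o′ o nb nb′ x< -x< y≤ -y≤ z≤ -z≤ γ₁ (α₁ - 1ℤ) β₁ (- γ) (- α) (- β - 1ℤ)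
        (proj₁ (even γ₁ ex)) (proj₁ (odd⁻ α₁ ey)) (proj₁ (odd⁺ β₁ ez)) (proj₂ (even γ ex)) (proj₂ (odd⁻ α ey)) (proj₂ (odd⁺ β ez))

  module ToUnit (C : Chain) where
    open Chain C
    open Facts C
    open Counts C
    open StepFacts C
    open Gaps C

    module _ {i k} (li : i ℕ.< p) (lk : k ℕ.< p) (t : T₄ i) (t′ : T₄ k) where
      x y z : ℤ
      x = + col k - + col i
      y = Y k - Y i
      z = Z k - Z i
      private
        s₁ : + s ≤ + col i
        s₁ = +≤+ (proj₁ t)
        s₂ : + s ≤ + col k
        s₂ = +≤+ (proj₁ t′)
        c₁ : 1ℤ + + col i ≤ + s + + m
        c₁ = +≤+ (col< i li)
        c₂ : 1ℤ + + col k ≤ + s + + m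
        c₂ = +≤+ (col< k lk)
        y₁ = proj₁ (proj₂ (proj₂ t))
        y₂ = proj₁ (proj₂ (proj₂ t′))
        z₁ = proj₂ (proj₂ (proj₂ t))
        z₂ = proj₂ (proj₂ (proj₂ t′))
        yi = Y≤ i
        yk = Y≤ k
        zi = Z≤ i
        zk = Z≤ k
      x< : x + 1ℤ ≤ + m
      x< = (lin≤ (+ col k ∷ + col i ∷ + m ∷ + s ∷ []) (#0 :- #1 :+ $1) #2 (#3 <= #1 by s₁ ∷ $1 :+ #0 <= #3 :+ #2 by c₂ ∷ []) [] [] refl)
      -x< : - x + 1ℤ ≤ + m
      -x< = (lin≤ (+ col k ∷ + col i ∷ + m ∷ + s ∷ []) (:- (#0 :- #1) :+ $1) #2 (#3 <= #0 by s₂ ∷ $1 :+ #1 <= #3 :+ #2 by c₁ ∷ []) [] [] refl)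
      y≤ : y ≤ V - hy
      y≤ = (lin≤ (Y k ∷ Y i ∷ V ∷ hy ∷ N ∷ []) (#0 :- #1) (#2 :- #3) (#4 :- #2 <= #1 by y₁ ∷ #0 :+ #3 <= #4 by yk ∷ []) [] [] refl)
      -y≤ : - y ≤ V - hy
      -y≤ = (lin≤ (Y k ∷ Y i ∷ V ∷ hy ∷ N ∷ []) (:- (#0 :- #1)) (#2 :- #3) (#4 :- #2 <= #0 by y₂ ∷ #1 :+ #3 <= #4 by yi ∷ []) [] [] refl)
      z≤ : z ≤ U - hz
      z≤ = (lin≤ (Z k ∷ Z i ∷ U ∷ hz ∷ N ∷ []) (#0 :- #1) (#2 :- #3) (#4 :- #2 <= #1 by z₁ ∷ #0 :+ #3 <= #4 by zk ∷ []) [] [] refl)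
      -z≤ : - z ≤ U - hz
      -z≤ = (lin≤ (Z k ∷ Z i ∷ U ∷ hz ∷ N ∷ []) (:- (#0 :- #1)) (#2 :- #3) (#4 :- #2 <= #0 by z₂ ∷ #1 :+ #3 <= #4 by zi ∷ []) [] [] refl)
      xyz : x * M + y + z ≡ δ * (+ k - + i)
      xyz = let a = trans (eqn i li) (cong (λ z → n₀ + δ * + i + z * N) (proj₁ (proj₂ t))) ; b = trans (eqn k lk) (cong (λ z → n₀ + δ * + k + z * N) (proj₁ (proj₂ t′))) in
        (lin≡ (+ col k ∷ + col i ∷ M ∷ Y k ∷ Y i ∷ Z k ∷ Z i ∷ δ ∷ + k ∷ + i ∷ n₀ ∷ N ∷ []) ((#0 :- #1) :* #2 :+ (#3 :- #4) :+ (#5 :- #6)) (#7 :* (#8 :- #9)) (#1 :* #2 :+ #4 :+ #6 =~ #10 :+ #7 :* #9 :+ $2 :* #11 by a ∷ #0 :* #2 :+ #3 :+ #5 == #10 :+ #7 :* #8 :+ $2 :* #11 by b ∷ []) [] refl)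

    unit₁ : Gap 1 → Unit C
    unit₁ (i , l , t , t′) = let li = ℕ.<-trans (ℕ.n<1+n i) l ; γ , c = col-step i l ; α , b = Y-step i l ; r = xyz li l t t′ in record
      { step = mkStep (x li l t t′) (y li l t t′) (z li l t t′) (trans r (lin≡ (δ ∷ + i ∷ []) (#0 :* ($1 :+ #1 :- #1)) #0 [] [] refl))
          (γ , (lin≡ (+ col (suc i) ∷ + col i ∷ ω ∷ γ ∷ + p ∷ []) (#0 :- #1) (#2 :+ #3 :* #4) (#0 == #1 :+ #2 :+ #3 :* #4 by c ∷ []) [] refl))
          (α , (lin≡ (Y (suc i) ∷ Y i ∷ υ ∷ α ∷ N ∷ []) (#0 :- #1) (#2 :+ #3 :* #4) (#0 == #1 :+ #2 :+ #3 :* #4 by b ∷ []) [] refl))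
      ; θ≤ = y≤ li l t t′ ; -θ≤ = -y≤ li l t t′ ; η≤ = z≤ li l t t′ ; -η≤ = -z≤ li l t t′ ; d< = x< li l t t′ ; -d< = -x< li l t t′ }

    -- The parities of the wraps `γ` and `α` over the double step decide whether the difference of
    -- the two points can be halved; the third parity follows from the sum. The three obstructed
    -- cases are one torsion of type yz, one of type xy, and one that becomes xy after exchanging
    -- `Y` and `Z`.
    unit₂ : Gap 2 → Unit C
    unit₂ (i , l , t , t′) = [ (λ ex → [ (λ ey → smooth ex ey) , (λ ey → ⊥-elim (Torsion.torsion-yz C (mk ex ey) refl refl refl)) ]′ (proj₂ (halve α)) )
                             , (λ ex → [ (λ ey → ⊥-elim (Torsion.torsion-xy (swap C) (swapHalf (mk′ ex ey)) refl refl refl)) , (λ ey → ⊥-elim (Torsion.torsion-xy C (mk″ ex ey) refl refl refl)) ]′ (proj₂ (halve α))) ]′ (proj₂ (halve γ))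
      where
      l′ = ℕ.<-trans (ℕ.n<1+n _) l
      li = ℕ.<-trans (ℕ.n<1+n _) l′
      γ α q r X : ℤ
      γ = proj₁ (col-step i l′) + proj₁ (col-step (suc i) l)
      α = proj₁ (Y-step i l′) + proj₁ (Y-step (suc i) l)
      q = proj₁ (halve γ)
      r = proj₁ (halve α)
      X = x li l t t′
      y₂ = y li l t t′
      z₂ = z li l t t′
      hx : X ≡ + 2 * ω + γ * + p
      hx = let a = proj₂ (col-step i l′) ; b = proj₂ (col-step (suc i) l) in
        (lin≡ (+ col (2 ℕ.+ i) ∷ + col i ∷ ω ∷ proj₁ (col-step i l′) ∷ proj₁ (col-step (suc i) l) ∷ + p ∷ + col (suc i) ∷ []) (#0 :- #1) ($2 :* #2 :+ (#3 :+ #4) :* #5) (#6 == #1 :+ #2 :+ #3 :* #5 by a ∷ #0 == #6 :+ #2 :+ #4 :* #5 by b ∷ []) [] refl)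
      hy₂ : y₂ ≡ + 2 * υ + α * N
      hy₂ = let a = proj₂ (Y-step i l′) ; b = proj₂ (Y-step (suc i) l) in
        (lin≡ (Y (2 ℕ.+ i) ∷ Y i ∷ υ ∷ proj₁ (Y-step i l′) ∷ proj₁ (Y-step (suc i) l) ∷ N ∷ Y (suc i) ∷ []) (#0 :- #1) ($2 :* #2 :+ (#3 :+ #4) :* #5) (#6 == #1 :+ #2 :+ #3 :* #5 by a ∷ #0 == #6 :+ #2 :+ #4 :* #5 by b ∷ []) [] refl)
      hs : X * M + y₂ + z₂ ≡ + 2 * δ
      hs = trans (xyz li l t t′) (lin≡ (δ ∷ + i ∷ []) (#0 :* ($2 :+ #1 :- #1)) ($2 :* #0) [] [] refl)
      S : ℤ → ℤ → Step C
      S q r = mkStep (ω + q * + p) (υ + r * N) (δ - (ω + q * + p) * M - (υ + r * N)) (lin≡ (ω ∷ q ∷ + p ∷ M ∷ υ ∷ r ∷ N ∷ δ ∷ []) ((#0 :+ #1 :* #2) :* #3 :+ (#4 :+ #5 :* #6) :+ (#7 :- (#0 :+ #1 :* #2) :* #3 :- (#4 :+ #5 :* #6))) #7 [] [] refl) (q , refl) (r , refl)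
      twice : ∀ {g h P} → g ≡ h → g * P ≡ h * P
      twice refl = refl
      h₀ : ∀ {εx εy εz} q r → + 2 * (ω + q * + p) ≡ X + εx * + p → + 2 * (υ + r * N) ≡ y₂ + εy * N → εx + εy + εz ≡ 0ℤ → Half C
      h₀ {εx} {εy} {εz} q r 2d 2θ es = record { step = S q r ; x = X ; y = y₂ ; z = z₂ ; εx = εx ; εy = εy ; εz = εz ; 2d = 2d ; 2θ = 2θ
        ; 2η = let 2d′ : + 2 * ((ω + q * + p) * M) ≡ X * M + εx * N
                   2d′ = trans (sym (ℤ.*-assoc (+ 2) (ω + q * + p) M)) (trans (cong (_* M) 2d) (trans (ℤ.*-distribʳ-+ M X (εx * + p)) (cong (λ z → X * M + z) (ℤ.*-assoc εx (+ p) M))))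
                   es′ = cong (_* N) es in
               (lin≡ (δ ∷ (ω + q * + p) * M ∷ υ ∷ r ∷ N ∷ z₂ ∷ εz ∷ X ∷ M ∷ εx ∷ y₂ ∷ εy ∷ []) ($2 :* (#0 :- #1 :- (#2 :+ #3 :* #4))) (#5 :+ #6 :* #4) ($2 :* #1 =~ #7 :* #8 :+ #9 :* #4 by 2d′ ∷ $2 :* (#2 :+ #3 :* #4) =~ #10 :+ #11 :* #4 by 2θ ∷ #7 :* #8 :+ #10 :+ #5 =~ $2 :* #0 by hs ∷ (#9 :+ #11 :+ #6) :* #4 =~ $0 by es′ ∷ []) [] refl)
        ; ε-sum = es ; x< = x< li l t t′ ; -x< = -x< li l t t′ ; y≤ = y≤ li l t t′ ; -y≤ = -y≤ li l t t′ ; z≤ = z≤ li l t t′ ; -z≤ = -z≤ li l t t′ }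
      mk : γ ≡ + 2 * q → α ≡ + 2 * r + 1ℤ → Half C
      mk ex ey = let ex′ = twice {P = + p} ex ; ey′ = twice {P = N} ey in h₀ {0ℤ} { - 1ℤ} {1ℤ} q r
        (lin≡ (ω ∷ q ∷ + p ∷ X ∷ γ ∷ []) ($2 :* (#0 :+ #1 :* #2)) (#3 :+ $0 :* #2) (#3 =~ $2 :* #0 :+ #4 :* #2 by hx ∷ #4 :* #2 =~ $2 :* #1 :* #2 by ex′ ∷ []) [] refl) (lin≡ (υ ∷ r ∷ N ∷ y₂ ∷ α ∷ []) ($2 :* (#0 :+ #1 :* #2)) (#3 :+ :- $1 :* #2) (#3 =~ $2 :* #0 :+ #4 :* #2 by hy₂ ∷ #4 :* #2 =~ ($2 :* #1 :+ $1) :* #2 by ey′ ∷ []) [] refl) refl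
      mk′ : γ ≡ + 2 * q + 1ℤ → α ≡ + 2 * r → Half C
      -- Rounding up to `q + 1` makes the torsion `(1 , 0 , -1)`, which the exchange turns into the
      -- pattern `(1 , -1 , 0)` of `torsion-xy`.
      mk′ ex ey = let ex′ = twice {P = + p} ex ; ey′ = twice {P = N} ey in h₀ {1ℤ} {0ℤ} { - 1ℤ} (q + 1ℤ) r
        (lin≡ (ω ∷ q ∷ + p ∷ X ∷ γ ∷ []) ($2 :* (#0 :+ (#1 :+ $1) :* #2)) (#3 :+ $1 :* #2) (#3 =~ $2 :* #0 :+ #4 :* #2 by hx ∷ #4 :* #2 =~ ($2 :* #1 :+ $1) :* #2 by ex′ ∷ []) [] refl) (lin≡ (υ ∷ r ∷ N ∷ y₂ ∷ α ∷ []) ($2 :* (#0 :+ #1 :* #2)) (#3 :+ $0 :* #2) (#3 =~ $2 :* #0 :+ #4 :* #2 by hy₂ ∷ #4 :* #2 =~ $2 :* #1 :* #2 by ey′ ∷ []) [] refl) refl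
      mk″ : γ ≡ + 2 * q + 1ℤ → α ≡ + 2 * r + 1ℤ → Half C
      mk″ ex ey = let ex′ = twice {P = + p} ex ; ey′ = twice {P = N} ey in h₀ {1ℤ} { - 1ℤ} {0ℤ} (q + 1ℤ) r
        (lin≡ (ω ∷ q ∷ + p ∷ X ∷ γ ∷ []) ($2 :* (#0 :+ (#1 :+ $1) :* #2)) (#3 :+ $1 :* #2) (#3 =~ $2 :* #0 :+ #4 :* #2 by hx ∷ #4 :* #2 =~ ($2 :* #1 :+ $1) :* #2 by ex′ ∷ []) [] refl) (lin≡ (υ ∷ r ∷ N ∷ y₂ ∷ α ∷ []) ($2 :* (#0 :+ #1 :* #2)) (#3 :+ :- $1 :* #2) (#3 =~ $2 :* #0 :+ #4 :* #2 by hy₂ ∷ #4 :* #2 =~ ($2 :* #1 :+ $1) :* #2 by ey′ ∷ []) [] refl) refl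
      smooth : γ ≡ + 2 * q → α ≡ + 2 * r → Unit C
      smooth ex ey = let
          ex′ = twice {P = + p} ex ; ey′ = twice {P = N} ey
          H = h₀ {0ℤ} {0ℤ} {0ℤ} q r (lin≡ (ω ∷ q ∷ + p ∷ X ∷ γ ∷ []) ($2 :* (#0 :+ #1 :* #2)) (#3 :+ $0 :* #2) (#3 =~ $2 :* #0 :+ #4 :* #2 by hx ∷ #4 :* #2 =~ $2 :* #1 :* #2 by ex′ ∷ []) [] refl) (lin≡ (υ ∷ r ∷ N ∷ y₂ ∷ α ∷ []) ($2 :* (#0 :+ #1 :* #2)) (#3 :+ $0 :* #2) (#3 =~ $2 :* #0 :+ #4 :* #2 by hy₂ ∷ #4 :* #2 =~ $2 :* #1 :* #2 by ey′ ∷ []) [] refl) refl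
        in halfUnit H refl refl refl
        where
        halfUnit : (H : Half C) → Half.εx H ≡ 0ℤ → Half.εy H ≡ 0ℤ → Half.εz H ≡ 0ℤ → Unit C
        halfUnit H refl refl refl = record { step = step
          ; θ≤ = (lin≤ (θ ∷ V ∷ hy ∷ ye ∷ N ∷ []) #0 (#1 :- #2) ($2 :* #0 == #3 :+ $0 :* #4 by ya ∷ #3 <= #1 :- #2 by yb ∷ :- #3 <= #1 :- #2 by yc ∷ []) (4 ∷ 2 ∷ 3 ∷ []) [] refl) ; -θ≤ = (lin≤ (θ ∷ V ∷ hy ∷ ye ∷ N ∷ []) (:- #0) (#1 :- #2) ($2 :* #0 =~ #3 :+ $0 :* #4 by ya ∷ :- #3 <= #1 :- #2 by yc ∷ #3 <= #1 :- #2 by yb ∷ []) (4 ∷ 2 ∷ 3 ∷ []) [] refl)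
          ; η≤ = (lin≤ (η ∷ U ∷ hz ∷ ze ∷ N ∷ []) #0 (#1 :- #2) ($2 :* #0 == #3 :+ $0 :* #4 by za ∷ #3 <= #1 :- #2 by zb ∷ :- #3 <= #1 :- #2 by zc ∷ []) (4 ∷ 2 ∷ 3 ∷ []) [] refl) ; -η≤ = (lin≤ (η ∷ U ∷ hz ∷ ze ∷ N ∷ []) (:- #0) (#1 :- #2) ($2 :* #0 =~ #3 :+ $0 :* #4 by za ∷ :- #3 <= #1 :- #2 by zc ∷ #3 <= #1 :- #2 by zb ∷ []) (4 ∷ 2 ∷ 3 ∷ []) [] refl)
          ; d< = (lin≤ (d ∷ + m ∷ xe ∷ + p ∷ []) (#0 :+ $1) #1 ($2 :* #0 == #2 :+ $0 :* #3 by xa ∷ #2 :+ $1 <= #1 by xb ∷ :- #2 :+ $1 <= #1 by xc ∷ []) (4 ∷ 2 ∷ 3 ∷ []) [] refl) ; -d< = (lin≤ (d ∷ + m ∷ xe ∷ + p ∷ []) (:- #0 :+ $1) #1 ($2 :* #0 =~ #2 :+ $0 :* #3 by xa ∷ :- #2 :+ $1 <= #1 by xc ∷ #2 :+ $1 <= #1 by xb ∷ []) (4 ∷ 2 ∷ 3 ∷ []) [] refl) }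
          where open Half H renaming (x to xe; y to ye; z to ze; 2θ to ya; 2η to za; 2d to xa; y≤ to yb; -y≤ to yc; z≤ to zb; -z≤ to zc; x< to xb; -x< to xc)

    unit : Unit C
    unit = [ unit₁ , unit₂ ]′ gap

-- Flows: small steps with forward columns, and where their jumps land.

module Flows where
  open Lin
  open Sums
  open ChainM
  open Count
  open Steps
  open Gap
  open Sym
  open Parity
  open Units

  -- A small step that moves the columns forward.
  record Flow (C : Chain) : Set where
    open Chain C
    field
      step : Step C
    open Step step using (θ; η) public
    field
      d : ℕ
      d≡ : Step.d step ≡ + d
      d≥1 : 1ℤ ≤ + d
      d<m : + d + 1ℤ ≤ + m
      θ≤ : θ ≤ V - hy
      -θ≤ : - θ ≤ V - hy
      η≤ : η ≤ U - hz
      -η≤ : - η ≤ U - hz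

  swapFlow : ∀ {C} → Flow C → Flow (swap C)
  swapFlow f = record { step = swapStep step ; d = d ; d≡ = d≡ ; d≥1 = d≥1 ; d<m = d<m ; θ≤ = η≤ ; -θ≤ = -η≤ ; η≤ = θ≤ ; -η≤ = -θ≤ }
    where open Flow f

  module _ (C : Chain) where
    open Chain C
    open Facts C
    open Counts C
    open StepFacts C

    -- With `d = 0` the first two points would share a column.
    d≢0 : (S : Step C) → Step.d S ≢ 0ℤ
    d≢0 S z = let open Step S
                  γ , h = col-d 0 1<p ; h′ = trans h (cong (λ z → + col 0 + z + γ * + p) z)
                  a = +≤+ (col< 0 (ℕ.<-trans (s≤s z≤n) 1<p)) ; b = +≤+ (col< 1 1<p) ; a₀ = +≤+ (z≤n {col 0}) ; b₀ = +≤+ (z≤n {col 1})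
                  g = small-multiple γ p≥1 (lin≤ (γ ∷ + p ∷ + col 1 ∷ + col 0 ∷ []) (#0 :* #1 :+ $1) #1 (#2 =~ #3 :+ $0 :+ #0 :* #1 by h′ ∷ $1 :+ #2 <= #1 by b ∷ $0 <= #3 by a₀ ∷ []) [] [] refl) (lin≤ (+ p ∷ γ ∷ + col 1 ∷ + col 0 ∷ []) (:- #0 :+ $1) (#1 :* #0) (#2 == #3 :+ $0 :+ #1 :* #0 by h′ ∷ $1 :+ #3 <= #0 by a ∷ $0 <= #2 by b₀ ∷ []) [] [] refl)
                  e : + col 1 ≡ + col 0
                  e = trans h′ (trans (cong (λ g → + col 0 + 0ℤ + g * + p) g) (lin≡ (+ col 0 ∷ + p ∷ []) (#0 :+ $0 :+ $0 :* #1) #0 [] [] refl))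
              in case trans (sym (pos-col 1 1<p)) (trans (cong pos (ℤ.+-injective e)) (pos-col 0 (ℕ.<-trans (s≤s z≤n) 1<p))) of λ ()

  flow : (C : Chain) → Flow C ⊎ Flow (reverse C)
  flow C with ToUnit.unit C
  ... | un with Unit.d un in eq
  ...   | + zero = ⊥-elim (d≢0 C (Unit.step un) eq)
  ...   | + suc n = inj₁ (record { step = step ; d = suc n ; d≡ = eq ; d≥1 = +≤+ (s≤s z≤n) ; d<m = subst (λ z → z + 1ℤ ≤ + m) eq d< ; θ≤ = θ≤ ; -θ≤ = -θ≤ ; η≤ = η≤ ; -η≤ = -η≤ })
    where open Chain C
          open Unit un
  ...   | -[1+ n ] = inj₂ (record { step = reverseStep step ; d = suc n ; d≡ = cong -_ eq ; d≥1 = +≤+ (s≤s z≤n) ; d<m = subst (λ z → - z + 1ℤ ≤ + m) eq -d<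
        ; θ≤ = -θ≤ ; -θ≤ = ≤-trans (≤-reflexive (ℤ.neg-involutive θ)) θ≤ ; η≤ = -η≤ ; -η≤ = ≤-trans (≤-reflexive (ℤ.neg-involutive η)) η≤ })
    where open Chain C
          open Unit un

  module Landing (C : Chain) (f : Flow C) where
    open Chain C
    open Facts C
    open Counts C
    open StepFacts C
    open Flow f
    open Jumps step public

    land : ∀ i j x κ → j ℕ.+ i ℕ.< p → x ℕ.< p → + col i + + j * + d ≡ + x + κ * + p → (J : Jump step i j) → pos x ≡ j ℕ.+ i × Jump.γ J ≡ - κ
    land i j x κ l x<p h J = let
        open Jump J
        c = trans colJ (cong (λ z → + col i + + j * z + γ * + p) d≡) ; k = j ℕ.+ i
        a = +≤+ (col< k l) ; b = +≤+ x<p ; a₀ = +≤+ (z≤n {col k}) ; b₀ = +≤+ (z≤n {x})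
        g = small-multiple (γ + κ) p≥1 (lin≤ (γ ∷ κ ∷ + p ∷ + col k ∷ + col i ∷ + j ∷ + d ∷ + x ∷ []) ((#0 :+ #1) :* #2 :+ $1) #2 (#3 =~ #4 :+ #5 :* #6 :+ #0 :* #2 by c ∷ #4 :+ #5 :* #6 =~ #7 :+ #1 :* #2 by h ∷ $1 :+ #3 <= #2 by a ∷ $0 <= #7 by b₀ ∷ []) [] [] refl) (lin≤ (+ p ∷ γ ∷ κ ∷ + col k ∷ + col i ∷ + j ∷ + d ∷ + x ∷ []) (:- #0 :+ $1) ((#1 :+ #2) :* #0) (#3 == #4 :+ #5 :* #6 :+ #1 :* #0 by c ∷ #4 :+ #5 :* #6 == #7 :+ #2 :* #0 by h ∷ $1 :+ #7 <= #0 by b ∷ $0 <= #3 by a₀ ∷ []) [] [] refl)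
        g′ = cong (_* + p) g
        e : + col k ≡ + x
        e = (lin≡ (+ col k ∷ + x ∷ + col i ∷ + j ∷ + d ∷ γ ∷ + p ∷ κ ∷ []) #0 #1 (#0 == #2 :+ #3 :* #4 :+ #5 :* #6 by c ∷ #2 :+ #3 :* #4 == #1 :+ #7 :* #6 by h ∷ (#5 :+ #7) :* #6 == $0 by g′ ∷ []) [] refl)
      in trans (cong pos (sym (ℤ.+-injective e))) (pos-col k l) , (lin≡ (γ ∷ κ ∷ []) #0 (:- #1) (#0 :+ #1 == $0 by g ∷ []) [] refl)

    step-sum′ : + d * M + θ + η ≡ δ
    step-sum′ = trans (cong (λ z → z * M + θ + η) (sym d≡)) (Step.step-sum step)

    δ≤1 : δ ≤ 1ℤ
    δ≤1 = [ ≤-reflexive , (λ e → ≤-trans (≤-reflexive e) ℤ.-≤+) ]′ δ≡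
    -1≤δ : - 1ℤ ≤ δ
    -1≤δ = [ (λ e → ≤-trans ℤ.-≤+ (≤-reflexive (sym e))) , (λ e → ≤-reflexive (sym e)) ]′ δ≡

    -- A jump of length `j` fails only by running past the end of the chain, which happens from the
    -- last `j` positions. They are indexed by column here, since the jumps are compared column by
    -- column.
    broken : ℕ → ℕ → ℤ
    broken j x = ⟨ p ℕ.≤? pos x ℕ.+ j ⟩
    broken≤ : ∀ j → ∑ p (broken j) ≤ + j
    broken≤ j = ≤-trans (≤-reflexive (sym (reindex (λ i → ⟨ p ℕ.≤? i ℕ.+ j ⟩)))) (tail≤ p j)
    unbroken : ∀ {i j} → ¬ (p ℕ.≤ i ℕ.+ j) → j ℕ.+ i ℕ.< p
    unbroken {i} {j} h = subst (ℕ._< p) (ℕ.+-comm i j) (ℕ.≰⇒> h)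

  -- Removing points from an interval cannot decrease the number of exceptions.
  deficit≤ : ∀ {P : ℕ → Set} (P? : ∀ i → Dec (P i)) lo k n → lo ℕ.+ k ℕ.≤ n →
    + k + ∑ n (λ i → ⟨ P? i ⟩) ≤ + n + ∑ k (λ i → ⟨ P? (lo ℕ.+ i) ⟩)
  deficit≤ P? lo k n l = let
      h = ∑-sub {λ i → 1ℤ + - ⟨ P? i ⟩} lo k n l (λ i _ → let q = ⟨⟩≤1 (P? i) in (lin≤ (⟨ P? i ⟩ ∷ []) $0 ($1 :+ :- #0) (#0 <= $1 by q ∷ []) [] [] refl))
      a = co {λ i → ⟨ P? i ⟩} n ; b = co {λ i → ⟨ P? (lo ℕ.+ i) ⟩} k in
    (lin≤ (+ k ∷ ∑ n (λ i → ⟨ P? i ⟩) ∷ + n ∷ ∑ k (λ i → ⟨ P? (lo ℕ.+ i) ⟩) ∷ ∑ k (λ i → 1ℤ + - ⟨ P? (lo ℕ.+ i) ⟩) ∷ ∑ n (λ i → 1ℤ + - ⟨ P? i ⟩) ∷ []) (#0 :+ #1) (#2 :+ #3) (#4 <= #5 by h ∷ #5 == #2 :* $1 :+ :- #1 by a ∷ #4 =~ #0 :* $1 :+ :- #3 by b ∷ []) [] [] refl)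
    where co : ∀ {f} n → ∑ n (λ i → 1ℤ + - f i) ≡ + n * 1ℤ + - ∑ n f
          co {f} n = trans (∑-+ {λ _ → 1ℤ} {λ i → - f i} n) (cong₂ _+_ (∑-const 1ℤ n) (∑-neg {f} n))

-- Flows along which neither Y nor Z increases.

module Mono where
  open import Data.Nat.DivMod using (_/_; _%_; m≡m%n+[m/n]*n; m%n<n)
  open Lin
  open Sums
  open ChainM
  open Count
  open Steps
  open Units
  open Flows

  module Monotone (C : Chain) (f : Flow C) where
    open Chain C
    open Facts C
    open Counts C
    open StepFacts C
    open Flow f
    open Landing C f

    module _ (θ≤0 : θ ≤ 0ℤ) (η≤0 : η ≤ 0ℤ) where
      -- Along a decreasing flow F cannot drop by two across one turn of the columns ...
      no-41 : ∀ i j → (l : j ℕ.+ i ℕ.< p) → (J : Jump step i j) → Jump.γ J ≡ - 1ℤ → F i ≡ + 2 → F (j ℕ.+ i) ≡ 0ℤ → ⊥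
      no-41 i j l J g fi fk = let
          open Jump J
          k = j ℕ.+ i ; jθ = ℤ.*-monoˡ-≤-nonNeg (+ j) θ≤0 ; jη = ℤ.*-monoˡ-≤-nonNeg (+ j) η≤0
          yi = Y≤ i ; zi = Z≤ i ; yk = 0≤Y k ; zk = 0≤Z k in
        case 0ℤ ℤ.≤? α of λ where
          (no q) → let q = ≰⇒1+≤ q in (lin⊥ (N ∷ α ∷ Y k ∷ Y i ∷ + j ∷ θ ∷ hy ∷ []) ($1 <= #0 by N≥1 ∷ $1 :+ #1 <= $0 by q ∷ #2 == #3 :+ #4 :* #5 :+ #1 :* #0 by YJ ∷ #4 :* #5 <= #4 :* $0 by jθ ∷ #3 :+ #6 <= #0 by yi ∷ $0 <= #2 by yk ∷ $1 <= #6 by hy≥1 ∷ []) (0 ∷ []) ((1 , 0) ∷ []) refl)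
          (yes q) → case 0ℤ ℤ.≤? β of λ where
            (no q′) → let q′ = ≰⇒1+≤ q′ in (lin⊥ (N ∷ β ∷ Z k ∷ Z i ∷ + j ∷ η ∷ hz ∷ []) ($1 <= #0 by N≥1 ∷ $1 :+ #1 <= $0 by q′ ∷ #2 == #3 :+ #4 :* #5 :+ #1 :* #0 by ZJ ∷ #4 :* #5 <= #4 :* $0 by jη ∷ #3 :+ #6 <= #0 by zi ∷ $0 <= #2 by zk ∷ $1 <= #6 by hz≥1 ∷ []) (0 ∷ []) ((1 , 0) ∷ []) refl)
            (yes q′) → (lin⊥ (α ∷ β ∷ F k ∷ F i ∷ γ ∷ []) ($0 <= #0 by q ∷ $0 <= #1 by q′ ∷ #2 =~ #3 :+ #4 :+ #0 :+ #1 by FJ ∷ #3 =~ $2 by fi ∷ #2 == $0 by fk ∷ #4 =~ :- $1 by g ∷ []) [] [] refl)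

      -- ... and cannot rise by one into a top corner.
      no-34 : ∀ i j → (l : j ℕ.+ i ℕ.< p) → (J : Jump step i j) → Jump.γ J ≡ 0ℤ → + j * (+ d * M + 1ℤ) + 1ℤ ≤ N → G₃ i → T (j ℕ.+ i) → ⊥
      no-34 i j l J g bd (fi , ny , nz) (fk , ty , tz) = let
          open Jump J
          k = j ℕ.+ i ; jθ = ℤ.*-monoˡ-≤-nonNeg (+ j) θ≤0 ; jη = ℤ.*-monoˡ-≤-nonNeg (+ j) η≤0
          yi = 0≤Y i ; zi = 0≤Z i ; yk = Y≤ k ; zk = Z≤ k
          lo : - (+ d * M + 1ℤ) ≤ θ
          lo = (lin≤ (+ d ∷ M ∷ θ ∷ η ∷ δ ∷ []) (:- (#0 :* #1 :+ $1)) #2 (#0 :* #1 :+ #2 :+ #3 =~ #4 by s′ ∷ #3 <= $0 by η≤0 ∷ :- $1 <= #4 by d₁ ∷ []) [] [] refl)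
          lo′ : - (+ d * M + 1ℤ) ≤ η
          lo′ = (lin≤ (+ d ∷ M ∷ η ∷ θ ∷ δ ∷ []) (:- (#0 :* #1 :+ $1)) #2 (#0 :* #1 :+ #3 :+ #2 =~ #4 by s′ ∷ #3 <= $0 by θ≤0 ∷ :- $1 <= #4 by d₁ ∷ []) [] [] refl)
          jl = ℤ.*-monoˡ-≤-nonNeg (+ j) lo ; jl′ = ℤ.*-monoˡ-≤-nonNeg (+ j) lo′ in
        case 1ℤ ℤ.≤? α of λ where
          (no q) → let q = ≰⇒1+≤ q in case 1ℤ ℤ.≤? - α of λ where
              (yes q₂) → let b₂ = q₃ q₂ FJ g fi fk in (lin⊥ (N ∷ β ∷ Z k ∷ Z i ∷ + j ∷ η ∷ + d ∷ M ∷ hz ∷ []) ($1 <= #0 by N≥1 ∷ $2 <= #1 by b₂ ∷ #2 =~ #3 :+ #4 :* #5 :+ #1 :* #0 by ZJ ∷ #4 :* :- (#6 :* #7 :+ $1) <= #4 :* #5 by jl′ ∷ #4 :* (#6 :* #7 :+ $1) :+ $1 <= #0 by bd ∷ $0 <= #3 by zi ∷ #2 :+ #8 <= #0 by zk ∷ $1 <= #8 by hz≥1 ∷ []) (0 ∷ []) ((1 , 0) ∷ []) refl)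
              (no q₂) → let q₂ = ≰⇒1+≤ q₂ ; a0 : α ≡ 0ℤ ; a0 = (≤-antisym (lin≤ (α ∷ []) #0 $0 ($1 :+ #0 <= $1 by q ∷ []) [] [] refl) (lin≤ (α ∷ []) $0 #0 ($1 :+ :- #0 <= $1 by q₂ ∷ []) [] [] refl)) ; aN = cong (_* N) a0 in
                (lin⊥ (α ∷ N ∷ Y k ∷ Y i ∷ + j ∷ θ ∷ V ∷ []) (#0 :* #1 == $0 by aN ∷ #2 == #3 :+ #4 :* #5 :+ #0 :* #1 by YJ ∷ #4 :* #5 <= #4 :* $0 by jθ ∷ $1 :+ #3 <= #1 :- #6 by ny ∷ #1 :- #6 <= #2 by ty ∷ []) [] [] refl)
          (yes q) → case + 2 ℤ.≤? α of λ where
              (yes q₂) → (lin⊥ (N ∷ α ∷ Y k ∷ Y i ∷ + j ∷ θ ∷ + d ∷ M ∷ hy ∷ []) ($1 <= #0 by N≥1 ∷ $2 <= #1 by q₂ ∷ #2 =~ #3 :+ #4 :* #5 :+ #1 :* #0 by YJ ∷ #4 :* :- (#6 :* #7 :+ $1) <= #4 :* #5 by jl ∷ #4 :* (#6 :* #7 :+ $1) :+ $1 <= #0 by bd ∷ $0 <= #3 by yi ∷ #2 :+ #8 <= #0 by yk ∷ $1 <= #8 by hy≥1 ∷ []) (0 ∷ []) ((1 , 0) ∷ []) refl)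
              (no q₂) → let q₂ = ≰⇒1+≤ q₂ ; b0 : β ≡ 0ℤ ; b0 = (≤-antisym (lin≤ (β ∷ α ∷ F k ∷ F i ∷ γ ∷ []) #0 $0 ($1 <= #1 by q ∷ #2 =~ #3 :+ #4 :+ #1 :+ #0 by FJ ∷ #3 =~ $1 by fi ∷ #2 == $2 by fk ∷ #4 =~ $0 by g ∷ []) [] [] refl) (lin≤ (β ∷ α ∷ F k ∷ F i ∷ γ ∷ []) $0 #0 ($1 :+ #1 <= $2 by q₂ ∷ #2 == #3 :+ #4 :+ #1 :+ #0 by FJ ∷ #3 == $1 by fi ∷ #2 =~ $2 by fk ∷ #4 == $0 by g ∷ []) [] [] refl)) ; bN = cong (_* N) b0 in
                (lin⊥ (β ∷ N ∷ Z k ∷ Z i ∷ + j ∷ η ∷ U ∷ []) (#0 :* #1 == $0 by bN ∷ #2 == #3 :+ #4 :* #5 :+ #0 :* #1 by ZJ ∷ #4 :* #5 <= #4 :* $0 by jη ∷ $1 :+ #3 <= #1 :- #6 by nz ∷ #1 :- #6 <= #2 by tz ∷ []) [] [] refl)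
        where
        s′ = step-sum′
        d₁ = -1≤δ
        q₃ : ∀ {α β γ x y} → 1ℤ ≤ - α → y ≡ x + γ + α + β → γ ≡ 0ℤ → x ≡ 1ℤ → y ≡ + 2 → + 2 ≤ β
        q₃ {α} {β} {γ} {x} {y} h a b c e = (lin≤ (β ∷ α ∷ y ∷ x ∷ γ ∷ []) $2 #0 ($1 <= :- #1 by h ∷ #2 == #3 :+ #4 :+ #1 :+ #0 by a ∷ #4 == $0 by b ∷ #3 == $1 by c ∷ #2 =~ $2 by e ∷ []) [] [] refl)

      module _ (j D D′ : ℕ) (D≡ : D ≡ j ℕ.* d) (D′≤D : D′ ℕ.≤ D) (D′≤u : D′ ℕ.≤ u) (D≤m : D ℕ.≤ m) (bd : + j * (+ d * M + 1ℤ) + 1ℤ ≤ N) where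
        private
          D+ : + D ≡ + j * + d
          D+ = trans (cong +_ D≡) (ℤ.pos-* j d)
          lo₁ lo₂ lo₃ : ℕ
          lo₁ = m ℕ.∸ D
          lo₂ = u ℕ.∸ D′
          lo₃ = D ℕ.∸ D′
          e₁ = cong +_ (ℕ.m∸n+n≡m D≤m)
          e₂ = cong +_ (ℕ.m∸n+n≡m D′≤u)
          e₃ = cong +_ (ℕ.m∸n+n≡m D′≤D)
          l₁ : lo₁ ℕ.+ D′ ℕ.≤ m
          l₁ = ℕ.≤-trans (ℕ.+-monoʳ-≤ lo₁ D′≤D) (ℕ.≤-reflexive (ℕ.m∸n+n≡m D≤m))
          l₂ : lo₂ ℕ.+ D′ ℕ.≤ u
          l₂ = ℕ.≤-reflexive (ℕ.m∸n+n≡m D′≤u)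
          l₃ : lo₃ ℕ.+ D′ ℕ.≤ m
          l₃ = ℕ.≤-trans (ℕ.≤-reflexive (ℕ.m∸n+n≡m D′≤D)) D≤m
          in₁ : ∀ {o} → o ℕ.< D′ → s ℕ.+ (lo₁ ℕ.+ o) ℕ.< p
          in₁ l = s+<p (ℕ.<-≤-trans (ℕ.+-monoʳ-< lo₁ l) l₁)
          in₂ : ∀ {o} → o ℕ.< D′ → v ℕ.+ (lo₂ ℕ.+ o) ℕ.< p
          in₂ l = v+<p (ℕ.<-≤-trans (ℕ.+-monoʳ-< lo₂ l) l₂)
          in₃ : ∀ {o} → o ℕ.< D′ → s ℕ.+ (lo₃ ℕ.+ o) ℕ.< p
          in₃ l = s+<p (ℕ.<-≤-trans (ℕ.+-monoʳ-< lo₃ l) l₃)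
          in₀ : ∀ {o} → o ℕ.< D′ → o ℕ.< p
          in₀ l = ℕ.<-≤-trans l (ℕ.≤-trans D′≤u u≤p)

          cross₁ : ∀ o → o ℕ.< D′ → T (pos (s ℕ.+ (lo₁ ℕ.+ o))) → G₁ (pos o) → p ℕ.≤ pos (s ℕ.+ (lo₁ ℕ.+ o)) ℕ.+ j
          cross₁ o l (ft , _) g with p ℕ.≤? pos (s ℕ.+ (lo₁ ℕ.+ o)) ℕ.+ j
          ... | yes h = h
          ... | no ¬h = let x = s ℕ.+ (lo₁ ℕ.+ o) ; i = pos x ; k<p = unbroken {i} {j} ¬h ; J = jump i j k<p ; c = cong +_ (col-pos x (in₁ l))
                            h , γ≡ = land i j o 1ℤ k<p (in₀ l) (lin≡ (+ col i ∷ + j ∷ + d ∷ + o ∷ + p ∷ + s ∷ + lo₁ ∷ + D ∷ + m ∷ []) (#0 :+ #1 :* #2) (#3 :+ $1 :* #4) (#0 == #5 :+ (#6 :+ #3) by c ∷ #6 :+ #7 == #8 by e₁ ∷ #7 =~ #1 :* #2 by D+ ∷ #4 =~ #5 :+ #8 by ps ∷ []) [] refl) J in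
            ⊥-elim (no-41 i j k<p J γ≡ ft (subst G₁ h g))
            where ps : + p ≡ + s + + m
                  ps = refl
          cross₃ : ∀ o → o ℕ.< D′ → G₃ (pos (v ℕ.+ (lo₂ ℕ.+ o))) → T (pos (s ℕ.+ (lo₃ ℕ.+ o))) → p ℕ.≤ pos (v ℕ.+ (lo₂ ℕ.+ o)) ℕ.+ j
          cross₃ o l g t with p ℕ.≤? pos (v ℕ.+ (lo₂ ℕ.+ o)) ℕ.+ j
          ... | yes h = h
          ... | no ¬h = let x = v ℕ.+ (lo₂ ℕ.+ o) ; i = pos x ; k<p = unbroken {i} {j} ¬h ; J = jump i j k<p ; c = cong +_ (col-pos x (in₂ l)) ; y = s ℕ.+ (lo₃ ℕ.+ o)
                            h , γ≡ = land i j y 0ℤ k<p (in₃ l) (lin≡ (+ col i ∷ + j ∷ + d ∷ + v ∷ + u ∷ + lo₃ ∷ + o ∷ + p ∷ + lo₂ ∷ + D′ ∷ + D ∷ []) (#0 :+ #1 :* #2) (#3 :+ #4 :+ (#5 :+ #6) :+ $0 :* #7) (#0 == #3 :+ (#8 :+ #6) by c ∷ #8 :+ #9 == #4 by e₂ ∷ #5 :+ #9 =~ #10 by e₃ ∷ #10 =~ #1 :* #2 by D+ ∷ []) [] refl) J in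
            ⊥-elim (no-34 i j k<p J γ≡ bd g (subst T h t))

        -- Two families of `D′` jumps by `D = j d` columns: from the last columns round to the first
        -- ones, where T cannot lead to G₁, and from `[v , s)` into `[s , p)`, where G₃ cannot lead
        -- to T. Their sources lie in different columns, so at most `j` jumps are broken altogether.
        bound : + 2 * + D′ ≤ + j + + 2 * + m + + 2 * + u - + 2 * τ - g₁ - g₃
        bound = let
            P = λ o → T? (pos (s ℕ.+ o)) ; Q = λ o → G₁? (pos o) ; R = λ o → G₃? (pos (v ℕ.+ o))
            a = pairs≤ (λ o → P (lo₁ ℕ.+ o)) Q (λ o → p ℕ.≤? pos (s ℕ.+ (lo₁ ℕ.+ o)) ℕ.+ j) D′ cross₁
            b = pairs≤ (λ o → R (lo₂ ℕ.+ o)) (λ o → P (lo₃ ℕ.+ o)) (λ o → p ℕ.≤? pos (v ℕ.+ (lo₂ ℕ.+ o)) ℕ.+ j) D′ cross₃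
            c = deficit≤ P lo₁ D′ m l₁ ; c′ = deficit≤ P lo₃ D′ m l₃ ; q = deficit≤ Q 0 D′ u D′≤u ; r = deficit≤ R lo₂ D′ u l₂
            t = broken≤ j ; sp = ∑-split {broken j} s m ; sp′ = ∑-split {broken j} v u
            x = ∑-sub {λ o → broken j (s ℕ.+ o)} lo₁ D′ m l₁ (λ _ _ → ⟨⟩≥0 (p ℕ.≤? _)) ; y = ∑-sub {λ o → broken j (v ℕ.+ o)} lo₂ D′ u l₂ (λ _ _ → ⟨⟩≥0 (p ℕ.≤? _))
            z = ∑-nonneg {broken j} v (λ _ _ → ⟨⟩≥0 (p ℕ.≤? _))
          in (lin≤ (+ D′ ∷ + j ∷ + m ∷ + u ∷ τ ∷ g₁ ∷ g₃ ∷ ∑ D′ (λ o → ⟨ P (lo₁ ℕ.+ o) ⟩) ∷ ∑ D′ (λ o → ⟨ Q o ⟩) ∷ ∑ D′ (λ o → broken j (s ℕ.+ (lo₁ ℕ.+ o))) ∷ ∑ D′ (λ o → ⟨ R (lo₂ ℕ.+ o) ⟩) ∷ ∑ D′ (λ o → ⟨ P (lo₃ ℕ.+ o) ⟩) ∷ ∑ D′ (λ o → broken j (v ℕ.+ (lo₂ ℕ.+ o))) ∷ ∑ p (broken j) ∷ ∑ s (broken j) ∷ ∑ m (λ o → broken j (s ℕ.+ o)) ∷ ∑ v (broken j) ∷ ∑ u (λ o → broken j (v ℕ.+ o)) ∷ []) ($2 :* #0) (#1 :+ $2 :* #2 :+ $2 :* #3 :- $2 :* #4 :- #5 :- #6)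 (#7 :+ #8 <= #0 :+ #9 by a ∷ #10 :+ #11 <= #0 :+ #12 by b ∷ #0 :+ #4 <= #2 :+ #7 by c ∷ #0 :+ #4 <= #2 :+ #11 by c′ ∷ #0 :+ #5 <= #3 :+ #8 by q ∷ #0 :+ #6 <= #3 :+ #10 by r ∷ #13 <= #1 by t ∷ #13 =~ #14 :+ #15 by sp ∷ #14 =~ #16 :+ #17 by sp′ ∷ #9 <= #15 by x ∷ #12 <= #17 by y ∷ $0 <= #16 by z ∷ []) [] [] refl)

      contradiction : ⊥
      contradiction with d ℕ.≤? u
      -- A single step passes more than `u` columns, so all `u` columns of the first and of the
      -- third interval take part.
      ... | no d>u = let
              d<m′ = d<m ; b = bound 1 d u (sym (ℕ.+-identityʳ d)) (ℕ.<⇒≤ (ℕ.≰⇒> d>u)) ℕ.≤-refl (ℤ.drop‿+≤+ (ℤ.≤-trans (≤-trans (+≤+ (ℕ.n≤1+n d)) (≤-reflexive (ℤ.+-comm 1ℤ (+ d)))) d<m))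
                (lin≤ (+ d ∷ M ∷ N ∷ + u ∷ + e ∷ + m ∷ []) ($1 :* (#0 :* #1 :+ $1) :+ $1) #2 ($1 <= #1 by M≥1 ∷ $2 <= #3 by u≥2 ∷ #2 =~ (#3 :+ #4 :+ #3 :+ #5) :* #1 by N≡′ ∷ #0 :+ $1 <= #5 by q ∷ $0 <= #4 by e≥0 ∷ []) (1 ∷ 5 ∷ 2 ∷ []) ((4 , 1) ∷ (2 , 1) ∷ (2 , 1) ∷ (5 , 1) ∷ []) refl)
            in (lin⊥ (A ∷ τ ∷ + u ∷ + m ∷ g₁ ∷ g₃ ∷ τ′ ∷ + e ∷ []) (#0 <= #1 :+ #2 by τ≥ ∷ $2 :* #2 <= $1 :+ $2 :* #3 :+ $2 :* #2 :- $2 :* #1 :- #4 :- #5 by b ∷ #0 :+ #2 <= #6 :+ #4 :+ #5 by good′ ∷ #6 <= #2 :+ #7 :+ #2 by τ′≤s ∷ $2 :* (#2 :+ #7 :+ #2 :+ #3) :+ $1 <= $3 :* #0 by large ∷ $2 <= #2 by u≥2 ∷ $0 <= #7 by e≥0 ∷ []) (2 ∷ []) [] refl)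
        where q = d<m
      -- `D` is the largest multiple of `d` up to `u`. The remainder `r < d` is compensated by
      -- `(j - 1)(d - 1) ≥ 0`, the product in the certificate.
      ... | yes d≤u = (lin⊥ (A ∷ τ ∷ + u ∷ + j ∷ + d ∷ + D ∷ + m ∷ g₁ ∷ g₃ ∷ τ′ ∷ + e ∷ + r ∷ []) (#0 <= #1 :+ #2 by τ≥ ∷ $1 <= #3 by j≥1 ∷ $1 <= #4 by dd ∷ $2 :* #5 <= #3 :+ $2 :* #6 :+ $2 :* #2 :- $2 :* #1 :- #7 :- #8 by b ∷ #0 :+ #2 <= #9 :+ #7 :+ #8 by good′ ∷ #9 <= #2 :+ #10 :+ #2 by τ′≤s ∷ $2 :* (#2 :+ #10 :+ #2 :+ #6) :+ $1 <= $3 :* #0 by large ∷ $0 <= #10 by e≥0 ∷ #2 == #11 :+ #5 by dv ∷ $1 :+ #11 <= #4 by rd ∷ #5 =~ #3 :* #4 by Dj ∷ []) (2 ∷ 0 ∷ 0 ∷ []) ((1 , 2) ∷ []) refl)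
        where
        instance
          d≢ : ℕ.NonZero d
          d≢ = ℕ.>-nonZero (ℤ.drop‿+≤+ d≥1)
        j r D : ℕ
        j = u / d
        r = u % d
        D = j ℕ.* d
        dd = d≥1
        dv = cong +_ (m≡m%n+[m/n]*n u d)
        Dj = ℤ.pos-* j d
        rd = +≤+ (m%n<n u d)
        j≥0 : 0ℤ ≤ + j
        j≥0 = +≤+ z≤n
        r≥0 : 0ℤ ≤ + r
        r≥0 = +≤+ z≤n
        j≥1 : 1ℤ ≤ + j
        j≥1 with 1ℤ ℤ.≤? + j
        ... | yes h = h
        ... | no h = let h = ≰⇒1+≤ h ; du = +≤+ d≤u in ⊥-elim (lin⊥ (+ d ∷ + j ∷ + u ∷ + r ∷ + D ∷ []) ($1 <= #0 by dd ∷ $1 :+ #1 <= $1 by h ∷ #2 == #3 :+ #4 by dv ∷ #4 == #1 :* #0 by Dj ∷ $1 :+ #3 <= #0 by rd ∷ #0 <= #2 by du ∷ []) (0 ∷ []) ((1 , 0) ∷ []) refl)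
        D≤u : D ℕ.≤ u
        D≤u = ℤ.drop‿+≤+ (lin≤ (+ D ∷ + u ∷ + r ∷ []) #0 #1 (#1 =~ #2 :+ #0 by dv ∷ $0 <= #2 by r≥0 ∷ []) [] [] refl)
        bd : + j * (+ d * M + 1ℤ) + 1ℤ ≤ N
        bd = let DM = cong (_* M) Dj ; dvM = cong (_* M) dv in
          (lin≤ (+ j ∷ + d ∷ M ∷ N ∷ + r ∷ + e ∷ + u ∷ + m ∷ + D ∷ []) (#0 :* (#1 :* #2 :+ $1) :+ $1) #3 ($0 <= #4 by r≥0 ∷ $1 <= #2 by M≥1 ∷ $0 <= #5 by e≥0 ∷ $1 <= #1 by dd ∷ $0 <= #0 by j≥0 ∷ #3 =~ (#6 :+ #5 :+ #6 :+ #7) :* #2 by N≡′ ∷ #6 :* #2 =~ (#4 :+ #8) :* #2 by dvM ∷ #8 :* #2 =~ #0 :* #1 :* #2 by DM ∷ #6 =~ #4 :+ #8 by dv ∷ #8 =~ #0 :* #1 by Dj ∷ $2 <= #6 by u≥2 ∷ #6 :+ $2 :* #5 :+ $1 <= #7 by 3v<p ∷ []) (1 ∷ 2 ∷ 5 ∷ 3 ∷ 0 ∷ 0 ∷ []) ((1 , 2) ∷ (4 , 5) ∷ (11 , 2) ∷ (11 , 2) ∷ (3 , 2) ∷ (3 , 2) ∷ (3 , 2) ∷ (12 , 2) ∷ []) refl)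
        b = bound j D D refl ℕ.≤-refl D≤u (ℕ.≤-trans D≤u (ℤ.drop‿+≤+ (lin≤ (+ u ∷ + m ∷ + e ∷ []) #0 #1 ($0 <= #2 by e≥0 ∷ #0 :+ $2 :* #2 :+ $1 <= #1 by 3v<p ∷ []) (1 ∷ 2 ∷ []) [] refl))) bd

-- Rising flows: the reach J, and the steep case.

module Rise where
  open import Data.Nat.DivMod using (_/_; _%_; m≡m%n+[m/n]*n; m%n<n)
  open Lin
  open Sums
  open ChainM
  open Count
  open Steps
  open Units
  open Flows

  no-half : ∀ x → + 2 * x ≢ 1ℤ
  no-half x h = case x ℤ.≤? 0ℤ of λ where
    (yes q) → (lin⊥ (x ∷ []) (#0 <= $0 by q ∷ $2 :* #0 =~ $1 by h ∷ []) (2 ∷ []) [] refl)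
    (no q) → let q = ≰⇒1+≤ q in (lin⊥ (x ∷ []) ($1 :+ $0 <= #0 by q ∷ $2 :* #0 == $1 by h ∷ []) (2 ∷ []) [] refl)

  module Rising (C : Chain) (f : Flow C) (θ≥1 : 1ℤ ≤ Flow.θ f) where
    open Chain C
    open Facts C
    open Counts C
    open StepFacts C
    open Flow f
    open Landing C f

    private
      s′ = step-sum′
      d₁ = -1≤δ
      d₂ = δ≤1
      d≥ = d≥1
      P : + p ≡ + u + + e + + u + + m
      P = refl
    dM≤ : + d * M ≤ - η
    dM≤ = (lin≤ (+ d ∷ M ∷ η ∷ θ ∷ δ ∷ []) (#0 :* #1) (:- #2) (#0 :* #1 :+ #3 :+ #2 == #4 by s′ ∷ #4 <= $1 by d₂ ∷ $1 <= #3 by θ≥1 ∷ []) [] [] refl)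
    -η≥1 : 1ℤ ≤ - η
    -η≥1 = (lin≤ (η ∷ + d ∷ M ∷ []) $1 (:- #0) (#1 :* #2 <= :- #0 by dM≤ ∷ $1 <= #1 by d≥ ∷ $1 <= #2 by M≥1 ∷ []) [] ((2 , 3) ∷ []) refl)
    private
      E≡ : + ℤ.∣ - η ∣ ≡ - η
      E≡ = ℤ.0≤i⇒+∣i∣≡i (≤-trans (+≤+ z≤n) -η≥1)
      W≡ : + ℤ.∣ U - hz ∣ ≡ U - hz
      W≡ = ℤ.0≤i⇒+∣i∣≡i (≤-trans (≤-trans (+≤+ z≤n) -η≥1) -η≤)
    instance
      E≢0 : ℕ.NonZero ℤ.∣ - η ∣
      E≢0 = ℕ.>-nonZero (ℤ.drop‿+≤+ (≤-trans -η≥1 (≤-reflexive (sym E≡))))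
    -- `J` is the number of whole steps of size `- η` within `U - hz`, the largest difference of two
    -- top values of `Z`; `D` is the number of columns passed meanwhile.
    J r D : ℕ
    J = ℤ.∣ U - hz ∣ / ℤ.∣ - η ∣
    r = ℤ.∣ U - hz ∣ % ℤ.∣ - η ∣
    D = J ℕ.* d
    wr : U - hz ≡ + r + + J * - η
    wr = trans (sym W≡) (trans (cong +_ (m≡m%n+[m/n]*n ℤ.∣ U - hz ∣ ℤ.∣ - η ∣)) (cong (λ z → + r + z) (trans (ℤ.pos-* J _) (cong (λ z → + J * z) E≡))))
    r< : 1ℤ + + r ≤ - η
    r< = ≤-trans (+≤+ (m%n<n ℤ.∣ U - hz ∣ ℤ.∣ - η ∣)) (≤-reflexive E≡)
    r≥0 : 0ℤ ≤ + r
    r≥0 = +≤+ z≤n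
    J≥0 : 0ℤ ≤ + J
    J≥0 = +≤+ z≤n
    Dj : + D ≡ + J * + d
    Dj = ℤ.pos-* J d
    J≥1 : 1ℤ ≤ + J
    J≥1 = case 1ℤ ℤ.≤? + J of λ where
      (yes h) → h
      (no h) → let h = ≰⇒1+≤ h in ⊥-elim (lin⊥ (η ∷ + J ∷ U ∷ hz ∷ + r ∷ []) ($1 <= :- #0 by -η≥1 ∷ $1 :+ #1 <= $1 by h ∷ #2 :- #3 == #4 :+ #1 :* :- #0 by wr ∷ $1 :+ #4 <= :- #0 by r< ∷ :- #0 <= #2 :- #3 by -η≤ ∷ []) (0 ∷ []) ((1 , 0) ∷ []) refl)
    private
      DM : + D * M ≡ + J * + d * M
      DM = cong (_* M) Dj
    -- `J` steps lower `Z` by at least `J d M = D M`, while `U - hz` is smaller than `ez M ≤ v M`.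
    D<v : + D + 1ℤ ≤ + v
    D<v = case + D + 1ℤ ℤ.≤? + v of λ where
      (yes h) → h
      (no h) → let h = ≰⇒1+≤ h in ⊥-elim (lin⊥ (+ d ∷ M ∷ η ∷ + J ∷ + u ∷ + e ∷ + D ∷ U ∷ hz ∷ + p ∷ + ez ∷ + r ∷ + m ∷ []) (#0 :* #1 <= :- #2 by dM≤ ∷ $0 <= #3 by J≥0 ∷ $1 <= #1 by M≥1 ∷ $1 :+ (#4 :+ #5) <= #6 :+ $1 by h ∷ #7 :- #8 :+ #9 <= #10 :* #1 by U≤ ∷ #7 :- #8 =~ #11 :+ #3 :* :- #2 by wr ∷ $0 <= #11 by r≥0 ∷ #6 :* #1 == #3 :* #0 :* #1 by DM ∷ $1 <= #4 :+ #5 :+ #4 :+ #12 by p≥1 ∷ #9 =~ #4 :+ #5 :+ #4 :+ #12 by P ∷ #10 <= #4 :+ #5 by ez≤v ∷ []) (0 ∷ 0 ∷ 0 ∷ []) ((0 , 1) ∷ (3 , 2) ∷ (10 , 2) ∷ []) refl)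
    -- (J - 1)(d - 1) ≥ 0
    J+d≤ : + J + + d ≤ + D + 1ℤ
    J+d≤ = (lin≤ (+ J ∷ + d ∷ + D ∷ []) (#0 :+ #1) (#2 :+ $1) ($1 <= #0 by J≥1 ∷ $1 <= #1 by d≥ ∷ #2 =~ #0 :* #1 by Dj ∷ []) (1 ∷ 0 ∷ 0 ∷ []) ((1 , 2) ∷ []) refl)

    module Steep (big : + d * M + 1ℤ ≤ θ) where
      e2 : + 2 * (+ d * M) ≤ - η
      e2 = (lin≤ (+ d ∷ M ∷ η ∷ θ ∷ δ ∷ []) ($2 :* (#0 :* #1)) (:- #2) (#0 :* #1 :+ #3 :+ #2 == #4 by s′ ∷ #4 <= $1 by d₂ ∷ #0 :* #1 :+ $1 <= #3 by big ∷ []) [] [] refl)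
      -- In a steep step `Z` pays for the column and for `Y`, at least `2 d M`, which halves the
      -- number of columns within reach.
      2D<v : + 2 * + D + 1ℤ ≤ + v
      2D<v = case + 2 * + D + 1ℤ ℤ.≤? + v of λ where
        (yes h) → h
        (no h) → let h = ≰⇒1+≤ h in ⊥-elim (lin⊥ (+ D ∷ M ∷ + J ∷ + d ∷ η ∷ + u ∷ + e ∷ + ez ∷ U ∷ hz ∷ + p ∷ + r ∷ + m ∷ []) (#0 :* #1 == #2 :* #3 :* #1 by DM ∷ $1 <= #1 by M≥1 ∷ $2 :* (#3 :* #1) <= :- #4 by e2 ∷ $0 <= #2 by J≥0 ∷ $1 :+ (#5 :+ #6) <= $2 :* #0 :+ $1 by h ∷ #7 <= #5 :+ #6 by ez≤v ∷ #8 :- #9 :+ #10 <= #7 :* #1 by U≤ ∷ #8 :- #9 =~ #11 :+ #2 :* :- #4 by wr ∷ $0 <= #11 by r≥0 ∷ $1 <= #5 :+ #6 :+ #5 :+ #12 by p≥1 ∷ #10 =~ #5 :+ #6 :+ #5 :+ #12 by P ∷ []) (2 ∷ 0 ∷ 0 ∷ 0 ∷ []) ((4 , 1) ∷ (5 , 1) ∷ (2 , 3) ∷ []) refl)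
      ι n : ℕ
      ι = D ℕ.+ d
      n = m ℕ.∸ ι
      ι≤m : ι ℕ.≤ m
      ι≤m = ℤ.drop‿+≤+ (lin≤ (+ D ∷ + d ∷ + m ∷ + J ∷ + u ∷ + e ∷ []) (#0 :+ #1) #2 ($1 <= #1 by d≥ ∷ #0 =~ #3 :* #1 by Dj ∷ $1 <= #3 by J≥1 ∷ $2 :* #0 :+ $1 <= #4 :+ #5 by 2D<v ∷ #4 :+ $2 :* #5 :+ $1 <= #2 by 3v<p ∷ $0 <= #5 by e≥0 ∷ []) (1 ∷ 0 ∷ []) ((1 , 3) ∷ []) refl)
      ι+n : ι ℕ.+ n ≡ m
      ι+n = ℕ.m+[n∸m]≡n ι≤m

      -- By the choice of `J`, `J + 1` steps take `Z` out of the top window, and `3 U < N` prevents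
      -- a wrap from bringing it back.
      cross : ∀ o → o ℕ.< n → T (pos (s ℕ.+ o)) → T (pos (s ℕ.+ (ι ℕ.+ o))) → p ℕ.≤ pos (s ℕ.+ o) ℕ.+ suc J
      cross o l t t′ with p ℕ.≤? pos (s ℕ.+ o) ℕ.+ suc J
      ... | yes h = h
      ... | no ¬h = ⊥-elim (low (subst T h t′))
        where
        i = pos (s ℕ.+ o)
        k = suc J ℕ.+ i
        k<p : k ℕ.< p
        k<p = unbroken {i} {suc J} ¬h
        jmp = jump i (suc J) k<p
        open Jump jmp
        l″ : ι ℕ.+ o ℕ.< m
        l″ = ℕ.<-≤-trans (ℕ.+-monoʳ-< ι l) (ℕ.≤-reflexive ι+n)
        l‴ : o ℕ.< m
        l‴ = ℕ.<-≤-trans l (ℕ.m∸n≤m m ι)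
        c = cong +_ (col-pos (s ℕ.+ o) (s+<p l‴))
        h = proj₁ (land i (suc J) (s ℕ.+ (ι ℕ.+ o)) 0ℤ k<p (s+<p l″) (lin≡ (+ col i ∷ + J ∷ + d ∷ + s ∷ + D ∷ + o ∷ + p ∷ []) (#0 :+ ($1 :+ #1) :* #2) (#3 :+ (#4 :+ #2 :+ #5) :+ $0 :* #6) (#0 == #3 :+ #5 by c ∷ #4 =~ #1 :* #2 by Dj ∷ []) [] refl) jmp)
        zi = Z≤ i
        zk = Z≤ k
        z0 = 0≤Z k
        ti = proj₂ (proj₂ t)
        low : T k → ⊥
        low (_ , _ , tk) = case 1ℤ ℤ.≤? β of λ where
          (yes q) → (lin⊥ (hz ∷ N ∷ β ∷ Z k ∷ Z i ∷ + J ∷ η ∷ U ∷ + r ∷ []) ($1 <= #0 by hz≥1 ∷ $1 <= #1 by N≥1 ∷ $1 <= #2 by q ∷ #3 =~ #4 :+ ($1 :+ #5) :* #6 :+ #2 :* #1 by ZJ ∷ #1 :- #7 <= #4 by ti ∷ #3 :+ #0 <= #1 by zk ∷ #7 :- #0 =~ #8 :+ #5 :* :- #6 by wr ∷ $0 <= #8 by r≥0 ∷ :- #6 <= #7 :- #0 by -η≤ ∷ $3 :* #7 :+ $1 <= #1 by 3U<N ∷ []) (3 ∷ 0 ∷ []) ((2 , 1) ∷ []) refl)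
          (no q) → let q = ≰⇒1+≤ q ; q′ = (lin≤ (β ∷ []) #0 $0 ($1 :+ #0 <= $1 by q ∷ []) [] [] refl) in
            (lin⊥ (N ∷ β ∷ Z k ∷ Z i ∷ + J ∷ η ∷ hz ∷ U ∷ + r ∷ []) ($1 <= #0 by N≥1 ∷ #1 <= $0 by q′ ∷ #2 == #3 :+ ($1 :+ #4) :* #5 :+ #1 :* #0 by ZJ ∷ #3 :+ #6 <= #0 by zi ∷ #0 :- #7 <= #2 by tk ∷ #7 :- #6 == #8 :+ #4 :* :- #5 by wr ∷ $1 :+ #8 <= :- #5 by r< ∷ []) (0 ∷ []) ((1 , 0) ∷ []) refl)

      impossible : ⊥
      impossible = let
          Q = λ o → T? (pos (s ℕ.+ o))
          a = pairs≤ Q (λ o → Q (ι ℕ.+ o)) (λ o → p ℕ.≤? pos (s ℕ.+ o) ℕ.+ suc J) n cross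
          n≤m = ℕ.m∸n≤m m ι
          b = deficit≤ Q 0 n m n≤m ; b′ = deficit≤ Q ι n m (ℕ.≤-reflexive ι+n)
          t = broken≤ (suc J) ; sp = ∑-split {broken (suc J)} s m
          x = ∑-sub {λ o → broken (suc J) (s ℕ.+ o)} 0 n m n≤m (λ _ _ → ⟨⟩≥0 (p ℕ.≤? _))
          z = ∑-nonneg {broken (suc J)} s (λ _ _ → ⟨⟩≥0 (p ℕ.≤? _))
          q = cong +_ ι+n
          main : + 2 * τ ≤ + m + + D + + d + + J + 1ℤ
          main = (lin≤ (τ ∷ + m ∷ + D ∷ + d ∷ + J ∷ ∑ n (λ o → ⟨ Q o ⟩) ∷ ∑ n (λ o → ⟨ Q (ι ℕ.+ o) ⟩) ∷ + n ∷ ∑ n (λ o → broken (suc J) (s ℕ.+ o)) ∷ ∑ p (broken (suc J)) ∷ ∑ s (broken (suc J)) ∷ ∑ m (λ o → broken (suc J) (s ℕ.+ o)) ∷ []) ($2 :* #0) (#1 :+ #2 :+ #3 :+ #4 :+ $1) (#5 :+ #6 <= #7 :+ #8 by a ∷ #7 :+ #0 <= #1 :+ #5 by b ∷ #7 :+ #0 <= #1 :+ #6 by b′ ∷ #9 <= $1 :+ #4 by t ∷ #9 =~ #10 :+ #11 by sp ∷ #8 <= #11 by x ∷ $0 <= #10 by z ∷ #2 :+ #3 :+ #7 =~ #1 by q ∷ []) [] [] refl)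
          hd , o = odd
        -- The counts give `p ≤ 6 D + 4`, and `2 D < v` with `3 v < p` gives the converse; but
        -- `6 D + 4` is even.
        in no-half (+ hd - + 3 * + D - 1ℤ) (≤-antisym (lin≤ (+ hd ∷ + D ∷ τ ∷ + m ∷ + d ∷ + J ∷ A ∷ + u ∷ + e ∷ []) ($2 :* (#0 :- $3 :* #1 :- $1)) $1 ($2 :* #2 <= #3 :+ #1 :+ #4 :+ #5 :+ $1 by main ∷ #6 <= #2 :+ #7 by τ≥ ∷ $2 :* (#7 :+ #8 :+ #7 :+ #3) :+ $1 <= $3 :* #6 by large ∷ #5 :+ #4 <= #1 :+ $1 by J+d≤ ∷ $0 <= #8 by e≥0 ∷ #7 :+ #8 :+ #7 :+ #3 =~ $1 :+ $2 :* #0 by o ∷ []) (1 ∷ 3 ∷ 6 ∷ 2 ∷ 3 ∷ 3 ∷ []) [] refl) (lin≤ (+ hd ∷ + D ∷ + u ∷ + e ∷ + m ∷ []) $1 ($2 :* (#0 :- $3 :* #1 :- $1)) ($2 :* #1 :+ $1 <= #2 :+ #3 by 2D<v ∷ #2 :+ #3 :+ #2 :+ #4 == $1 :+ $2 :* #0 by o ∷ #2 :+ $2 :* #3 :+ $1 <= #4 by 3v<p ∷ []) (1 ∷ 3 ∷ []) [] refl))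

-- Gentle rising flows: windows formed by the turns of the columns.

module Slide where
  open import Data.Nat.DivMod using (_/_; _%_; m≡m%n+[m/n]*n; m%n<n; /-monoˡ-≤)
  open Lin
  open Sums
  open ChainM
  open Count
  open Steps
  open Units
  open Flows
  open Rise

  module Sliding (C : Chain) (f : Flow C) (θ≥1 : 1ℤ ≤ Flow.θ f) (gentle : Flow.θ f ≤ + Flow.d f * Chain.M C) where
    open Chain C
    open Facts C
    open Counts C
    open StepFacts C
    open Flow f
    open Landing C f
    open Rising C f θ≥1

    private
      s′ = step-sum′
      d₁ = -1≤δ
      d₂ = δ≤1
      d≥ = d≥1
      P : + p ≡ + u + + e + + u + + m
      P = refl

    o₀ : ℕ
    o₀ = off (col 0)
    -- How often the offset has passed `p` after `i` steps. As the chain advances by less than `d p`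
    -- offsets, the windows are numbered from 0 to `d`; the first and the last are in general
    -- incomplete.
    win : ℕ → ℕ
    win i = (o₀ ℕ.+ i ℕ.* d) / p

    off-win : ∀ i → i ℕ.< p → + off (col i) + + win i * + p ≡ + o₀ + + i * + d
    off-win i l = let
        i0 = ℕ.+-identityʳ i
        J′ = jump 0 i (subst (ℕ._< p) (sym i0) l)
        open Jump J′
        c : + col i ≡ + col 0 + + i * + d + γ * + p
        c = trans (cong (λ z → + col z) (sym i0)) (trans colJ (cong (λ z → + col 0 + + i * z + γ * + p) d≡))
        a = dm (col i ℕ.+ (u ℕ.+ m)) ; b = dm (col 0 ℕ.+ (u ℕ.+ m))
        w = trans (cong (λ z → + o₀ + z) (sym (ℤ.pos-* i d))) (dm (o₀ ℕ.+ i ℕ.* d))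
        x = (o₀ ℕ.+ i ℕ.* d) % p ; x< = +≤+ (m%n<n (o₀ ℕ.+ i ℕ.* d) p) ; x≥0 = +≤+ (z≤n {x}) ; y< = +≤+ (off< (col i)) ; y≥0 = +≤+ (z≤n {off (col i)})
        qi = (col i ℕ.+ (u ℕ.+ m)) / p ; q0 = (col 0 ℕ.+ (u ℕ.+ m)) / p
        K = γ - + qi + + q0 + + win i
        z = small-multiple (γ - + qi + + q0 + + win i) p≥1
          (lin≤ (γ ∷ + qi ∷ + q0 ∷ + win i ∷ + p ∷ + col i ∷ + col 0 ∷ + i ∷ + d ∷ + u ∷ + m ∷ + off (col i) ∷ + o₀ ∷ + x ∷ []) ((#0 :- #1 :+ #2 :+ #3) :* #4 :+ $1) #4 (#5 =~ #6 :+ #7 :* #8 :+ #0 :* #4 by c ∷ #5 :+ (#9 :+ #10) == #11 :+ #1 :* #4 by a ∷ #6 :+ (#9 :+ #10) =~ #12 :+ #2 :* #4 by b ∷ #12 :+ #7 :* #8 =~ #13 :+ #3 :* #4 by w ∷ $1 :+ #11 <= #4 by y< ∷ $0 <= #13 by x≥0 ∷ []) [] [] refl)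
          (lin≤ (+ p ∷ γ ∷ + qi ∷ + q0 ∷ + win i ∷ + col i ∷ + col 0 ∷ + i ∷ + d ∷ + u ∷ + m ∷ + off (col i) ∷ + o₀ ∷ + x ∷ []) (:- #0 :+ $1) ((#1 :- #2 :+ #3 :+ #4) :* #0) (#5 == #6 :+ #7 :* #8 :+ #1 :* #0 by c ∷ #5 :+ (#9 :+ #10) =~ #11 :+ #2 :* #0 by a ∷ #6 :+ (#9 :+ #10) == #12 :+ #3 :* #0 by b ∷ #12 :+ #7 :* #8 == #13 :+ #4 :* #0 by w ∷ $1 :+ #13 <= #0 by x< ∷ $0 <= #11 by y≥0 ∷ []) [] [] refl)
        z′ = cong (_* + p) z
      in (lin≡ (+ off (col i) ∷ + win i ∷ + p ∷ + o₀ ∷ + i ∷ + d ∷ γ ∷ + qi ∷ + q0 ∷ + col i ∷ + col 0 ∷ + u ∷ + m ∷ []) (#0 :+ #1 :* #2) (#3 :+ #4 :* #5) ((#6 :- #7 :+ #8 :+ #1) :* #2 == $0 by z′ ∷ #9 == #10 :+ #4 :* #5 :+ #6 :* #2 by c ∷ #9 :+ (#11 :+ #12) =~ #0 :+ #7 :* #2 by a ∷ #10 :+ (#11 :+ #12) == #3 :+ #8 :* #2 by b ∷ []) [] refl)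
      where
      dm : ∀ n → + n ≡ + (n % p) + + (n / p) * + p
      dm n = trans (cong +_ (m≡m%n+[m/n]*n n p)) (cong (λ z → + (n % p) + z) (ℤ.pos-* (n / p) p))

    o₀< : 1ℤ + + o₀ ≤ + p
    o₀< = +≤+ (off< (col 0))

    win≤d : ∀ i → i ℕ.< p → win i ℕ.< suc d
    win≤d i l with win i ℕ.<? suc d
    ... | yes h = h
    ... | no h = let h = +≤+ (ℕ.≮⇒≥ h) ; w = off-win i l ; l = +≤+ l ; d≥0 = +≤+ (z≤n {d}) ; y = +≤+ (z≤n {off (col i)}) ; pp = p≥1 in
      ⊥-elim (lin⊥ (+ p ∷ + i ∷ + d ∷ + win i ∷ + off (col i) ∷ + o₀ ∷ []) ($1 <= #0 by pp ∷ $1 :+ #1 <= #0 by l ∷ $1 :+ #2 <= #3 by h ∷ #4 :+ #3 :* #0 == #5 :+ #1 :* #2 by w ∷ $0 <= #2 by d≥0 ∷ $1 :+ #5 <= #0 by o₀< ∷ $0 <= #4 by y ∷ []) (0 ∷ 0 ∷ []) ((2 , 0) ∷ (1 , 4) ∷ []) refl)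

    win-mono : ∀ {i k} → i ℕ.≤ k → win i ℕ.≤ win k
    win-mono l = /-monoˡ-≤ p (ℕ.+-monoʳ-≤ o₀ (ℕ.*-monoˡ-≤ d l))

    -- Within one window the lifted columns advance by exactly `j d`, so the wraps of `Y` and `Z`
    -- cancel. `Y` rises, so an upward wrap would overflow; after a downward wrap it could not
    -- regain the top, because `θ ≤ d M`. Hence `Z` falls without wrapping and stays top for at most
    -- `J` steps.
    close : ∀ i k → i ℕ.< k → k ℕ.< p → T′ i → T′ k → win i ≡ win k → k ℕ.≤ i ℕ.+ J
    close i k l k<p t t′ w = subst (ℕ._≤ i ℕ.+ J) k≡ (subst (j ℕ.+ i ℕ.≤_) (ℕ.+-comm J i) (ℕ.+-monoˡ-≤ i (go (subst T′ (sym k≡) t′) (subst (λ z → win i ≡ win z) (sym k≡) w) (subst (ℕ._< p) (sym k≡) k<p))))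
      where
      j : ℕ
      j = k ℕ.∸ i
      k≡ : j ℕ.+ i ≡ k
      k≡ = ℕ.m∸n+n≡m (ℕ.<⇒≤ l)
      go : T′ (j ℕ.+ i) → win i ≡ win (j ℕ.+ i) → j ℕ.+ i ℕ.< p → j ℕ.≤ J
      go t′ w l′ = case j ℕ.≤? J of λ where
        (yes h) → h
        (no h) → ⊥-elim (let
          k = j ℕ.+ i
          i<p = ℕ.≤-<-trans (ℕ.m≤n+m i j) l′
          h = +≤+ (ℕ.≰⇒> h) ; j≥0 = +≤+ (z≤n {j})
          J′ = jump i j l′
          open Jump J′
          y = YJ ; z = ZJ
          a = lift-eqn i i<p t ; b = lift-eqn k l′ t′ ; a′ = cong +_ (lift≡ i i<p) ; b′ = cong +_ (lift≡ k l′)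
          a″ = cong (_* M) a′ ; b″ = cong (_* M) b′
          w₁ = off-win i i<p ; w₂ = off-win k l′ ; w = cong (λ z → + z * + p) w
          near = +≤+ (off-near k i l′ i<p t′ t)
          oj : + off (col k) ≡ + off (col i) + + j * + d
          oj = (lin≡ (+ off (col k) ∷ + off (col i) ∷ + j ∷ + d ∷ + win i ∷ + p ∷ + o₀ ∷ + i ∷ + win k ∷ []) #0 (#1 :+ #2 :* #3) (#1 :+ #4 :* #5 =~ #6 :+ #7 :* #3 by w₁ ∷ #0 :+ #8 :* #5 == #6 :+ (#2 :+ #7) :* #3 by w₂ ∷ #4 :* #5 == #8 :* #5 by w ∷ []) [] refl)
          ojM = cong (_* M) oj ; js = cong (+ j *_) s′
          αβ : α * N + β * N ≡ 0ℤ
          αβ = (lin≡ (α ∷ N ∷ β ∷ + lift i ∷ M ∷ Y i ∷ Z i ∷ n₀ ∷ δ ∷ + i ∷ + lift k ∷ Y k ∷ Z k ∷ + j ∷ + v ∷ + off (col i) ∷ + off (col k) ∷ + d ∷ θ ∷ η ∷ []) (#0 :* #1 :+ #2 :* #1) $0 (#3 :* #4 :+ #5 :+ #6 =~ #7 :+ #8 :* #9 :+ $2 :* #1 by a ∷ #10 :* #4 :+ #11 :+ #12 == #7 :+ #8 :* (#13 :+ #9) :+ $2 :* #1 by b ∷ #3 :* #4 == (#14 :+ #15) :* #4 by a″ ∷ #10 :* #4 =~ (#14 :+ #16) :* #4 by b″ ∷ #16 :* #4 =~ (#15 :+ #13 :* #17) :* #4 by ojM ∷ #13 :* (#17 :*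 #4 :+ #18 :+ #19) =~ #13 :* #8 by js ∷ #11 =~ #5 :+ #13 :* #18 :+ #0 :* #1 by y ∷ #12 =~ #6 :+ #13 :* #19 :+ #2 :* #1 by z ∷ []) [] refl)
          yi = 0≤Y i ; zi = Z≤ i ; yk = Y≤ k ; zk = proj₂ (proj₁ t′) ; ty = proj₁ (proj₁ t′) ; yi′ = Y≤ i
          jd : + j * + d + 1ℤ ≤ + s
          jd = (lin≤ (+ j ∷ + d ∷ + s ∷ + off (col k) ∷ + off (col i) ∷ []) (#0 :* #1 :+ $1) #2 (#3 =~ #4 :+ #0 :* #1 by oj ∷ $1 :+ #3 <= #4 :+ #2 by near ∷ []) [] [] refl)
          in case 1ℤ ℤ.≤? α of λ where
            (yes q) → (lin⊥ (N ∷ θ ∷ α ∷ Y k ∷ Y i ∷ + j ∷ hy ∷ []) ($1 <= #0 by N≥1 ∷ $1 <= #1 by θ≥1 ∷ $1 <= #2 by q ∷ #3 =~ #4 :+ #5 :* #1 :+ #2 :* #0 by y ∷ $0 <= #4 by yi ∷ #3 :+ #6 <= #0 by yk ∷ $0 <= #5 by j≥0 ∷ $1 <= #6 by hy≥1 ∷ []) (0 ∷ 0 ∷ []) ((2 , 0) ∷ (6 , 1) ∷ []) refl)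
            (no q) → let q = ≰⇒1+≤ q in case 1ℤ ℤ.≤? - α of λ where
              (yes q₂) → (lin⊥ (M ∷ N ∷ + j ∷ θ ∷ + d ∷ α ∷ Y k ∷ Y i ∷ hy ∷ V ∷ + u ∷ + e ∷ + p ∷ + ey ∷ + m ∷ []) ($1 <= #0 by M≥1 ∷ $1 <= #1 by N≥1 ∷ $0 <= #2 by j≥0 ∷ #3 <= #4 :* #0 by gentle ∷ $1 <= :- #5 by q₂ ∷ #6 == #7 :+ #2 :* #3 :+ #5 :* #1 by y ∷ #7 :+ #8 <= #1 by yi′ ∷ #1 :- #9 <= #6 by ty ∷ #2 :* #4 :+ $1 <= #10 :+ #11 :+ #10 by jd ∷ #9 :- #8 :+ #12 <= #13 :* #0 by V≤ ∷ #13 <= #10 :+ #11 by ey≤v ∷ #1 =~ (#10 :+ #11 :+ #10 :+ #14) :* #0 by N≡′ ∷ #10 :+ $2 :* #11 :+ $1 <= #14 by 3v<p ∷ $1 <= #10 :+ #11 :+ #10 :+ #14 by p≥1 ∷ #12 =~ #10 :+ #11 :+ #10 :+ #14 by P ∷ $0 <= #11 by e≥0 ∷ []) (2 ∷ 0 ∷ 0 ∷ 0 ∷ []) ((4 , 1) ∷ (2 , 3) ∷ (8 , 0) ∷ (10 , 0) ∷ (12 , 0) ∷ (15 , 0) ∷ []) refl)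
              (no q₂) → let q₂ = ≰⇒1+≤ q₂ ; a0 : α ≡ 0ℤ ; a0 = (≤-antisym (lin≤ (α ∷ []) #0 $0 ($1 :+ #0 <= $1 by q ∷ []) [] [] refl) (lin≤ (α ∷ []) $0 #0 ($1 :+ :- #0 <= $1 by q₂ ∷ []) [] [] refl)) ; aN = cong (_* N) a0 in
                (lin⊥ (η ∷ α ∷ N ∷ β ∷ Z k ∷ Z i ∷ + j ∷ hz ∷ U ∷ + r ∷ + J ∷ []) ($1 <= :- #0 by -η≥1 ∷ #1 :* #2 =~ $0 by aN ∷ #1 :* #2 :+ #3 :* #2 == $0 by αβ ∷ #4 == #5 :+ #6 :* #0 :+ #3 :* #2 by z ∷ #5 :+ #7 <= #2 by zi ∷ #2 :- #8 <= #4 by zk ∷ #8 :- #7 == #9 :+ #10 :* :- #0 by wr ∷ $1 :+ #9 <= :- #0 by r< ∷ $1 :+ #10 <= #6 by h ∷ []) (0 ∷ []) ((8 , 0) ∷ []) refl))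

    -- Every window contains at most J + 1 of the T′-points.
    W? : ∀ n i → Dec (T′ i × win i ≡ n)
    W? n i = T′? i ×-dec (win i ℕ.≟ n)
    τ# : ℕ → ℤ
    τ# n = ∑ p (λ i → ⟨ W? n i ⟩)
    τ#≤ : ∀ n → τ# n ≤ 1ℤ + + J
    τ#≤ n = span≤ (W? n) J p (λ i k l l′ (t , w) (t′ , w′) → close i k l l′ t t′ (trans w (sym w′)))

    τ′≡ : τ′ ≡ ∑ (suc d) τ#
    τ′≡ = trans (∑-cong p (λ i l → sym (trans (∑-single (suc d) (win i) (win≤d i l) (λ n _ ne → ⟨⟩-no (W? n i) (λ (_ , w) → ne (sym w)))) (⟨⟩-cong (W? (win i) i) (T′? i) proj₁ (_, refl)))))
      (∑-swap (λ i n → ⟨ W? n i ⟩) p (suc d))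

    -- The first and the last window are kept apart from the others.
    τ′≤ : τ′ + 1ℤ + + J ≤ τ# 0 + τ# d + + d * (1ℤ + + J)
    τ′≤ = let d₀ = ℕ.pred d ; e₀ = ℕ.suc-pred d {{ℕ.>-nonZero (ℤ.drop‿+≤+ d≥1)}} ; e = cong +_ e₀
              a = trans (cong (λ z → ∑ z τ#) (sym e₀)) (∑-split {τ#} 1 d₀)
              b = ≤-trans (∑-mono {λ n → τ# (suc n)} {λ _ → 1ℤ + + J} d₀ (λ n _ → τ#≤ (suc n))) (≤-reflexive (∑-const (1ℤ + + J) d₀))
              e′ = cong (_* (1ℤ + + J)) e ; t = τ′≡
      in (lin≤ (τ′ ∷ + J ∷ τ# 0 ∷ τ# d ∷ + d ∷ ∑ d τ# ∷ ∑ d₀ (λ n → τ# (suc n)) ∷ + d₀ ∷ []) (#0 :+ $1 :+ #1) (#2 :+ #3 :+ #4 :* ($1 :+ #1)) (#0 == #5 :+ #3 by t ∷ #5 == $0 :+ #2 :+ #6 by a ∷ #6 <= #7 :* ($1 :+ #1) by b ∷ ($1 :+ #7) :* ($1 :+ #1) == #4 :* ($1 :+ #1) by e′ ∷ []) [] [] refl)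

    -- Sources of a jump from G₁ to G₃, as columns.
    w lo : ℕ
    w = D ℕ.∸ e
    lo = u ℕ.∸ w
    w≤u : w ℕ.≤ u
    w≤u = ℕ.≤-trans (ℕ.∸-monoˡ-≤ e (ℤ.drop‿+≤+ (lin≤ (+ D ∷ + u ∷ + e ∷ []) #0 (#1 :+ #2) (#0 :+ $1 <= #1 :+ #2 by D<v ∷ []) [] [] refl))) (ℕ.≤-reflexive (ℕ.m+n∸n≡m u e))
    lo+w : lo ℕ.+ w ≡ u
    lo+w = ℕ.m∸n+n≡m w≤u
    w+e : 0 ℕ.< w → w ℕ.+ e ≡ D
    w+e l = ℕ.m∸n+n≡m {D} {e} (ℕ.<⇒≤ (ℕ.m∸n≢0⇒n<m {D} {e} (λ z → ℕ.<⇒≢ l (sym z))))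
    w≥ : + D ≤ + w + + e
    w≥ = +≤+ (subst (D ℕ.≤_) (ℕ.+-comm e w) (ℕ.m≤n+m∸n D e))

    -- The exceptions of `cross`: sources whose jump of length `J` would leave the chain.
    B : ℕ → Set
    B i = (lo ℕ.≤ col i × col i ℕ.< u) × p ℕ.≤ i ℕ.+ J
    B? : ∀ i → Dec (B i)
    B? i = ((lo ℕ.≤? col i) ×-dec (col i ℕ.<? u)) ×-dec (p ℕ.≤? i ℕ.+ J)
    b♯ : ℤ
    b♯ = ∑ p (λ i → ⟨ B? i ⟩)

    -- `J` steps lead from column `lo + o` to column `v + o` without passing `p`, so F could rise
    -- from 0 to 1 only through a wrap of `Y` or `Z`. An upward wrap makes the rising `Y` overflow,
    -- and it would leave `Z` within `U` of `N`, hence top, which a G₃ is not.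
    cross : ∀ o → o ℕ.< w → G₁ (pos (lo ℕ.+ o)) → G₃ (pos (v ℕ.+ o)) → p ℕ.≤ pos (lo ℕ.+ o) ℕ.+ J
    cross o l g g′ = case p ℕ.≤? pos (lo ℕ.+ o) ℕ.+ J of λ where
        (yes h) → h
        (no ¬h) → ⊥-elim (let
          i = pos (lo ℕ.+ o) ; k = J ℕ.+ i
          k<p = unbroken {i} {J} ¬h
          jmp = jump i J k<p
          open Jump jmp
          c = cong +_ (col-pos (lo ℕ.+ o) (ℕ.<-≤-trans in-u u≤p))
          e₁ = cong +_ lo+w ; e₂ = cong +_ (w+e (ℕ.≤-<-trans z≤n l))
          h , γ0 = land i J (v ℕ.+ o) 0ℤ k<p (v+<p (ℕ.<-≤-trans l w≤u)) (lin≡ (+ col i ∷ + J ∷ + d ∷ + u ∷ + e ∷ + o ∷ + p ∷ + lo ∷ + D ∷ + w ∷ []) (#0 :+ #1 :* #2) (#3 :+ #4 :+ #5 :+ $0 :* #6) (#0 == #7 :+ #5 by c ∷ #8 =~ #1 :* #2 by Dj ∷ #7 :+ #9 == #3 by e₁ ∷ #9 :+ #4 =~ #8 by e₂ ∷ []) [] refl) jmp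
          (fk , ny , nz) = subst G₃ h g′
          yi = 0≤Y i ; zi = 0≤Z i ; yk = Y≤ k
          in case 1ℤ ℤ.≤? α of λ where
            (yes q) → (lin⊥ (N ∷ θ ∷ α ∷ Y k ∷ Y i ∷ + J ∷ hy ∷ []) ($1 <= #0 by N≥1 ∷ $1 <= #1 by θ≥1 ∷ $1 <= #2 by q ∷ #3 =~ #4 :+ #5 :* #1 :+ #2 :* #0 by YJ ∷ $0 <= #5 by J≥0 ∷ $0 <= #4 by yi ∷ #3 :+ #6 <= #0 by yk ∷ $1 <= #6 by hy≥1 ∷ []) (0 ∷ 0 ∷ []) ((2 , 0) ∷ (4 , 1) ∷ []) refl)
            (no q) → let q = ≰⇒1+≤ q ; b : 1ℤ ≤ β ; b = (lin≤ (β ∷ F k ∷ F i ∷ γ ∷ α ∷ []) $1 #0 (#1 == #2 :+ #3 :+ #4 :+ #0 by FJ ∷ #2 == $0 by g ∷ #3 == $0 by γ0 ∷ #1 =~ $1 by fk ∷ $1 :+ #4 <= $1 by q ∷ []) [] [] refl) in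
              (lin⊥ (N ∷ β ∷ Z k ∷ Z i ∷ + J ∷ η ∷ U ∷ hz ∷ + r ∷ []) ($1 <= #0 by N≥1 ∷ $1 <= #1 by b ∷ #2 =~ #3 :+ #4 :* #5 :+ #1 :* #0 by ZJ ∷ $0 <= #3 by zi ∷ $1 :+ #2 <= #0 :- #6 by nz ∷ #6 :- #7 =~ #8 :+ #4 :* :- #5 by wr ∷ $0 <= #8 by r≥0 ∷ $1 <= #7 by hz≥1 ∷ []) (0 ∷ []) ((1 , 0) ∷ []) refl))
      where in-u : lo ℕ.+ o ℕ.< u
            in-u = ℕ.<-≤-trans (ℕ.+-monoʳ-< lo l) (ℕ.≤-reflexive lo+w)

    g₁+g₃≤ : g₁ + g₃ + + D ≤ + s + b♯
    g₁+g₃≤ = let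
        Q = λ o → G₁? (pos o) ; R = λ o → G₃? (pos (v ℕ.+ o)) ; S = λ o → p ℕ.≤? pos (lo ℕ.+ o) ℕ.+ J
        a = pairs≤ (λ o → Q (lo ℕ.+ o)) R S w cross
        b = deficit≤ Q lo w u (ℕ.≤-reflexive lo+w) ; c = deficit≤ R 0 w u w≤u
        l≤ = ℕ.≤-trans (ℕ.≤-reflexive lo+w) u≤p
        x = ∑-mono w (λ o l → ⟨⟩-mono (S o) (B? (pos (lo ℕ.+ o))) (λ h → let q = col-pos (lo ℕ.+ o) (ℕ.<-≤-trans (ℕ.+-monoʳ-< lo l) l≤) in
              (subst (lo ℕ.≤_) (sym q) (ℕ.m≤m+n lo o) , subst (ℕ._< u) (sym q) (ℕ.<-≤-trans (ℕ.+-monoʳ-< lo l) (ℕ.≤-reflexive lo+w))) , h))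
        y = ∑-sub {λ z → ⟨ B? (pos z) ⟩} lo w p l≤ (λ _ _ → ⟨⟩≥0 (B? _))
        z = reindex (λ i → ⟨ B? i ⟩) ; w≥′ = w≥
      in (lin≤ (g₁ ∷ g₃ ∷ + D ∷ + u ∷ + e ∷ b♯ ∷ ∑ w (λ o → ⟨ Q (lo ℕ.+ o) ⟩) ∷ ∑ w (λ o → ⟨ R o ⟩) ∷ + w ∷ ∑ w (λ o → ⟨ S o ⟩) ∷ ∑ w (λ o → ⟨ B? (pos (lo ℕ.+ o)) ⟩) ∷ ∑ p (λ z → ⟨ B? (pos z) ⟩) ∷ []) (#0 :+ #1 :+ #2) (#3 :+ #4 :+ #3 :+ #5) (#6 :+ #7 <= #8 :+ #9 by a ∷ #8 :+ #0 <= #3 :+ #6 by b ∷ #8 :+ #1 <= #3 :+ #7 by c ∷ #9 <= #10 by x ∷ #10 <= #11 by y ∷ #5 =~ #11 by z ∷ #2 <= #8 :+ #4 by w≥′ ∷ []) [] [] refl)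

-- Gentle rising flows: the incomplete first and last windows.

module Fall where
  open import Data.Nat.DivMod using (m<n⇒m%n≡m)
  open Lin
  open Sums
  open ChainM
  open Count
  open Steps
  open Units
  open Flows
  open Rise
  open Slide

  module Falling (C : Chain) (f : Flow C) (θ≥1 : 1ℤ ≤ Flow.θ f) (gentle : Flow.θ f ≤ + Flow.d f * Chain.M C) where
    open Chain C
    open Facts C
    open Counts C
    open StepFacts C
    open Flow f
    open Landing C f
    open Rising C f θ≥1
    open Sliding C f θ≥1 gentle

    private
      P : + p ≡ + u + + e + + u + + m
      P = refl
      d≥ = d≥1
      d≥0 : 0ℤ ≤ + d
      d≥0 = +≤+ z≤n
      1≤p : 1ℤ ≤ + p
      1≤p = p≥1

    off-low : ∀ x → x ℕ.< u → off x ≡ x ℕ.+ (u ℕ.+ m)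
    off-low x l = m<n⇒m%n≡m (subst (x ℕ.+ (u ℕ.+ m) ℕ.<_) (sym (ℕ.+-assoc v u m)) (ℕ.+-monoˡ-< (u ℕ.+ m) (ℕ.<-≤-trans l (ℕ.m≤m+n u e))))

    either≤ : ∀ {Q R S : ℕ → Set} (Q? : ∀ i → Dec (Q i)) (R? : ∀ i → Dec (R i)) (S? : ∀ i → Dec (S i)) n →
      (∀ i → i ℕ.< n → Q i → S i) → (∀ i → i ℕ.< n → R i → S i) → (∀ i → i ℕ.< n → Q i → R i → ⊥) →
      ∑ n (λ i → ⟨ Q? i ⟩) + ∑ n (λ i → ⟨ R? i ⟩) ≤ ∑ n (λ i → ⟨ S? i ⟩)
    either≤ Q? R? S? n a b c = ≤-trans (≤-reflexive (sym (∑-+ {λ i → ⟨ Q? i ⟩} {λ i → ⟨ R? i ⟩} n))) (∑-mono n (λ i l → go (Q? i) (R? i) (S? i) (a i l) (b i l) (c i l)))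
      where
      go : ∀ {Q R S : Set} (q : Dec Q) (r : Dec R) (s : Dec S) → (Q → S) → (R → S) → (Q → R → ⊥) → ⟨ q ⟩ + ⟨ r ⟩ ≤ ⟨ s ⟩
      go (yes q) (yes r) _ _ _ c = ⊥-elim (c q r)
      go (yes q) (no _) s a _ _ = ≤-reflexive (sym (⟨⟩-yes s (a q)))
      go (no _) (yes r) s _ b _ = ≤-reflexive (sym (⟨⟩-yes s (b r)))
      go (no _) (no _) s _ _ _ = ⟨⟩≥0 s

    J≤p : J ℕ.≤ p
    J≤p = ℤ.drop‿+≤+ (lin≤ (+ J ∷ + u ∷ + e ∷ + m ∷ + d ∷ + D ∷ []) #0 (#1 :+ #2 :+ #1 :+ #3) ($0 <= #1 by u≥0 ∷ $0 <= #2 by e≥0 ∷ #0 :+ #4 <= #5 :+ $1 by J+d≤ ∷ #5 :+ $1 <= #1 :+ #2 by D<v ∷ $1 <= #4 by d≥ ∷ #1 :+ $2 :* #2 :+ $1 <= #3 by 3v<p ∷ []) (1 ∷ 2 ∷ 2 ∷ []) [] refl)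

    head≤ : ∀ {Q : ℕ → Set} (Q? : ∀ i → Dec (Q i)) → (∀ i → i ℕ.< p → Q i → i ℕ.< J) → ∑ p (λ i → ⟨ Q? i ⟩) ≤ ∑ J (λ i → ⟨ Q? i ⟩)
    head≤ Q? h = let k = p ℕ.∸ J ; e = ℕ.m+[n∸m]≡n J≤p in
      ≤-reflexive (trans (cong (λ z → ∑ z (λ i → ⟨ Q? i ⟩)) (sym e)) (trans (∑-split {λ i → ⟨ Q? i ⟩} J k)
        (trans (cong (λ z → ∑ J (λ i → ⟨ Q? i ⟩) + z) (∑-zero k (λ i l → ⟨⟩-no (Q? (J ℕ.+ i)) (λ q → ℕ.<⇒≱ (h _ (ℕ.<-≤-trans (ℕ.+-monoʳ-< J l) (ℕ.≤-reflexive e)) q) (ℕ.m≤m+n J i))))) (ℤ.+-identityʳ _))))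

    tail≡ : ∀ {Q : ℕ → Set} (Q? : ∀ i → Dec (Q i)) → (∀ i → Q i → p ℕ.≤ i ℕ.+ J) → ∑ p (λ i → ⟨ Q? i ⟩) ≡ ∑ J (λ i → ⟨ Q? (p ℕ.∸ J ℕ.+ i) ⟩)
    tail≡ Q? h = let k = p ℕ.∸ J ; e = ℕ.m∸n+n≡m J≤p in
      trans (cong (λ z → ∑ z (λ i → ⟨ Q? i ⟩)) (sym e)) (trans (∑-split {λ i → ⟨ Q? i ⟩} k J)
        (trans (cong (_+ ∑ J (λ i → ⟨ Q? (k ℕ.+ i) ⟩)) (∑-zero k (λ i l → ⟨⟩-no (Q? i) (λ q → ℕ.<⇒≱ (ℕ.<-≤-trans (ℕ.+-monoˡ-< J l) (ℕ.≤-reflexive e)) (h i q))))) (ℤ.+-identityˡ _)))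

    module Low (o₀<u : o₀ ℕ.< u) where
      -- Columns below `u` have offset at least `u + m`, whereas the last window ends at an offset
      -- below `o₀ < u`.
      early : ∀ i → i ℕ.< p → B i → win i ℕ.< d
      early i l ((_ , c<u) , _) = case win i ℕ.<? d of λ where
        (yes h) → h
        (no h) → let h = +≤+ (ℕ.≮⇒≥ h) ; w = off-win i l ; l = +≤+ l ; a = cong +_ (off-low (col i) c<u) ; o = +≤+ o₀<u ; c = +≤+ (z≤n {col i}) in
          ⊥-elim (lin⊥ (+ p ∷ + i ∷ + d ∷ + win i ∷ + off (col i) ∷ + o₀ ∷ + col i ∷ + u ∷ + m ∷ []) ($1 <= #0 by 1≤p ∷ $1 :+ #1 <= #0 by l ∷ #2 <= #3 by h ∷ #4 :+ #3 :* #0 == #5 :+ #1 :* #2 by w ∷ #4 =~ #6 :+ (#7 :+ #8) by a ∷ $1 :+ #5 <= #7 by o ∷ $0 <= #6 by c ∷ $0 <= #8 by m≥0 ∷ $0 <= #2 by d≥0 ∷ []) (0 ∷ 0 ∷ []) ((2 , 0) ∷ (1 , 8) ∷ []) refl)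
      -- The points of B are among the last `J` positions. So are those of the last window, since
      -- they come after `i`; and by `early` the two sets are disjoint.
      bound : ∀ i → i ℕ.< p → B i → τ# d + b♯ ≤ + J
      bound i l b = ≤-trans (either≤ (W? d) B? (λ k → p ℕ.≤? k ℕ.+ J) p
        (λ k _ (_ , w) → ℕ.≤-trans (proj₂ b) (ℕ.+-monoˡ-≤ J (ℕ.≮⇒≥ (λ k<i → ℕ.<⇒≱ (early i l b) (subst (ℕ._≤ win i) w (win-mono (ℕ.<⇒≤ k<i)))))))
        (λ k _ → proj₂) (λ k l (_ , w) b → ℕ.<⇒≢ (early k l b) w)) (tail≤ p J)

    module High (u≤o₀ : u ℕ.≤ o₀) where
      w>0 : lo ℕ.< u → 0 ℕ.< w
      w>0 l = ℕ.n≢0⇒n>0 (λ z → ℕ.<⇒≢ l (trans (sym (ℕ.+-identityʳ lo)) (trans (cong (lo ℕ.+_) (sym z)) lo+w)))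
      -- Under `u ≤ o₀` a source in B has reached the last window. Columns repeat after `p` steps,
      -- so `k` may be read as position `k + p` in that window; but `J` steps from a column at least
      -- `lo` bring the offset to at least `p`, so the window ends before `i + J`.
      late : ∀ i k → i ℕ.< p → k ℕ.< p → B i → win k ≡ 0 → k ℕ.+ p ℕ.< i ℕ.+ J
      late i k l l′ ((lo≤ , c<u) , far) wk = case k ℕ.+ p ℕ.<? i ℕ.+ J of λ where
        (yes h) → h
        (no h) → ⊥-elim (let
          h = +≤+ (ℕ.≮⇒≥ h) ; f = +≤+ far ; lo≤ = +≤+ lo≤ ; c<u′ = +≤+ c<u
          a = cong +_ (off-low (col i) c<u) ; e₁ = cong +_ lo+w ; e₂ = cong +_ (w+e (w>0 (ℕ.≤-<-trans (ℤ.drop‿+≤+ lo≤) c<u)))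
          wi = off-win i l ; wk′ = trans (cong (λ z → + off (col k) + z) (sym (cong (λ z → + z * + p) wk))) (off-win k l′) ; k< = +≤+ (off< (col k)) ; u≤ = +≤+ u≤o₀
          in case + win i + 1ℤ ℤ.≤? + d of λ where
            (yes q) → (lin⊥ (+ p ∷ + i ∷ + J ∷ + d ∷ + win i ∷ + off (col i) ∷ + o₀ ∷ + col i ∷ + u ∷ + m ∷ + e ∷ + D ∷ []) ($1 <= #0 by 1≤p ∷ #0 <= #1 :+ #2 by f ∷ $0 <= #3 by d≥0 ∷ #4 :+ $1 <= #3 by q ∷ #5 :+ #4 :* #0 =~ #6 :+ #1 :* #3 by wi ∷ #5 == #7 :+ (#8 :+ #9) by a ∷ $1 :+ #7 <= #8 by c<u′ ∷ #0 =~ #8 :+ #10 :+ #8 :+ #9 by P ∷ #11 =~ #2 :* #3 by Dj ∷ #11 :+ $1 <= #8 :+ #10 by D<v ∷ #8 <= #6 by u≤ ∷ []) (0 ∷ 0 ∷ 0 ∷ []) ((3 , 0) ∷ (1 , 2) ∷ []) refl)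
            (no q) → let q = ≰⇒1+≤ q ; q′ : + d ≤ + win i ; q′ = (lin≤ (+ d ∷ + win i ∷ []) #0 #1 ($1 :+ #0 <= #1 :+ $1 by q ∷ []) [] [] refl) in
              (lin⊥ (+ p ∷ + i ∷ + J ∷ + k ∷ + d ∷ + win i ∷ + off (col i) ∷ + o₀ ∷ + off (col k) ∷ + col i ∷ + u ∷ + m ∷ + lo ∷ + w ∷ + e ∷ + D ∷ []) ($1 <= #0 by 1≤p ∷ #1 :+ #2 <= #3 :+ #0 by h ∷ $0 <= #4 by d≥0 ∷ #4 <= #5 by q′ ∷ #6 :+ #5 :* #0 == #7 :+ #1 :* #4 by wi ∷ #8 :+ $0 :* #0 =~ #7 :+ #3 :* #4 by wk′ ∷ $1 :+ #8 <= #0 by k< ∷ #6 =~ #9 :+ (#10 :+ #11) by a ∷ #12 <= #9 by lo≤ ∷ #12 :+ #13 =~ #10 by e₁ ∷ #13 :+ #14 == #15 by e₂ ∷ #0 == #10 :+ #14 :+ #10 :+ #11 by P ∷ #15 == #2 :* #4 by Dj ∷ []) (0 ∷ 0 ∷ 0 ∷ []) ((3 , 0) ∷ (1 , 2) ∷ []) refl))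
      -- By `late`, window 0 is confined to the first `J` positions, and a point of it at `t`
      -- excludes a point of B at `p - J + t`.
      bound : ∀ i → i ℕ.< p → B i → τ# 0 + b♯ ≤ + J
      bound i l b = let e = ℕ.m∸n+n≡m J≤p ; k = p ℕ.∸ J
                        t< : ∀ t → t ℕ.< J → k ℕ.+ t ℕ.< p
                        t< t q = ℕ.<-≤-trans (ℕ.+-monoʳ-< k q) (ℕ.≤-reflexive e) in
        ≤-trans (ℤ.+-mono-≤
          (head≤ (W? 0) (λ j q (_ , w) → ℕ.+-cancelʳ-< p j J (ℕ.<-trans (late i j l q b w) (subst (i ℕ.+ J ℕ.<_) (ℕ.+-comm p J) (ℕ.+-monoˡ-< J l)))))
          (≤-reflexive (tail≡ B? (λ _ → proj₂))))
          (disjoint≤ (W? 0) (λ t → B? (k ℕ.+ t)) J (λ t q (_ , w) b′ → ℕ.<⇒≢ (late (k ℕ.+ t) t (t< t q) (ℕ.<-≤-trans q J≤p) b′ w)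
            (trans (cong (t ℕ.+_) (sym e)) (trans (sym (ℕ.+-assoc t k J)) (cong (ℕ._+ J) (ℕ.+-comm t k))))))

    -- Without such a point the first window has at most `J` instead of `J + 1` points; `E₁?` serves
    -- the last window in the same way.
    E₀? : ∀ i → Dec (J ℕ.≤ i × (T′ i × win i ≡ 0))
    E₀? i = (J ℕ.≤? i) ×-dec W? 0 i
    E₁? : ∀ k → Dec (k ℕ.+ J ℕ.< p × (T′ k × win k ≡ d))
    E₁? k = (k ℕ.+ J ℕ.<? p) ×-dec W? d k

    -- The two offsets are at least `o₀ + D` and at most `o₀ - D - d`, while T′-points are less than
    -- `s` apart.
    spread : ∀ i k → i ℕ.< p → k ℕ.< p → J ℕ.≤ i × (T′ i × win i ≡ 0) → k ℕ.+ J ℕ.< p × (T′ k × win k ≡ d) → + 2 * + D + + d + 1ℤ ≤ + s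
    spread i k l l′ (a , t , w) (b , t′ , w′) = let
        x = trans (cong (λ z → + off (col i) + z) (sym (cong (λ z → + z * + p) w))) (off-win i l)
        y = trans (cong (λ z → + off (col k) + z) (sym (cong (λ z → + z * + p) w′))) (off-win k l′)
        n = +≤+ (off-near i k l l′ t t′) ; a = +≤+ a ; b = +≤+ b
      in (lin≤ (+ D ∷ + d ∷ + u ∷ + e ∷ + J ∷ + i ∷ + k ∷ + p ∷ + off (col i) ∷ + o₀ ∷ + off (col k) ∷ []) ($2 :* #0 :+ #1 :+ $1) (#2 :+ #3 :+ #2) (#0 == #4 :* #1 by Dj ∷ #4 <= #5 by a ∷ $0 <= #1 by d≥0 ∷ $1 :+ (#6 :+ #4) <= #7 by b ∷ #8 :+ $0 :* #7 =~ #9 :+ #5 :* #1 by x ∷ #10 :+ #1 :* #7 == #9 :+ #6 :* #1 by y ∷ $1 :+ #8 <= #10 :+ (#2 :+ #3 :+ #2) by n ∷ []) (1 ∷ 2 ∷ 0 ∷ 0 ∷ 0 ∷ []) ((2 , 3) ∷ (4 , 3) ∷ []) refl)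

    module Ends (M′ : ℤ) (few : τ# 0 + τ# d + b♯ ≤ M′) where
      private t₀ = few
      -- The product `D = J d` cancels between the bounds for `τ′` and for `g₁ + g₃`; only the end
      -- windows and the exceptions remain.
      total : A + + u + + 1 + + J ≤ M′ + + d + + s
      total = (lin≤ (A ∷ + u ∷ + J ∷ M′ ∷ + d ∷ + e ∷ τ# 0 ∷ τ# d ∷ b♯ ∷ τ′ ∷ g₁ ∷ g₃ ∷ + D ∷ []) (#0 :+ #1 :+ $1 :+ #2) (#3 :+ #4 :+ (#1 :+ #5 :+ #1)) (#6 :+ #7 :+ #8 <= #3 by t₀ ∷ #0 :+ #1 <= #9 :+ #10 :+ #11 by good′ ∷ #9 :+ $1 :+ #2 <= #6 :+ #7 :+ #4 :* ($1 :+ #2) by τ′≤ ∷ #10 :+ #11 :+ #12 <= #1 :+ #5 :+ #1 :+ #8 by g₁+g₃≤ ∷ #12 =~ #2 :* #4 by Dj ∷ []) [] [] refl)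

    -- Two full end windows have `2 (J + 1)` points. Saving one of them already contradicts
    -- `3 A > 2 p`.
    regular : τ# 0 + τ# d + b♯ ≤ 1ℤ + + 2 * + J → ⊥
    regular h = let t = Ends.total (1ℤ + + 2 * + J) h in
      (lin⊥ (A ∷ + u ∷ + J ∷ + d ∷ + e ∷ + D ∷ + m ∷ []) (#0 :+ #1 :+ $1 :+ #2 <= $1 :+ $2 :* #2 :+ #3 :+ (#1 :+ #4 :+ #1) by t ∷ #2 :+ #3 <= #5 :+ $1 by J+d≤ ∷ #5 :+ $1 <= #1 :+ #4 by D<v ∷ #1 :+ $2 :* #4 :+ $1 <= #6 by 3v<p ∷ $2 :* (#1 :+ #4 :+ #1 :+ #6) :+ $1 <= $3 :* #0 by large ∷ []) (3 ∷ 3 ∷ 3 ∷ 2 ∷ []) [] refl)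

    -- With nothing saved all estimates are equalities: `D + 1 = v` and `p = 3 v + 1`, and the
    -- spread forces `d = 1` and `e = 0`. Then `9 = ± 1 + K p` with `p ≥ 7`, so `K = 1` and `p` is 8
    -- or 10, which is even.
    special : b♯ ≡ 0ℤ → + 2 * + D + + d + 1ℤ ≤ + s → ⊥
    special b0 sp = let
        a = τ#≤ 0 ; b = τ#≤ d
        t = Ends.total (+ 2 + + 2 * + J) (lin≤ (τ# 0 ∷ τ# d ∷ b♯ ∷ + J ∷ []) (#0 :+ #1 :+ #2) ($2 :+ $2 :* #3) (#0 <= $1 :+ #3 by a ∷ #1 <= $1 :+ #3 by b ∷ #2 == $0 by b0 ∷ []) [] [] refl)
        dv : + D + 1ℤ ≡ + u + + e
        dv = (≤-antisym (lin≤ (+ D ∷ + u ∷ + e ∷ []) (#0 :+ $1) (#1 :+ #2) (#0 :+ $1 <= #1 :+ #2 by D<v ∷ []) [] [] refl) (lin≤ (+ u ∷ + e ∷ + D ∷ A ∷ + J ∷ + d ∷ + m ∷ []) (#0 :+ #1) (#2 :+ $1) (#3 :+ #0 :+ $1 :+ #4 <= $2 :+ $2 :* #4 :+ #5 :+ (#0 :+ #1 :+ #0) by t ∷ #4 :+ #5 <= #2 :+ $1 by J+d≤ ∷ #0 :+ $2 :* #1 :+ $1 <= #6 by 3v<p ∷ $2 :* (#0 :+ #1 :+ #0 :+ #6) :+ $1 <= $3 :* #3 by large ∷ []) (3 ∷ 3 ∷ 3 ∷ 2 ∷ []) [] refl))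
        d1 : + d ≡ 1ℤ
        d1 = (≤-antisym (lin≤ (+ d ∷ + D ∷ + u ∷ + e ∷ []) #0 $1 (#1 :+ $1 =~ #2 :+ #3 by dv ∷ $2 :* #1 :+ #0 :+ $1 <= #2 :+ #3 :+ #2 by sp ∷ $0 <= #3 by e≥0 ∷ []) (1 ∷ 2 ∷ []) [] refl) (lin≤ (+ d ∷ []) $1 #0 ($1 <= #0 by d≥ ∷ []) [] [] refl))
        e0 : + e ≡ 0ℤ
        e0 = (≤-antisym (lin≤ (+ e ∷ + D ∷ + u ∷ + d ∷ []) #0 $0 (#1 :+ $1 =~ #2 :+ #0 by dv ∷ $2 :* #1 :+ #3 :+ $1 <= #2 :+ #0 :+ #2 by sp ∷ $1 <= #3 by d≥ ∷ []) (1 ∷ 2 ∷ []) [] refl) (lin≤ (+ e ∷ []) $0 #0 ($0 <= #0 by e≥0 ∷ []) [] [] refl))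
        pe : + p ≡ + 3 * + u + 1ℤ
        pe = (≤-antisym (lin≤ (+ p ∷ + u ∷ + e ∷ + m ∷ A ∷ + J ∷ + d ∷ + D ∷ []) #0 ($3 :* #1 :+ $1) (#0 == #1 :+ #2 :+ #1 :+ #3 by P ∷ #4 :+ #1 :+ $1 :+ #5 <= $2 :+ $2 :* #5 :+ #6 :+ (#1 :+ #2 :+ #1) by t ∷ #5 :+ #6 <= #7 :+ $1 by J+d≤ ∷ #7 :+ $1 <= #1 :+ #2 by D<v ∷ #2 == $0 by e0 ∷ $2 :* (#1 :+ #2 :+ #1 :+ #3) :+ $1 <= $3 :* #4 by large ∷ []) (2 ∷ 2 ∷ 3 ∷ 3 ∷ 3 ∷ 6 ∷ []) [] refl) (lin≤ (+ u ∷ + p ∷ + e ∷ + m ∷ []) ($3 :* #0 :+ $1) #1 ($0 <= #2 by e≥0 ∷ #1 =~ #0 :+ #2 :+ #0 :+ #3 by P ∷ #0 :+ $2 :* #2 :+ $1 <= #3 by 3v<p ∷ []) (1 ∷ 3 ∷ []) [] refl))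
      in [ (λ (K , h) → no9 K 1ℤ (inj₁ refl) (trans (sym (cong (+ 9 *_) (trans d≡ d1))) h)) , (λ (K , h) → no9 K (- 1ℤ) (inj₂ refl) (trans (sym (cong (+ 9 *_) (trans d≡ d1))) h)) ]′ (nine step e0 pe)
      where
      no9 : ∀ K c → (c ≡ 1ℤ) ⊎ (c ≡ - 1ℤ) → + 9 * 1ℤ ≡ c + K * + p → ⊥
      no9 K c hc h = let
          c₁ : c ≤ 1ℤ
          c₁ = [ ≤-reflexive , (λ q → ≤-trans (≤-reflexive q) ℤ.-≤+) ]′ hc
          c₂ : - 1ℤ ≤ c
          c₂ = [ (λ q → ≤-trans ℤ.-≤+ (≤-reflexive (sym q))) , (λ q → ≤-reflexive (sym q)) ]′ hc
          7≤ = p≥7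
          k1 : K ≡ 1ℤ
          k1 = case K ℤ.≤? 1ℤ of λ where
            (no q) → let q = ≰⇒1+≤ q in ⊥-elim (lin⊥ (K ∷ + p ∷ c ∷ []) ($1 :+ $1 <= #0 by q ∷ $7 <= #1 by 7≤ ∷ $9 :* $1 =~ #2 :+ #0 :* #1 by h ∷ :- $1 <= #2 by c₂ ∷ []) (7 ∷ 2 ∷ []) ((0 , 1) ∷ []) refl)
            (yes q) → case 1ℤ ℤ.≤? K of λ where
              (yes q′) → ≤-antisym q q′
              (no q′) → let q′ = ≰⇒1+≤ q′ in ⊥-elim (lin⊥ (K ∷ + p ∷ c ∷ []) ($1 :+ #0 <= $1 by q′ ∷ $7 <= #1 by 7≤ ∷ $9 :* $1 == #2 :+ #0 :* #1 by h ∷ #2 <= $1 by c₁ ∷ []) (7 ∷ 0 ∷ []) ((0 , 1) ∷ []) refl)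
          kp = cong (_* + p) k1 ; hd , o = odd
        in [ (λ q → no-half (+ hd - + 3) (lin≡ (+ hd ∷ c ∷ K ∷ + p ∷ []) ($2 :* (#0 :- $3)) $1 ($9 :* $1 =~ #1 :+ #2 :* #3 by h ∷ #2 :* #3 =~ $1 :* #3 by kp ∷ #3 =~ $1 :+ $2 :* #0 by o ∷ #1 =~ $1 by q ∷ []) [] refl)) , (λ q → no-half (+ hd - + 4) (lin≡ (+ hd ∷ c ∷ K ∷ + p ∷ []) ($2 :* (#0 :- $4)) $1 ($9 :* $1 =~ #1 :+ #2 :* #3 by h ∷ #2 :* #3 =~ $1 :* #3 by kp ∷ #3 =~ $1 :+ $2 :* #0 by o ∷ #1 =~ :- $1 by q ∷ []) [] refl)) ]′ hc

    impossible : ⊥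
    impossible with find B? p
    ... | inj₁ (i , l , b) = case o₀ ℕ.<? u of λ where
            (yes h) → let a = Low.bound h i l b ; t = τ#≤ 0 in regular (lin≤ (τ# 0 ∷ τ# d ∷ b♯ ∷ + J ∷ []) (#0 :+ #1 :+ #2) ($1 :+ $2 :* #3) (#1 :+ #2 <= #3 by a ∷ #0 <= $1 :+ #3 by t ∷ []) [] [] refl)
            (no h) → let a = High.bound (ℕ.≮⇒≥ h) i l b ; t = τ#≤ d in regular (lin≤ (τ# 0 ∷ τ# d ∷ b♯ ∷ + J ∷ []) (#0 :+ #1 :+ #2) ($1 :+ $2 :* #3) (#0 :+ #2 <= #3 by a ∷ #1 <= $1 :+ #3 by t ∷ []) [] [] refl)
    ... | inj₂ b0 with ℕ.anyUpTo? E₀? p | ℕ.anyUpTo? E₁? p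
    ...   | yes (i , l , h) | yes (k , l′ , h′) = special b0 (spread i k l l′ h h′)
    ...   | no n | _ = let a = ≤-trans (head≤ (W? 0) (λ i l w → ℕ.≰⇒> (λ q → n (i , l , q , w)))) (count≤ (W? 0) J) ; t = τ#≤ d in
            regular (lin≤ (τ# 0 ∷ τ# d ∷ b♯ ∷ + J ∷ []) (#0 :+ #1 :+ #2) ($1 :+ $2 :* #3) (#0 <= #3 by a ∷ #1 <= $1 :+ #3 by t ∷ #2 == $0 by b0 ∷ []) [] [] refl)
    ...   | yes _ | no n = let a = ≤-trans (∑-mono p (λ k l → ⟨⟩-mono (W? d k) (p ℕ.≤? k ℕ.+ J) (λ w → ℕ.≮⇒≥ (λ q → n (k , l , q , w))))) (tail≤ p J) ; t = τ#≤ 0 in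
            regular (lin≤ (τ# 0 ∷ τ# d ∷ b♯ ∷ + J ∷ []) (#0 :+ #1 :+ #2) ($1 :+ $2 :* #3) (#1 <= #3 by a ∷ #0 <= $1 :+ #3 by t ∷ #2 == $0 by b0 ∷ []) [] [] refl)

-- There is no chain.

module Core where
  open Lin
  open ChainM
  open Sym
  open Flows
  open Mono
  open Rise
  open Fall

  module _ (C : Chain) where
    open Chain C

    no-rise : (f : Flow C) → 1ℤ ≤ Flow.θ f → ⊥
    no-rise f θ≥1 = case Flow.θ f ℤ.≤? + Flow.d f * M of λ where
      (yes q) → Falling.impossible C f θ≥1 q
      (no q) → Rising.Steep.impossible C f θ≥1 (≤-trans (≤-reflexive (ℤ.+-comm (+ Flow.d f * M) 1ℤ)) (≰⇒1+≤ q))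

  no-flow : ∀ C → Flow C → ⊥
  no-flow C f = case Flow.θ f ℤ.≤? 0ℤ of λ where
    (no q) → no-rise C f (≰⇒1+≤ q)
    (yes q) → case Flow.η f ℤ.≤? 0ℤ of λ where
      (no q′) → no-rise (swap C) (swapFlow f) (≰⇒1+≤ q′)
      (yes q′) → Monotone.contradiction C f q q′

  no-chain : Chain → ⊥
  no-chain C = [ no-flow C , no-flow (reverse C) ]′ (flow C)

-- Digits of an integer with respect to qr, pr and pq.

module Coord where
  open import Data.Integer.DivMod using (_%ℕ_; _/ℕ_; a≡a%ℕn+[a/ℕn]*n; n%ℕd<d)
  open Lin
  open Sums
  open Steps using (small-multiple)

  1≤* : ∀ {x y} → 1ℤ ≤ x → 1ℤ ≤ y → 1ℤ ≤ x * y
  1≤* {x} {y} h k = (lin≤ (x ∷ y ∷ []) $1 (#0 :* #1) ($1 <= #0 by h ∷ $1 <= #1 by k ∷ []) [] ((1 , 2) ∷ []) refl)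

  private
    cancel : ∀ k {x y} → k + x ≡ k + y → x ≡ y
    cancel k {x} {y} h = (lin≡ (x ∷ y ∷ k ∷ []) #0 #1 (#2 :+ #0 == #2 :+ #1 by h ∷ []) [] refl)

  record Inverses (p q r : ℕ) : Set where
    field
      {{p≢0}} : ℕ.NonZero p
      {{q≢0}} : ℕ.NonZero q
      {{r≢0}} : ℕ.NonZero r
      ia ib ic κa κb κc : ℤ
      ha : ia * (+ q * + r) ≡ 1ℤ + κa * + p
      hb : ib * (+ p * + r) ≡ 1ℤ + κb * + q
      hc : ic * (+ p * + q) ≡ 1ℤ + κc * + r

  -- Every integer k is a qr + b pr + c pq - F pqr for unique digits a < p, b < q, c < r and a unique F.
  module Coordinates {p q r : ℕ} (I : Inverses p q r) where
    open Inverses I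

    M N : ℤ
    M = + q * + r
    N = + p * M

    ca cb cc : ℤ → ℕ
    ca k = (k * ia) %ℕ p
    cb k = (k * ib) %ℕ q
    cc k = (k * ic) %ℕ r

    private
      X₁ X₂ X₃ E G : ℤ
      X₁ = κa + ib * + r + ic * + q
      X₂ = κb + ia * + r + ic * + p
      X₃ = κc + ia * + q + ib * + p
      E = ia * (+ q * + r) + ib * (+ p * + r) + ic * (+ p * + q) - 1ℤ
      G = X₁ * ia - κa * (X₂ * ib * + p - κb * X₃)
      E₁ : E ≡ + p * X₁
      E₁ = (lin≡ (ia ∷ + q ∷ + r ∷ ib ∷ + p ∷ ic ∷ κa ∷ []) (#0 :* (#1 :* #2) :+ #3 :* (#4 :* #2) :+ #5 :* (#4 :* #1) :- $1) (#4 :* (#6 :+ #3 :* #2 :+ #5 :* #1)) (#0 :* (#1 :* #2) == $1 :+ #6 :* #4 by ha ∷ []) [] refl)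
      E₂ : E ≡ + q * X₂
      E₂ = (lin≡ (ia ∷ + q ∷ + r ∷ ib ∷ + p ∷ ic ∷ κb ∷ []) (#0 :* (#1 :* #2) :+ #3 :* (#4 :* #2) :+ #5 :* (#4 :* #1) :- $1) (#1 :* (#6 :+ #0 :* #2 :+ #5 :* #4)) (#3 :* (#4 :* #2) == $1 :+ #6 :* #1 by hb ∷ []) [] refl)
      E₃ : E ≡ + r * X₃
      E₃ = (lin≡ (ia ∷ + q ∷ + r ∷ ib ∷ + p ∷ ic ∷ κc ∷ []) (#0 :* (#1 :* #2) :+ #3 :* (#4 :* #2) :+ #5 :* (#4 :* #1) :- $1) (#2 :* (#6 :+ #0 :* #1 :+ #3 :* #4)) (#5 :* (#4 :* #1) == $1 :+ #6 :* #2 by hc ∷ []) [] refl)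

      -- `E` is divisible by each of `p`, `q` and `r`; the inverses `ia` and `ib` express
      -- coprimality and combine the three quotients into the cofactor `G`.
      E≡ : E ≡ G * N
      E≡ = lemma E X₁ X₂ X₃ (+ p) (+ q) (+ r) ia ib κa κb ha hb E₁ E₂ E₃
        where
        lemma : ∀ E X₁ X₂ X₃ p q r ia ib κa κb → ia * (q * r) ≡ 1ℤ + κa * p → ib * (p * r) ≡ 1ℤ + κb * q → E ≡ p * X₁ → E ≡ q * X₂ → E ≡ r * X₃ →
          E ≡ (X₁ * ia - κa * (X₂ * ib * p - κb * X₃)) * (p * (q * r))
        lemma E X₁ X₂ X₃ p q r ia ib κa κb ha hb E₁ E₂ E₃ = let
            h₀ = cong (E *_) ha ; h₁ = cong (_* (ia * (q * r))) E₁ ; h₂ = cong (λ z → κa * (E * p * z)) hb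
            h₃ = cong (λ z → κa * (z * p * (ib * (p * r)))) E₂ ; h₄ = cong (λ z → κa * κb * (z * p * q)) E₃
          in (lin≡ (E ∷ X₁ ∷ ia ∷ κa ∷ X₂ ∷ ib ∷ p ∷ κb ∷ X₃ ∷ q ∷ r ∷ []) #0 ((#1 :* #2 :- #3 :* (#4 :* #5 :* #6 :- #7 :* #8)) :* (#6 :* (#9 :* #10))) (#0 :* (#2 :* (#9 :* #10)) =~ #0 :* ($1 :+ #3 :* #6) by h₀ ∷ #0 :* (#2 :* (#9 :* #10)) == #6 :* #1 :* (#2 :* (#9 :* #10)) by h₁ ∷ #3 :* (#0 :* #6 :* (#5 :* (#6 :* #10))) == #3 :* (#0 :* #6 :* ($1 :+ #7 :* #9)) by h₂ ∷ #3 :* (#0 :* #6 :* (#5 :* (#6 :* #10))) =~ #3 :* (#9 :* #4 :* #6 :* (#5 :* (#6 :* #10))) by h₃ ∷ #3 :* #7 :* (#0 :* #6 :* #9) == #3 :* #7 :* (#10 :* #8 :* #6 :* #9) by h₄ ∷ []) [] refl)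

    da : ∀ k → k * ia ≡ + ca k + (k * ia) /ℕ p * + p
    da k = a≡a%ℕn+[a/ℕn]*n (k * ia) p
    db : ∀ k → k * ib ≡ + cb k + (k * ib) /ℕ q * + q
    db k = a≡a%ℕn+[a/ℕn]*n (k * ib) q
    dc : ∀ k → k * ic ≡ + cc k + (k * ic) /ℕ r * + r
    dc k = a≡a%ℕn+[a/ℕn]*n (k * ic) r

    ca< : ∀ k → ca k ℕ.< p
    ca< k = n%ℕd<d (k * ia) p
    cb< : ∀ k → cb k ℕ.< q
    cb< k = n%ℕd<d (k * ib) q
    cc< : ∀ k → cc k ℕ.< r
    cc< k = n%ℕd<d (k * ic) r

    -- Multiply `ia qr + ib pr + ic pq = 1 + G N` by `k` and reduce the three coefficients to
    -- digits: each quotient removes that many multiples of `N`.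
    F : ℤ → ℤ
    F k = k * G - ((k * ia) /ℕ p + (k * ib) /ℕ q + (k * ic) /ℕ r)

    coords : ∀ k → + ca k * M + + cb k * (+ p * + r) + + cc k * (+ p * + q) ≡ k + F k * N
    coords k = lemma k G (+ p) (+ q) (+ r) ia ib ic (+ ca k) (+ cb k) (+ cc k) ((k * ia) /ℕ p) ((k * ib) /ℕ q) ((k * ic) /ℕ r) (da k) (db k) (dc k) E≡
      where
      lemma : ∀ k G p q r ia ib ic a b c x y z → k * ia ≡ a + x * p → k * ib ≡ b + y * q → k * ic ≡ c + z * r →
        ia * (q * r) + ib * (p * r) + ic * (p * q) - 1ℤ ≡ G * (p * (q * r)) → a * (q * r) + b * (p * r) + c * (p * q) ≡ k + (k * G - (x + y + z)) * (p * (q * r))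
      lemma k G p q r ia ib ic a b c x y z da db dc e = let
          h₁ = cong (_* (q * r)) da ; h₂ = cong (_* (p * r)) db ; h₃ = cong (_* (p * q)) dc ; h₄ = cong (k *_) e
        in (lin≡ (a ∷ q ∷ r ∷ b ∷ p ∷ c ∷ k ∷ G ∷ x ∷ y ∷ z ∷ ia ∷ ib ∷ ic ∷ []) (#0 :* (#1 :* #2) :+ #3 :* (#4 :* #2) :+ #5 :* (#4 :* #1)) (#6 :+ (#6 :* #7 :- (#8 :+ #9 :+ #10)) :* (#4 :* (#1 :* #2))) (#6 :* #11 :* (#1 :* #2) =~ (#0 :+ #8 :* #4) :* (#1 :* #2) by h₁ ∷ #6 :* #12 :* (#4 :* #2) =~ (#3 :+ #9 :* #1) :* (#4 :* #2) by h₂ ∷ #6 :* #13 :* (#4 :* #1) =~ (#5 :+ #10 :* #2) :* (#4 :* #1) by h₃ ∷ #6 :* (#11 :* (#1 :* #2) :+ #12 :* (#4 :* #2) :+ #13 :* (#4 :* #1) :- $1) == #6 :* (#7 :* (#4 :* (#1 :* #2))) by h₄ ∷ []) [] refl)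

    private
      1≤ : ∀ n → .{{ℕ.NonZero n}} → 1ℤ ≤ + n
      1≤ n = +≤+ (ℕ.>-nonZero⁻¹ n)
      -- Multiplication by the inverse `i` of `Q R` modulo `P` leaves `a - a′` plus multiples of
      -- `P`.
      digit : ∀ P Q R i κ a a′ b c g → i * (Q * R) ≡ 1ℤ + κ * + P → .{{ℕ.NonZero P}} → a ℕ.< P → a′ ℕ.< P →
        (+ a - + a′) * (Q * R) + b * (+ P * R) + c * (+ P * Q) ≡ g * (+ P * (Q * R)) → a ≡ a′
      digit P Q R i κ a a′ b c g h l l′ e = let
          h₁ = cong ((+ a - + a′) *_) h ; h₂ = cong (i *_) e ; l = +≤+ l ; l′ = +≤+ l′ ; z = +≤+ (z≤n {a}) ; z′ = +≤+ (z≤n {a′})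
          K = i * (g * (Q * R) - b * R - c * Q) - (+ a - + a′) * κ
          k≡ : K * + P ≡ + a - + a′
          k≡ = (lin≡ (i ∷ g ∷ Q ∷ R ∷ b ∷ c ∷ + a ∷ + a′ ∷ κ ∷ + P ∷ []) ((#0 :* (#1 :* (#2 :* #3) :- #4 :* #3 :- #5 :* #2) :- (#6 :- #7) :* #8) :* #9) (#6 :- #7) ((#6 :- #7) :* (#0 :* (#2 :* #3)) == (#6 :- #7) :* ($1 :+ #8 :* #9) by h₁ ∷ #0 :* ((#6 :- #7) :* (#2 :* #3) :+ #4 :* (#9 :* #3) :+ #5 :* (#9 :* #2)) =~ #0 :* (#1 :* (#9 :* (#2 :* #3))) by h₂ ∷ []) [] refl)
          k0 = small-multiple K (1≤ P)
            (≤-trans (≤-reflexive (cong (_+ 1ℤ) k≡)) (lin≤ (+ a ∷ + a′ ∷ + P ∷ []) (#0 :- #1 :+ $1) #2 ($1 :+ #0 <= #2 by l ∷ $0 <= #1 by z′ ∷ []) [] [] refl))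
            (≤-trans (lin≤ (+ P ∷ + a ∷ + a′ ∷ []) (:- #0 :+ $1) (#1 :- #2) ($1 :+ #2 <= #0 by l′ ∷ $0 <= #1 by z ∷ []) [] [] refl) (≤-reflexive (sym k≡)))
        in ℤ.+-injective (ℤ.i-j≡0⇒i≡j (+ a) (+ a′) (trans (sym k≡) (cong (_* + P) k0)))

    M≥1 : 1ℤ ≤ M
    M≥1 = 1≤* (1≤ q) (1≤ r)
    N≥1 : 1ℤ ≤ N
    N≥1 = 1≤* (1≤ p) M≥1

    unique : ∀ k {a b c} {f} → a ℕ.< p → b ℕ.< q → c ℕ.< r → + a * M + + b * (+ p * + r) + + c * (+ p * + q) ≡ k + f * N →
      a ≡ ca k × b ≡ cb k × c ≡ cc k × f ≡ F k
    unique k {a} {b} {c} {f} la lb lc e = ea , eb , ec , ef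
      where
      h = coords k
      ea = digit p (+ q) (+ r) ia κa a (ca k) (+ b - + cb k) (+ c - + cc k) (f - F k) ha la (ca< k)
        (lin≡ (+ a ∷ + ca k ∷ + q ∷ + r ∷ + b ∷ + cb k ∷ + p ∷ + c ∷ + cc k ∷ f ∷ F k ∷ k ∷ []) ((#0 :- #1) :* (#2 :* #3) :+ (#4 :- #5) :* (#6 :* #3) :+ (#7 :- #8) :* (#6 :* #2)) ((#9 :- #10) :* (#6 :* (#2 :* #3))) (#1 :* (#2 :* #3) :+ #5 :* (#6 :* #3) :+ #8 :* (#6 :* #2) =~ #11 :+ #10 :* (#6 :* (#2 :* #3)) by h ∷ #0 :* (#2 :* #3) :+ #4 :* (#6 :* #3) :+ #7 :* (#6 :* #2) == #11 :+ #9 :* (#6 :* (#2 :* #3)) by e ∷ []) [] refl)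
      eb = digit q (+ p) (+ r) ib κb b (cb k) (+ a - + ca k) (+ c - + cc k) (f - F k) hb lb (cb< k)
        (lin≡ (+ b ∷ + cb k ∷ + p ∷ + r ∷ + a ∷ + ca k ∷ + q ∷ + c ∷ + cc k ∷ f ∷ F k ∷ k ∷ []) ((#0 :- #1) :* (#2 :* #3) :+ (#4 :- #5) :* (#6 :* #3) :+ (#7 :- #8) :* (#6 :* #2)) ((#9 :- #10) :* (#6 :* (#2 :* #3))) (#5 :* (#6 :* #3) :+ #1 :* (#2 :* #3) :+ #8 :* (#2 :* #6) =~ #11 :+ #10 :* (#2 :* (#6 :* #3)) by h ∷ #4 :* (#6 :* #3) :+ #0 :* (#2 :* #3) :+ #7 :* (#2 :* #6) == #11 :+ #9 :* (#2 :* (#6 :* #3)) by e ∷ []) [] refl)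
      ec = digit r (+ p) (+ q) ic κc c (cc k) (+ a - + ca k) (+ b - + cb k) (f - F k) hc lc (cc< k)
        (lin≡ (+ c ∷ + cc k ∷ + p ∷ + q ∷ + a ∷ + ca k ∷ + r ∷ + b ∷ + cb k ∷ f ∷ F k ∷ k ∷ []) ((#0 :- #1) :* (#2 :* #3) :+ (#4 :- #5) :* (#6 :* #3) :+ (#7 :- #8) :* (#6 :* #2)) ((#9 :- #10) :* (#6 :* (#2 :* #3))) (#5 :* (#3 :* #6) :+ #8 :* (#2 :* #6) :+ #1 :* (#2 :* #3) =~ #11 :+ #10 :* (#2 :* (#3 :* #6)) by h ∷ #4 :* (#3 :* #6) :+ #7 :* (#2 :* #6) :+ #0 :* (#2 :* #3) == #11 :+ #9 :* (#2 :* (#3 :* #6)) by e ∷ []) [] refl)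
      ef : f ≡ F k
      ef = ℤ.*-cancelʳ-≡ f (F k) N {{ℤ.>-nonZero (ℤ.suc[i]≤j⇒i<j N≥1)}} (cancel k (trans (sym e) (trans
        (cong₂ _+_ (cong₂ _+_ (cong (λ a → + a * M) ea) (cong (λ b → + b * (+ p * + r)) eb)) (cong (λ c → + c * (+ p * + q)) ec)) h)))

    private
      borrow : ∀ {P a E} → a ℕ.< P → E ℕ.≤ P → ∃ λ a′ → a′ ℕ.< P × + a′ ≡ + a - + E + ⟨ a ℕ.<? E ⟩ * + P
      borrow {P} {a} {E} l h with a ℕ.<? E
      ... | yes a<E = let x = cong +_ (ℕ.m∸n+n≡m (ℕ.≤-trans h (ℕ.m≤n+m P a))) in (a ℕ.+ P) ℕ.∸ E ,
              ℕ.+-cancelʳ-< E _ _ (subst₂ ℕ._<_ (sym (ℕ.m∸n+n≡m (ℕ.≤-trans h (ℕ.m≤n+m P a)))) (ℕ.+-comm E P) (ℕ.+-monoˡ-< P a<E)) ,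
              (lin≡ (+ ((a ℕ.+ P) ℕ.∸ E) ∷ + a ∷ + E ∷ + P ∷ []) #0 (#1 :- #2 :+ $1 :* #3) (#0 :+ #2 == #1 :+ #3 by x ∷ []) [] refl)
      ... | no a≮E = let x = cong +_ (ℕ.m∸n+n≡m (ℕ.≮⇒≥ a≮E)) in a ℕ.∸ E , ℕ.≤-<-trans (ℕ.m∸n≤m a E) l ,
              (lin≡ (+ (a ℕ.∸ E) ∷ + a ∷ + E ∷ + P ∷ []) #0 (#1 :- #2 :+ $0 :* #3) (#0 :+ #2 == #1 by x ∷ []) [] refl)
      carry : ∀ {P a E} → a ℕ.< P → E ℕ.≤ P → ∃ λ a′ → a′ ℕ.< P × + a′ ≡ + a + + E - ⟨ P ℕ.≤? a ℕ.+ E ⟩ * + P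
      carry {P} {a} {E} l h with P ℕ.≤? a ℕ.+ E
      ... | yes c = let x = cong +_ (ℕ.m∸n+n≡m c) in (a ℕ.+ E) ℕ.∸ P , ℕ.+-cancelʳ-< P _ _ (subst (ℕ._< P ℕ.+ P) (sym (ℕ.m∸n+n≡m c)) (ℕ.+-mono-<-≤ l h)) ,
              (lin≡ (+ ((a ℕ.+ E) ℕ.∸ P) ∷ + a ∷ + E ∷ + P ∷ []) #0 (#1 :+ #2 :- $1 :* #3) (#0 :+ #3 == #1 :+ #2 by x ∷ []) [] refl)
      ... | no n = a ℕ.+ E , ℕ.≰⇒> n , (lin≡ (+ a ∷ + E ∷ + P ∷ []) (#0 :+ #1) (#0 :+ #1 :- $0 :* #2) [] [] refl)

    -- The signs suit shifts by `q` and `r`: `q` is `r⁻¹ qr` minus a multiple of `pq`, so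
    -- subtracting it lowers the first digit and raises another. A borrow raises F, a carry lowers
    -- it.
    F-shift : ∀ k x E B C g → E ℕ.≤ p → B ℕ.≤ q → C ℕ.≤ r → x ≡ + E * M - + B * (+ p * + r) - + C * (+ p * + q) + g * N →
      F (k - x) ≡ F k + g + ⟨ ca k ℕ.<? E ⟩ - ⟨ q ℕ.≤? cb k ℕ.+ B ⟩ - ⟨ r ℕ.≤? cc k ℕ.+ C ⟩
    F-shift k x E B C g lE lB lC hx = let
        a′ , la , ea = borrow (ca< k) lE ; b′ , lb , eb = carry (cb< k) lB ; c′ , lc , ec = carry (cc< k) lC
        ea = cong (_* M) ea ; eb = cong (_* (+ p * + r)) eb ; ec = cong (_* (+ p * + q)) ec ; h = coords k
        i = ⟨ ca k ℕ.<? E ⟩ ; j = ⟨ q ℕ.≤? cb k ℕ.+ B ⟩ ; l = ⟨ r ℕ.≤? cc k ℕ.+ C ⟩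
      in sym (proj₂ (proj₂ (proj₂ (unique (k - x) {f = F k + g + i - j - l} la lb lc
        (lin≡ (+ a′ ∷ + q ∷ + r ∷ + b′ ∷ + p ∷ + c′ ∷ k ∷ x ∷ F k ∷ g ∷ i ∷ j ∷ l ∷ + ca k ∷ + E ∷ + cb k ∷ + B ∷ + cc k ∷ + C ∷ []) (#0 :* (#1 :* #2) :+ #3 :* (#4 :* #2) :+ #5 :* (#4 :* #1)) (#6 :- #7 :+ (#8 :+ #9 :+ #10 :- #11 :- #12) :* (#4 :* (#1 :* #2))) (#0 :* (#1 :* #2) == (#13 :- #14 :+ #10 :* #4) :* (#1 :* #2) by ea ∷ #3 :* (#4 :* #2) == (#15 :+ #16 :- #11 :* #1) :* (#4 :* #2) by eb ∷ #5 :* (#4 :* #1) == (#17 :+ #18 :- #12 :* #2) :* (#4 :* #1) by ec ∷ #13 :* (#1 :* #2) :+ #15 :* (#4 :* #2) :+ #17 :* (#4 :* #1) == #6 :+ #8 :* (#4 :* (#1 :* #2)) by h ∷ #7 == #14 :* (#1 :* #2) :- #16 :* (#4 :* #2) :- #18 :* (#4 :* #1) :+ #9 :* (#4 :* (#1 :* #2)) by hx ∷ []) [] refl)))))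

    χ : ℤ → ℤ
    χ k = ⟨ F k ℤ.≟ 0ℤ ⟩

    g : ℤ → ℤ → ℤ → ℤ
    g x y k = χ k - χ (k - x) - χ (k - y) + χ (k - x - y)

-- Case analysis for a single point.

module Frame where
  open import Relation.Nullary.Decidable using (True; toWitness)
  open Lin
  open Sums
  open Steps using (small-multiple)
  open Coord
  open ChainM
  open Core

  mod-unique : ∀ {P a b} K → a ℕ.< P → b ℕ.< P → + a ≡ + b + K * + P → a ≡ b
  mod-unique {P} {a} {b} K l l′ h = let
      l₁ = +≤+ l ; l₂ = +≤+ l′ ; z = +≤+ (z≤n {a}) ; z′ = +≤+ (z≤n {b})
      k = small-multiple K (lin≤ (+ P ∷ + a ∷ []) $1 #0 ($1 :+ #1 <= #0 by l₁ ∷ $0 <= #1 by z ∷ []) [] [] refl) (lin≤ (K ∷ + P ∷ + a ∷ + b ∷ []) (#0 :* #1 :+ $1) #1 (#2 =~ #3 :+ #0 :* #1 by h ∷ $1 :+ #2 <= #1 by l₁ ∷ $0 <= #3 by z′ ∷ []) [] [] refl) (lin≤ (+ P ∷ K ∷ + a ∷ + b ∷ []) (:- #0 :+ $1) (#1 :* #0) (#2 == #3 :+ #1 :* #0 by h ∷ $1 :+ #3 <= #0 by l₂ ∷ $0 <= #2 by z ∷ []) [] [] refl)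
    in ℤ.+-injective (trans h (trans (cong (λ k → + b + k * + P) k) (ℤ.+-identityʳ (+ b))))

  -- The alternating sum of the four indicators [F = 0] in terms of F and of the carries.
  corner : ∀ {A B : Set} → ℤ → ℤ → ℤ → ℤ → Dec A → Dec B → ℤ
  corner f a b c y z = ⟨ f ℤ.≟ 0ℤ ⟩ - ⟨ f + a - ⟨ z ⟩ ℤ.≟ 0ℤ ⟩ - ⟨ f + b - ⟨ y ⟩ ℤ.≟ 0ℤ ⟩ + ⟨ f + c - ⟨ y ⟩ - ⟨ z ⟩ ℤ.≟ 0ℤ ⟩

  data Small : ℤ → Set where
    is0 : Small 0ℤ
    is1 : Small 1ℤ
    is2 : Small (+ 2)

  private
    auto : ∀ {x y} {_ : True (x ℤ.≤? y)} → x ≤ y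
    auto {_} {_} {t} = toWitness t

  -- In `corner`, `a`, `b` and `c` say whether the column lies below `ez`, `ey` and `ez + ey`. The
  -- four intervals of columns give the patterns (1,1,1), (0,1,1) or (1,0,1), (0,0,1) and (0,0,0),
  -- each settled by enumeration.
  region₁ : ∀ {A B : Set} {f} (y : Dec A) (z : Dec B) → Small f → corner f 1ℤ 1ℤ 1ℤ y z ≤ ⟨ f ℤ.≟ 0ℤ ⟩ + ⟨ (f ℤ.≟ 1ℤ) ×-dec (y ×-dec z) ⟩
  region₁ (yes _) (yes _) is0 = auto
  region₁ (yes _) (yes _) is1 = auto
  region₁ (yes _) (yes _) is2 = auto
  region₁ (yes _) (no _) is0 = auto
  region₁ (yes _) (no _) is1 = auto
  region₁ (yes _) (no _) is2 = auto
  region₁ (no _) (yes _) is0 = auto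
  region₁ (no _) (yes _) is1 = auto
  region₁ (no _) (yes _) is2 = auto
  region₁ (no _) (no _) is0 = auto
  region₁ (no _) (no _) is1 = auto
  region₁ (no _) (no _) is2 = auto

  region₂ : ∀ {A B : Set} {f} (y : Dec A) (z : Dec B) → Small f → (B → f ≢ 0ℤ) → corner f 0ℤ 1ℤ 1ℤ y z ≤ 0ℤ
  region₂ _ (yes b) is0 h = ⊥-elim (h b refl)
  region₂ (yes _) (yes _) is1 h = auto
  region₂ (yes _) (yes _) is2 h = auto
  region₂ (yes _) (no _) is0 h = auto
  region₂ (yes _) (no _) is1 h = auto
  region₂ (yes _) (no _) is2 h = auto
  region₂ (no _) (yes _) is1 h = auto
  region₂ (no _) (yes _) is2 h = auto
  region₂ (no _) (no _) is0 h = auto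
  region₂ (no _) (no _) is1 h = auto
  region₂ (no _) (no _) is2 h = auto

  region₂′ : ∀ {A B : Set} {f} (y : Dec A) (z : Dec B) → Small f → (A → f ≢ 0ℤ) → corner f 1ℤ 0ℤ 1ℤ y z ≤ 0ℤ
  region₂′ (yes a) _ is0 h = ⊥-elim (h a refl)
  region₂′ (yes _) (yes _) is1 h = auto
  region₂′ (yes _) (yes _) is2 h = auto
  region₂′ (yes _) (no _) is1 h = auto
  region₂′ (yes _) (no _) is2 h = auto
  region₂′ (no _) (yes _) is0 h = auto
  region₂′ (no _) (yes _) is1 h = auto
  region₂′ (no _) (yes _) is2 h = auto
  region₂′ (no _) (no _) is0 h = auto
  region₂′ (no _) (no _) is1 h = auto
  region₂′ (no _) (no _) is2 h = auto

  -- The -1, once for each of the `u` columns of the third interval, is the source of the term `- u`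
  -- in the total.
  region₃ : ∀ {A B A′ B′ : Set} {f} (y : Dec A) (z : Dec B) (y′ : Dec A′) (z′ : Dec B′) → (¬ A → A′) → (¬ B → B′) → Small f → (A → f ≢ 0ℤ) → (B → f ≢ 0ℤ) → corner f 0ℤ 0ℤ 1ℤ y z ≤ ⟨ (f ℤ.≟ 1ℤ) ×-dec (y′ ×-dec z′) ⟩ + ⟨ f ℤ.≟ + 2 ⟩ - 1ℤ
  region₃ (yes a) _ _ _ ny nz is0 h k = ⊥-elim (h a refl)
  region₃ _ (yes b) _ _ ny nz is0 h k = ⊥-elim (k b refl)
  region₃ (no a) _ (no a′) _ ny nz _ h k = ⊥-elim (a′ (ny a))
  region₃ _ (no b) _ (no b′) ny nz _ h k = ⊥-elim (b′ (nz b))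
  region₃ (no _) (no _) (yes _) (yes _) ny nz is0 h k = auto
  region₃ (no _) (no _) (yes _) (yes _) ny nz is1 h k = auto
  region₃ (no _) (no _) (yes _) (yes _) ny nz is2 h k = auto
  region₃ (yes _) (yes _) (yes _) (yes _) ny nz is1 h k = auto
  region₃ (yes _) (yes _) (yes _) (no _) ny nz is1 h k = auto
  region₃ (yes _) (yes _) (no _) _ ny nz is1 h k = auto
  region₃ (yes _) (yes _) (yes _) (yes _) ny nz is2 h k = auto
  region₃ (yes _) (yes _) (yes _) (no _) ny nz is2 h k = auto
  region₃ (yes _) (yes _) (no _) _ ny nz is2 h k = auto
  region₃ (yes _) (no _) (yes _) (yes _) ny nz is1 h k = auto
  region₃ (yes _) (no _) (no _) (yes _) ny nz is1 h k = auto
  region₃ (yes _) (no _) (yes _) (yes _) ny nz is2 h k = auto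
  region₃ (yes _) (no _) (no _) (yes _) ny nz is2 h k = auto
  region₃ (no _) (yes _) (yes _) (yes _) ny nz is1 h k = auto
  region₃ (no _) (yes _) (yes _) (no _) ny nz is1 h k = auto
  region₃ (no _) (yes _) (yes _) (yes _) ny nz is2 h k = auto
  region₃ (no _) (yes _) (yes _) (no _) ny nz is2 h k = auto

  region₄ : ∀ {A B : Set} {f} (y : Dec A) (z : Dec B) → Small f → (A → f ≢ 0ℤ) → (B → f ≢ 0ℤ) → corner f 0ℤ 0ℤ 0ℤ y z ≤ ⟨ (f ℤ.≟ + 2) ×-dec (y ×-dec z) ⟩
  region₄ (yes a) _ is0 h k = ⊥-elim (h a refl)
  region₄ _ (yes b) is0 h k = ⊥-elim (k b refl)
  region₄ (yes _) (yes _) is1 h k = auto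
  region₄ (yes _) (yes _) is2 h k = auto
  region₄ (yes _) (no _) is1 h k = auto
  region₄ (yes _) (no _) is2 h k = auto
  region₄ (no _) (yes _) is1 h k = auto
  region₄ (no _) (yes _) is2 h k = auto
  region₄ (no _) (no _) is0 h k = auto
  region₄ (no _) (no _) is1 h k = auto
  region₄ (no _) (no _) is2 h k = auto

-- From p consecutive integers to a chain.

module Config where
  open import Data.Integer.DivMod using (_%ℕ_; _/ℕ_; a≡a%ℕn+[a/ℕn]*n; n%ℕd<d)
  open Lin
  open Sums
  open Coord
  open ChainM
  open Core
  open Frame

  -- In the applications `q̃` is `± q` and `r̃` is `± r`, according to the base point. Divided by
  -- `q`, `U≡` says that `ez` is the inverse of `± r` modulo `p`; likewise `V≡` for `ey` and `± q`.
  record Setting (p u e m q r : ℕ) (I : Inverses p q r) : Set where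
    open Coordinates I
    open Inverses I using (ia)
    field
      ez ey tz ty : ℕ
      q̃ r̃ n₀ : ℤ
      U≡ : + ez * M - q̃ ≡ + tz * (+ p * + q)
      V≡ : + ey * M - r̃ ≡ + ty * (+ p * + r)
      tz≤ : tz ℕ.≤ r
      ty≤ : ty ℕ.≤ q
      order : (ez ≡ u × ey ≡ u ℕ.+ e) ⊎ (ez ≡ u ℕ.+ e × ey ≡ u)
      q̃≥ : - + q ≤ q̃
      r̃≥ : - + r ≤ r̃
      p≥2 : + 2 ≤ + p
      q≥2 : + 2 ≤ + q
      r≥2 : + 2 ≤ + r
      ia≡ : (∃ λ κ → ia ≡ + (u ℕ.* (u ℕ.+ e)) + κ * + p) ⊎ (∃ λ κ → ia ≡ - + (u ℕ.* (u ℕ.+ e)) + κ * + p)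
      lower : - (+ p + + q + + r) ≤ n₀
      upper : n₀ + + p ≤ N
      upper-q : n₀ + + p ≤ N + q̃
      upper-r : n₀ + + p ≤ N + r̃

  module Blocks {u e m q r : ℕ} {I : Inverses (u ℕ.+ e ℕ.+ u ℕ.+ m) q r} (S : Setting (u ℕ.+ e ℕ.+ u ℕ.+ m) u e m q r I) where
    open Setting S
    open Inverses I
    open Coordinates I
    p v s : ℕ
    p = u ℕ.+ e ℕ.+ u ℕ.+ m
    v = u ℕ.+ e
    s = v ℕ.+ u

    at : ℕ → ℤ
    at i = n₀ + + i
    hy hz U V : ℤ
    hy = + p * + r
    hz = + p * + q
    U = + ez * M - q̃
    V = + ey * M - r̃
    col : ℕ → ℕ
    col i = ca (at i)
    -- Modulo `p` only the term `a qr` survives, so column `x` occurs where `n₀ + i` is congruent to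
    -- `x qr`.
    pos : ℕ → ℕ
    pos x = (+ x * M - n₀) %ℕ p
    Y Z : ℕ → ℤ
    Y i = + cb (at i) * hy
    Z i = + cc (at i) * hz

    private
      pos≡ : ∀ x → + x * M - n₀ ≡ + pos x + (+ x * M - n₀) /ℕ p * + p
      pos≡ x = a≡a%ℕn+[a/ℕn]*n (+ x * M - n₀) p
      hy≥1 : 1ℤ ≤ hy
      hy≥1 = 1≤* (≤-trans (+≤+ (s≤s z≤n)) p≥2) (≤-trans (+≤+ (s≤s z≤n)) r≥2)
      hz≥1 : 1ℤ ≤ hz
      hz≥1 = 1≤* (≤-trans (+≤+ (s≤s z≤n)) p≥2) (≤-trans (+≤+ (s≤s z≤n)) q≥2)

    pos-col : ∀ i → i ℕ.< p → pos (col i) ≡ i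
    pos-col i l = mod-unique (F (at i) * M - + cb (at i) * + r - + cc (at i) * + q - (+ col i * M - n₀) /ℕ p) (n%ℕd<d (+ col i * M - n₀) p) l
      (go (+ pos (col i)) (+ i) ((+ col i * M - n₀) /ℕ p) (+ col i) (+ cb (at i)) (+ cc (at i)) (F (at i)) (+ p) (+ q) (+ r) n₀ (pos≡ (col i)) (coords (at i)))
      where
      go : ∀ x i z a b c f p q r n → a * (q * r) - n ≡ x + z * p → a * (q * r) + b * (p * r) + c * (p * q) ≡ n + i + f * (p * (q * r)) →
        x ≡ i + (f * (q * r) - b * r - c * q - z) * p
      go x i z a b c f p q r n h k = (lin≡ (x ∷ i ∷ f ∷ q ∷ r ∷ b ∷ c ∷ z ∷ p ∷ a ∷ n ∷ []) #0 (#1 :+ (#2 :* (#3 :* #4) :- #5 :* #4 :- #6 :* #3 :- #7) :* #8) (#9 :* (#3 :* #4) :- #10 =~ #0 :+ #7 :* #8 by h ∷ #9 :* (#3 :* #4) :+ #5 :* (#8 :* #4) :+ #6 :* (#8 :* #3) == #10 :+ #1 :+ #2 :* (#8 :* (#3 :* #4)) by k ∷ []) [] refl)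

    col-pos : ∀ x → x ℕ.< p → col (pos x) ≡ x
    col-pos x l = mod-unique (+ x * κa - (+ x * M - n₀) /ℕ p * ia - (at (pos x) * ia) /ℕ p) (ca< (at (pos x))) l
      (go (+ x) (+ pos x) ((+ x * M - n₀) /ℕ p) (+ ca (at (pos x))) ((at (pos x) * ia) /ℕ p) ia κa (+ p) M n₀ (pos≡ x) (da (at (pos x))) ha)
      where
      go : ∀ x y z a w ia κ p M n → x * M - n ≡ y + z * p → (n + y) * ia ≡ a + w * p → ia * M ≡ 1ℤ + κ * p → a ≡ x + (x * κ - z * ia - w) * p
      go x y z a w ia κ p M n h k l = let h = cong (_* ia) h ; l = cong (x *_) l in
        (lin≡ (a ∷ x ∷ κ ∷ z ∷ ia ∷ w ∷ p ∷ M ∷ n ∷ y ∷ []) #0 (#1 :+ (#1 :* #2 :- #3 :* #4 :- #5) :* #6) ((#1 :* #7 :- #8) :* #4 =~ (#9 :+ #3 :* #6) :* #4 by h ∷ (#8 :+ #9) :* #4 =~ #0 :+ #5 :* #6 by k ∷ #1 :* (#4 :* #7) == #1 :* ($1 :+ #2 :* #6) by l ∷ []) [] refl)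

    private
      digit-step : ∀ P (i : ℤ) n k .{{_ : ℕ.NonZero P}} → ∃ λ γ → + (((n + (1ℤ + k)) * i) %ℕ P) ≡ + (((n + k) * i) %ℕ P) + i + γ * + P
      digit-step P i n k = let a = a≡a%ℕn+[a/ℕn]*n ((n + (1ℤ + k)) * i) P ; b = a≡a%ℕn+[a/ℕn]*n ((n + k) * i) P
                               x = + (((n + (1ℤ + k)) * i) %ℕ P) ; y = + (((n + k) * i) %ℕ P) ; x′ = ((n + (1ℤ + k)) * i) /ℕ P ; y′ = ((n + k) * i) /ℕ P in
        y′ - x′ , (lin≡ (x ∷ y ∷ i ∷ y′ ∷ x′ ∷ + P ∷ n ∷ k ∷ []) #0 (#1 :+ #2 :+ (#3 :- #4) :* #5) ((#6 :+ ($1 :+ #7)) :* #2 =~ #0 :+ #4 :* #5 by a ∷ (#6 :+ #7) :* #2 == #1 :+ #3 :* #5 by b ∷ []) [] refl)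

      ord : (+ u ≤ + ey × + ey ≤ + v) × (+ u ≤ + ez × + ez ≤ + v) × + ey + + ez ≡ + s
      ord with order
      ... | inj₁ (refl , refl) = (+≤+ (ℕ.m≤m+n u e) , ≤-refl) , (≤-refl , +≤+ (ℕ.m≤m+n u e)) , refl
      ... | inj₂ (refl , refl) = (≤-refl , +≤+ (ℕ.m≤m+n u e)) , (+≤+ (ℕ.m≤m+n u e) , ≤-refl) , ℤ.+-comm (+ u) (+ v)

      U-bound : ∀ {P Q t : ℤ} → + 2 ≤ P → + 2 ≤ Q → - Q ≤ t → ∀ x → x - t - P * Q + P ≤ x
      U-bound {P} {Q} {t} h k l x = (lin≤ (x ∷ t ∷ P ∷ Q ∷ []) (#0 :- #1 :- #2 :* #3 :+ #2) #0 ($2 <= #2 by h ∷ $2 <= #3 by k ∷ :- #3 <= #1 by l ∷ []) [] ((1 , 2) ∷ []) refl)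

      digit≤ : ∀ {a P h} → a ℕ.< P → 1ℤ ≤ h → + a * h + h ≤ + P * h
      digit≤ {a} {P} {h} l k = let l = +≤+ l in (lin≤ (+ a ∷ h ∷ + P ∷ []) (#0 :* #1 :+ #1) (#2 :* #1) ($1 <= #1 by k ∷ $1 :+ #0 <= #2 by l ∷ []) (1 ∷ 0 ∷ []) ((2 , 1) ∷ []) refl)
      ≥0 : ∀ {h} a → 1ℤ ≤ h → 0ℤ ≤ + a * h
      ≥0 {h} a k = let a≥0 = +≤+ (z≤n {a}) in (lin≤ (+ a ∷ h ∷ []) $0 (#0 :* #1) ($1 <= #1 by k ∷ $0 <= #0 by a≥0 ∷ []) (1 ∷ 0 ∷ []) ((2 , 1) ∷ []) refl)
      qN : ∀ p q r → q * (p * r) ≡ p * (q * r)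
      qN p q r = (lin≡ (q ∷ p ∷ r ∷ []) (#0 :* (#1 :* #2)) (#1 :* (#0 :* #2)) [] [] refl)
      rN : ∀ p q r → r * (p * q) ≡ p * (q * r)
      rN p q r = (lin≡ (r ∷ p ∷ q ∷ []) (#0 :* (#1 :* #2)) (#1 :* (#2 :* #0)) [] [] refl)

    Y≤ : ∀ i → Y i + hy ≤ N
    Y≤ i = ≤-trans (digit≤ (cb< (at i)) hy≥1) (≤-reflexive (qN (+ p) (+ q) (+ r)))
    Z≤ : ∀ i → Z i + hz ≤ N
    Z≤ i = ≤-trans (digit≤ (cc< (at i)) hz≥1) (≤-reflexive (rN (+ p) (+ q) (+ r)))

    D : Data
    D = record
      { u = u ; e = e ; m = m ; M = M ; hy = hy ; hz = hz ; V = V ; U = U ; n₀ = n₀ ; δ = 1ℤ ; ω = ia ; υ = ib * hy ; ζ = ic * hz ; ey = ey ; ez = ez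
      ; col = col ; pos = pos ; Y = Y ; Z = Z ; F = λ i → F (at i)
      ; col< = λ i _ → ca< (at i) ; pos< = λ x _ → n%ℕd<d (+ x * M - n₀) p ; pos-col = pos-col ; col-pos = col-pos
      ; M≥1 = M≥1 ; hy≥1 = hy≥1 ; hz≥1 = hz≥1 ; 0≤Y = λ i → ≥0 (cb (at i)) hy≥1 ; 0≤Z = λ i → ≥0 (cc (at i)) hz≥1 ; Y≤ = Y≤ ; Z≤ = Z≤
      ; V≤ = U-bound p≥2 r≥2 r̃≥ (+ ey * M) ; U≤ = U-bound p≥2 q≥2 q̃≥ (+ ez * M)
      ; u≤ey = proj₁ (proj₁ ord) ; ey≤v = proj₂ (proj₁ ord) ; u≤ez = proj₁ (proj₁ (proj₂ ord)) ; ez≤v = proj₂ (proj₁ (proj₂ ord)) ; ey+ez = proj₂ (proj₂ ord)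
      ; δ≡ = inj₁ refl
      ; eqn = λ i _ → trans (coords (at i)) (cong (λ z → n₀ + z + F (at i) * N) (sym (ℤ.*-identityˡ (+ i))))
      ; col-step = λ i _ → digit-step p ia n₀ (+ i)
      ; Y-step = λ i _ → let γ , h = digit-step q ib n₀ (+ i) in γ , Y-scaled (+ cb (at (suc i))) (+ cb (at i)) ib γ (+ p) (+ q) (+ r) h
      ; Z-step = λ i _ → let γ , h = digit-step r ic n₀ (+ i) in γ , Z-scaled (+ cc (at (suc i))) (+ cc (at i)) ic γ (+ p) (+ q) (+ r) h
      ; ω≡ = ia≡ }
      where
      Y-scaled : ∀ x y i γ p q r → x ≡ y + i + γ * q → x * (p * r) ≡ y * (p * r) + i * (p * r) + γ * (p * (q * r))
      Y-scaled x y i γ p q r h = let h = cong (_* (p * r)) h in (lin≡ (x ∷ p ∷ r ∷ y ∷ i ∷ γ ∷ q ∷ []) (#0 :* (#1 :* #2)) (#3 :* (#1 :* #2) :+ #4 :* (#1 :* #2) :+ #5 :* (#1 :* (#6 :* #2))) (#0 :* (#1 :* #2) == (#3 :+ #4 :+ #5 :* #6) :* (#1 :* #2) by h ∷ []) [] refl)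
      Z-scaled : ∀ x y i γ p q r → x ≡ y + i + γ * r → x * (p * q) ≡ y * (p * q) + i * (p * q) + γ * (p * (q * r))
      Z-scaled x y i γ p q r h = let h = cong (_* (p * q)) h in (lin≡ (x ∷ p ∷ q ∷ y ∷ i ∷ γ ∷ r ∷ []) (#0 :* (#1 :* #2)) (#3 :* (#1 :* #2) :+ #4 :* (#1 :* #2) :+ #5 :* (#1 :* (#2 :* #6))) (#0 :* (#1 :* #2) == (#3 :+ #4 :+ #5 :* #6) :* (#1 :* #2) by h ∷ []) [] refl)

    open Labels D
    open DataFacts D

    module Point (i : ℕ) (i<p : i ℕ.< p) where
      k : ℤ
      k = at i
      private
        lk : + suc i ≤ + p
        lk = +≤+ i<p
        h = coords k
        yb = Y≤ i
        zb = Z≤ i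
        ab : + col i * M + M ≤ N
        ab = digit≤ (ca< k) M≥1
        y0 = ≥0 (cb k) hy≥1
        z0 = ≥0 (cc k) hz≥1
        a0 = ≥0 (ca k) M≥1
        i≥0 : 0ℤ ≤ + i
        i≥0 = +≤+ z≤n
      -- F is nonnegative because `k < N`. It is at most 2 because the digits fall short of `3 N` by
      -- at least `qr + pr + pq`, which exceeds `p + q + r ≥ - k`.
      small : Small (F k)
      small = sm (F k) F≥0 F≤2
        where
        F≥0 : 0ℤ ≤ F k
        F≥0 = case 0ℤ ℤ.≤? F k of λ where
          (yes q) → q
          (no q) → let q = ≰⇒1+≤ q in ⊥-elim (lin⊥ (N ∷ F k ∷ + col i ∷ M ∷ Y i ∷ Z i ∷ n₀ ∷ + i ∷ + p ∷ []) ($1 <= #0 by N≥1 ∷ $1 :+ #1 <= $0 by q ∷ #2 :* #3 :+ #4 :+ #5 == #6 :+ #7 :+ #1 :* #0 by h ∷ $0 <= #4 by y0 ∷ $0 <= #5 by z0 ∷ $0 <= #2 :* #3 by a0 ∷ $1 :+ #7 <= #8 by lk ∷ #6 :+ #8 <= #0 by upper ∷ []) (0 ∷ []) ((1 , 0) ∷ []) refl)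
        big : + p + + q + + r + 1ℤ ≤ M + hy + hz
        big = (lin≤ (+ p ∷ + q ∷ + r ∷ []) (#0 :+ #1 :+ #2 :+ $1) (#1 :* #2 :+ #0 :* #2 :+ #0 :* #1) ($2 <= #0 by p≥2 ∷ $2 <= #1 by q≥2 ∷ $2 <= #2 by r≥2 ∷ []) (1 ∷ 3 ∷ 3 ∷ 3 ∷ []) ((1 , 2) ∷ (1 , 3) ∷ (2 , 3) ∷ []) refl)
        F≤2 : F k ≤ + 2
        F≤2 = case F k ℤ.≤? + 2 of λ where
          (yes q) → q
          (no n) → let n = ≰⇒1+≤ n in ⊥-elim (lin⊥ (N ∷ F k ∷ + col i ∷ M ∷ Y i ∷ Z i ∷ n₀ ∷ + i ∷ hy ∷ hz ∷ + p ∷ + q ∷ + r ∷ []) ($1 <= #0 by N≥1 ∷ $1 :+ $2 <= #1 by n ∷ #2 :* #3 :+ #4 :+ #5 =~ #6 :+ #7 :+ #1 :* #0 by h ∷ #4 :+ #8 <= #0 by yb ∷ #5 :+ #9 <= #0 by zb ∷ #2 :* #3 :+ #3 <= #0 by ab ∷ :- (#10 :+ #11 :+ #12) <= #6 by lower ∷ $0 <= #7 by i≥0 ∷ #10 :+ #11 :+ #12 :+ $1 <= #3 :+ #8 :+ #9 by big ∷ []) (0 ∷ []) ((1 , 0) ∷ []) refl)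
        sm : ∀ f → 0ℤ ≤ f → f ≤ + 2 → Small f
        sm (+ 0) _ _ = is0
        sm (+ 1) _ _ = is1
        sm (+ 2) _ _ = is2
        sm (+ suc (suc (suc n))) _ (+≤+ (s≤s (s≤s ())))

      -- With F = 0 the integer `k` would be at least `ez M + N - U = N + q̃`, beyond the block.
      top-z : ez ℕ.≤ col i → TopZ i → F k ≢ 0ℤ
      top-z l t f0 = let l = +≤+ l ; fN = cong (_* N) f0 in (lin⊥ (M ∷ F k ∷ N ∷ + col i ∷ Y i ∷ Z i ∷ n₀ ∷ + i ∷ U ∷ + ez ∷ q̃ ∷ + p ∷ []) ($1 <= #0 by M≥1 ∷ #1 :* #2 == $0 by fN ∷ #3 :* #0 :+ #4 :+ #5 == #6 :+ #7 :+ #1 :* #2 by h ∷ #2 :- #8 <= #5 by t ∷ #8 == #9 :* #0 :- #10 by U′ ∷ #9 <= #3 by l ∷ $0 <= #4 by y0 ∷ $1 :+ #7 <= #11 by lk ∷ #6 :+ #11 <= #2 :+ #10 by upper-q ∷ []) (0 ∷ []) ((5 , 0) ∷ []) refl)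
        where U′ : U ≡ + ez * M - q̃
              U′ = refl
      top-y : ey ℕ.≤ col i → TopY i → F k ≢ 0ℤ
      top-y l t f0 = let l = +≤+ l ; fN = cong (_* N) f0 in (lin⊥ (M ∷ F k ∷ N ∷ + col i ∷ Y i ∷ Z i ∷ n₀ ∷ + i ∷ V ∷ + ey ∷ r̃ ∷ + p ∷ []) ($1 <= #0 by M≥1 ∷ #1 :* #2 == $0 by fN ∷ #3 :* #0 :+ #4 :+ #5 == #6 :+ #7 :+ #1 :* #2 by h ∷ #2 :- #8 <= #4 by t ∷ #8 == #9 :* #0 :- #10 by V′ ∷ #9 <= #3 by l ∷ $0 <= #5 by z0 ∷ $1 :+ #7 <= #11 by lk ∷ #6 :+ #11 <= #2 :+ #10 by upper-r ∷ []) (0 ∷ []) ((5 , 0) ∷ []) refl)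
        where V′ : V ≡ + ey * M - r̃
              V′ = refl

      y? = N - V ℤ.≤? Y i
      z? = N - U ℤ.≤? Z i
      private
        carry≡ : ∀ P c t h n W → + P * h ≡ n → W ≡ + t * h → 1ℤ ≤ h → ⟨ P ℕ.≤? c ℕ.+ t ⟩ ≡ ⟨ n - W ℤ.≤? + c * h ⟩
        carry≡ P c t h n W e w k = ⟨⟩-cong (P ℕ.≤? c ℕ.+ t) (n - W ℤ.≤? + c * h)
          (λ l → let l = +≤+ l in (lin≤ (n ∷ W ∷ + c ∷ h ∷ + P ∷ + t ∷ []) (#0 :- #1) (#2 :* #3) ($1 <= #3 by k ∷ #4 <= #2 :+ #5 by l ∷ #4 :* #3 =~ #0 by e ∷ #1 =~ #5 :* #3 by w ∷ []) (1 ∷ 0 ∷ []) ((2 , 1) ∷ []) refl))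
          (λ l → case P ℕ.≤? c ℕ.+ t of λ where
            (yes q) → q
            (no q) → let q = +≤+ (ℕ.≰⇒> q) in ⊥-elim (lin⊥ (+ c ∷ + t ∷ + P ∷ h ∷ n ∷ W ∷ []) ($1 :+ (#0 :+ #1) <= #2 by q ∷ $1 <= #3 by k ∷ #2 :* #3 == #4 by e ∷ #5 == #1 :* #3 by w ∷ #4 :- #5 <= #0 :* #3 by l ∷ []) [] ((0 , 1) ∷ []) refl))
        no-carry : ∀ P c → c ℕ.< P → ⟨ P ℕ.≤? c ℕ.+ 0 ⟩ ≡ 0ℤ
        no-carry P c l = ⟨⟩-no (P ℕ.≤? c ℕ.+ 0) (λ q → ℕ.<⇒≱ l (subst (P ℕ.≤_) (ℕ.+-identityʳ c) q))
        carry-z : ⟨ r ℕ.≤? cc k ℕ.+ tz ⟩ ≡ ⟨ z? ⟩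
        carry-z = carry≡ r (cc k) tz hz N U (rN (+ p) (+ q) (+ r)) U≡ hz≥1
        carry-y : ⟨ q ℕ.≤? cb k ℕ.+ ty ⟩ ≡ ⟨ y? ⟩
        carry-y = carry≡ q (cb k) ty hy N V (qN (+ p) (+ q) (+ r)) V≡ hy≥1
        inside : s ℕ.≤ p
        inside = ℕ.m≤m+n s m
        sum≡ : ez ℕ.+ ey ≡ s
        sum≡ = ℤ.+-injective (trans (ℤ.+-comm (+ ez) (+ ey)) (proj₂ (proj₂ ord)))
        sum≤ : ez ℕ.+ ey ℕ.≤ p
        sum≤ = ℕ.≤-trans (ℕ.≤-reflexive sum≡) inside
        at-q : F (k - q̃) ≡ F k + ⟨ ca k ℕ.<? ez ⟩ - ⟨ z? ⟩
        at-q = let hx = U≡ in trans (F-shift k q̃ ez 0 tz 0ℤ (ℕ.≤-trans (ℕ.m≤m+n ez ey) sum≤) z≤n tz≤ (lin≡ (q̃ ∷ + ez ∷ M ∷ hy ∷ + tz ∷ hz ∷ N ∷ []) #0 (#1 :* #2 :- $0 :* #3 :- #4 :* #5 :+ $0 :* #6) (#1 :* #2 :- #0 =~ #4 :* #5 by hx ∷ []) [] refl))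
          (tidy (F k) ⟨ ca k ℕ.<? ez ⟩ {⟨ q ℕ.≤? cb k ℕ.+ 0 ⟩} {⟨ r ℕ.≤? cc k ℕ.+ tz ⟩} {⟨ z? ⟩} (no-carry q (cb k) (cb< k)) carry-z)
          where tidy : ∀ f a {x y z} → x ≡ 0ℤ → y ≡ z → f + 0ℤ + a - x - y ≡ f + a - z
                tidy f a {x} {y} {z} h h′ = (lin≡ (f ∷ a ∷ x ∷ y ∷ z ∷ []) (#0 :+ $0 :+ #1 :- #2 :- #3) (#0 :+ #1 :- #4) (#2 =~ $0 by h ∷ #3 =~ #4 by h′ ∷ []) [] refl)
        at-r : F (k - r̃) ≡ F k + ⟨ ca k ℕ.<? ey ⟩ - ⟨ y? ⟩
        at-r = let hx = V≡ in trans (F-shift k r̃ ey ty 0 0ℤ (ℕ.≤-trans (ℕ.m≤n+m ey ez) sum≤) ty≤ z≤n (lin≡ (r̃ ∷ + ey ∷ M ∷ + ty ∷ hy ∷ hz ∷ N ∷ []) #0 (#1 :* #2 :- #3 :* #4 :- $0 :* #5 :+ $0 :* #6) (#1 :* #2 :- #0 =~ #3 :* #4 by hx ∷ []) [] refl))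
          (tidy (F k) ⟨ ca k ℕ.<? ey ⟩ {⟨ r ℕ.≤? cc k ℕ.+ 0 ⟩} {⟨ q ℕ.≤? cb k ℕ.+ ty ⟩} {⟨ y? ⟩} (no-carry r (cc k) (cc< k)) carry-y)
          where tidy : ∀ f a {x y z} → x ≡ 0ℤ → y ≡ z → f + 0ℤ + a - y - x ≡ f + a - z
                tidy f a {x} {y} {z} h h′ = (lin≡ (f ∷ a ∷ y ∷ x ∷ z ∷ []) (#0 :+ $0 :+ #1 :- #2 :- #3) (#0 :+ #1 :- #4) (#3 =~ $0 by h ∷ #2 =~ #4 by h′ ∷ []) [] refl)
        at-qr : F (k - q̃ - r̃) ≡ F k + ⟨ ca k ℕ.<? ez ℕ.+ ey ⟩ - ⟨ y? ⟩ - ⟨ z? ⟩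
        at-qr = let hx = U≡ ; hy′ = V≡ in trans (cong F (lin≡ (k ∷ q̃ ∷ r̃ ∷ []) (#0 :- #1 :- #2) (#0 :- (#1 :+ #2)) [] [] refl)) (trans (F-shift k (q̃ + r̃) (ez ℕ.+ ey) ty tz 0ℤ sum≤ ty≤ tz≤
            (lin≡ (q̃ ∷ r̃ ∷ + ez ∷ + ey ∷ M ∷ + ty ∷ hy ∷ + tz ∷ hz ∷ N ∷ []) (#0 :+ #1) ((#2 :+ #3) :* #4 :- #5 :* #6 :- #7 :* #8 :+ $0 :* #9) (#2 :* #4 :- #0 =~ #7 :* #8 by hx ∷ #3 :* #4 :- #1 =~ #5 :* #6 by hy′ ∷ []) [] refl))
          (tidy (F k) ⟨ ca k ℕ.<? ez ℕ.+ ey ⟩ {⟨ q ℕ.≤? cb k ℕ.+ ty ⟩} {⟨ r ℕ.≤? cc k ℕ.+ tz ⟩} {⟨ y? ⟩} {⟨ z? ⟩} carry-y carry-z))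
          where tidy : ∀ f a {x y x′ y′} → x ≡ x′ → y ≡ y′ → f + 0ℤ + a - x - y ≡ f + a - x′ - y′
                tidy f a {x} {y} {x′} {y′} h h′ = (lin≡ (f ∷ a ∷ x ∷ y ∷ x′ ∷ y′ ∷ []) (#0 :+ $0 :+ #1 :- #2 :- #3) (#0 :+ #1 :- #4 :- #5) (#2 =~ #4 by h ∷ #3 =~ #5 by h′ ∷ []) [] refl)

      private
        g≡ : ∀ {a b c} → ⟨ ca k ℕ.<? ez ⟩ ≡ a → ⟨ ca k ℕ.<? ey ⟩ ≡ b → ⟨ ca k ℕ.<? ez ℕ.+ ey ⟩ ≡ c → g q̃ r̃ k ≡ corner (F k) a b c y? z?
        g≡ refl refl refl = cong₂ _+_ (cong₂ _-_ (cong (λ x → χ k - ⟨ x ℤ.≟ 0ℤ ⟩) at-q) (cong (λ x → ⟨ x ℤ.≟ 0ℤ ⟩) at-r)) (cong (λ x → ⟨ x ℤ.≟ 0ℤ ⟩) at-qr)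
        lt : ∀ {n} → ca k ℕ.< n → ⟨ ca k ℕ.<? n ⟩ ≡ 1ℤ
        lt = ⟨⟩-yes (ca k ℕ.<? _)
        ge : ∀ {n} → n ℕ.≤ ca k → ⟨ ca k ℕ.<? n ⟩ ≡ 0ℤ
        ge h = ⟨⟩-no (ca k ℕ.<? _) (ℕ.≤⇒≯ h)
        in-s : col i ℕ.< s → ca k ℕ.< ez ℕ.+ ey
        in-s = subst (col i ℕ.<_) (sym sum≡)
        v≤ : ∀ {x} → v ℕ.≤ x → ez ℕ.≤ x × ey ℕ.≤ x
        v≤ h = ℕ.≤-trans (ℤ.drop‿+≤+ (proj₂ (proj₁ (proj₂ ord)))) h , ℕ.≤-trans (ℤ.drop‿+≤+ (proj₂ (proj₁ ord))) h
        u≤ : ∀ {x} → x ℕ.< u → x ℕ.< ez × x ℕ.< ey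
        u≤ h = ℕ.<-≤-trans h (ℤ.drop‿+≤+ (proj₁ (proj₁ (proj₂ ord)))) , ℕ.<-≤-trans h (ℤ.drop‿+≤+ (proj₁ (proj₁ ord)))
        flip : ∀ {x y} → ¬ (x ≤ y) → 1ℤ + y ≤ x
        flip h = ≰⇒1+≤ h

      in-R₁ : col i ℕ.< u → g q̃ r̃ k ≤ ⟨ G₁? i ⟩ + ⟨ T₁? i ⟩
      in-R₁ l = ≤-trans (≤-reflexive (g≡ (lt (proj₁ (u≤ l))) (lt (proj₂ (u≤ l))) (lt (in-s (ℕ.<-≤-trans l (ℕ.m≤n+m u v)))))) (region₁ y? z? small)
      in-R₂ : u ℕ.≤ col i → col i ℕ.< v → g q̃ r̃ k ≤ 0ℤ
      in-R₂ l l′ = case order of λ where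
          (inj₁ (eu , ev)) → let a = subst (ℕ._≤ col i) (sym eu) l in
            ≤-trans (≤-reflexive (g≡ (ge a) (lt (subst (col i ℕ.<_) (sym ev) l′)) (lt (in-s l″)))) (region₂ y? z? small (top-z a))
          (inj₂ (ev , eu)) → let a = subst (ℕ._≤ col i) (sym eu) l in
            ≤-trans (≤-reflexive (g≡ (lt (subst (col i ℕ.<_) (sym ev) l′)) (ge a) (lt (in-s l″)))) (region₂′ y? z? small (top-y a))
        where l″ = ℕ.<-≤-trans l′ (ℕ.m≤m+n v u)
      in-R₃ : v ℕ.≤ col i → col i ℕ.< s → g q̃ r̃ k ≤ ⟨ G₃? i ⟩ + ⟨ H? i ⟩ - 1ℤ
      in-R₃ l l′ = let a , b = v≤ l in ≤-trans (≤-reflexive (g≡ (ge a) (ge b) (lt (in-s l′)))) (region₃ y? z? (1ℤ + Y i ℤ.≤? N - V) (1ℤ + Z i ℤ.≤? N - U) flip flip small (top-y b) (top-z a))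
      in-R₄ : s ℕ.≤ col i → g q̃ r̃ k ≤ ⟨ T? i ⟩
      in-R₄ l = let a , b = v≤ (ℕ.≤-trans (ℕ.m≤m+n v u) l) in ≤-trans (≤-reflexive (g≡ (ge a) (ge b) (ge (ℕ.≤-trans (ℕ.≤-reflexive sum≡) l)))) (region₄ y? z? small (top-y b) (top-z a))

    Σg : ℤ
    Σg = ∑ p (λ i → g q̃ r̃ (at i))

    total : Σg + + u ≤ τ + g₁ + t₁ + g₃ + h₃
    total = let
        f = λ x → g q̃ r̃ (at (pos x))
        sp = trans (reindex (λ i → g q̃ r̃ (at i))) (col-split f)
        a = ≤-trans (∑-mono {f} u (λ o l → let l′ = ℕ.<-≤-trans l u≤p in Point.in-R₁ (pos o) (pos<′ o) (subst (ℕ._< u) (sym (col-pos o l′)) l)))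
              (≤-reflexive (∑-+ {λ o → ⟨ G₁? (pos o) ⟩} {λ o → ⟨ T₁? (pos o) ⟩} u))
        b = ≤-trans (∑-mono {λ o → f (u ℕ.+ o)} {λ _ → 0ℤ} e (λ o l → let c = col-pos (u ℕ.+ o) (ℕ.<-≤-trans (ℕ.+-monoʳ-< u l) (ℕ.≤-trans (ℕ.m≤m+n v u) (ℕ.m≤m+n s m))) in
              Point.in-R₂ (pos (u ℕ.+ o)) (pos<′ (u ℕ.+ o)) (subst (u ℕ.≤_) (sym c) (ℕ.m≤m+n u o)) (subst (ℕ._< v) (sym c) (ℕ.+-monoʳ-< u l)))) (≤-reflexive (∑-zero e (λ _ _ → refl)))
        c = ≤-trans (∑-mono {λ o → f (v ℕ.+ o)} u (λ o l → let c = col-pos (v ℕ.+ o) (v+<p l) in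
              Point.in-R₃ (pos (v ℕ.+ o)) (pos<′ (v ℕ.+ o)) (subst (v ℕ.≤_) (sym c) (ℕ.m≤m+n v o)) (subst (ℕ._< s) (sym c) (ℕ.+-monoʳ-< v l))))
              (≤-reflexive (trans (∑-+ {λ o → ⟨ G₃? (pos (v ℕ.+ o)) ⟩ + ⟨ H? (pos (v ℕ.+ o)) ⟩} {λ _ → - 1ℤ} u) (cong₂ _+_ (∑-+ {λ o → ⟨ G₃? (pos (v ℕ.+ o)) ⟩} {λ o → ⟨ H? (pos (v ℕ.+ o)) ⟩} u) (∑-const (- 1ℤ) u))))
        d = ∑-mono {λ o → f (s ℕ.+ o)} m (λ o l → Point.in-R₄ (pos (s ℕ.+ o)) (pos<′ (s ℕ.+ o)) (subst (s ℕ.≤_) (sym (col-pos (s ℕ.+ o) (s+<p l))) (ℕ.m≤m+n s o)))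
      in (lin≤ (Σg ∷ + u ∷ τ ∷ g₁ ∷ t₁ ∷ g₃ ∷ h₃ ∷ ∑ u f ∷ ∑ e (λ o → f (u ℕ.+ o)) ∷ ∑ u (λ o → f (v ℕ.+ o)) ∷ ∑ m (λ o → f (s ℕ.+ o)) ∷ []) (#0 :+ #1) (#2 :+ #3 :+ #4 :+ #5 :+ #6) (#0 == #7 :+ #8 :+ #9 :+ #10 by sp ∷ #7 <= #3 :+ #4 by a ∷ #8 <= $0 by b ∷ #9 <= #5 :+ #6 :+ #1 :* :- $1 by c ∷ #10 <= #2 by d ∷ []) [] [] refl)
      where
      pos<′ : ∀ x → pos x ℕ.< p
      pos<′ x = n%ℕd<d (+ x * M - n₀) p

    bound₁ : Σg ≤ + m + + u
    bound₁ = (lin≤ (Σg ∷ + m ∷ + u ∷ τ ∷ g₁ ∷ t₁ ∷ g₃ ∷ h₃ ∷ []) #0 (#1 :+ #2) (#0 :+ #2 <= #3 :+ #4 :+ #5 :+ #6 :+ #7 by total ∷ #3 <= #1 by τ≤m ∷ #4 :+ #5 <= #2 by g₁+t₁≤u ∷ #6 :+ #7 <= #2 by g₃+h₃≤u ∷ []) [] [] refl)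
    bound₂ : Σg ≤ + s + + u
    bound₂ = (lin≤ (Σg ∷ + s ∷ + u ∷ τ ∷ g₁ ∷ t₁ ∷ g₃ ∷ h₃ ∷ []) #0 (#1 :+ #2) (#0 :+ #2 <= #3 :+ #4 :+ #5 :+ #6 :+ #7 by total ∷ #3 <= #1 by τ≤s ∷ #4 :+ #5 <= #2 by g₁+t₁≤u ∷ #6 :+ #7 <= #2 by g₃+h₃≤u ∷ []) [] [] refl)
    private
      -- The shift costs at most `R`, and `3 R + 1 ≤ Q R` is where the larger primes must be at
      -- least 4.
      third : ∀ x {Q R t} → + 2 ≤ R → + 4 ≤ Q → - R ≤ t → + 3 * (x - t) + 1ℤ ≤ + 3 * x + Q * R
      third x {Q} {R} {t} h k l = (lin≤ (x ∷ t ∷ Q ∷ R ∷ []) ($3 :* (#0 :- #1) :+ $1) ($3 :* #0 :+ #2 :* #3) ($4 <= #2 by k ∷ :- #3 <= #1 by l ∷ $2 <= #3 by h ∷ []) (1 ∷ 2 ∷ 3 ∷ []) ((3 , 1) ∷ []) refl)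
    bound₃ : (∃ λ h → + p ≡ 1ℤ + + 2 * + h) → + 4 ≤ + q → + 4 ≤ + r → + 3 * Σg ≤ + 2 * + p
    bound₃ odd q≥4 r≥4 = case + 3 * Σg ℤ.≤? + 2 * + p of λ where
      (yes h) → h
      (no h) → ⊥-elim (no-chain (record { datum = D ; 3V≤ = third (+ ey * M) r≥2 q≥4 r̃≥ ; 3U≤ = ≤-trans (third (+ ez * M) q≥2 r≥4 q̃≥) (≤-reflexive (cong (λ z → + 3 * (+ ez * M) + z) (ℤ.*-comm (+ r) (+ q))))
        ; odd = odd ; A = Σg ; large = ≤-trans (≤-reflexive (ℤ.+-comm (+ 2 * + p) 1ℤ)) (≰⇒1+≤ h) ; good = total }))

-- Access to the private functions of the definitions.

module Link where
  open import Data.Nat.Divisibility using (_∣?_)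
  open import Data.List using (List; []; _∷_; _++_; reverse; length)

  -- The private functions of the definitions are recovered by unification: once all their arguments are
  -- variables, the metavariables below have a unique solution.
  mutual
    divGo′ : List ℤ → ℕ → List ℤ → List ℤ → List ℤ
    divGo′ = _

    link : ∀ A D d ds y ys → reverse D ≡ d ∷ ds → reverse A ≡ y ∷ ys → ∀ n → length A ∸ length D ≡ n → ∀ qs → (y - dot ds []) ∷ [] ≡ qs → divMonic A D ≡ divGo′ ds n ys qs
    link A D d ds y ys e₁ e₂ n e₃ qs e₄ with reverse D | reverse A | length A ∸ length D
    link A D d ds y ys refl refl n refl qs e₄ | _ | _ | _ rewrite e₄ = refl

  mutual
    lastOr′ : Poly → List Poly → Poly
    lastOr′ = _
    Φ-link : ∀ n d → 1ℤ ∷ [] ≡ d → Φ n ≡ lastOr′ d (phis n)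
    Φ-link n d e with phis n
    ... | ps rewrite e = refl

  mutual
    prodDiv′ : ℕ → ℕ → List Poly → Poly
    prodDiv′ = _
    phis-link : ∀ n m d → suc n ≡ m → 1 ≡ d → (rev : List ℤ → List ℤ) → reverse ≡ rev → phis (suc n) ≡ phis n ++ (divMonic (xn-1 (suc n)) (prodDiv′ m d (phis n)) ∷ [])
    phis-link n m d e e′ rev h with phis n | suc n
    phis-link n m d refl e′ rev h | ps | _ rewrite e′ | h = refl

  prodDiv-∷ : ∀ m d φ ps → prodDiv′ m d (φ ∷ ps) ≡ (if ⌊ d ∣? m ⌋ then mulP φ (prodDiv′ m (suc d) ps) else prodDiv′ m (suc d) ps)
  prodDiv-∷ _ _ _ _ = refl

  Φ-suc : ∀ n → Φ (suc n) ≡ divMonic (xn-1 (suc n)) (prodDiv′ (suc n) 1 (phis n))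
  Φ-suc n = last (1ℤ ∷ []) (phis n)
    where
    last : ∀ d ps {φ} → lastOr′ d (ps ++ φ ∷ []) ≡ φ
    last d [] = refl
    last d (x ∷ ps) = last x ps

-- Polynomials as operators on sequences, and long division.

module Poly where
  open import Data.List using (_++_; reverse; length; replicate)
  import Data.List.Properties as List
  open Lin
  open Sums
  open Link

  -- R A f is the sequence f multiplied by A(x⁻¹): division from the top makes this the convenient direction.
  R : Poly → (ℤ → ℤ) → ℤ → ℤ
  R [] f n = 0ℤ
  R (c ∷ A) f n = c * f n + R A f (n + 1ℤ)

  private
    variable
      f g : ℤ → ℤ

  R-cong : ∀ A → (∀ n → f n ≡ g n) → ∀ n → R A f n ≡ R A g n
  R-cong [] h n = refl
  R-cong (c ∷ A) h n = cong₂ (λ x y → c * x + y) (h n) (R-cong A h (n + 1ℤ))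

  R-add : ∀ A B n → R (addP A B) f n ≡ R A f n + R B f n
  R-add [] B n = sym (ℤ.+-identityˡ _)
  R-add (c ∷ A) [] n = sym (ℤ.+-identityʳ _)
  R-add {f} (c ∷ A) (d ∷ B) n = let h = R-add {f} A B (n + 1ℤ) in
    (lin≡ (c ∷ d ∷ f n ∷ R (addP A B) f (n + 1ℤ) ∷ R A f (n + 1ℤ) ∷ R B f (n + 1ℤ) ∷ []) ((#0 :+ #1) :* #2 :+ #3) (#0 :* #2 :+ #4 :+ (#1 :* #2 :+ #5)) (#3 == #4 :+ #5 by h ∷ []) [] refl)

  R-scale : ∀ c A n → R (scaleP c A) f n ≡ c * R A f n
  R-scale c [] n = sym (ℤ.*-zeroʳ c)
  R-scale {f} c (d ∷ A) n = let h = R-scale {f} c A (n + 1ℤ) in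
    (lin≡ (c ∷ d ∷ f n ∷ R (scaleP c A) f (n + 1ℤ) ∷ R A f (n + 1ℤ) ∷ []) (#0 :* #1 :* #2 :+ #3) (#0 :* (#1 :* #2 :+ #4)) (#3 == #0 :* #4 by h ∷ []) [] refl)

  R-mul : ∀ A B n → R (mulP A B) f n ≡ R A (R B f) n
  R-mul [] B n = refl
  R-mul {f} (c ∷ A) B n = let a = R-add {f} (scaleP c B) (0ℤ ∷ mulP A B) n ; b = R-scale {f} c B n ; h = R-mul {f} A B (n + 1ℤ) in
    (lin≡ (R (mulP (c ∷ A) B) f n ∷ c ∷ R B f n ∷ R A (R B f) (n + 1ℤ) ∷ R (scaleP c B) f n ∷ f n ∷ R (mulP A B) f (n + 1ℤ) ∷ []) #0 (#1 :* #2 :+ #3) (#0 == #4 :+ ($0 :* #5 :+ #6) by a ∷ #4 == #1 :* #2 by b ∷ #6 == #3 by h ∷ []) [] refl)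

  R-linear : ∀ A c n → R A (λ n → c * f n + g n) n ≡ c * R A f n + R A g n
  R-linear [] c n = sym (trans (ℤ.+-identityʳ _) (ℤ.*-zeroʳ c))
  R-linear {f} {g} (d ∷ A) c n = let h = R-linear {f} {g} A c (n + 1ℤ) in
    (lin≡ (d ∷ c ∷ f n ∷ g n ∷ R A (λ n → c * f n + g n) (n + 1ℤ) ∷ R A f (n + 1ℤ) ∷ R A g (n + 1ℤ) ∷ []) (#0 :* (#1 :* #2 :+ #3) :+ #4) (#1 :* (#0 :* #2 :+ #5) :+ (#0 :* #3 :+ #6)) (#4 == #1 :* #5 :+ #6 by h ∷ []) [] refl)

  R-shift : ∀ A k n → R A (λ n → f (n + k)) n ≡ R A f (n + k)
  R-shift [] k n = refl
  R-shift {f} (c ∷ A) k n = cong (λ z → c * f (n + k) + z) (trans (R-shift {f} A k (n + 1ℤ)) (cong (R A f) (lin≡ (n ∷ k ∷ []) (#0 :+ $1 :+ #1) (#0 :+ #1 :+ $1) [] [] refl)))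

  R-0 : ∀ A n → R A (λ _ → 0ℤ) n ≡ 0ℤ
  R-0 [] n = refl
  R-0 (c ∷ A) n = trans (cong₂ _+_ (ℤ.*-zeroʳ c) (R-0 A (n + 1ℤ))) refl

  R-comm : ∀ A B n → R A (R B f) n ≡ R B (R A f) n
  R-comm [] B n = sym (R-0 B n)
  R-comm {f} (c ∷ A) B n = sym (trans (R-linear {f} {λ n → R A f (n + 1ℤ)} B c n)
    (cong (λ z → c * R B f n + z) (trans (R-shift {R A f} B 1ℤ n) (sym (R-comm {f} A B (n + 1ℤ))))))

  Ops : List Poly → (ℤ → ℤ) → ℤ → ℤ
  Ops [] f = f
  Ops (A ∷ As) f = R A (Ops As f)

  Ops-cong : ∀ As → (∀ n → f n ≡ g n) → ∀ n → Ops As f n ≡ Ops As g n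
  Ops-cong [] h = h
  Ops-cong (A ∷ As) h = R-cong A (Ops-cong As h)

  Ops-shift : ∀ As k n → Ops As (λ n → f (n + k)) n ≡ Ops As f (n + k)
  Ops-shift [] k n = refl
  Ops-shift {f} (A ∷ As) k n = trans (R-cong A (Ops-shift {f} As k) n) (R-shift {Ops As f} A k n)

  -- perm ks As takes successively the ks-th of the remaining entries.
  pick : ℕ → Poly → List Poly → Poly × List Poly
  pick zero A As = A , As
  pick (suc k) A [] = A , []
  pick (suc k) A (B ∷ As) = let C , Cs = pick k B As in C , A ∷ Cs

  perm : List ℕ → List Poly → List Poly
  perm [] As = As
  perm (k ∷ ks) [] = []
  perm (k ∷ ks) (A ∷ As) = let B , Bs = pick k A As in B ∷ perm ks Bs

  Ops-perm : ∀ ks As n → Ops (perm ks As) f n ≡ Ops As f n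
  Ops-perm {f} ks As = go ks As
    where
    pick-≡ : ∀ k A As n → R (proj₁ (pick k A As)) (Ops (proj₂ (pick k A As)) f) n ≡ R A (Ops As f) n
    pick-≡ zero A As n = refl
    pick-≡ (suc k) A [] n = refl
    pick-≡ (suc k) A (B ∷ As) n = trans (R-comm (proj₁ (pick k B As)) A n) (R-cong A (pick-≡ k B As) n)
    go : ∀ ks As n → Ops (perm ks As) f n ≡ Ops As f n
    go [] As n = refl
    go (k ∷ ks) [] n = refl
    go (k ∷ ks) (A ∷ As) n = trans (R-cong (proj₁ (pick k A As)) (go ks (proj₂ (pick k A As))) n) (pick-≡ k A As n)

  coeff-add : ∀ A B j → coeffList (addP A B) j ≡ coeffList A j + coeffList B j
  coeff-add [] B j = sym (ℤ.+-identityˡ _)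
  coeff-add (c ∷ A) [] j = sym (ℤ.+-identityʳ _)
  coeff-add (c ∷ A) (d ∷ B) zero = refl
  coeff-add (c ∷ A) (d ∷ B) (suc j) = coeff-add A B j

  coeff-scale : ∀ c A j → coeffList (scaleP c A) j ≡ c * coeffList A j
  coeff-scale c [] j = sym (ℤ.*-zeroʳ c)
  coeff-scale c (d ∷ A) zero = refl
  coeff-scale c (d ∷ A) (suc j) = coeff-scale c A j

  R-coeff : ∀ A B → (∀ j → coeffList A j ≡ coeffList B j) → ∀ n → R A f n ≡ R B f n
  R-coeff [] [] h n = refl
  R-coeff [] (d ∷ B) h n = sym (trans (cong₂ (λ x y → x * _ + y) (sym (h 0)) (sym (R-coeff [] B (h ∘ suc) (n + 1ℤ)))) refl)
  R-coeff {f} (c ∷ A) [] h n = trans (cong₂ (λ x y → x * f n + y) (h 0) (R-coeff A [] (h ∘ suc) (n + 1ℤ))) refl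
  R-coeff {f} (c ∷ A) (d ∷ B) h n = cong₂ (λ x y → x * f n + y) (h 0) (R-coeff A B (h ∘ suc) (n + 1ℤ))

  R-vanish : ∀ A {K} → (∀ n → K < n → f n ≡ 0ℤ) → ∀ n → K < n → R A f n ≡ 0ℤ
  R-vanish [] h n l = refl
  R-vanish {f} (c ∷ A) h n l = trans (cong₂ (λ x y → c * x + y) (h n l) (R-vanish {f} A h (n + 1ℤ) (ℤ.<-trans l (ℤ.suc[i]≤j⇒i<j (≤-reflexive (ℤ.+-comm 1ℤ n)))))) (trans (ℤ.+-identityʳ _) (ℤ.*-zeroʳ c))

  -- The coefficients of D Q, where Q has the coefficients g K, g (K - 1), …
  coeff-mul : ∀ D Q K → (∀ n → K < n → f n ≡ 0ℤ) → (∀ j → coeffList Q j ≡ f (K - + j)) → ∀ j → coeffList (mulP D Q) j ≡ R D f (K - + j)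
  coeff-mul [] Q K v h j = refl
  coeff-mul {f} (d ∷ D) Q K v h zero = trans (coeff-add (scaleP d Q) _ 0) (cong₂ _+_ (trans (coeff-scale d Q 0) (cong (d *_) (h 0)))
    (sym (R-vanish {f} D v (K - + 0 + 1ℤ) (ℤ.suc[i]≤j⇒i<j (≤-reflexive (lin≡ (K ∷ []) ($1 :+ #0) (#0 :- $0 :+ $1) [] [] refl))))))
  coeff-mul {f} (d ∷ D) Q K v h (suc j) = trans (coeff-add (scaleP d Q) _ (suc j)) (cong₂ _+_ (trans (coeff-scale d Q (suc j)) (cong (d *_) (h (suc j))))
    (trans (coeff-mul {f} D Q K v h j) (cong (R D f) (lin≡ (K ∷ + j ∷ []) (#0 :- #1) (#0 :- ($1 :+ #1) :+ $1) [] [] refl))))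

  data Monic : Poly → ℕ → Set where
    one : Monic (1ℤ ∷ []) 0
    cons : ∀ {c A L} → Monic A L → Monic (c ∷ A) (suc L)

  monic-length : ∀ {A L} → Monic A L → length A ≡ suc L
  monic-length one = refl
  monic-length (cons h) = cong suc (monic-length h)

  monic-add : ∀ A {B L} → length A ℕ.≤ L → Monic B L → Monic (addP A B) L
  monic-add [] l h = h
  monic-add (c ∷ A) (s≤s l) (cons h) = cons (monic-add A l h)

  length-scale : ∀ c A → length (scaleP c A) ≡ length A
  length-scale c [] = refl
  length-scale c (_ ∷ A) = cong suc (length-scale c A)

  monic-mul : ∀ {A B a b} → Monic A a → Monic B b → Monic (mulP A B) (a ℕ.+ b)
  monic-mul {_} {B} one h = go h
    where
    go : ∀ {B b} → Monic B b → Monic (addP (scaleP 1ℤ B) (0ℤ ∷ [])) b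
    go one = one
    go {_ ∷ _ ∷ _} (cons h) = cons (id-scale h)
      where
      id-scale : ∀ {B b} → Monic B b → Monic (addP (scaleP 1ℤ B) []) b
      id-scale one = one
      id-scale {_ ∷ _ ∷ _} (cons h) = cons (tail h)
        where tail : ∀ {B b} → Monic B b → Monic (scaleP 1ℤ B) b
              tail one = one
              tail (cons h) = cons (tail h)
  monic-mul {c ∷ A} {B} {suc a} {b} (cons h) k = monic-add (scaleP c B) (ℕ.≤-trans (ℕ.≤-reflexive (trans (length-scale c B) (monic-length k))) (s≤s (ℕ.m≤n+m b a))) (cons (monic-mul h k))

  monic-coeff : ∀ {A L} → Monic A L → coeffList A L ≡ 1ℤ × (∀ j → L ℕ.< j → coeffList A j ≡ 0ℤ)
  monic-coeff one = refl , λ { (suc j) _ → refl }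
  monic-coeff (cons h) = proj₁ (monic-coeff h) , λ { (suc j) (s≤s l) → proj₂ (monic-coeff h) j l }

  private
    unit : ℤ → ℤ
    unit n = ⟨ n ℤ.≟ 0ℤ ⟩

  -- Applied to the unit impulse, an operator returns the coefficients of its polynomial; thus equal
  -- operators have equal degrees.
  R-unit : ∀ A j → R A unit (- + j) ≡ coeffList A j
  R-unit [] j = refl
  R-unit (c ∷ A) zero = trans (cong₂ _+_ (ℤ.*-identityʳ c) (R-vanish {unit} A {0ℤ} (λ n l → ⟨⟩-no (n ℤ.≟ 0ℤ) (λ e → ℤ.<⇒≢ l (sym e))) (0ℤ + 1ℤ) (+<+ (s≤s z≤n)))) (ℤ.+-identityʳ c)
  R-unit (c ∷ A) (suc j) = trans (cong₂ _+_ (ℤ.*-zeroʳ c) (trans (cong (R A unit) (step j)) (R-unit A j))) (ℤ.+-identityˡ _)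
    where step : ∀ j → - + suc j + 1ℤ ≡ - + j
          step j = (lin≡ (+ j ∷ []) (:- ($1 :+ #0) :+ $1) (:- #0) [] [] refl)

  same-degree : ∀ {A B a b} → (∀ f n → R A f n ≡ R B f n) → Monic A a → Monic B b → a ≡ b
  same-degree {A} {B} {a} {b} h k l = ℕ.≤-antisym (le h k l) (le (λ f n → sym (h f n)) l k)
    where
    le : ∀ {A B a b} → (∀ f n → R A f n ≡ R B f n) → Monic A a → Monic B b → a ℕ.≤ b
    le {A} {B} {a} h k l = ℕ.≮⇒≥ (λ q → case trans (sym (proj₁ (monic-coeff k))) (trans (sym (R-unit A a)) (trans (h unit (- + a)) (trans (R-unit B a) (proj₂ (monic-coeff l) a q)))) of λ ())

  ∇ : ℕ → (ℤ → ℤ) → ℤ → ℤ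
  ∇ m f n = f (n + + m) - f n

  R-xn-1 : ∀ m n → R (xn-1 (suc m)) f n ≡ ∇ (suc m) f n
  R-xn-1 {f} m n = trans (cong (λ z → -1ℤ * f n + z) (go m (n + 1ℤ))) (trans (cong (λ z → -1ℤ * f n + f z) (lin≡ (n ∷ + m ∷ []) (#0 :+ $1 :+ #1) (#0 :+ ($1 :+ #1)) [] [] refl)) (ex (f n) (f (n + + suc m))))
    where
    ex : ∀ x y → -1ℤ * x + y ≡ y - x
    ex x y = (lin≡ (x ∷ y ∷ []) (:- $1 :* #0 :+ #1) (#1 :- #0) [] [] refl)
    go : ∀ m n → R (replicate m 0ℤ ++ 1ℤ ∷ []) f n ≡ f (n + + m)
    go zero n = trans (ℤ.+-identityʳ _) (trans (ℤ.*-identityˡ _) (cong f (sym (ℤ.+-identityʳ n))))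
    go (suc m) n = trans (ℤ.+-identityˡ _) (trans (go m (n + 1ℤ)) (cong f (lin≡ (n ∷ + m ∷ []) (#0 :+ $1 :+ #1) (#0 :+ ($1 :+ #1)) [] [] refl)))

  coeff-xn-1 : ∀ m j → coeffList (xn-1 (suc m)) j ≡ ⟨ + suc m - + j ℤ.≟ 0ℤ ⟩ - ⟨ + suc m - + j ℤ.≟ + suc m ⟩
  coeff-xn-1 m zero = sym (cong₂ _-_ (⟨⟩-no (+ suc m - + 0 ℤ.≟ 0ℤ) (λ e → case trans (sym (ℤ.+-identityʳ (+ suc m))) e of λ ())) (⟨⟩-yes (+ suc m - + 0 ℤ.≟ + suc m) (ℤ.+-identityʳ _)))
  coeff-xn-1 m (suc j) = trans (go m j) (trans (sym (ℤ.+-identityʳ _)) (cong₂ _-_ (⟨⟩-cong (m ℕ.≟ j) (+ suc m - + suc j ℤ.≟ 0ℤ) (λ { refl → ℤ.+-inverseʳ (+ suc m) }) (λ e → ℕ.suc-injective (ℤ.+-injective (ℤ.i-j≡0⇒i≡j (+ suc m) (+ suc j) e))))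
      (sym (⟨⟩-no (+ suc m - + suc j ℤ.≟ + suc m) (λ e → ne m j e)))))
    where
    go : ∀ m j → coeffList (replicate m 0ℤ ++ 1ℤ ∷ []) j ≡ ⟨ m ℕ.≟ j ⟩
    go zero zero = refl
    go zero (suc j) = refl
    go (suc m) zero = refl
    go (suc m) (suc j) = trans (go m j) (⟨⟩-cong (m ℕ.≟ j) (suc m ℕ.≟ suc j) (cong suc) ℕ.suc-injective)
    ne : ∀ m j → + suc m - + suc j ≡ + suc m → ⊥
    ne m j e = let j≥0 = +≤+ (z≤n {j}) in (lin⊥ (+ m ∷ + j ∷ []) ($1 :+ #0 :- ($1 :+ #1) =~ $1 :+ #0 by e ∷ $0 <= #1 by j≥0 ∷ []) [] [] refl)

  -- The quotient of x^m - 1 by a monic D, produced from the top, is read off any g that satisfies the recursion of the division.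
  module Quotient (D : Poly) (L K m : ℕ) (monic : Monic D (suc L)) (K+L : suc m ≡ K ℕ.+ suc L) (g : ℤ → ℤ) (g<0 : ∀ n → n < 0ℤ → g n ≡ 0ℤ) (g0 : g 0ℤ ≡ 1ℤ)
    (rec : ∀ c → 1 ℕ.≤ c → c ℕ.≤ K → R D g (+ c - + suc L) ≡ 0ℤ) where

    ls : ℕ → Poly
    ls zero = []
    ls (suc c) = g (+ c) ∷ ls c

    private
      -- The operator of the reversed list, read downwards, because the division keeps the
      -- coefficients of `D` highest first.
      R↓ : List ℤ → ℤ → ℤ
      R↓ [] n = 0ℤ
      R↓ (e ∷ es) n = e * g n + R↓ es (n - 1ℤ)
      R-snoc : ∀ A c n → R (A ++ c ∷ []) g n ≡ R A g n + c * g (n + + length A)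
      R-snoc [] c n = trans (ℤ.+-comm (c * g n) 0ℤ) (cong (λ z → 0ℤ + c * g z) (sym (ℤ.+-identityʳ n)))
      R-snoc (d ∷ A) c n = let h = R-snoc A c (n + 1ℤ) ; k = cong g (ex n (length A)) in
        (lin≡ (d ∷ g n ∷ R (A ++ c ∷ []) g (n + 1ℤ) ∷ R A g (n + 1ℤ) ∷ c ∷ g (n + + length (d ∷ A)) ∷ g (n + 1ℤ + + length A) ∷ []) (#0 :* #1 :+ #2) (#0 :* #1 :+ #3 :+ #4 :* #5) (#2 == #3 :+ #4 :* #6 by h ∷ #4 :* #6 == #4 :* #5 by k′ ∷ []) [] refl)
        where
        ex : ∀ n l → n + 1ℤ + + l ≡ n + + suc l
        ex n l = (lin≡ (n ∷ + l ∷ []) (#0 :+ $1 :+ #1) (#0 :+ ($1 :+ #1)) [] [] refl)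
        k′ : c * g (n + 1ℤ + + length A) ≡ c * g (n + + length (d ∷ A))
        k′ = cong (λ z → c * g z) (ex n (length A))
      R-reverse : ∀ es n → R (reverse es) g (n - + length es) ≡ R↓ es (n - 1ℤ)
      R-reverse [] n = refl
      R-reverse (e ∷ es) n = trans (cong (λ A → R A g (n - + suc (length es))) (List.unfold-reverse e es)) (trans (R-snoc (reverse es) e _)
        (trans (ℤ.+-comm (R (reverse es) g (n - + suc (length es))) _) (cong₂ _+_ (cong (λ z → e * g z) (trans (cong (λ z → n - + suc (length es) + + z) (List.length-reverse es)) (ex n (length es))))
          (trans (cong (R (reverse es) g) (ex′ n (length es))) (R-reverse es (n - 1ℤ))))))
        where
        ex : ∀ n l → n - + suc l + + l ≡ n - 1ℤ
        ex n l = (lin≡ (n ∷ + l ∷ []) (#0 :- ($1 :+ #1) :+ #1) (#0 :- $1) [] [] refl)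
        ex′ : ∀ n l → n - + suc l ≡ n - 1ℤ - + l
        ex′ n l = (lin≡ (n ∷ + l ∷ []) (#0 :- ($1 :+ #1)) (#0 :- $1 :- #1) [] [] refl)
      dot-nil : ∀ es → dot es [] ≡ 0ℤ
      dot-nil [] = refl
      dot-nil (_ ∷ _) = refl
      R↓-neg : ∀ es n → n < 0ℤ → R↓ es n ≡ 0ℤ
      R↓-neg [] n l = refl
      R↓-neg (e ∷ es) n l = trans (cong₂ (λ x y → e * x + y) (g<0 n l) (R↓-neg es (n - 1ℤ) (ℤ.<-trans (ℤ.suc[i]≤j⇒i<j (≤-reflexive (lin≡ (n ∷ []) ($1 :+ (#0 :- $1)) #0 [] [] refl))) l))) (trans (ℤ.+-identityʳ _) (ℤ.*-zeroʳ e))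
      dot-ls : ∀ es c → dot es (ls c) ≡ R↓ es (+ c - 1ℤ)
      dot-ls [] c = refl
      dot-ls (e ∷ es) zero = sym (R↓-neg (e ∷ es) (- 1ℤ) ℤ.-<+)
      dot-ls (e ∷ es) (suc c) = cong₂ _+_ (cong (λ z → e * g z) (ex c)) (trans (dot-ls es c) (cong (λ z → R↓ es (z - 1ℤ)) (ex c)))
        where ex : ∀ c → + c ≡ + suc c - 1ℤ
              ex c = (lin≡ (+ c ∷ []) #0 ($1 :+ #0 :- $1) [] [] refl)
      reversed : ∀ {D L} → Monic D L → ∃ λ es → reverse D ≡ 1ℤ ∷ es × length es ≡ L
      reversed one = [] , refl , refl
      reversed {c ∷ A} (cons h) = let es , e , l = reversed h in es ++ c ∷ [] , trans (List.unfold-reverse c A) (cong (_++ c ∷ []) e) , trans (List.length-++ es) (trans (ℕ.+-comm (length es) 1) (cong suc l))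
      es = proj₁ (reversed monic)
      D≡ : reverse (1ℤ ∷ es) ≡ D
      D≡ = trans (cong reverse (sym (proj₁ (proj₂ (reversed monic))))) (List.reverse-involutive D)
      -- At this place the dividend has coefficient 0, so the division emits `- dot es (ls c)`;
      -- `rec` identifies it with the next value of `g`.
      next : ∀ c → 1 ℕ.≤ c → c ℕ.≤ K → 0ℤ - dot es (ls c) ≡ g (+ c)
      next c l l′ = let
          a = trans (sym (R-reverse (1ℤ ∷ es) (+ suc c))) (trans (cong₂ (λ A n → R A g n) D≡ (trans (cong (λ l → + suc c - + suc l) (proj₂ (proj₂ (reversed monic)))) (ex c (suc L)))) (rec c l l′))
          b = dot-ls es c ; z = cong g (ex′ c) ; w = cong (λ z → R↓ es (z - 1ℤ)) (ex′ c)
        in (lin≡ (dot es (ls c) ∷ g (+ c) ∷ g (+ suc c - 1ℤ) ∷ R↓ es (+ suc c - 1ℤ - 1ℤ) ∷ R↓ es (+ c - 1ℤ) ∷ []) ($0 :- #0) #1 ($1 :* #2 :+ #3 =~ $0 by a ∷ #0 =~ #4 by b ∷ #2 == #1 by z ∷ #3 == #4 by w ∷ []) [] refl)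
        where
        ex : ∀ c L → + suc c - + suc L ≡ + c - + L
        ex c L = (lin≡ (+ c ∷ + L ∷ []) ($1 :+ #0 :- ($1 :+ #1)) (#0 :- #1) [] [] refl)
        ex′ : ∀ c → + suc c - 1ℤ ≡ + c
        ex′ c = (lin≡ (+ c ∷ []) ($1 :+ #0 :- $1) #0 [] [] refl)
      loop : ∀ k c j ys → 1 ℕ.≤ c → k ℕ.+ c ℕ.≤ suc K → divGo′ es k (replicate (k ℕ.+ j) 0ℤ ++ ys) (ls c) ≡ ls (k ℕ.+ c)
      loop zero c j ys l l′ = refl
      loop (suc k) c j ys l l′ = trans (cong (λ z → divGo′ es k (replicate (k ℕ.+ j) 0ℤ ++ ys) (z ∷ ls c)) (next c l (ℕ.≤-trans (ℕ.m≤n+m c k) (ℕ.s≤s⁻¹ l′))))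
        (trans (loop k (suc c) j ys (s≤s z≤n) (subst (ℕ._≤ suc K) (sym (ℕ.+-suc k c)) l′)) (cong ls (ℕ.+-suc k c)))
      rep-snoc : ∀ n → replicate n 0ℤ ++ 0ℤ ∷ [] ≡ 0ℤ ∷ replicate n 0ℤ
      rep-snoc zero = refl
      rep-snoc (suc n) = cong (0ℤ ∷_) (rep-snoc n)
      rev-rep : ∀ n → reverse (replicate n 0ℤ) ≡ replicate n 0ℤ
      rev-rep zero = refl
      rev-rep (suc n) = trans (List.unfold-reverse 0ℤ (replicate n 0ℤ)) (trans (cong (_++ 0ℤ ∷ []) (rev-rep n)) (rep-snoc n))
      rev-xn : reverse (xn-1 (suc m)) ≡ 1ℤ ∷ (replicate m 0ℤ ++ -1ℤ ∷ [])
      rev-xn = trans (List.unfold-reverse -1ℤ (replicate m 0ℤ ++ 1ℤ ∷ [])) (cong (_++ -1ℤ ∷ []) (trans (List.reverse-++ (replicate m 0ℤ) (1ℤ ∷ [])) (cong (1ℤ ∷_) (rev-rep m))))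
      len : length (xn-1 (suc m)) ∸ length D ≡ K
      len = trans (cong₂ _∸_ (cong suc (trans (List.length-++ (replicate m 0ℤ)) (trans (cong (ℕ._+ 1) (List.length-replicate m)) (ℕ.+-comm m 1)))) (monic-length monic))
        (trans (cong (_∸ suc L) K+L) (ℕ.m+n∸n≡m K (suc L)))
      m≡ : m ≡ K ℕ.+ L
      m≡ = ℕ.suc-injective (trans K+L (ℕ.+-suc K L))

    quotient : divMonic (xn-1 (suc m)) D ≡ ls (suc K)
    quotient = trans (link (xn-1 (suc m)) D 1ℤ es 1ℤ (replicate m 0ℤ ++ -1ℤ ∷ []) (proj₁ (proj₂ (reversed monic))) rev-xn K len (ls 1) first)
      (trans (cong (λ z → divGo′ es K (replicate z 0ℤ ++ -1ℤ ∷ []) (ls 1)) m≡) (trans (loop K 1 L _ (s≤s z≤n) (ℕ.≤-reflexive (ℕ.+-comm K 1))) (cong ls (ℕ.+-comm K 1))))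
      where first : (1ℤ - dot es []) ∷ [] ≡ g 0ℤ ∷ []
            first = cong (_∷ []) (trans (cong (λ z → 1ℤ - z) (dot-nil es)) (sym g0))

    coeff-quotient : ∀ j → coeffList (divMonic (xn-1 (suc m)) D) j ≡ g (+ K - + j)
    coeff-quotient j = trans (cong (λ A → coeffList A j) quotient) (trans (go (suc K) j) (cong g (lin≡ (+ K ∷ + j ∷ []) ($1 :+ #0 :- $1 :- #1) (#0 :- #1) [] [] refl)))
      where
      go : ∀ c j → coeffList (ls c) j ≡ g (+ c - 1ℤ - + j)
      go zero j = sym (g<0 _ (ℤ.suc[i]≤j⇒i<j (let j≥0 = +≤+ (z≤n {j}) in (lin≤ (+ j ∷ []) ($1 :+ ($0 :- $1 :- #0)) $0 ($0 <= #0 by j≥0 ∷ []) [] [] refl))))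
      go (suc c) zero = cong g (lin≡ (+ c ∷ []) #0 ($1 :+ #0 :- $1 :- $0) [] [] refl)
      go (suc c) (suc j) = trans (go c j) (cong g (lin≡ (+ c ∷ + j ∷ []) (#0 :- $1 :- #1) ($1 :+ #0 :- $1 :- ($1 :+ #1)) [] [] refl))

    monic-quotient : Monic (divMonic (xn-1 (suc m)) D) K
    monic-quotient = subst (λ A → Monic A K) (sym quotient) (go K)
      where go : ∀ c → Monic (ls (suc c)) c
            go zero = subst (λ z → Monic (z ∷ []) 0) (sym g0) one
            go (suc c) = cons (go c)

    -- `rec` concerns only the coefficients that the division emits. That `g` vanishes above `K` and
    -- satisfies the equation everywhere means that the remainder is 0.
    exact : (∀ n → + K < n → g n ≡ 0ℤ) → (∀ n → R D g n ≡ ⟨ n + + suc L ℤ.≟ 0ℤ ⟩ - ⟨ n + + suc L ℤ.≟ + suc m ⟩) → ∀ f n → R D (R (divMonic (xn-1 (suc m)) D) f) n ≡ ∇ (suc m) f n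
    exact v h f n = trans (sym (R-mul {f} D Q n)) (trans (R-coeff (mulP D Q) (xn-1 (suc m)) (λ j →
        trans (coeff-mul {g} D Q (+ K) v coeff-quotient j) (trans (h (+ K - + j)) (trans (cong (λ z → ⟨ z ℤ.≟ 0ℤ ⟩ - ⟨ z ℤ.≟ + suc m ⟩) (at j)) (sym (coeff-xn-1 m j))))) n) (R-xn-1 {f} m n))
      where
      Q = divMonic (xn-1 (suc m)) D
      at : ∀ j → + K - + j + + suc L ≡ + suc m - + j
      at j = let e = cong +_ K+L in (lin≡ (+ K ∷ + j ∷ + L ∷ + m ∷ []) (#0 :- #1 :+ ($1 :+ #2)) ($1 :+ #3 :- #1) ($1 :+ #3 =~ #0 :+ ($1 :+ #2) by e ∷ []) [] refl)

-- Products over proper divisors, and the case of a prime.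

module Cyclo where
  open import Data.Bool using (not)
  open import Data.List using (_++_; map; foldr)
  open import Data.List.Membership.Propositional using (_∈_)
  open import Data.List.Relation.Unary.Any using (here; there)
  open import Data.List.Relation.Unary.All using (All; []; _∷_)
  open import Data.List.Relation.Unary.AllPairs using ([]; _∷_)
  open import Data.List.Relation.Unary.Unique.Propositional using (Unique)
  open import Data.Nat.Divisibility as Div using (_∣?_; divides) renaming (_∣_ to _∣ⁿ_)
  open import Data.Nat.Primality using (Prime; prime⇒irreducible; prime⇒nonTrivial; prime⇒nonZero)
  open import Data.Nat.Coprimality using (coprime-divisor)
  open Lin
  open Sums
  open Link
  open Poly

  private
    variable
      f g : ℤ → ℤ

  Φs : ℕ → ℕ → List Poly
  Φs d zero = []
  Φs d (suc k) = Φ d ∷ Φs (suc d) k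

  phis≡ : ∀ n → phis n ≡ Φs 1 n
  phis≡ zero = refl
  phis≡ (suc n) = trans (cong₂ (λ ps φ → ps ++ φ ∷ []) (phis≡ n) (sym (Φ-suc n))) (snoc 1 n)
    where
    snoc : ∀ d k → Φs d k ++ Φ (d ℕ.+ k) ∷ [] ≡ Φs d (suc k)
    snoc d zero = cong (λ z → Φ z ∷ []) (ℕ.+-identityʳ d)
    snoc d (suc k) = cong (Φ d ∷_) (trans (cong (λ z → Φs (suc d) k ++ Φ z ∷ []) (ℕ.+-suc d k)) (snoc (suc d) k))

  -- The operator of the product of all `Φ x` with `P x` and `d ≤ x < d + k`, built with the same
  -- recursion as the product in the definition of `phis`.
  Comp : (ℕ → Bool) → ℕ → ℕ → (ℤ → ℤ) → ℤ → ℤ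
  Comp P d zero f = f
  Comp P d (suc k) f = if P d then R (Φ d) (Comp P (suc d) k f) else Comp P (suc d) k f

  _−_ : (ℕ → Bool) → ℕ → ℕ → Bool
  (P − x) y = P y ∧ not ⌊ y ℕ.≟ x ⌋

  −-≢ : ∀ P {x y} → y ≢ x → (P − x) y ≡ P y
  −-≢ P {x} {y} h with P y | y ℕ.≟ x
  ... | _ | yes e = ⊥-elim (h e)
  ... | true | no _ = refl
  ... | false | no _ = refl

  −-≡ : ∀ P x → (P − x) x ≡ false
  −-≡ P x with P x | x ℕ.≟ x
  ... | _ | no h = ⊥-elim (h refl)
  ... | true | yes _ = refl
  ... | false | yes _ = refl

  −-true : ∀ P {x y} → (P − x) y ≡ true → P y ≡ true × y ≢ x
  −-true P {x} {y} h with P y | y ℕ.≟ x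
  −-true P refl | true | no n = refl , n
  −-true P () | true | yes _
  −-true P () | false | _

  Comp-ext : ∀ P Q d k → (∀ x → d ℕ.≤ x → x ℕ.< d ℕ.+ k → P x ≡ Q x) → ∀ n → Comp P d k f n ≡ Comp Q d k f n
  Comp-ext P Q d zero h n = refl
  Comp-ext {f} P Q d (suc k) h n with P d | Q d | h d ℕ.≤-refl (ℕ.m<m+n d (s≤s z≤n)) | Comp-ext {f} P Q (suc d) k (λ x l l′ → h x (ℕ.<⇒≤ l) (subst (x ℕ.<_) (sym (ℕ.+-suc d k)) l′))
  ... | true | true | refl | ih = R-cong (Φ d) ih n
  ... | false | false | refl | ih = ih n

  -- Operators commute, so any factor can be moved to the front.
  extract : ∀ P d k x → d ℕ.≤ x → x ℕ.< d ℕ.+ k → P x ≡ true → ∀ n → Comp P d k f n ≡ R (Φ x) (Comp (P − x) d k f) n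
  extract P d zero x l l′ h n = ⊥-elim (ℕ.<⇒≱ l′ (ℕ.≤-trans (ℕ.≤-reflexive (ℕ.+-identityʳ d)) l))
  extract {f} P d (suc k) x l l′ h n = go (d ℕ.≟ x)
    where
    step : ∀ b → (∀ n → Comp P (suc d) k f n ≡ R (Φ x) (Comp (P − x) (suc d) k f) n) → ∀ n →
      (if b then R (Φ d) (Comp P (suc d) k f) else Comp P (suc d) k f) n ≡ R (Φ x) (if b then R (Φ d) (Comp (P − x) (suc d) k f) else Comp (P − x) (suc d) k f) n
    step true ih n = trans (R-cong (Φ d) ih n) (R-comm (Φ d) (Φ x) n)
    step false ih n = ih n
    go : Dec (d ≡ x) → Comp P d (suc k) f n ≡ R (Φ x) (Comp (P − x) d (suc k) f) n
    go (yes refl) = trans (cong (λ b → (if b then R (Φ d) (Comp P (suc d) k f) else Comp P (suc d) k f) n) h)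
      (R-cong (Φ d) (λ n → sym (trans (cong (λ b → (if b then R (Φ d) (Comp (P − d) (suc d) k f) else Comp (P − d) (suc d) k f) n) (−-≡ P d))
        (Comp-ext {f} (P − d) P (suc d) k (λ y ly _ → −-≢ P (λ e → ℕ.<⇒≢ ly (sym e))) n))) n)
    go (no ne) = trans (step (P d) (extract {f} P (suc d) k x (ℕ.≤∧≢⇒< l ne) (subst (x ℕ.<_) (ℕ.+-suc d k) l′) h) n)
      (R-cong (Φ x) (λ n → cong (λ b → (if b then R (Φ d) (Comp (P − x) (suc d) k f) else Comp (P − x) (suc d) k f) n) (sym (−-≢ P ne))) n)

  covers : ∀ ds P N → (∀ x → 1 ℕ.≤ x → x ℕ.≤ N → P x ≡ true → x ∈ ds) → All (λ x → 1 ℕ.≤ x × x ℕ.≤ N × P x ≡ true) ds → Unique ds →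
    ∀ n → Comp P 1 N f n ≡ Ops (map Φ ds) f n
  covers {f} [] P N c _ _ n = none 1 N (λ x l l′ h → case c x l (ℕ.s≤s⁻¹ l′) h of λ ()) n
    where
    none : ∀ d k → (∀ x → d ℕ.≤ x → x ℕ.< d ℕ.+ k → P x ≡ true → ⊥) → ∀ n → Comp P d k f n ≡ f n
    none d zero h n = refl
    none d (suc k) h n with P d in eq
    ... | true = ⊥-elim (h d ℕ.≤-refl (ℕ.m<m+n d (s≤s z≤n)) eq)
    ... | false = none (suc d) k (λ x l l′ → h x (ℕ.<⇒≤ l) (subst (x ℕ.<_) (sym (ℕ.+-suc d k)) l′)) n
  covers {f} (x ∷ ds) P N c ((l , l′ , h) ∷ a) (u ∷ us) n = trans (extract {f} P 1 N x l (s≤s l′) h n)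
    (R-cong (Φ x) (covers {f} ds (P − x) N (λ y m m′ k → let k′ , ne = −-true P k in drop (c y m m′ k′) ne) (keep a u) us) n)
    where
    drop : ∀ {y} → y ∈ x ∷ ds → y ≢ x → y ∈ ds
    drop (here e) ne = ⊥-elim (ne e)
    drop (there q) _ = q
    keep : ∀ {ds} → All (λ x → 1 ℕ.≤ x × x ℕ.≤ N × P x ≡ true) ds → All (x ≢_) ds → All (λ y → 1 ℕ.≤ y × y ℕ.≤ N × (P − x) y ≡ true) ds
    keep [] [] = []
    keep ((l , l′ , h) ∷ a) (ne ∷ u) = (l , l′ , trans (−-≢ P (λ e → ne (sym e))) h) ∷ keep a u

  Degree : ℕ → Set
  Degree x = ∃ (Monic (Φ x))

  degrees : ∀ {ds} → All Degree ds → ℕ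
  degrees [] = 0
  degrees ((L , _) ∷ a) = L ℕ.+ degrees a

  module ProperDivisors (n : ℕ) (ds : List ℕ) (complete : ∀ x → 1 ℕ.≤ x → x ℕ.≤ n → x ∣ⁿ suc n → x ∈ ds)
    (sound : All (λ x → 1 ℕ.≤ x × x ℕ.≤ n × x ∣ⁿ suc n) ds) (unique : Unique ds) (deg : All Degree ds) where

    D : Poly
    D = prodDiv′ (suc n) 1 (phis n)

    private
      P : ℕ → Bool
      P d = ⌊ d ∣? suc n ⌋
      P⇒ : ∀ {x} → P x ≡ true → x ∣ⁿ suc n
      P⇒ {x} h with x ∣? suc n
      ... | yes d = d
      P⇐ : ∀ {x} → x ∣ⁿ suc n → P x ≡ true
      P⇐ {x} h with x ∣? suc n
      ... | yes _ = refl
      ... | no k = ⊥-elim (k h)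
      mark : ∀ {ds} → All (λ x → 1 ℕ.≤ x × x ℕ.≤ n × x ∣ⁿ suc n) ds → All (λ x → 1 ℕ.≤ x × x ℕ.≤ n × P x ≡ true) ds
      mark [] = []
      mark ((a , b , c) ∷ h) = (a , b , P⇐ c) ∷ mark h
      R-prod : ∀ d k m → R (prodDiv′ (suc n) d (Φs d k)) f m ≡ Comp P d k f m
      R-prod {f} d zero m = trans (ℤ.+-identityʳ _) (ℤ.*-identityˡ (f m))
      R-prod {f} d (suc k) m = trans (cong (λ A → R A f m) (prodDiv-∷ (suc n) d (Φ d) (Φs (suc d) k))) (step (P d))
        where
        X = prodDiv′ (suc n) (suc d) (Φs (suc d) k)
        step : ∀ b → R (if b then mulP (Φ d) X else X) f m ≡ (if b then R (Φ d) (Comp P (suc d) k f) else Comp P (suc d) k f) m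
        step true = trans (R-mul {f} (Φ d) X m) (R-cong (Φ d) (R-prod {f} (suc d) k) m)
        step false = R-prod {f} (suc d) k m
      lookup : ∀ {ds x} → All Degree ds → x ∈ ds → Degree x
      lookup (h ∷ _) (here refl) = h
      lookup (_ ∷ a) (there q) = lookup a q
      monic-prod : ∀ d k → 1 ℕ.≤ d → d ℕ.+ k ℕ.≤ suc n → ∃ (Monic (prodDiv′ (suc n) d (Φs d k)))
      monic-prod d zero _ _ = 0 , one
      monic-prod d (suc k) l h = subst (λ A → ∃ (Monic A)) (sym (prodDiv-∷ (suc n) d (Φ d) (Φs (suc d) k))) (step (d ∣? suc n) (monic-prod (suc d) k (s≤s z≤n) (subst (ℕ._≤ suc n) (ℕ.+-suc d k) h)))
        where
        X = prodDiv′ (suc n) (suc d) (Φs (suc d) k)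
        step : ∀ q → ∃ (Monic X) → ∃ (Monic (if ⌊ q ⌋ then mulP (Φ d) X else X))
        step (yes q) (L , ih) = let K , φ = lookup deg (complete d l (ℕ.s≤s⁻¹ (ℕ.≤-trans (ℕ.m<m+n d (s≤s z≤n)) h)) q) in K ℕ.+ L , monic-mul φ ih
        step (no _) ih = ih
      E : List ℕ → Poly
      E ds = foldr mulP (1ℤ ∷ []) (map Φ ds)
      R-E : ∀ ds m → R (E ds) f m ≡ Ops (map Φ ds) f m
      R-E {f} [] m = trans (ℤ.+-identityʳ _) (ℤ.*-identityˡ (f m))
      R-E {f} (x ∷ ds) m = trans (R-mul {f} (Φ x) (E ds) m) (R-cong (Φ x) (R-E {f} ds) m)
      monic-E : ∀ {ds} (a : All Degree ds) → Monic (E ds) (degrees a)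
      monic-E [] = one
      monic-E ((_ , h) ∷ a) = monic-mul h (monic-E a)

    R-D : ∀ f m → R D f m ≡ Ops (map Φ ds) f m
    R-D f m = trans (cong (λ ps → R (prodDiv′ (suc n) 1 ps) f m) (phis≡ n)) (trans (R-prod {f} 1 n m)
      (covers {f} ds P n (λ x l l′ h → complete x l l′ (P⇒ h)) (mark sound) unique m))

    -- The recursion only yields some degree; comparing operators with the product over the explicit
    -- list `ds` identifies it.
    monic-D : Monic D (degrees deg)
    monic-D = let L , h = subst (λ ps → ∃ (Monic (prodDiv′ (suc n) 1 ps))) (sym (phis≡ n)) (monic-prod 1 n (s≤s z≤n) ℕ.≤-refl) in
      subst (Monic D) (same-degree (λ f m → trans (R-D f m) (sym (R-E {f} ds m))) h (monic-E deg)) h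

  prime-split : ∀ {p d n} → Prime p → d ∣ⁿ p ℕ.* n → (∃ λ d′ → d ≡ p ℕ.* d′ × d′ ∣ⁿ n) ⊎ d ∣ⁿ n
  prime-split {p} {d} {n} pp h with p ∣? d
  ... | yes (divides d′ e) = inj₁ (d′ , trans e (ℕ.*-comm d′ p) , Div.*-cancelˡ-∣ p {{prime⇒nonZero pp}} (subst (_∣ⁿ p ℕ.* n) (trans e (ℕ.*-comm d′ p)) h))
  ... | no np = inj₂ (coprime-divisor {d} {p} (λ (a , b) → [ (λ e → e) , (λ e → ⊥-elim (np (subst (_∣ⁿ d) e a))) ]′ (prime⇒irreducible pp b)) h)

  Φ₁ : ∀ n → R (Φ 1) f n ≡ ∇ 1 f n
  Φ₁ {f} n = R-xn-1 {f} 0 n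

  deg₁ : Degree 1
  deg₁ = 1 , cons one

  step≡ : ∀ c n → ⟨ c ℤ.≤? n ⟩ - ⟨ c ℤ.≤? n - 1ℤ ⟩ ≡ ⟨ n ℤ.≟ c ⟩
  step≡ c n with c ℤ.≤? n | c ℤ.≤? n - 1ℤ | n ℤ.≟ c
  ... | yes _ | yes l | yes refl = ⊥-elim (lin⊥ (c ∷ []) (#0 <= #0 :- $1 by l ∷ []) [] [] refl)
  ... | yes _ | yes _ | no _ = refl
  ... | yes _ | no _ | yes _ = refl
  ... | yes l | no h | no ne = ⊥-elim (ne (≤-antisym (let h = ≰⇒1+≤ h in (lin≤ (n ∷ c ∷ []) #0 #1 ($1 :+ (#0 :- $1) <= #1 by h ∷ []) [] [] refl)) l))
  ... | no h | yes l | _ = ⊥-elim (h (lin≤ (c ∷ n ∷ []) #0 #1 (#0 <= #1 :- $1 by l ∷ []) [] [] refl))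
  ... | no h | no _ | yes refl = ⊥-elim (h ≤-refl)
  ... | no _ | no _ | no _ = refl

  at-least : ∀ c n → n < c → ⟨ c ℤ.≤? n ⟩ ≡ 0ℤ
  at-least c n l = ⟨⟩-no (c ℤ.≤? n) (ℤ.<⇒≱ l)

  positive≢0 : ∀ c → 1 ℕ.≤ c → ⟨ + c ℤ.≟ 0ℤ ⟩ ≡ 0ℤ
  positive≢0 c l = ⟨⟩-no (+ c ℤ.≟ 0ℤ) (λ e → ℕ.<⇒≢ l (sym (ℤ.+-injective e)))

  module PrimeCase (m : ℕ) (prime : Prime (suc m)) where
    private
      p : ℕ
      p = suc m
      1<p : 1 ℕ.< p
      1<p = ℕ.nonTrivial⇒n>1 p {{prime⇒nonTrivial prime}}
      one≤ : 1 ℕ.≤ m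
      one≤ = ℕ.s≤s⁻¹ 1<p
    open ProperDivisors m (1 ∷ []) (λ x _ l h → [ here , (λ e → ⊥-elim (ℕ.<⇒≢ (s≤s l) e)) ]′ (prime⇒irreducible prime h))
      ((ℕ.≤-refl , one≤ , divides (suc m) (sym (ℕ.*-identityʳ (suc m)))) ∷ []) ([] ∷ []) (deg₁ ∷ [])

    -- The coefficients of `1 + x + … + x^(p-1)`, continued by 0.
    γ : ℤ → ℤ
    γ n = ⟨ 0ℤ ℤ.≤? n ⟩ - ⟨ + p ℤ.≤? n ⟩

    γ<0 : ∀ n → n < 0ℤ → γ n ≡ 0ℤ
    γ<0 n l = cong₂ _-_ (at-least 0ℤ n l) (at-least (+ p) n (ℤ.<-≤-trans l (+≤+ z≤n)))
    R-γ : ∀ n → R D γ n ≡ ⟨ n + 1ℤ ℤ.≟ 0ℤ ⟩ - ⟨ n + 1ℤ ℤ.≟ + p ⟩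
    R-γ n = trans (R-D γ n) (trans (Φ₁ {γ} n) (let
        a = step≡ 0ℤ (n + 1ℤ) ; b = step≡ (+ p) (n + 1ℤ) ; e = cong (λ z → ⟨ 0ℤ ℤ.≤? z ⟩) (back n) ; e′ = cong (λ z → ⟨ + p ℤ.≤? z ⟩) (back n) in
      (lin≡ (⟨ 0ℤ ℤ.≤? n + 1ℤ ⟩ ∷ ⟨ + p ℤ.≤? n + 1ℤ ⟩ ∷ ⟨ 0ℤ ℤ.≤? n ⟩ ∷ ⟨ + p ℤ.≤? n ⟩ ∷ ⟨ n + 1ℤ ℤ.≟ 0ℤ ⟩ ∷ ⟨ n + 1ℤ ℤ.≟ + p ⟩ ∷ ⟨ 0ℤ ℤ.≤? n + 1ℤ - 1ℤ ⟩ ∷ ⟨ + p ℤ.≤? n + 1ℤ - 1ℤ ⟩ ∷ []) (#0 :- #1 :- (#2 :- #3)) (#4 :- #5) (#0 :- #6 == #4 by a ∷ #1 :- #7 =~ #5 by b ∷ #6 == #2 by e ∷ #7 =~ #3 by e′ ∷ []) [] refl)))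
      where back : ∀ n → n + 1ℤ - 1ℤ ≡ n
            back n = (lin≡ (n ∷ []) (#0 :+ $1 :- $1) #0 [] [] refl)

    private
      γ0 : γ 0ℤ ≡ 1ℤ
      γ0 = cong₂ _-_ (⟨⟩-yes (0ℤ ℤ.≤? 0ℤ) ≤-refl) (at-least (+ p) 0ℤ (+<+ (s≤s z≤n)))
      rec : ∀ c → 1 ℕ.≤ c → c ℕ.≤ m → R D γ (+ c - + 1) ≡ 0ℤ
      rec c l l′ = trans (R-γ (+ c - 1ℤ)) (trans (cong (λ z → ⟨ z ℤ.≟ 0ℤ ⟩ - ⟨ z ℤ.≟ + p ⟩) (lin≡ (+ c ∷ []) (#0 :- $1 :+ $1) #0 [] [] refl))
        (cong₂ _-_ (positive≢0 c l) (⟨⟩-no (+ c ℤ.≟ + p) (λ e → ℕ.<⇒≢ (s≤s l′) (ℤ.+-injective e)))))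
    open Quotient D 0 m m monic-D (ℕ.+-comm 1 m) γ γ<0 γ0 rec

    degree : Monic (Φ p) m
    degree = subst (λ A → Monic A m) (sym (Φ-suc m)) monic-quotient
    Φₚ : ∀ f n → R (Φ 1) (R (Φ p) f) n ≡ ∇ p f n
    Φₚ f n = trans (sym (R-D (R (Φ p) f) n)) (trans (cong (λ A → R D (R A f) n) (Φ-suc m))
      (exact (λ n l → trans (cong₂ _-_ (⟨⟩-yes (0ℤ ℤ.≤? n) (≤-trans (+≤+ z≤n) (ℤ.i<j⇒suc[i]≤j l))) (⟨⟩-yes (+ p ℤ.≤? n) (ℤ.i<j⇒suc[i]≤j l))) refl) R-γ f n))

  prime-degree : ∀ {p} → Prime p → Monic (Φ p) (ℕ.pred p)
  prime-degree {suc m} h = PrimeCase.degree m h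

  prime-∇ : ∀ {p} → Prime p → ∀ f n → R (Φ 1) (R (Φ p) f) n ≡ ∇ p f n
  prime-∇ {suc m} h = PrimeCase.Φₚ m h

-- Products of two primes.

module Semi where
  open import Data.List.Membership.Propositional using (_∈_)
  open import Data.List.Relation.Unary.Any using (here; there)
  open import Data.List.Relation.Unary.All using (All; []; _∷_)
  open import Data.List.Relation.Unary.AllPairs using ([]; _∷_)
  open import Data.Nat.Divisibility using (divides) renaming (_∣_ to _∣ⁿ_)
  open import Data.Nat.GCD using (module Bézout)
  open import Data.Nat.Primality using (Prime; prime⇒irreducible; prime⇒nonTrivial)
  open import Data.Nat.Coprimality using (Coprime; coprime-Bézout)
  open import Data.Integer.DivMod using (_%ℕ_; _/ℕ_; a≡a%ℕn+[a/ℕn]*n; n%ℕd<d)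
  open Lin
  open Sums
  open Frame using (mod-unique)
  open Link
  open Poly
  open Cyclo

  private
    variable
      f : ℤ → ℤ

  inverse : ∀ {m n} → Coprime m n → ∃ λ i → ∃ λ κ → i * + m ≡ 1ℤ + κ * + n
  inverse {m} {n} c with coprime-Bézout c
  ... | Bézout.+- x y e = let e = cong +_ e ; a = ℤ.pos-* x m ; b = ℤ.pos-* y n in + x , + y ,
          (lin≡ (+ x ∷ + m ∷ + y ∷ + n ∷ + (y ℕ.* n) ∷ + (x ℕ.* m) ∷ []) (#0 :* #1) ($1 :+ #2 :* #3) ($1 :+ #4 =~ #5 by e ∷ #5 =~ #0 :* #1 by a ∷ #4 == #2 :* #3 by b ∷ []) [] refl)
  ... | Bézout.-+ x y e = let e = cong +_ e ; a = ℤ.pos-* x m ; b = ℤ.pos-* y n in - + x , - + y ,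
          (lin≡ (+ x ∷ + m ∷ + y ∷ + n ∷ + (x ℕ.* m) ∷ + (y ℕ.* n) ∷ []) (:- #0 :* #1) ($1 :+ :- #2 :* #3) ($1 :+ #4 =~ #5 by e ∷ #4 == #0 :* #1 by a ∷ #5 =~ #2 :* #3 by b ∷ []) [] refl)

  primes-coprime : ∀ {p q} → Prime p → Prime q → p ≢ q → Coprime p q
  primes-coprime pp pq ne (a , b) with prime⇒irreducible pp a | prime⇒irreducible pq b
  ... | inj₁ e | _ = e
  ... | inj₂ _ | inj₁ e = e
  ... | inj₂ e | inj₂ e′ = ⊥-elim (ne (trans (sym e) e′))

  prime>1 : ∀ {p} → Prime p → 1 ℕ.< p
  prime>1 {p} h = ℕ.nonTrivial⇒n>1 p {{prime⇒nonTrivial h}}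

  -- Representations n = y p + w q with 0 ≤ y < q; the sequence [w ≥ 0] is (1 - x^{pq}) / ((1 - x^p)(1 - x^q)).
  module Pairs (p q : ℕ) {{q≢0 : ℕ.NonZero q}} (p≥1 : 1 ℕ.≤ p) (ip κ : ℤ) (hp : ip * + p ≡ 1ℤ + κ * + q) where

    y : ℤ → ℕ
    y n = (n * ip) %ℕ q
    w : ℤ → ℤ
    w n = (n * ip) /ℕ q * + p - n * κ

    y< : ∀ n → y n ℕ.< q
    y< n = n%ℕd<d (n * ip) q

    rep : ∀ n → n ≡ + y n * + p + w n * + q
    rep n = go n ip κ (+ p) (+ q) (+ y n) ((n * ip) /ℕ q) hp (a≡a%ℕn+[a/ℕn]*n (n * ip) q)
      where
      go : ∀ n i κ p q y x → i * p ≡ 1ℤ + κ * q → n * i ≡ y + x * q → n ≡ y * p + (x * p - n * κ) * q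
      go n i κ p q y x h k = let h = cong (n *_) h ; k = cong (_* p) k in
        (lin≡ (n ∷ y ∷ p ∷ x ∷ κ ∷ q ∷ i ∷ []) #0 (#1 :* #2 :+ (#3 :* #2 :- #0 :* #4) :* #5) (#0 :* (#6 :* #2) =~ #0 :* ($1 :+ #4 :* #5) by h ∷ #0 :* #6 :* #2 == (#1 :+ #3 :* #5) :* #2 by k ∷ []) [] refl)

    uniq : ∀ n {y′ w′} → y′ ℕ.< q → n ≡ + y′ * + p + w′ * + q → y′ ≡ y n × w′ ≡ w n
    uniq n {y′} {w′} l h = ey , ℤ.*-cancelʳ-≡ w′ (w n) (+ q) {{nz}} (go (+ p) (+ q) (w n) w′ (+ y n) n (rep n) (trans h (cong (λ y → + y * + p + w′ * + q) ey)))
      where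
      nz : ℤ.NonZero (+ q)
      nz = q≢0
      dig : ∀ i κ p q y y′ w w′ n → i * p ≡ 1ℤ + κ * q → n ≡ y * p + w * q → n ≡ y′ * p + w′ * q → y′ ≡ y + (i * (w - w′) - κ * (y′ - y)) * q
      dig i κ p q y y′ w w′ n h a b = let h = cong ((y′ - y) *_) h ; a = cong (i *_) a ; b = cong (i *_) b in
        (lin≡ (y′ ∷ y ∷ i ∷ w ∷ w′ ∷ κ ∷ q ∷ p ∷ n ∷ []) #0 (#1 :+ (#2 :* (#3 :- #4) :- #5 :* (#0 :- #1)) :* #6) ((#0 :- #1) :* (#2 :* #7) =~ (#0 :- #1) :* ($1 :+ #5 :* #6) by h ∷ #2 :* #8 == #2 :* (#1 :* #7 :+ #3 :* #6) by a ∷ #2 :* #8 =~ #2 :* (#0 :* #7 :+ #4 :* #6) by b ∷ []) [] refl)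
      ey : y′ ≡ y n
      ey = mod-unique (ip * (w n - w′) - κ * (+ y′ - + y n)) l (y< n) (dig ip κ (+ p) (+ q) (+ y n) (+ y′) (w n) w′ n hp (rep n) h)
      go : ∀ p q w w′ y n → n ≡ y * p + w * q → n ≡ y * p + w′ * q → w′ * q ≡ w * q
      go p q w w′ y n a b = (lin≡ (w′ ∷ q ∷ w ∷ n ∷ y ∷ p ∷ []) (#0 :* #1) (#2 :* #1) (#3 == #4 :* #5 :+ #2 :* #1 by a ∷ #3 =~ #4 :* #5 :+ #0 :* #1 by b ∷ []) [] refl)

    χ₂ : ℤ → ℤ
    χ₂ n = ⟨ 0ℤ ℤ.≤? w n ⟩

    w-q : ∀ n → w (n - + q) ≡ w n - 1ℤ
    w-q n = sym (proj₂ (uniq (n - + q) (y< n) (go (+ y n) (w n) (+ p) (+ q) n (rep n))))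
      where go : ∀ y w p q n → n ≡ y * p + w * q → n - q ≡ y * p + (w - 1ℤ) * q
            go y w p q n h = (lin≡ (n ∷ q ∷ y ∷ p ∷ w ∷ []) (#0 :- #1) (#2 :* #3 :+ (#4 :- $1) :* #1) (#0 == #2 :* #3 :+ #4 :* #1 by h ∷ []) [] refl)

    drop-q : ∀ n → χ₂ n - χ₂ (n - + q) ≡ ⟨ w n ℤ.≟ 0ℤ ⟩
    drop-q n = trans (cong (λ z → χ₂ n - ⟨ 0ℤ ℤ.≤? z ⟩) (w-q n)) (step≡ 0ℤ (w n))

    -- Subtracting `p` lowers the digit `y` and keeps `w`, except that `y = 0` borrows and turns `w`
    -- into `w - p`. So the two indicators of `w = 0` can differ only for `y = 0`, namely at `n = 0`
    -- and `n = p q`.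
    drop-pq : ∀ n → χ₂ n - χ₂ (n - + q) - (χ₂ (n - + p) - χ₂ (n - + p - + q)) ≡ ⟨ n ℤ.≟ 0ℤ ⟩ - ⟨ n ℤ.≟ + (p ℕ.* q) ⟩
    drop-pq n = trans (cong₂ _-_ (drop-q n) (drop-q (n - + p))) (go (y n) refl)
      where
      go : ∀ k → y n ≡ k → ⟨ w n ℤ.≟ 0ℤ ⟩ - ⟨ w (n - + p) ℤ.≟ 0ℤ ⟩ ≡ ⟨ n ℤ.≟ 0ℤ ⟩ - ⟨ n ℤ.≟ + (p ℕ.* q) ⟩
      go zero e = cong₂ _-_
        (⟨⟩-cong (w n ℤ.≟ 0ℤ) (n ℤ.≟ 0ℤ) (λ z → trans n≡ (cong (_* + q) z)) (λ z → sym (proj₂ (uniq n (ℕ.>-nonZero⁻¹ q) (trans z refl)))))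
        (⟨⟩-cong (w (n - + p) ℤ.≟ 0ℤ) (n ℤ.≟ + (p ℕ.* q))
          (λ z → trans n≡ (trans (cong (_* + q) (ℤ.i-j≡0⇒i≡j (w n) (+ p) (trans (sym w≡) z))) (sym (ℤ.pos-* p q))))
          (λ z → trans w≡ (trans (cong (_- + p) (ℤ.*-cancelʳ-≡ (w n) (+ p) (+ q) {{q≢0}} (trans (sym n≡) (trans z (ℤ.pos-* p q))))) (ℤ.+-inverseʳ (+ p)))))
        where
        n≡ : n ≡ w n * + q
        n≡ = trans (rep n) (trans (cong (λ k → + k * + p + w n * + q) e) (ℤ.+-identityˡ _))
        q-1< : ℕ.pred q ℕ.< q
        q-1< = ℕ.≤-reflexive (ℕ.suc-pred q)
        w≡ : w (n - + p) ≡ w n - + p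
        w≡ = sym (proj₂ (uniq (n - + p) {ℕ.pred q} q-1< (ex n (w n) (+ p) (+ q) (+ ℕ.pred q) n≡ (cong +_ (ℕ.suc-pred q)))))
          where ex : ∀ n w p q q₀ → n ≡ w * q → 1ℤ + q₀ ≡ q → n - p ≡ q₀ * p + (w - p) * q
                ex n w p q q₀ h k = let k = cong (_* p) k in (lin≡ (n ∷ p ∷ q₀ ∷ w ∷ q ∷ []) (#0 :- #1) (#2 :* #1 :+ (#3 :- #1) :* #4) (#0 == #3 :* #4 by h ∷ ($1 :+ #2) :* #1 =~ #4 :* #1 by k ∷ []) [] refl)
      go (suc k) e = trans (cong (λ z → ⟨ w n ℤ.≟ 0ℤ ⟩ - ⟨ z ℤ.≟ 0ℤ ⟩) w≡) (trans (ℤ.+-inverseʳ ⟨ w n ℤ.≟ 0ℤ ⟩) (sym (cong₂ _-_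
          (⟨⟩-no (n ℤ.≟ 0ℤ) (λ z → not0 (proj₁ (uniq n {0} {0ℤ} (ℕ.>-nonZero⁻¹ q) z))))
          (⟨⟩-no (n ℤ.≟ + (p ℕ.* q)) (λ z → not0 (proj₁ (uniq n {0} {+ p} (ℕ.>-nonZero⁻¹ q) (trans z (trans (ℤ.pos-* p q) (sym (ℤ.+-identityˡ _)))))))))))
        where
        not0 : 0 ≡ y n → ⊥
        not0 z = case trans z e of λ ()
        w≡ : w (n - + p) ≡ w n
        w≡ = sym (proj₂ (uniq (n - + p) {k} (ℕ.<-trans (ℕ.n<1+n k) (subst (ℕ._< q) e (y< n))) (ex n (w n) (+ p) (+ q) (+ k) (trans (rep n) (cong (λ k → + k * + p + w n * + q) e)))))
          where ex : ∀ n w p q k → n ≡ (1ℤ + k) * p + w * q → n - p ≡ k * p + w * q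
                ex n w p q k h = (lin≡ (n ∷ p ∷ k ∷ w ∷ q ∷ []) (#0 :- #1) (#2 :* #1 :+ #3 :* #4) (#0 == ($1 :+ #2) :* #1 :+ #3 :* #4 by h ∷ []) [] refl)

    χ₂-neg : ∀ n → n < 0ℤ → χ₂ n ≡ 0ℤ
    χ₂-neg n l = ⟨⟩-no (0ℤ ℤ.≤? w n) (λ h → go (+ y n) (w n) (+ p) (+ q) (rep n) (ℤ.i<j⇒suc[i]≤j l) h (+≤+ z≤n) (+≤+ z≤n) (+≤+ z≤n))
      where go : ∀ y w p q → n ≡ y * p + w * q → 1ℤ + n ≤ 0ℤ → 0ℤ ≤ w → 0ℤ ≤ y → 0ℤ ≤ p → 0ℤ ≤ q → ⊥
            go y w p q h l a b c d = (lin⊥ (y ∷ p ∷ w ∷ q ∷ n ∷ []) ($0 <= #0 by b ∷ $0 <= #1 by c ∷ $0 <= #2 by a ∷ $0 <= #3 by d ∷ #4 =~ #0 :* #1 :+ #2 :* #3 by h ∷ $1 :+ #4 <= $0 by l ∷ []) (0 ∷ 0 ∷ 0 ∷ 0 ∷ []) ((0 , 1) ∷ (2 , 3) ∷ []) refl)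
    -- `p q - p - q` is the Frobenius number of `p` and `q`.
    χ₂-large : ∀ n → + p * + q - + p - + q < n → χ₂ n ≡ 1ℤ
    χ₂-large n l = ⟨⟩-yes (0ℤ ℤ.≤? w n) (case 0ℤ ℤ.≤? w n of λ where
        (yes h) → h
        (no h) → ⊥-elim (go (+ y n) (w n) (+ p) (+ q) (rep n) (ℤ.i<j⇒suc[i]≤j l) (≰⇒1+≤ h) (+≤+ (y< n)) (+≤+ z≤n) (+≤+ z≤n)))
      where go : ∀ y w p q → n ≡ y * p + w * q → 1ℤ + (p * q - p - q) ≤ n → 1ℤ + w ≤ 0ℤ → 1ℤ + y ≤ q → 0ℤ ≤ p → 0ℤ ≤ q → ⊥
            go y w p q h l a b c d = (lin⊥ (y ∷ q ∷ p ∷ w ∷ n ∷ []) ($1 :+ #0 <= #1 by b ∷ $0 <= #2 by c ∷ $1 :+ #3 <= $0 by a ∷ $0 <= #1 by d ∷ #4 == #0 :* #2 :+ #3 :* #1 by h ∷ $1 :+ (#2 :* #1 :- #2 :- #1) <= #4 by l ∷ []) (0 ∷ 0 ∷ 0 ∷ 0 ∷ []) ((0 , 1) ∷ (2 , 3) ∷ []) refl)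
    χ₂-0 : χ₂ 0ℤ ≡ 1ℤ
    χ₂-0 = ⟨⟩-yes (0ℤ ℤ.≤? w 0ℤ) (≤-reflexive (proj₂ (uniq 0ℤ {0} {0ℤ} (ℕ.>-nonZero⁻¹ q) refl)))

  module Semiprime (p₀ q₀ : ℕ) (pp : Prime (suc p₀)) (pq : Prime (suc q₀)) (p≢q : suc p₀ ≢ suc q₀) (m : ℕ) (m≡ : suc m ≡ suc p₀ ℕ.* suc q₀) where
    private
      p q K L : ℕ
      p = suc p₀
      q = suc q₀
      K = p₀ ℕ.* q₀
      L = p₀ ℕ.+ (q₀ ℕ.+ 0)
      1<p = prime>1 pp
      1<q = prime>1 pq
      complete : ∀ x → 1 ℕ.≤ x → x ℕ.≤ m → x ∣ⁿ suc m → x ∈ 1 ∷ p ∷ q ∷ []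
      complete x _ l h with prime-split pp (subst (x ∣ⁿ_) m≡ h)
      ... | inj₂ h′ = [ here , (λ e → there (there (here e))) ]′ (prime⇒irreducible pq h′)
      ... | inj₁ (d , refl , h′) = [ (λ e → there (here (trans (cong (p ℕ.*_) e) (ℕ.*-identityʳ p)))) , (λ e → ⊥-elim (ℕ.<⇒≢ (s≤s l) (trans (cong (p ℕ.*_) e) (sym m≡)))) ]′ (prime⇒irreducible pq h′)
      p<m : p ℕ.< suc m
      p<m = subst (p ℕ.<_) (sym m≡) (ℕ.m<m*n p q 1<q)
      q<m : q ℕ.< suc m
      q<m = subst (q ℕ.<_) (sym (trans m≡ (ℕ.*-comm p q))) (ℕ.m<m*n q p 1<p)
      open ProperDivisors m (1 ∷ p ∷ q ∷ []) complete
        ((ℕ.≤-refl , ℕ.≤-trans (ℕ.<⇒≤ 1<p) (ℕ.s≤s⁻¹ p<m) , divides (suc m) (sym (ℕ.*-identityʳ (suc m)))) ∷ (s≤s z≤n , ℕ.s≤s⁻¹ p<m , divides q (trans m≡ (ℕ.*-comm p q))) ∷ (s≤s z≤n , ℕ.s≤s⁻¹ q<m , divides p m≡) ∷ [])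
        ((ℕ.<⇒≢ 1<p ∷ ℕ.<⇒≢ 1<q ∷ []) ∷ (p≢q ∷ []) ∷ [] ∷ []) (deg₁ ∷ (p₀ , prime-degree pp) ∷ (q₀ , prime-degree pq) ∷ [])
      inv = inverse (primes-coprime pp pq p≢q)
      open Pairs p q (s≤s z≤n) (proj₁ inv) (proj₁ (proj₂ inv)) (proj₂ (proj₂ inv))

      -- The coefficients of `(1 - x)(1 - x^(pq)) / ((1 - x^p)(1 - x^q))`.
      γ : ℤ → ℤ
      γ n = χ₂ n - χ₂ (n - 1ℤ)

      pred< : ∀ n → n - 1ℤ < n
      pred< n = ℤ.suc[i]≤j⇒i<j (≤-reflexive (lin≡ (n ∷ []) ($1 :+ (#0 :- $1)) #0 [] [] refl))

      -- `γ` is `Φ 1` applied to `χ₂`, shifted by one. The second `Φ 1` lets the factors be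
      -- regrouped into `Φ 1 Φ p` and `Φ 1 Φ q`, which are plain differences.
      R-γ : ∀ n → R D γ n ≡ ⟨ n + + suc L ℤ.≟ 0ℤ ⟩ - ⟨ n + + suc L ℤ.≟ + suc m ⟩
      R-γ n = begin
        R D γ n ≡⟨ R-D γ n ⟩
        Ops (Φ 1 ∷ Φ p ∷ Φ q ∷ []) γ n ≡⟨ Ops-cong (Φ 1 ∷ Φ p ∷ Φ q ∷ []) (λ n → trans (cong (λ z → χ₂ z - χ₂ (n - 1ℤ)) (ex₁ n)) (sym (Φ₁ {χ₂} (n - 1ℤ)))) n ⟩
        Ops (Φ 1 ∷ Φ p ∷ Φ q ∷ []) (λ n → R (Φ 1) χ₂ (n + - 1ℤ)) n ≡⟨ Ops-shift {R (Φ 1) χ₂} (Φ 1 ∷ Φ p ∷ Φ q ∷ []) (- 1ℤ) n ⟩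
        Ops (Φ 1 ∷ Φ p ∷ Φ q ∷ Φ 1 ∷ []) χ₂ k ≡⟨ Ops-perm {χ₂} (0 ∷ 0 ∷ 1 ∷ []) (Φ 1 ∷ Φ p ∷ Φ q ∷ Φ 1 ∷ []) k ⟨
        Ops (Φ 1 ∷ Φ p ∷ Φ 1 ∷ Φ q ∷ []) χ₂ k ≡⟨ prime-∇ pp (Ops (Φ 1 ∷ Φ q ∷ []) χ₂) k ⟩
        ∇ p (Ops (Φ 1 ∷ Φ q ∷ []) χ₂) k ≡⟨ cong₂ _-_ (prime-∇ pq χ₂ (k + + p)) (prime-∇ pq χ₂ k) ⟩
        χ₂ N - χ₂ (k + + p) - (χ₂ (k + + q) - χ₂ k) ≡⟨ cong₂ _-_ (cong (λ z → χ₂ N - χ₂ z) (ex₂ k (+ p) (+ q))) (cong₂ (λ x y → χ₂ x - χ₂ y) (ex₃ k (+ p) (+ q)) (ex₄ k (+ p) (+ q))) ⟩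
        χ₂ N - χ₂ (N - + q) - (χ₂ (N - + p) - χ₂ (N - + p - + q)) ≡⟨ drop-pq N ⟩
        ⟨ N ℤ.≟ 0ℤ ⟩ - ⟨ N ℤ.≟ + (p ℕ.* q) ⟩ ≡⟨ cong₂ (λ x y → ⟨ x ℤ.≟ 0ℤ ⟩ - ⟨ x ℤ.≟ + y ⟩) (ex₅ n p₀ q₀) (sym m≡) ⟩
        ⟨ n + + suc L ℤ.≟ 0ℤ ⟩ - ⟨ n + + suc L ℤ.≟ + suc m ⟩ ∎
        where
        open ≡-Reasoning
        k N : ℤ
        k = n + - 1ℤ
        N = k + + p + + q
        ex₁ : ∀ n → n ≡ n - 1ℤ + 1ℤ
        ex₁ n = (lin≡ (n ∷ []) #0 (#0 :- $1 :+ $1) [] [] refl)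
        ex₂ : ∀ k p q → k + p ≡ k + p + q - q
        ex₂ k p q = (lin≡ (k ∷ p ∷ q ∷ []) (#0 :+ #1) (#0 :+ #1 :+ #2 :- #2) [] [] refl)
        ex₃ : ∀ k p q → k + q ≡ k + p + q - p
        ex₃ k p q = (lin≡ (k ∷ q ∷ p ∷ []) (#0 :+ #1) (#0 :+ #2 :+ #1 :- #2) [] [] refl)
        ex₄ : ∀ k p q → k ≡ k + p + q - p - q
        ex₄ k p q = (lin≡ (k ∷ p ∷ q ∷ []) #0 (#0 :+ #1 :+ #2 :- #1 :- #2) [] [] refl)
        ex₅ : ∀ n p₀ q₀ → n + - 1ℤ + + suc p₀ + + suc q₀ ≡ n + + suc (p₀ ℕ.+ (q₀ ℕ.+ 0))
        ex₅ n p₀ q₀ = (lin≡ (n ∷ + p₀ ∷ + q₀ ∷ []) (#0 :+ :- $1 :+ ($1 :+ #1) :+ ($1 :+ #2)) (#0 :+ ($1 :+ (#1 :+ (#2 :+ $0)))) [] [] refl)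

      K+L : suc m ≡ K ℕ.+ suc L
      K+L = trans m≡ (ℤ.+-injective (trans (ℤ.pos-* p q) (sym (let k = ℤ.pos-* p₀ q₀ in
        (lin≡ (+ K ∷ + p₀ ∷ + q₀ ∷ []) (#0 :+ ($1 :+ (#1 :+ (#2 :+ $0)))) (($1 :+ #1) :* ($1 :+ #2)) (#0 == #1 :* #2 by k ∷ []) [] refl)))))

      γ<0 : ∀ n → n < 0ℤ → γ n ≡ 0ℤ
      γ<0 n l = cong₂ _-_ (χ₂-neg n l) (χ₂-neg (n - 1ℤ) (ℤ.<-trans (pred< n) l))
      γ>K : ∀ n → + K < n → γ n ≡ 0ℤ
      γ>K n l = cong₂ _-_ (χ₂-large n (ℤ.<-trans l′ (pred< n))) (χ₂-large (n - 1ℤ) l′)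
        where
        k = ℤ.pos-* p₀ q₀
        pt = ℤ.i<j⇒suc[i]≤j l
        l′ : + p * + q - + p - + q < n - 1ℤ
        l′ = ℤ.suc[i]≤j⇒i<j (lin≤ (+ p₀ ∷ + q₀ ∷ n ∷ + K ∷ []) ($1 :+ (($1 :+ #0) :* ($1 :+ #1) :- ($1 :+ #0) :- ($1 :+ #1))) (#2 :- $1) ($1 :+ #3 <= #2 by pt ∷ #3 =~ #0 :* #1 by k ∷ []) [] [] refl)
      K<m : ∀ c → c ℕ.≤ K → c ≢ suc m
      K<m c l e = ℕ.<⇒≱ (ℕ.≤-<-trans l (ℕ.<-≤-trans (ℕ.m<m+n K (s≤s z≤n)) (ℕ.≤-reflexive (sym K+L)))) (ℕ.≤-reflexive (sym e))
      γ0 : γ 0ℤ ≡ 1ℤ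
      γ0 = cong₂ _-_ χ₂-0 (χ₂-neg (- 1ℤ) ℤ.-<+)
      rec : ∀ c → 1 ℕ.≤ c → c ℕ.≤ K → R D γ (+ c - + suc L) ≡ 0ℤ
      rec c l l′ = trans (R-γ (+ c - + suc L)) (trans (cong (λ z → ⟨ z ℤ.≟ 0ℤ ⟩ - ⟨ z ℤ.≟ + suc m ⟩) (lin≡ (+ c ∷ + L ∷ []) (#0 :- ($1 :+ #1) :+ ($1 :+ #1)) #0 [] [] refl))
        (cong₂ _-_ (positive≢0 c l) (⟨⟩-no (+ c ℤ.≟ + suc m) (λ e → K<m c l′ (ℤ.+-injective e)))))
      module Q = Quotient D L K m monic-D K+L γ γ<0 γ0 rec

    degree : Monic (Φ (p ℕ.* q)) K
    degree = subst (λ n → Monic (Φ n) K) m≡ (subst (λ A → Monic A K) (sym (Φ-suc m)) Q.monic-quotient)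
    Φₚ∇ : ∀ f n → Ops (Φ 1 ∷ Φ p ∷ Φ q ∷ Φ (p ℕ.* q) ∷ []) f n ≡ ∇ (p ℕ.* q) f n
    Φₚ∇ f n = subst (λ k → Ops (Φ 1 ∷ Φ p ∷ Φ q ∷ Φ k ∷ []) f n ≡ ∇ k f n) m≡ (trans (sym (R-D (R (Φ (suc m)) f) n))
      (trans (cong (λ A → R D (R A f) n) (Φ-suc m)) (Q.exact γ>K R-γ f n)))

  semiprime-degree : ∀ {p q} → Prime p → Prime q → p ≢ q → Monic (Φ (p ℕ.* q)) (ℕ.pred p ℕ.* ℕ.pred q)
  semiprime-degree {suc p₀} {suc q₀} a b c = Semiprime.degree p₀ q₀ a b c _ refl

  semiprime-∇ : ∀ {p q} → Prime p → Prime q → p ≢ q → ∀ f n → Ops (Φ 1 ∷ Φ p ∷ Φ q ∷ Φ (p ℕ.* q) ∷ []) f n ≡ ∇ (p ℕ.* q) f n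
  semiprime-∇ {suc p₀} {suc q₀} a b c = Semiprime.Φₚ∇ p₀ q₀ a b c _ refl

-- The indicator sequence of three primes.

module Series where
  open Lin
  open Sums
  open Coord
  open Link
  open Poly
  open Cyclo
  open Semi

  ∑-telescope : ∀ (f : ℕ → ℤ) n → ∑ n (λ i → f (suc i)) - ∑ n f ≡ f n - f 0
  ∑-telescope f zero = sym (ℤ.+-inverseʳ (f 0))
  ∑-telescope f (suc n) = let h = ∑-telescope f n in
    (lin≡ (∑ n (λ i → f (suc i)) ∷ f (suc n) ∷ ∑ n f ∷ f n ∷ f 0 ∷ []) (#0 :+ #1 :- (#2 :+ #3)) (#1 :- #4) (#0 :- #2 == #3 :- #4 by h ∷ []) [] refl)

  -- If one of the increments is 0, the difference in its direction cancels. If all are 1, every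
  -- term but the first vanishes because `f ≥ 0`.
  cube : ∀ {A B C : Set} {f} → 0ℤ ≤ f → (x : Dec A) (y : Dec B) (z : Dec C) →
    ⟨ f ℤ.≟ 0ℤ ⟩ - ⟨ f + ⟨ x ⟩ ℤ.≟ 0ℤ ⟩ - (⟨ f + ⟨ y ⟩ ℤ.≟ 0ℤ ⟩ - ⟨ f + ⟨ x ⟩ + ⟨ y ⟩ ℤ.≟ 0ℤ ⟩)
    - (⟨ f + ⟨ z ⟩ ℤ.≟ 0ℤ ⟩ - ⟨ f + ⟨ x ⟩ + ⟨ z ⟩ ℤ.≟ 0ℤ ⟩ - (⟨ f + ⟨ y ⟩ + ⟨ z ⟩ ℤ.≟ 0ℤ ⟩ - ⟨ f + ⟨ x ⟩ + ⟨ y ⟩ + ⟨ z ⟩ ℤ.≟ 0ℤ ⟩))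
    ≡ ⟨ (f ℤ.≟ 0ℤ) ×-dec (x ×-dec (y ×-dec z)) ⟩
  cube {f = + zero} _ (yes _) (yes _) (yes _) = refl
  cube {f = + zero} _ (yes _) (yes _) (no _) = refl
  cube {f = + zero} _ (yes _) (no _) (yes _) = refl
  cube {f = + zero} _ (yes _) (no _) (no _) = refl
  cube {f = + zero} _ (no _) (yes _) (yes _) = refl
  cube {f = + zero} _ (no _) (yes _) (no _) = refl
  cube {f = + zero} _ (no _) (no _) (yes _) = refl
  cube {f = + zero} _ (no _) (no _) (no _) = refl
  cube {f = + suc _} _ (yes _) (yes _) (yes _) = refl
  cube {f = + suc _} _ (yes _) (yes _) (no _) = refl
  cube {f = + suc _} _ (yes _) (no _) (yes _) = refl
  cube {f = + suc _} _ (yes _) (no _) (no _) = refl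
  cube {f = + suc _} _ (no _) (yes _) (yes _) = refl
  cube {f = + suc _} _ (no _) (yes _) (no _) = refl
  cube {f = + suc _} _ (no _) (no _) (yes _) = refl
  cube {f = + suc _} _ (no _) (no _) (no _) = refl

  module Indicator {p q r : ℕ} (I : Inverses p q r) where
    open Inverses I
    open Coordinates I

    private
      a≥0 : ∀ {x} n → 0ℤ ≤ x → 0ℤ ≤ + n * x
      a≥0 {x} n h = let n≥0 = +≤+ (z≤n {n}) in (lin≤ (+ n ∷ x ∷ []) $0 (#0 :* #1) ($0 <= #0 by n≥0 ∷ $0 <= #1 by h ∷ []) (1 ∷ 0 ∷ 0 ∷ []) ((1 , 2) ∷ []) refl)
      sum≥0 : ∀ k → 0ℤ ≤ k + F k * N
      sum≥0 k = ≤-trans (ℤ.+-mono-≤ (ℤ.+-mono-≤ (a≥0 (ca k) (a≥0 q (+≤+ z≤n))) (a≥0 (cb k) (a≥0 p (+≤+ z≤n)))) (a≥0 (cc k) (a≥0 p (+≤+ z≤n)))) (≤-reflexive (coords k))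

    F≥0 : ∀ k → k < N → 0ℤ ≤ F k
    F≥0 k l = case 0ℤ ℤ.≤? F k of λ where
      (yes h) → h
      (no h) → let h = ≰⇒1+≤ h ; s = sum≥0 k ; l = ℤ.i<j⇒suc[i]≤j l ; o = N≥1 in ⊥-elim (lin⊥ (N ∷ F k ∷ k ∷ []) ($1 <= #0 by o ∷ $1 :+ #1 <= $0 by h ∷ $0 <= #2 :+ #1 :* #0 by s ∷ $1 :+ #2 <= #0 by l ∷ []) (0 ∷ []) ((1 , 0) ∷ []) refl)

    χ-neg : ∀ k → k < 0ℤ → χ k ≡ 0ℤ
    χ-neg k l = ⟨⟩-no (F k ℤ.≟ 0ℤ) (λ e → ℤ.<⇒≱ l (≤-trans (sum≥0 k) (≤-reflexive (trans (cong (λ z → k + z * N) e) (ℤ.+-identityʳ k)))))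

    private
      zero-coords : 0 ≡ ca 0ℤ × 0 ≡ cb 0ℤ × 0 ≡ cc 0ℤ × 0ℤ ≡ F 0ℤ
      zero-coords = unique 0ℤ (ℕ.>-nonZero⁻¹ p) (ℕ.>-nonZero⁻¹ q) (ℕ.>-nonZero⁻¹ r) refl

    χ-0 : χ 0ℤ ≡ 1ℤ
    χ-0 = ⟨⟩-yes (F 0ℤ ℤ.≟ 0ℤ) (sym (proj₂ (proj₂ (proj₂ zero-coords))))

    private
      wrap : ∀ P k → .{{_ : ℕ.NonZero P}} → k ℕ.< P → ⟨ P ℕ.≤? k ℕ.+ ℕ.pred P ⟩ ≡ 1ℤ - ⟨ k ℕ.≟ 0 ⟩
      wrap (suc P) zero l = ⟨⟩-no (suc P ℕ.≤? P) (ℕ.<⇒≱ ℕ.≤-refl)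
      wrap (suc P) (suc k) l = ⟨⟩-yes (suc P ℕ.≤? suc k ℕ.+ P) (s≤s (ℕ.m≤n+m P k))
      nowrap : ∀ P k → k ℕ.< P → ⟨ P ℕ.≤? k ℕ.+ 0 ⟩ ≡ 0ℤ
      nowrap P k l = ⟨⟩-no (P ℕ.≤? k ℕ.+ 0) (λ h → ℕ.<⇒≱ l (subst (P ℕ.≤_) (ℕ.+-identityʳ k) h))
      low : ∀ k → ⟨ k ℕ.<? 1 ⟩ ≡ ⟨ k ℕ.≟ 0 ⟩
      low zero = refl
      low (suc k) = ⟨⟩-no (suc k ℕ.<? 1) (λ { (s≤s ()) })
      none : ∀ k → ⟨ k ℕ.<? 0 ⟩ ≡ 0ℤ
      none k = ⟨⟩-no (k ℕ.<? 0) λ ()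
      shape : ∀ {F g a b c a′ b′ c′} → a ≡ a′ → b ≡ b′ → c ≡ c′ → F + g + a - b - c ≡ F + g + a′ - b′ - c′
      shape refl refl refl = refl
      predN : ∀ n → .{{_ : ℕ.NonZero n}} → + n ≡ 1ℤ + + ℕ.pred n
      predN n = cong +_ (sym (ℕ.suc-pred n))
      qr pr pq : ℤ
      qr = + q * + r
      pr = + p * + r
      pq = + p * + q

    module Turn (k : ℤ) where
      A B C : ℤ
      A = ⟨ ca k ℕ.≟ 0 ⟩
      B = ⟨ cb k ℕ.≟ 0 ⟩
      C = ⟨ cc k ℕ.≟ 0 ⟩
      private
        q₀ r₀ : ℕ
        q₀ = ℕ.pred q
        r₀ = ℕ.pred r
        q₀≤ : q₀ ℕ.≤ q
        q₀≤ = ℕ.pred[n]≤n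
        r₀≤ : r₀ ℕ.≤ r
        r₀≤ = ℕ.pred[n]≤n
        p≥ : 1 ℕ.≤ p
        p≥ = ℕ.>-nonZero⁻¹ p
        a₁ = low (ca k)
        a₀ = none (ca k)
        b₁ = wrap q (cb k) (cb< k)
        b₀ = nowrap q (cb k) (cb< k)
        c₁ = wrap r (cc k) (cc< k)
        c₀ = nowrap r (cc k) (cc< k)
        via : ∀ {x y} {z} (E B C : ℕ) (g : ℤ) → E ℕ.≤ p → B ℕ.≤ q → C ℕ.≤ r → x ≡ + E * M - + B * (+ p * + r) - + C * (+ p * + q) + g * N →
          F k + g + ⟨ ca k ℕ.<? E ⟩ - ⟨ q ℕ.≤? cb k ℕ.+ B ⟩ - ⟨ r ℕ.≤? cc k ℕ.+ C ⟩ ≡ y → k - x ≡ z → F z ≡ y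
        via {x} E B C g a b c h e z = trans (cong F (sym z)) (trans (F-shift k x E B C g a b c h) e)
        bN : ∀ {p q r q₀} → q ≡ 1ℤ + q₀ → q₀ * (p * r) ≡ p * (q * r) - p * r
        bN {p} {q} {r} {q₀} h = let h = cong (λ z → p * (z * r)) h in (lin≡ (q₀ ∷ p ∷ r ∷ q ∷ []) (#0 :* (#1 :* #2)) (#1 :* (#3 :* #2) :- #1 :* #2) (#1 :* (#3 :* #2) =~ #1 :* (($1 :+ #0) :* #2) by h ∷ []) [] refl)
        cN : ∀ {p q r r₀} → r ≡ 1ℤ + r₀ → r₀ * (p * q) ≡ p * (q * r) - p * q
        cN {p} {q} {r} {r₀} h = let h = cong (λ z → p * (q * z)) h in (lin≡ (r₀ ∷ p ∷ q ∷ r ∷ []) (#0 :* (#1 :* #2)) (#1 :* (#2 :* #3) :- #1 :* #2) (#1 :* (#2 :* #3) =~ #1 :* (#2 :* ($1 :+ #0)) by h ∷ []) [] refl)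
        wb : + q₀ * pr ≡ N - pr
        wb = bN {+ p} {+ q} {+ r} {+ q₀} (predN q)
        wc : + r₀ * pq ≡ N - pq
        wc = cN {+ p} {+ q} {+ r} {+ r₀} (predN r)
      F₁ : F (k - qr) ≡ F k + A
      F₁ = via {qr} 1 0 0 0ℤ p≥ z≤n z≤n (lin≡ (qr ∷ pr ∷ pq ∷ N ∷ []) #0 ($1 :* #0 :- $0 :* #1 :- $0 :* #2 :+ $0 :* #3) [] [] refl) (trans (shape {F k} {0ℤ} a₁ b₀ c₀) (ex (F k) A)) refl
        where ex : ∀ f a → f + 0ℤ + a - 0ℤ - 0ℤ ≡ f + a
              ex f a = (lin≡ (f ∷ a ∷ []) (#0 :+ $0 :+ #1 :- $0 :- $0) (#0 :+ #1) [] [] refl)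
      -- Subtracting `pr` is adding `(q - 1) pr` and removing `N`; adding `q - 1` to the second
      -- digit carries unless that digit is 0.
      F₂ : F (k - pr) ≡ F k + B
      F₂ = via {pr} 0 q₀ 0 1ℤ z≤n q₀≤ z≤n (lin≡ (pr ∷ qr ∷ + q₀ ∷ pq ∷ N ∷ []) #0 ($0 :* #1 :- #2 :* #0 :- $0 :* #3 :+ $1 :* #4) (#2 :* #0 == #4 :- #0 by wb ∷ []) [] refl) (trans (shape {F k} {1ℤ} a₀ b₁ c₀) (ex (F k) B)) refl
        where ex : ∀ f b → f + 1ℤ + 0ℤ - (1ℤ - b) - 0ℤ ≡ f + b
              ex f b = (lin≡ (f ∷ b ∷ []) (#0 :+ $1 :+ $0 :- ($1 :- #1) :- $0) (#0 :+ #1) [] [] refl)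
      F₃ : F (k - pq) ≡ F k + C
      F₃ = via {pq} 0 0 r₀ 1ℤ z≤n z≤n r₀≤ (lin≡ (pq ∷ qr ∷ pr ∷ + r₀ ∷ N ∷ []) #0 ($0 :* #1 :- $0 :* #2 :- #3 :* #0 :+ $1 :* #4) (#3 :* #0 == #4 :- #0 by wc ∷ []) [] refl) (trans (shape {F k} {1ℤ} a₀ b₀ c₁) (ex (F k) C)) refl
        where ex : ∀ f c → f + 1ℤ + 0ℤ - 0ℤ - (1ℤ - c) ≡ f + c
              ex f c = (lin≡ (f ∷ c ∷ []) (#0 :+ $1 :+ $0 :- $0 :- ($1 :- #1)) (#0 :+ #1) [] [] refl)
      F₁₂ : F (k - qr - pr) ≡ F k + A + B
      F₁₂ = via {qr + pr} 1 q₀ 0 1ℤ p≥ q₀≤ z≤n (lin≡ (qr ∷ pr ∷ + q₀ ∷ pq ∷ N ∷ []) (#0 :+ #1) ($1 :* #0 :- #2 :* #1 :- $0 :* #3 :+ $1 :* #4) (#2 :* #1 == #4 :- #1 by wb ∷ []) [] refl) (trans (shape {F k} {1ℤ} a₁ b₁ c₀) (ex (F k) A B)) (lin≡ (k ∷ qr ∷ pr ∷ []) (#0 :- (#1 :+ #2)) (#0 :- #1 :- #2) [] [] refl)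
        where ex : ∀ f a b → f + 1ℤ + a - (1ℤ - b) - 0ℤ ≡ f + a + b
              ex f a b = (lin≡ (f ∷ a ∷ b ∷ []) (#0 :+ $1 :+ #1 :- ($1 :- #2) :- $0) (#0 :+ #1 :+ #2) [] [] refl)
      F₁₃ : F (k - qr - pq) ≡ F k + A + C
      F₁₃ = via {qr + pq} 1 0 r₀ 1ℤ p≥ z≤n r₀≤ (lin≡ (qr ∷ pq ∷ pr ∷ + r₀ ∷ N ∷ []) (#0 :+ #1) ($1 :* #0 :- $0 :* #2 :- #3 :* #1 :+ $1 :* #4) (#3 :* #1 == #4 :- #1 by wc ∷ []) [] refl) (trans (shape {F k} {1ℤ} a₁ b₀ c₁) (ex (F k) A C)) (lin≡ (k ∷ qr ∷ pq ∷ []) (#0 :- (#1 :+ #2)) (#0 :- #1 :- #2) [] [] refl)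
        where ex : ∀ f a c → f + 1ℤ + a - 0ℤ - (1ℤ - c) ≡ f + a + c
              ex f a c = (lin≡ (f ∷ a ∷ c ∷ []) (#0 :+ $1 :+ #1 :- $0 :- ($1 :- #2)) (#0 :+ #1 :+ #2) [] [] refl)
      F₂₃ : F (k - pr - pq) ≡ F k + B + C
      F₂₃ = via {pr + pq} 0 q₀ r₀ (+ 2) z≤n q₀≤ r₀≤ (lin≡ (pr ∷ pq ∷ qr ∷ + q₀ ∷ + r₀ ∷ N ∷ []) (#0 :+ #1) ($0 :* #2 :- #3 :* #0 :- #4 :* #1 :+ $2 :* #5) (#3 :* #0 == #5 :- #0 by wb ∷ #4 :* #1 == #5 :- #1 by wc ∷ []) [] refl) (trans (shape {F k} {+ 2} a₀ b₁ c₁) (ex (F k) B C)) (lin≡ (k ∷ pr ∷ pq ∷ []) (#0 :- (#1 :+ #2)) (#0 :- #1 :- #2) [] [] refl)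
        where ex : ∀ f b c → f + + 2 + 0ℤ - (1ℤ - b) - (1ℤ - c) ≡ f + b + c
              ex f b c = (lin≡ (f ∷ b ∷ c ∷ []) (#0 :+ $2 :+ $0 :- ($1 :- #1) :- ($1 :- #2)) (#0 :+ #1 :+ #2) [] [] refl)
      F₁₂₃ : F (k - qr - pr - pq) ≡ F k + A + B + C
      F₁₂₃ = via {qr + pr + pq} 1 q₀ r₀ (+ 2) p≥ q₀≤ r₀≤ (lin≡ (qr ∷ pr ∷ pq ∷ + q₀ ∷ + r₀ ∷ N ∷ []) (#0 :+ #1 :+ #2) ($1 :* #0 :- #3 :* #1 :- #4 :* #2 :+ $2 :* #5) (#3 :* #1 == #5 :- #1 by wb ∷ #4 :* #2 == #5 :- #2 by wc ∷ []) [] refl) (trans (shape {F k} {+ 2} a₁ b₁ c₁) (ex (F k) A B C)) (lin≡ (k ∷ qr ∷ pr ∷ pq ∷ []) (#0 :- (#1 :+ #2 :+ #3)) (#0 :- #1 :- #2 :- #3) [] [] refl)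
        where ex : ∀ f a b c → f + + 2 + a - (1ℤ - b) - (1ℤ - c) ≡ f + a + b + c
              ex f a b c = (lin≡ (f ∷ a ∷ b ∷ c ∷ []) (#0 :+ $2 :+ #1 :- ($1 :- #2) :- ($1 :- #3)) (#0 :+ #1 :+ #2 :+ #3) [] [] refl)

      -- (1 - x^{qr}) (1 - x^{pr}) (1 - x^{pq}) χ = 1 below degree pqr.
      impulse : k < N → χ k - χ (k - qr) - (χ (k - pr) - χ (k - qr - pr)) - (χ (k - pq) - χ (k - qr - pq) - (χ (k - pr - pq) - χ (k - qr - pr - pq))) ≡ ⟨ k ℤ.≟ 0ℤ ⟩
      impulse l = trans (cong₂ _-_
          (cong₂ (λ x y → χ k - x - y) (is0 (k - qr) F₁) (cong₂ _-_ (is0 (k - pr) F₂) (is0 (k - qr - pr) F₁₂)))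
          (cong₂ _-_ (cong₂ _-_ (is0 (k - pq) F₃) (is0 (k - qr - pq) F₁₃)) (cong₂ _-_ (is0 (k - pr - pq) F₂₃) (is0 (k - qr - pr - pq) F₁₂₃))))
        (trans (cube (F≥0 k l) (ca k ℕ.≟ 0) (cb k ℕ.≟ 0) (cc k ℕ.≟ 0))
          (⟨⟩-cong ((F k ℤ.≟ 0ℤ) ×-dec ((ca k ℕ.≟ 0) ×-dec ((cb k ℕ.≟ 0) ×-dec (cc k ℕ.≟ 0)))) (k ℤ.≟ 0ℤ) fwd bwd))
        where
        is0 : ∀ x {y} → F x ≡ y → χ x ≡ ⟨ y ℤ.≟ 0ℤ ⟩
        is0 _ = cong (λ z → ⟨ z ℤ.≟ 0ℤ ⟩)
        fwd : F k ≡ 0ℤ × (ca k ≡ 0 × (cb k ≡ 0 × cc k ≡ 0)) → k ≡ 0ℤ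
        fwd (f , a , b , c) = trans (trans (sym (ℤ.+-identityʳ k)) (cong (λ z → k + z * N) (sym f))) (trans (sym (coords k))
          (trans (cong₂ _+_ (cong₂ (λ a b → + a * M + + b * (+ p * + r)) a b) (cong (λ c → + c * (+ p * + q)) c)) refl))
        bwd : k ≡ 0ℤ → F k ≡ 0ℤ × (ca k ≡ 0 × (cb k ≡ 0 × cc k ≡ 0))
        bwd refl = let a , b , c , f = zero-coords in sym f , sym a , sym b , sym c

-- The coefficient formula for three primes.

module Top where
  open import Data.List.Membership.Propositional using (_∈_)
  open import Data.List.Relation.Unary.Any using (here; there)
  open import Data.List.Relation.Unary.All using (All; []; _∷_)
  open import Data.List.Relation.Unary.AllPairs using ([]; _∷_)
  open import Data.Nat.Divisibility using (divides) renaming (_∣_ to _∣ⁿ_)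
  open import Data.Nat.Primality using (Prime; prime⇒irreducible; prime⇒nonZero)
  open Lin
  open Sums
  open Coord
  open Link
  open Poly
  open Cyclo
  open Semi
  open Series

  prime-not-product : ∀ {x a b} → Prime x → 1 ℕ.< a → 1 ℕ.< b → x ≢ a ℕ.* b
  prime-not-product {x} {a} {b} h la lb e with prime⇒irreducible h (divides b (trans e (ℕ.*-comm a b)))
  ... | inj₁ refl = ℕ.<⇒≢ la refl
  ... | inj₂ refl = ℕ.<⇒≢ (ℕ.m<m*n a b {{prime⇒nonZero h}} lb) e

  module Ternary (p₀ q₀ r₀ : ℕ) (pp : Prime (suc p₀)) (pq : Prime (suc q₀)) (pr : Prime (suc r₀)) (p<q : suc p₀ ℕ.< suc q₀) (q<r : suc q₀ ℕ.< suc r₀)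
    (I : Inverses (suc p₀) (suc q₀) (suc r₀)) (m : ℕ) (m≡ : suc m ≡ suc p₀ ℕ.* suc q₀ ℕ.* suc r₀) where
    open Coordinates I
    open Indicator I

    -- `L` is spelled out, with its final 0, so that `suc L` is by computation the sum of the
    -- degrees of the seven proper factors.
    K L : ℕ
    K = p₀ ℕ.* q₀ ℕ.* r₀
    L = p₀ ℕ.+ (q₀ ℕ.+ (r₀ ℕ.+ (p₀ ℕ.* q₀ ℕ.+ (p₀ ℕ.* r₀ ℕ.+ (q₀ ℕ.* r₀ ℕ.+ 0)))))

    private
      1<p = prime>1 pp
      1<q = prime>1 pq
      1<r = prime>1 pr
      p≢q = ℕ.<⇒≢ p<q
      q≢r = ℕ.<⇒≢ q<r
      p≢r = ℕ.<⇒≢ (ℕ.<-trans p<q q<r)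
      ds : List ℕ
      ds = 1 ∷ (suc p₀) ∷ (suc q₀) ∷ (suc r₀) ∷ (suc p₀) ℕ.* (suc q₀) ∷ (suc p₀) ℕ.* (suc r₀) ∷ (suc q₀) ℕ.* (suc r₀) ∷ []
      m≡′ : suc m ≡ (suc p₀) ℕ.* ((suc q₀) ℕ.* (suc r₀))
      m≡′ = trans m≡ (ℕ.*-assoc (suc p₀) (suc q₀) (suc r₀))

      of-qr : ∀ {d} → d ∣ⁿ (suc q₀) ℕ.* (suc r₀) → d ≡ 1 ⊎ d ≡ (suc q₀) ⊎ d ≡ (suc r₀) ⊎ d ≡ (suc q₀) ℕ.* (suc r₀)
      of-qr h with prime-split pq h
      ... | inj₂ h′ = [ inj₁ , inj₂ ∘ inj₂ ∘ inj₁ ]′ (prime⇒irreducible pr h′)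
      ... | inj₁ (d , refl , h′) = [ (λ e → inj₂ (inj₁ (trans (cong ((suc q₀) ℕ.*_) e) (ℕ.*-identityʳ (suc q₀))))) , (λ e → inj₂ (inj₂ (inj₂ (cong ((suc q₀) ℕ.*_) e)))) ]′ (prime⇒irreducible pr h′)
      complete : ∀ x → 1 ℕ.≤ x → x ℕ.≤ m → x ∣ⁿ suc m → x ∈ ds
      complete x _ l h with prime-split pp (subst (x ∣ⁿ_) m≡′ h)
      ... | inj₂ h′ with of-qr h′
      ...   | inj₁ e = here e
      ...   | inj₂ (inj₁ e) = there (there (here e))
      ...   | inj₂ (inj₂ (inj₁ e)) = there (there (there (here e)))
      ...   | inj₂ (inj₂ (inj₂ e)) = there (there (there (there (there (there (here e))))))
      complete x _ l h | inj₁ (d , refl , h′) with of-qr h′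
      ...   | inj₁ e = there (here (trans (cong ((suc p₀) ℕ.*_) e) (ℕ.*-identityʳ (suc p₀))))
      ...   | inj₂ (inj₁ e) = there (there (there (there (here (cong ((suc p₀) ℕ.*_) e)))))
      ...   | inj₂ (inj₂ (inj₁ e)) = there (there (there (there (there (here (cong ((suc p₀) ℕ.*_) e))))))
      ...   | inj₂ (inj₂ (inj₂ e)) = ⊥-elim (ℕ.<⇒≢ (s≤s l) (trans (cong ((suc p₀) ℕ.*_) e) (sym m≡′)))

      proper : ∀ {x k} → suc m ≡ k ℕ.* suc x → 1 ℕ.< k → 1 ℕ.≤ suc x × suc x ℕ.≤ m × suc x ∣ⁿ suc m
      proper {x} {k} e l = s≤s z≤n , ℕ.s≤s⁻¹ (subst (suc x ℕ.<_) (trans (ℕ.*-comm (suc x) k) (sym e)) (ℕ.m<m*n (suc x) k l)) , divides k e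
      1<* : ∀ {a b} → 1 ℕ.< a → 1 ℕ.< suc b → 1 ℕ.< a ℕ.* suc b
      1<* {a} {b} h k = ℕ.<-≤-trans h (ℕ.m≤m*n a (suc b))
      sound : All (λ x → 1 ℕ.≤ x × x ℕ.≤ m × x ∣ⁿ suc m) ds
      sound = (ℕ.≤-refl , ℕ.s≤s⁻¹ (subst (1 ℕ.<_) (sym m≡) (1<* (1<* 1<p 1<q) 1<r)) , divides (suc m) (sym (ℕ.*-identityʳ (suc m))))
        ∷ proper (trans m≡′ (ℕ.*-comm (suc p₀) ((suc q₀) ℕ.* (suc r₀)))) (1<* 1<q 1<r)
        ∷ proper (trans m≡ (trans (cong (ℕ._* (suc r₀)) (ℕ.*-comm (suc p₀) (suc q₀))) (trans (ℕ.*-assoc (suc q₀) (suc p₀) (suc r₀)) (ℕ.*-comm (suc q₀) ((suc p₀) ℕ.* (suc r₀)))))) (1<* 1<p 1<r)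
        ∷ proper m≡ (1<* 1<p 1<q)
        ∷ proper (trans m≡ (ℕ.*-comm ((suc p₀) ℕ.* (suc q₀)) (suc r₀))) 1<r
        ∷ proper (trans m≡ (trans (cong (ℕ._* (suc r₀)) (ℕ.*-comm (suc p₀) (suc q₀))) (ℕ.*-assoc (suc q₀) (suc p₀) (suc r₀)))) 1<q
        ∷ proper m≡′ 1<p ∷ []
      pq≢pr : (suc p₀) ℕ.* (suc q₀) ≢ (suc p₀) ℕ.* (suc r₀)
      pq≢pr e = q≢r (ℕ.*-cancelˡ-≡ (suc q₀) (suc r₀) (suc p₀) e)
      pq≢qr : (suc p₀) ℕ.* (suc q₀) ≢ (suc q₀) ℕ.* (suc r₀)
      pq≢qr e = p≢r (ℕ.*-cancelˡ-≡ (suc p₀) (suc r₀) (suc q₀) (trans (ℕ.*-comm (suc q₀) (suc p₀)) e))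
      pr≢qr : (suc p₀) ℕ.* (suc r₀) ≢ (suc q₀) ℕ.* (suc r₀)
      pr≢qr e = p≢q (ℕ.*-cancelʳ-≡ (suc p₀) (suc q₀) (suc r₀) e)
      open ProperDivisors m ds complete sound
        ((ℕ.<⇒≢ 1<p ∷ ℕ.<⇒≢ 1<q ∷ ℕ.<⇒≢ 1<r ∷ ℕ.<⇒≢ (1<* 1<p 1<q) ∷ ℕ.<⇒≢ (1<* 1<p 1<r) ∷ ℕ.<⇒≢ (1<* 1<q 1<r) ∷ [])
         ∷ (p≢q ∷ p≢r ∷ prime-not-product pp 1<p 1<q ∷ prime-not-product pp 1<p 1<r ∷ prime-not-product pp 1<q 1<r ∷ [])
         ∷ (q≢r ∷ prime-not-product pq 1<p 1<q ∷ prime-not-product pq 1<p 1<r ∷ prime-not-product pq 1<q 1<r ∷ [])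
         ∷ (prime-not-product pr 1<p 1<q ∷ prime-not-product pr 1<p 1<r ∷ prime-not-product pr 1<q 1<r ∷ [])
         ∷ (pq≢pr ∷ pq≢qr ∷ []) ∷ (pr≢qr ∷ []) ∷ [] ∷ [])
        (deg₁ ∷ (p₀ , prime-degree pp) ∷ (q₀ , prime-degree pq) ∷ (r₀ , prime-degree pr) ∷ (p₀ ℕ.* q₀ , semiprime-degree pp pq p≢q) ∷ (p₀ ℕ.* r₀ , semiprime-degree pp pr p≢r)
         ∷ (q₀ ℕ.* r₀ , semiprime-degree pq pr q≢r) ∷ [])

    S : ℤ → ℤ
    S n = ∑ (suc p₀) (λ i → g (+ (suc q₀)) (+ (suc r₀)) (n - + (suc p₀) + 1ℤ + + i))

    private
      lt : ∀ {a b} → 1ℤ + a ≤ b → a < b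
      lt = ℤ.suc[i]≤j⇒i<j

      g-neg : ∀ k → k < 0ℤ → g (+ (suc q₀)) (+ (suc r₀)) k ≡ 0ℤ
      g-neg k l = cong₂ _+_ (cong₂ _-_ (cong₂ _-_ (χ-neg k l) (χ-neg (k - + (suc q₀)) (ℤ.≤-<-trans (down k (suc q₀)) l))) (χ-neg (k - + (suc r₀)) (ℤ.≤-<-trans (down k (suc r₀)) l)))
        (χ-neg (k - + (suc q₀) - + (suc r₀)) (ℤ.≤-<-trans (≤-trans (down (k - + (suc q₀)) (suc r₀)) (down k (suc q₀))) l))
        where
        down : ∀ k n → k - + n ≤ k
        down k n = let n≥0 = +≤+ (z≤n {n}) in (lin≤ (k ∷ + n ∷ []) (#0 :- #1) #0 ($0 <= #1 by n≥0 ∷ []) [] [] refl)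

    S-neg : ∀ n → n < 0ℤ → S n ≡ 0ℤ
    S-neg n l = ∑-zero (suc p₀) (λ i i<p → g-neg (n - + (suc p₀) + 1ℤ + + i) (lt (let i<p = +≤+ i<p ; l = ℤ.i<j⇒suc[i]≤j l in (lin≤ (n ∷ + (suc p₀) ∷ + i ∷ []) ($1 :+ (#0 :- #1 :+ $1 :+ #2)) $0 ($1 :+ #2 <= #1 by i<p ∷ $1 :+ #0 <= $0 by l ∷ []) [] [] refl))))

    S-0 : S 0ℤ ≡ 1ℤ
    S-0 = trans (cong₂ _+_ (∑-zero p₀ (λ i i<p → g-neg (0ℤ - + (suc p₀) + 1ℤ + + i) (lt (let i<p = +≤+ i<p in (lin≤ (+ p₀ ∷ + i ∷ []) ($1 :+ ($0 :- ($1 :+ #0) :+ $1 :+ #1)) $0 ($1 :+ #1 <= #0 by i<p ∷ []) [] [] refl)))))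
        (cong (g (+ (suc q₀)) (+ (suc r₀))) (lin≡ (+ p₀ ∷ []) ($0 :- ($1 :+ #0) :+ $1 :+ #0) $0 [] [] refl)))
      (trans (ℤ.+-identityˡ (g (+ (suc q₀)) (+ (suc r₀)) 0ℤ)) (cong₂ _+_ (cong₂ _-_ (cong₂ _-_ χ-0 (χ-neg (- + (suc q₀)) ℤ.-<+)) (χ-neg (- + (suc r₀)) ℤ.-<+)) (χ-neg (- + (suc q₀) - + (suc r₀)) ℤ.-<+)))

    private
      As Bs : List Poly
      As = Φ (suc p₀) ∷ Φ (suc q₀) ∷ Φ (suc r₀) ∷ Φ ((suc p₀) ℕ.* (suc q₀)) ∷ Φ ((suc p₀) ℕ.* (suc r₀)) ∷ Φ ((suc q₀) ℕ.* (suc r₀)) ∷ []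
      Bs = Φ 1 ∷ Φ (suc p₀) ∷ Φ 1 ∷ Φ (suc q₀) ∷ Φ 1 ∷ Φ (suc r₀) ∷ []
      c : ℤ
      c = 1ℤ - + (suc p₀) - + (suc q₀) - + (suc r₀)

      three : ∀ {a b d} (x y z : ℕ) (f : ℤ → ℤ) n → (∀ f n → Ops a f n ≡ ∇ x f n) → (∀ f n → Ops b f n ≡ ∇ y f n) → (∀ f n → Ops d f n ≡ ∇ z f n) →
        Ops a (Ops b (Ops d f)) n ≡ f (n + + x + + y + + z) - f (n + + x + + y) - (f (n + + x + + z) - f (n + + x)) - (f (n + + y + + z) - f (n + + y) - (f (n + + z) - f n))
      three {a} {b} {d} x y z f n h k l = trans (h (Ops b (Ops d f)) n) (cong₂ _-_ (two (n + + x)) (two n))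
        where
        two : ∀ n → Ops b (Ops d f) n ≡ f (n + + y + + z) - f (n + + y) - (f (n + + z) - f n)
        two n = trans (k (Ops d f) n) (cong₂ _-_ (l f (n + + y)) (l f n))

      -- The sum over `p` consecutive integers telescopes, which supplies the factor `1 - x^p`
      -- beside those of `q` and `r` contained in `g`.
      difference : ∀ n → R (Φ 1) S n ≡ Ops Bs χ (n + c)
      difference n = trans (Φ₁ {S} n) (trans (cong₂ _-_ (∑-cong (suc p₀) (λ i _ → cong (g (+ (suc q₀)) (+ (suc r₀))) (ex₁ n (+ (suc p₀)) i))) refl) (trans (∑-telescope (λ i → g (+ (suc q₀)) (+ (suc r₀)) (n - + (suc p₀) + 1ℤ + + i)) (suc p₀))
        (trans (ex₂ (χ x₁) (χ (x₁ - + (suc q₀))) (χ (x₁ - + (suc r₀))) (χ (x₁ - + (suc q₀) - + (suc r₀))) (χ x₀) (χ (x₀ - + (suc q₀))) (χ (x₀ - + (suc r₀))) (χ (x₀ - + (suc q₀) - + (suc r₀))))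
        (trans (cong₂ _-_ (cong₂ _-_ (cong₂ (λ x y → χ x - χ y) (e₁ n (+ (suc p₀)) (+ (suc q₀)) (+ (suc r₀))) (e₂ n (+ (suc p₀)) (+ (suc q₀)) (+ (suc r₀)))) (cong₂ (λ x y → χ x - χ y) (e₃ n (+ (suc p₀)) (+ (suc q₀)) (+ (suc r₀))) (e₄ n (+ (suc p₀)) (+ (suc q₀)) (+ (suc r₀)))))
            (cong₂ _-_ (cong₂ (λ x y → χ x - χ y) (e₅ n (+ (suc p₀)) (+ (suc q₀)) (+ (suc r₀))) (e₆ n (+ (suc p₀)) (+ (suc q₀)) (+ (suc r₀)))) (cong₂ (λ x y → χ x - χ y) (e₇ n (+ (suc p₀)) (+ (suc q₀)) (+ (suc r₀))) (e₈ n (+ (suc p₀)) (+ (suc q₀)) (+ (suc r₀))))))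
          (sym (three {Φ 1 ∷ Φ (suc p₀) ∷ []} {Φ 1 ∷ Φ (suc q₀) ∷ []} {Φ 1 ∷ Φ (suc r₀) ∷ []} (suc p₀) (suc q₀) (suc r₀) χ (n + c) (prime-∇ pp) (prime-∇ pq) (prime-∇ pr)))))))
        where
        x₁ x₀ : ℤ
        x₁ = n - + (suc p₀) + 1ℤ + + (suc p₀)
        x₀ = n - + (suc p₀) + 1ℤ + + 0
        ex₁ : ∀ n p i → n + 1ℤ - p + 1ℤ + + i ≡ n - p + 1ℤ + + suc i
        ex₁ n p i = (lin≡ (n ∷ p ∷ + i ∷ []) (#0 :+ $1 :- #1 :+ $1 :+ #2) (#0 :- #1 :+ $1 :+ ($1 :+ #2)) [] [] refl)
        ex₂ : ∀ a b d e a′ b′ d′ e′ → (a - b - d + e) - (a′ - b′ - d′ + e′) ≡ a - d - (b - e) - (a′ - d′ - (b′ - e′))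
        ex₂ a b d e a′ b′ d′ e′ = (lin≡ (a ∷ b ∷ d ∷ e ∷ a′ ∷ b′ ∷ d′ ∷ e′ ∷ []) (#0 :- #1 :- #2 :+ #3 :- (#4 :- #5 :- #6 :+ #7)) (#0 :- #2 :- (#1 :- #3) :- (#4 :- #6 :- (#5 :- #7))) [] [] refl)
        e₁ : ∀ n p q r → n - p + 1ℤ + p ≡ n + (1ℤ - p - q - r) + p + q + r
        e₁ n p q r = (lin≡ (n ∷ p ∷ q ∷ r ∷ []) (#0 :- #1 :+ $1 :+ #1) (#0 :+ ($1 :- #1 :- #2 :- #3) :+ #1 :+ #2 :+ #3) [] [] refl)
        e₂ : ∀ n p q r → n - p + 1ℤ + p - r ≡ n + (1ℤ - p - q - r) + p + q
        e₂ n p q r = (lin≡ (n ∷ p ∷ r ∷ q ∷ []) (#0 :- #1 :+ $1 :+ #1 :- #2) (#0 :+ ($1 :- #1 :- #3 :- #2) :+ #1 :+ #3) [] [] refl)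
        e₃ : ∀ n p q r → n - p + 1ℤ + p - q ≡ n + (1ℤ - p - q - r) + p + r
        e₃ n p q r = (lin≡ (n ∷ p ∷ q ∷ r ∷ []) (#0 :- #1 :+ $1 :+ #1 :- #2) (#0 :+ ($1 :- #1 :- #2 :- #3) :+ #1 :+ #3) [] [] refl)
        e₄ : ∀ n p q r → n - p + 1ℤ + p - q - r ≡ n + (1ℤ - p - q - r) + p
        e₄ n p q r = (lin≡ (n ∷ p ∷ q ∷ r ∷ []) (#0 :- #1 :+ $1 :+ #1 :- #2 :- #3) (#0 :+ ($1 :- #1 :- #2 :- #3) :+ #1) [] [] refl)
        e₅ : ∀ n p q r → n - p + 1ℤ + + 0 ≡ n + (1ℤ - p - q - r) + q + r
        e₅ n p q r = (lin≡ (n ∷ p ∷ q ∷ r ∷ []) (#0 :- #1 :+ $1 :+ $0) (#0 :+ ($1 :- #1 :- #2 :- #3) :+ #2 :+ #3) [] [] refl)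
        e₆ : ∀ n p q r → n - p + 1ℤ + + 0 - r ≡ n + (1ℤ - p - q - r) + q
        e₆ n p q r = (lin≡ (n ∷ p ∷ r ∷ q ∷ []) (#0 :- #1 :+ $1 :+ $0 :- #2) (#0 :+ ($1 :- #1 :- #3 :- #2) :+ #3) [] [] refl)
        e₇ : ∀ n p q r → n - p + 1ℤ + + 0 - q ≡ n + (1ℤ - p - q - r) + r
        e₇ n p q r = (lin≡ (n ∷ p ∷ q ∷ r ∷ []) (#0 :- #1 :+ $1 :+ $0 :- #2) (#0 :+ ($1 :- #1 :- #2 :- #3) :+ #3) [] [] refl)
        e₈ : ∀ n p q r → n - p + 1ℤ + + 0 - q - r ≡ n + (1ℤ - p - q - r)
        e₈ n p q r = (lin≡ (n ∷ p ∷ q ∷ r ∷ []) (#0 :- #1 :+ $1 :+ $0 :- #2 :- #3) (#0 :+ ($1 :- #1 :- #2 :- #3)) [] [] refl)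

      -- The twelve factors of `As` and `Bs` are regrouped into three blocks, the factorisations of
      -- `x^(pq) - 1`, `x^(pr) - 1` and `x^(qr) - 1`.
      R-S : ∀ n → R D S n ≡ Ops (Φ 1 ∷ Φ (suc p₀) ∷ Φ (suc q₀) ∷ Φ ((suc p₀) ℕ.* (suc q₀)) ∷ []) (Ops (Φ 1 ∷ Φ (suc p₀) ∷ Φ (suc r₀) ∷ Φ ((suc p₀) ℕ.* (suc r₀)) ∷ []) (Ops (Φ 1 ∷ Φ (suc q₀) ∷ Φ (suc r₀) ∷ Φ ((suc q₀) ℕ.* (suc r₀)) ∷ []) χ)) (n + c)
      R-S n = begin
        R D S n ≡⟨ R-D S n ⟩
        Ops (Φ 1 ∷ As) S n ≡⟨ Ops-perm {S} (1 ∷ 1 ∷ 1 ∷ 1 ∷ 1 ∷ 1 ∷ []) (Φ 1 ∷ As) n ⟨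
        Ops As (R (Φ 1) S) n ≡⟨ Ops-cong As difference n ⟩
        Ops As (λ n → Ops Bs χ (n + c)) n ≡⟨ Ops-shift {Ops Bs χ} As c n ⟩
        Ops As (Ops Bs χ) (n + c) ≡⟨ Ops-perm {χ} (6 ∷ 0 ∷ 0 ∷ 1 ∷ 4 ∷ 3 ∷ 0 ∷ 0 ∷ 2 ∷ 1 ∷ 1 ∷ []) (Φ (suc p₀) ∷ Φ (suc q₀) ∷ Φ (suc r₀) ∷ Φ ((suc p₀) ℕ.* (suc q₀)) ∷ Φ ((suc p₀) ℕ.* (suc r₀)) ∷ Φ ((suc q₀) ℕ.* (suc r₀)) ∷ Bs) (n + c) ⟨
        Ops (Φ 1 ∷ Φ (suc p₀) ∷ Φ (suc q₀) ∷ Φ ((suc p₀) ℕ.* (suc q₀)) ∷ []) (Ops (Φ 1 ∷ Φ (suc p₀) ∷ Φ (suc r₀) ∷ Φ ((suc p₀) ℕ.* (suc r₀)) ∷ []) (Ops (Φ 1 ∷ Φ (suc q₀) ∷ Φ (suc r₀) ∷ Φ ((suc q₀) ℕ.* (suc r₀)) ∷ []) χ)) (n + c) ∎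
        where open ≡-Reasoning

    R-S-unit : ∀ n → n + + suc L < N → R D S n ≡ ⟨ n + + suc L ℤ.≟ 0ℤ ⟩
    R-S-unit n l = begin
      R D S n ≡⟨ R-S n ⟩
      Ops Cs (Ops Ds (Ops Es χ)) (n + c) ≡⟨ three {Cs} {Ds} {Es} ((suc p₀) ℕ.* (suc q₀)) ((suc p₀) ℕ.* (suc r₀)) ((suc q₀) ℕ.* (suc r₀)) χ (n + c) (semiprime-∇ pp pq p≢q) (semiprime-∇ pp pr p≢r) (semiprime-∇ pq pr q≢r) ⟩
      χ (t + X + Y + Z) - χ (t + X + Y) - (χ (t + X + Z) - χ (t + X)) - (χ (t + Y + Z) - χ (t + Y) - (χ (t + Z) - χ t)) ≡⟨
        cong₂ _-_ (cong₂ _-_ (cong₂ (λ x y → χ x - χ y) (e₁ t) (e₂ t)) (cong₂ (λ x y → χ x - χ y) (e₃ t) (e₄ t)))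
          (cong₂ _-_ (cong₂ (λ x y → χ x - χ y) (e₅ t) (e₆ t)) (cong₂ (λ x y → χ x - χ y) (e₇ t) (e₈ t))) ⟩
      χ k - χ (k - qr) - (χ (k - pr′) - χ (k - qr - pr′)) - (χ (k - pq′) - χ (k - qr - pq′) - (χ (k - pr′ - pq′) - χ (k - qr - pr′ - pq′))) ≡⟨ Turn.impulse k (subst (_< N) (sym k≡) l) ⟩
      ⟨ k ℤ.≟ 0ℤ ⟩ ≡⟨ cong (λ z → ⟨ z ℤ.≟ 0ℤ ⟩) k≡ ⟩
      ⟨ n + + suc L ℤ.≟ 0ℤ ⟩ ∎
      where
      open ≡-Reasoning
      Cs = Φ 1 ∷ Φ (suc p₀) ∷ Φ (suc q₀) ∷ Φ ((suc p₀) ℕ.* (suc q₀)) ∷ []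
      Ds = Φ 1 ∷ Φ (suc p₀) ∷ Φ (suc r₀) ∷ Φ ((suc p₀) ℕ.* (suc r₀)) ∷ []
      Es = Φ 1 ∷ Φ (suc q₀) ∷ Φ (suc r₀) ∷ Φ ((suc q₀) ℕ.* (suc r₀)) ∷ []
      t k qr pr′ pq′ X Y Z : ℤ
      t = n + c
      X = + ((suc p₀) ℕ.* (suc q₀))
      Y = + ((suc p₀) ℕ.* (suc r₀))
      Z = + ((suc q₀) ℕ.* (suc r₀))
      qr = + (suc q₀) * + (suc r₀)
      pr′ = + (suc p₀) * + (suc r₀)
      pq′ = + (suc p₀) * + (suc q₀)
      k = t + pq′ + pr′ + qr
      x = ℤ.pos-* (suc p₀) (suc q₀)
      y = ℤ.pos-* (suc p₀) (suc r₀)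
      z = ℤ.pos-* (suc q₀) (suc r₀)
      e₁ : ∀ t → t + X + Y + Z ≡ t + pq′ + pr′ + qr
      e₁ t = (lin≡ (t ∷ X ∷ Y ∷ Z ∷ pq′ ∷ pr′ ∷ qr ∷ []) (#0 :+ #1 :+ #2 :+ #3) (#0 :+ #4 :+ #5 :+ #6) (#1 == #4 by x ∷ #2 == #5 by y ∷ #3 == #6 by z ∷ []) [] refl)
      e₂ : ∀ t → t + X + Y ≡ t + pq′ + pr′ + qr - qr
      e₂ t = (lin≡ (t ∷ X ∷ Y ∷ pq′ ∷ pr′ ∷ qr ∷ []) (#0 :+ #1 :+ #2) (#0 :+ #3 :+ #4 :+ #5 :- #5) (#1 == #3 by x ∷ #2 == #4 by y ∷ []) [] refl)
      e₃ : ∀ t → t + X + Z ≡ t + pq′ + pr′ + qr - pr′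
      e₃ t = (lin≡ (t ∷ X ∷ Z ∷ pq′ ∷ pr′ ∷ qr ∷ []) (#0 :+ #1 :+ #2) (#0 :+ #3 :+ #4 :+ #5 :- #4) (#1 == #3 by x ∷ #2 == #5 by z ∷ []) [] refl)
      e₄ : ∀ t → t + X ≡ t + pq′ + pr′ + qr - qr - pr′
      e₄ t = (lin≡ (t ∷ X ∷ pq′ ∷ pr′ ∷ qr ∷ []) (#0 :+ #1) (#0 :+ #2 :+ #3 :+ #4 :- #4 :- #3) (#1 == #2 by x ∷ []) [] refl)
      e₅ : ∀ t → t + Y + Z ≡ t + pq′ + pr′ + qr - pq′
      e₅ t = (lin≡ (t ∷ Y ∷ Z ∷ pq′ ∷ pr′ ∷ qr ∷ []) (#0 :+ #1 :+ #2) (#0 :+ #3 :+ #4 :+ #5 :- #3) (#1 == #4 by y ∷ #2 == #5 by z ∷ []) [] refl)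
      e₆ : ∀ t → t + Y ≡ t + pq′ + pr′ + qr - qr - pq′
      e₆ t = (lin≡ (t ∷ Y ∷ pq′ ∷ pr′ ∷ qr ∷ []) (#0 :+ #1) (#0 :+ #2 :+ #3 :+ #4 :- #4 :- #2) (#1 == #3 by y ∷ []) [] refl)
      e₇ : ∀ t → t + Z ≡ t + pq′ + pr′ + qr - pr′ - pq′
      e₇ t = (lin≡ (t ∷ Z ∷ pq′ ∷ pr′ ∷ qr ∷ []) (#0 :+ #1) (#0 :+ #2 :+ #3 :+ #4 :- #3 :- #2) (#1 == #4 by z ∷ []) [] refl)
      e₈ : ∀ t → t ≡ t + pq′ + pr′ + qr - qr - pr′ - pq′
      e₈ t = (lin≡ (t ∷ pq′ ∷ pr′ ∷ qr ∷ []) #0 (#0 :+ #1 :+ #2 :+ #3 :- #3 :- #2 :- #1) [] [] refl)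
      k≡ : k ≡ n + + suc L
      k≡ = let a = ℤ.pos-* p₀ q₀ ; b = ℤ.pos-* p₀ r₀ ; d = ℤ.pos-* q₀ r₀ in
        (lin≡ (n ∷ + p₀ ∷ + q₀ ∷ + r₀ ∷ + (p₀ ℕ.* q₀) ∷ + (p₀ ℕ.* r₀) ∷ + (q₀ ℕ.* r₀) ∷ []) (#0 :+ ($1 :- ($1 :+ #1) :- ($1 :+ #2) :- ($1 :+ #3)) :+ ($1 :+ #1) :* ($1 :+ #2) :+ ($1 :+ #1) :* ($1 :+ #3) :+ ($1 :+ #2) :* ($1 :+ #3)) (#0 :+ ($1 :+ (#1 :+ (#2 :+ (#3 :+ (#4 :+ (#5 :+ (#6 :+ $0)))))))) (#4 =~ #1 :* #2 by a ∷ #5 =~ #1 :* #3 by b ∷ #6 =~ #2 :* #3 by d ∷ []) [] refl)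

    N≡m : N ≡ + suc m
    N≡m = sym (trans (cong +_ m≡′) (trans (ℤ.pos-* (suc p₀) ((suc q₀) ℕ.* (suc r₀))) (cong (λ z → + (suc p₀) * z) (ℤ.pos-* (suc q₀) (suc r₀)))))

    K+L : suc m ≡ K ℕ.+ suc L
    K+L = ℤ.+-injective (trans (sym N≡m) (let a = ℤ.pos-* p₀ q₀ ; b = ℤ.pos-* p₀ r₀ ; d = ℤ.pos-* q₀ r₀ ; e = trans (ℤ.pos-* (p₀ ℕ.* q₀) r₀) (cong (_* + r₀) a) in
      (lin≡ (+ p₀ ∷ + q₀ ∷ + r₀ ∷ + K ∷ + (p₀ ℕ.* q₀) ∷ + (p₀ ℕ.* r₀) ∷ + (q₀ ℕ.* r₀) ∷ []) (($1 :+ #0) :* (($1 :+ #1) :* ($1 :+ #2))) (#3 :+ ($1 :+ (#0 :+ (#1 :+ (#2 :+ (#4 :+ (#5 :+ (#6 :+ $0)))))))) (#3 =~ #0 :* #1 :* #2 by e ∷ #4 =~ #0 :* #1 by a ∷ #5 =~ #0 :* #2 by b ∷ #6 =~ #1 :* #2 by d ∷ []) [] refl)))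

    K<N : + K < N
    K<N = subst (+ K <_) (sym N≡m) (+<+ (subst (K ℕ.<_) (sym K+L) (ℕ.m<m+n K (s≤s z≤n))))

    private
      back : ∀ c → + c - + suc L + + suc L ≡ + c
      back c = (lin≡ (+ c ∷ + L ∷ []) (#0 :- ($1 :+ #1) :+ ($1 :+ #1)) #0 [] [] refl)
      rec : ∀ c → 1 ℕ.≤ c → c ℕ.≤ K → R D S (+ c - + suc L) ≡ 0ℤ
      rec c l l′ = trans (R-S-unit (+ c - + suc L) (subst (_< N) (sym (back c)) (ℤ.≤-<-trans (+≤+ l′) K<N))) (trans (cong (λ z → ⟨ z ℤ.≟ 0ℤ ⟩) (back c)) (positive≢0 c l))
      module Q = Quotient D L K m monic-D K+L S S-neg S-0 rec

    coefficient : ∀ j → a ((suc p₀) ℕ.* (suc q₀) ℕ.* (suc r₀)) (+ j) ≡ S (+ K - + j)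
    coefficient j = subst (λ n → coeffList (Φ n) j ≡ S (+ K - + j)) m≡ (trans (cong (λ A → coeffList A j) (Φ-suc m)) (Q.coeff-quotient j))

  a-formula : ∀ {p q r} → Prime p → Prime q → Prime r → p ℕ.< q → q ℕ.< r → (I : Inverses p q r) → let open Coordinates I in
    ∀ i → a (p ℕ.* q ℕ.* r) i ≡ 0ℤ ⊎ ∃ λ n → 0ℤ ≤ n × n < N × a (p ℕ.* q ℕ.* r) i ≡ ∑ p (λ i → g (+ q) (+ r) (n - + p + 1ℤ + + i))
  a-formula _ _ _ _ _ _ -[1+ _ ] = inj₁ refl
  a-formula {suc p₀} {suc q₀} {suc r₀} pp pq pr p<q q<r I (+ j) = go (0ℤ ℤ.≤? + T.K - + j)
    where
    module T = Ternary p₀ q₀ r₀ pp pq pr p<q q<r I _ refl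
    open Coordinates I
    go : Dec (0ℤ ≤ + T.K - + j) → a (suc p₀ ℕ.* suc q₀ ℕ.* suc r₀) (+ j) ≡ 0ℤ ⊎ ∃ λ n → 0ℤ ≤ n × n < N × a (suc p₀ ℕ.* suc q₀ ℕ.* suc r₀) (+ j) ≡ T.S n
    go (yes h) = inj₂ (+ T.K - + j , h , ℤ.≤-<-trans (let j≥0 = +≤+ (z≤n {j}) ; k = + T.K in (lin≤ (k ∷ + j ∷ []) (#0 :- #1) #0 ($0 <= #1 by j≥0 ∷ []) [] [] refl)) T.K<N , T.coefficient j)
    go (no h) = inj₁ (trans (T.coefficient j) (T.S-neg (+ T.K - + j) (ℤ.≰⇒> h)))

-- Bounds in terms of two inverses, and their relation to α and β.

module Final where
  open import Data.Nat using (_⊓_; _⊔_)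
  open import Data.Nat.Divisibility as Div using (_∣?_; divides)
  open import Data.Nat.Primality using (Prime; prime⇒irreducible)
  import Data.Integer.Divisibility as ℤDiv
  open import Data.Integer.Divisibility.Signed using (∣ᵤ⇒∣) renaming (divides to dividesₛ)
  open Lin
  open Sums
  open Coord
  open Config
  open Semi
  open Top

  module _ {p q r : ℕ} {I : Inverses p q r} where
    open Coordinates I

    sum : (x y n : ℤ) → ℤ
    sum x y n = ∑ p (λ i → g x y (n + + i))

    -- Chains require `p` odd and `q`, `r ≥ 4`. Outside this only `p = 2` occurs, where the trivial
    -- bound suffices.
    Edge : Set
    Edge = p ≡ 2 ⊎ ((∃ λ h → + p ≡ 1ℤ + + 2 * + h) × + 4 ≤ + q × + 4 ≤ + r)

    private
      setting-bounds : ∀ u e m → p ≡ u ℕ.+ e ℕ.+ u ℕ.+ m → 1 ℕ.≤ u → Edge → (S : Setting p u e m q r I) → let X = sum (Setting.q̃ S) (Setting.r̃ S) (Setting.n₀ S) in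
        X ≤ + p - + (u ℕ.+ e) × X ≤ + 2 * + u + + (u ℕ.+ e) × + 3 * X ≤ + 2 * + p
      setting-bounds u e m refl u≥1 edge S = b₁ , b₂ , b₃ edge
        where
        open Blocks S using (Σg; bound₁; bound₂; bound₃)
        X = Σg
        c₁ = bound₁
        c₂ = bound₂
        u≥ = +≤+ u≥1
        e≥0 = +≤+ (z≤n {e})
        b₁ : X ≤ + p - + (u ℕ.+ e)
        b₁ = (lin≤ (X ∷ + u ∷ + e ∷ + m ∷ []) #0 (#1 :+ #2 :+ #1 :+ #3 :- (#1 :+ #2)) (#0 <= #3 :+ #1 by c₁ ∷ []) [] [] refl)
        b₂ : X ≤ + 2 * + u + + (u ℕ.+ e)
        b₂ = (lin≤ (X ∷ + u ∷ + e ∷ []) #0 ($2 :* #1 :+ (#1 :+ #2)) (#0 <= #1 :+ #2 :+ #1 :+ #1 by c₂ ∷ []) [] [] refl)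
        b₃ : Edge → + 3 * X ≤ + 2 * + p
        b₃ (inj₁ two) = let two = cong +_ two in (lin≤ (X ∷ + u ∷ + e ∷ + m ∷ []) ($3 :* #0) ($2 :* (#1 :+ #2 :+ #1 :+ #3)) (#0 <= #3 :+ #1 by c₁ ∷ $1 <= #1 by u≥ ∷ $0 <= #2 by e≥0 ∷ #1 :+ #2 :+ #1 :+ #3 == $2 by two ∷ []) (1 ∷ 3 ∷ 3 ∷ 3 ∷ []) [] refl)
        b₃ (inj₂ (odd , q≥4 , r≥4)) = bound₃ odd q≥4 r≥4

    -- A setting before it is known which of the two inverses is the smaller one.
    record Arms (ez ey : ℕ) (x y n₀ : ℤ) : Set where
      field
        ez≥1 : 1 ℕ.≤ ez
        ey≥1 : 1 ℕ.≤ ey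
        ez+ey≤p : ez ℕ.+ ey ℕ.≤ p
        tz ty : ℕ
        U≡ : + ez * M - x ≡ + tz * (+ p * + q)
        V≡ : + ey * M - y ≡ + ty * (+ p * + r)
        tz≤ : tz ℕ.≤ r
        ty≤ : ty ℕ.≤ q
        x≥ : - + q ≤ x
        y≥ : - + r ≤ y
        ia≡ : (∃ λ κ → Inverses.ia I ≡ + (ez ℕ.* ey) + κ * + p) ⊎ (∃ λ κ → Inverses.ia I ≡ - + (ez ℕ.* ey) + κ * + p)
        lower : - (+ p + + q + + r) ≤ n₀
        upper : n₀ + + p ≤ N
        upper-x : n₀ + + p ≤ N + x
        upper-y : n₀ + + p ≤ N + y

    arms-bounds : ∀ {ez ey x y n₀} → + 2 ≤ + p → + 2 ≤ + q → + 2 ≤ + r → Edge → Arms ez ey x y n₀ → let X = sum x y n₀ in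
      X ≤ + p - + (ez ⊔ ey) × X ≤ + 2 * + (ez ⊓ ey) + + (ez ⊔ ey) × + 3 * X ≤ + 2 * + p
    arms-bounds {ez} {ey} {x} {y} {n₀} p≥2 q≥2 r≥2 edge A = go (ℕ.≤-total ez ey)
      where
      open Arms A
      X = sum x y n₀
      Goal : ℕ → ℕ → Set
      Goal a b = X ≤ + p - + b × X ≤ + 2 * + a + + b × + 3 * X ≤ + 2 * + p
      use : ∀ u v → 1 ℕ.≤ u → u ℕ.≤ v → u ℕ.+ v ℕ.≤ p → (ez ≡ u × ey ≡ v) ⊎ (ez ≡ v × ey ≡ u) → ez ℕ.* ey ≡ u ℕ.* v → Goal u v
      use u v u≥1 u≤v l o pr = subst (Goal u) v≡ (setting-bounds u (v ℕ.∸ u) (p ℕ.∸ (u ℕ.+ v)) p≡ u≥1 edge (record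
          { ez = ez ; ey = ey ; tz = tz ; ty = ty ; q̃ = x ; r̃ = y ; n₀ = n₀ ; U≡ = U≡ ; V≡ = V≡ ; tz≤ = tz≤ ; ty≤ = ty≤
          ; order = [ (λ (a , b) → inj₁ (a , trans b (sym v≡))) , (λ (a , b) → inj₂ (trans a (sym v≡) , b)) ]′ o
          ; q̃≥ = x≥ ; r̃≥ = y≥ ; p≥2 = p≥2 ; q≥2 = q≥2 ; r≥2 = r≥2
          ; ia≡ = subst (λ z → (∃ λ κ → Inverses.ia I ≡ + z + κ * + p) ⊎ (∃ λ κ → Inverses.ia I ≡ - + z + κ * + p)) (trans pr (cong (u ℕ.*_) (sym v≡))) ia≡
          ; lower = lower ; upper = upper ; upper-q = upper-x ; upper-r = upper-y }))
        where
        v≡ : u ℕ.+ (v ℕ.∸ u) ≡ v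
        v≡ = ℕ.m+[n∸m]≡n u≤v
        p≡ : p ≡ u ℕ.+ (v ℕ.∸ u) ℕ.+ u ℕ.+ (p ℕ.∸ (u ℕ.+ v))
        p≡ = sym (trans (cong (λ z → z ℕ.+ u ℕ.+ (p ℕ.∸ (u ℕ.+ v))) v≡) (trans (cong (ℕ._+ (p ℕ.∸ (u ℕ.+ v))) (ℕ.+-comm v u)) (ℕ.m+[n∸m]≡n l)))
      go : ez ℕ.≤ ey ⊎ ey ℕ.≤ ez → Goal (ez ⊓ ey) (ez ⊔ ey)
      go (inj₁ h) = subst₂ Goal (sym (ℕ.m≤n⇒m⊓n≡m h)) (sym (ℕ.m≤n⇒m⊔n≡n h)) (use ez ey ez≥1 h ez+ey≤p (inj₁ (refl , refl)) refl)
      go (inj₂ h) = subst₂ Goal (sym (ℕ.m≥n⇒m⊓n≡n h)) (sym (ℕ.m≥n⇒m⊔n≡m h)) (use ey ez ey≥1 h (subst (ℕ._≤ p) (ℕ.+-comm ez ey) ez+ey≤p) (inj₂ (refl , refl)) (ℕ.*-comm ez ey))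

  -- `a + b ≤ p` gives `a ≤ p - b` and `b ≤ p - a`, so the complements cannot lower the minimum.
  near-min : ∀ {p a b} → a ℕ.+ b ℕ.≤ p → (b ⊓ (p ∸ b)) ⊓ (a ⊓ (p ∸ a)) ≡ a ⊓ b
  near-min {p} {a} {b} l = ℕ.≤-antisym (ℕ.⊓-glb (ℕ.≤-trans (ℕ.m⊓n≤n _ _) (ℕ.m⊓n≤m a _)) (ℕ.≤-trans (ℕ.m⊓n≤m _ _) (ℕ.m⊓n≤m b _)))
    (ℕ.⊓-glb (ℕ.⊓-glb (ℕ.m⊓n≤n a b) (ℕ.≤-trans (ℕ.m⊓n≤m a b) (ℕ.m+n≤o⇒m≤o∸n a l))) (ℕ.⊓-glb (ℕ.m⊓n≤m a b) (ℕ.≤-trans (ℕ.m⊓n≤n a b) (ℕ.m+n≤o⇒m≤o∸n b (subst (ℕ._≤ p) (ℕ.+-comm a b) l)))))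

  flip-min : ∀ {p a} → a ℕ.≤ p → (p ∸ a) ⊓ (p ∸ (p ∸ a)) ≡ a ⊓ (p ∸ a)
  flip-min {p} {a} l = trans (cong ((p ∸ a) ⊓_) (ℕ.m∸[m∸n]≡n l)) (ℕ.⊓-comm (p ∸ a) a)

  ⊓*⊔ : ∀ a b → (a ⊓ b) ℕ.* (a ⊔ b) ≡ a ℕ.* b
  ⊓*⊔ a b with ℕ.≤-total a b
  ... | inj₁ h = cong₂ ℕ._*_ (ℕ.m≤n⇒m⊓n≡m h) (ℕ.m≤n⇒m⊔n≡n h)
  ... | inj₂ h = trans (cong₂ ℕ._*_ (ℕ.m≥n⇒m⊓n≡n h) (ℕ.m≥n⇒m⊔n≡m h)) (ℕ.*-comm b a)

  -- Both β and ± max invert α q r modulo p.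
  β-mod : ∀ {p M ia α β v κ κa κβ : ℤ} (σ : ℤ) → ia * M ≡ 1ℤ + κa * p → ia ≡ σ * (α * v) + κ * p → α * β * M ≡ 1ℤ + κβ * p → β ≡ σ * v + (σ * κβ * v + β * κ * M - β * κa) * p
  β-mod {p} {M} {ia} {α} {β} {v} {κ} {κa} {κβ} σ ha h hβ = let ha = cong (β *_) ha ; h = cong (λ z → β * (z * M)) h ; hβ = cong (σ * v *_) hβ in
    (lin≡ (β ∷ σ ∷ v ∷ κβ ∷ κ ∷ M ∷ κa ∷ p ∷ ia ∷ α ∷ []) #0 (#1 :* #2 :+ (#1 :* #3 :* #2 :+ #0 :* #4 :* #5 :- #0 :* #6) :* #7) (#0 :* (#8 :* #5) =~ #0 :* ($1 :+ #6 :* #7) by ha ∷ #0 :* (#8 :* #5) == #0 :* ((#1 :* (#9 :* #2) :+ #4 :* #7) :* #5) by h ∷ #1 :* #2 :* (#9 :* #0 :* #5) == #1 :* #2 :* ($1 :+ #3 :* #7) by hβ ∷ []) [] refl)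

  quotient≥0 : ∀ {p n} → 1 ℕ.≤ p → 1 ℕ.≤ n → + p ℤDiv.∣ (+ n - 1ℤ) → ∃ λ t → + n ≡ 1ℤ + + t * + p
  quotient≥0 {p} {n} p≥1 n≥1 h with ∣ᵤ⇒∣ {+ p} {+ n - 1ℤ} h
  ... | dividesₛ (+ t) e = t , (lin≡ (+ n ∷ + t ∷ + p ∷ []) #0 ($1 :+ #1 :* #2) (#0 :- $1 == #1 :* #2 by e ∷ []) [] refl)
  ... | dividesₛ -[1+ t ] e = let e′ = trans e (ℤ.*-comm -[1+ t ] (+ p)) ; n′ = +≤+ n≥1 ; p′ = +≤+ p≥1 ; t≥0 = +≤+ (z≤n {t})
                                  neg : -[1+ t ] ≡ - (1ℤ + + t)
                                  neg = refl
                                  e″ = trans e (cong (_* + p) neg)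
                              in ⊥-elim (lin⊥ (+ n ∷ + t ∷ + p ∷ []) (#0 :- $1 == :- ($1 :+ #1) :* #2 by e″ ∷ $1 <= #0 by n′ ∷ $1 <= #2 by p′ ∷ $0 <= #1 by t≥0 ∷ []) [] ((3 , 2) ∷ []) refl)

  edge : ∀ {p q r} → Prime p → p ℕ.< q → q ℕ.< r → p ≡ 2 ⊎ ((∃ λ h → + p ≡ 1ℤ + + 2 * + h) × + 4 ≤ + q × + 4 ≤ + r)
  edge {p} {q} {r} pp p<q q<r with 2 ∣? p
  ... | yes d = inj₁ ([ (λ ()) , sym ]′ (prime⇒irreducible pp d))
  ... | no ¬d = inj₂ (parity p ¬d , +≤+ q≥4 , +≤+ (ℕ.≤-trans q≥4 (ℕ.<⇒≤ q<r)))
    where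
    parity : ∀ n → ¬ (2 Div.∣ n) → ∃ λ h → + n ≡ 1ℤ + + 2 * + h
    parity zero h = ⊥-elim (h (divides 0 refl))
    parity (suc zero) h = 0 , refl
    parity (suc (suc n)) h = let k , e = parity n (λ { (divides t e) → h (divides (suc t) (cong (2 ℕ.+_) e)) }) in suc k , (lin≡ (+ n ∷ + k ∷ []) ($2 :+ #0) ($1 :+ $2 :* ($1 :+ #1)) (#0 == $1 :+ $2 :* #1 by e ∷ []) [] refl)
    p≥3 : ∀ p → 1 ℕ.< p → ¬ (2 Div.∣ p) → 3 ℕ.≤ p
    p≥3 (suc (suc zero)) _ h = ⊥-elim (h (divides 1 refl))
    p≥3 (suc (suc (suc p))) _ _ = s≤s (s≤s (s≤s z≤n))
    p≥3 (suc zero) (s≤s ()) _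
    q≥4 : 4 ℕ.≤ q
    q≥4 = ℕ.≤-trans (s≤s (p≥3 p (prime>1 pp) ¬d)) p<q

-- Choice of the base point and assembly of the bounds.

module Main where
  open import Data.Nat using (_⊓_; _⊔_)
  open import Data.Nat.Primality using (Prime; prime⇒nonZero)
  import Data.Integer.Divisibility as ℤDiv
  open import Data.Integer.Divisibility.Signed using (∣ᵤ⇒∣) renaming (divides to dividesₛ)
  open Lin
  open Sums
  open Coord
  open Frame using (mod-unique)
  open Semi
  open Top
  open Final

  Bounds : (p α β : ℕ) → ℤ → Set
  Bounds p α β x = ((x ≤ + (2 ℕ.* α ℕ.+ β)) × (x ≤ + p - + β) × (+ 3 * x ≤ + (2 ℕ.* p)))
    × ((- x ≤ + (p ℕ.+ 2 ℕ.* α) - + β) × (- x ≤ + β) × (+ 3 * (- x) ≤ + (2 ℕ.* p)))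

  private
    twice : ∀ n → + (2 ℕ.* n) ≡ + 2 * + n
    twice = ℤ.pos-* 2

  bounds-0 : ∀ {p α β} → β ℕ.≤ p → Bounds p α β 0ℤ
  bounds-0 {p} {α} {β} l = (+≤+ z≤n , pb , +≤+ z≤n) , (c , +≤+ z≤n , +≤+ z≤n)
    where
    l′ = +≤+ l
    a≥0 = +≤+ (z≤n {α})
    t = twice α
    pb : 0ℤ ≤ + p - + β
    pb = (lin≤ (+ p ∷ + β ∷ []) $0 (#0 :- #1) (#1 <= #0 by l′ ∷ []) [] [] refl)
    c : - 0ℤ ≤ + (p ℕ.+ 2 ℕ.* α) - + β
    c = (lin≤ (+ p ∷ + (2 ℕ.* α) ∷ + β ∷ + α ∷ []) (:- $0) (#0 :+ #1 :- #2) ($0 <= #3 by a≥0 ∷ #2 <= #0 by l′ ∷ #1 =~ $2 :* #3 by t ∷ []) (1 ∷ 2 ∷ []) [] refl)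

  module Flip {p q r : ℕ} (I : Inverses p q r) where
    open Coordinates I

    flip-x : ∀ x y k → g (- x) y (k - x) ≡ - g x y k
    flip-x x y k = trans (cong₂ _+_ (cong₂ _-_ (cong (λ z → χ (k - x) - χ z) (lin≡ (k ∷ x ∷ []) (#0 :- #1 :- :- #1) #0 [] [] refl)) refl) (cong χ (lin≡ (k ∷ x ∷ y ∷ []) (#0 :- #1 :- :- #1 :- #2) (#0 :- #2) [] [] refl)))
      (go (χ k) (χ (k - x)) (χ (k - y)) (χ (k - x - y)))
      where go : ∀ a b c d → b - a - d + c ≡ - (a - b - c + d)
            go a b c d = (lin≡ (b ∷ a ∷ d ∷ c ∷ []) (#0 :- #1 :- #2 :+ #3) (:- (#1 :- #0 :- #3 :+ #2)) [] [] refl)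
    flip-y : ∀ x y k → g x (- y) (k - y) ≡ - g x y k
    flip-y x y k = trans (cong₂ _+_ (cong₂ (λ u v → χ (k - y) - u - χ v) (cong χ (lin≡ (k ∷ y ∷ x ∷ []) (#0 :- #1 :- #2) (#0 :- #2 :- #1) [] [] refl)) (lin≡ (k ∷ y ∷ []) (#0 :- #1 :- :- #1) #0 [] [] refl)) (cong χ (lin≡ (k ∷ y ∷ x ∷ []) (#0 :- #1 :- #2 :- :- #1) (#0 :- #2) [] [] refl)))
      (go (χ k) (χ (k - x)) (χ (k - y)) (χ (k - x - y)))
      where go : ∀ a b c d → c - d - a + b ≡ - (a - b - c + d)
            go a b c d = (lin≡ (c ∷ d ∷ a ∷ b ∷ []) (#0 :- #1 :- #2 :+ #3) (:- (#2 :- #3 :- #0 :+ #1)) [] [] refl)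

    sum-x : ∀ x y n → sum {I = I} (- x) y (n - x) ≡ - sum {I = I} x y n
    sum-x x y n = trans (∑-cong p (λ i _ → trans (cong (g (- x) y) (ex n x (+ i))) (flip-x x y (n + + i)))) (∑-neg {λ i → g x y (n + + i)} p)
      where ex : ∀ n x i → n - x + i ≡ n + i - x
            ex n x i = (lin≡ (n ∷ x ∷ i ∷ []) (#0 :- #1 :+ #2) (#0 :+ #2 :- #1) [] [] refl)
    sum-y : ∀ x y n → sum {I = I} x (- y) (n - y) ≡ - sum {I = I} x y n
    sum-y x y n = trans (∑-cong p (λ i _ → trans (cong (g x (- y)) (ex n y (+ i))) (flip-y x y (n + + i)))) (∑-neg {λ i → g x y (n + + i)} p)
      where ex : ∀ n x i → n - x + i ≡ n + i - x
            ex n x i = (lin≡ (n ∷ x ∷ i ∷ []) (#0 :- #1 :+ #2) (#0 :+ #2 :- #1) [] [] refl)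

  product-inverse : ∀ {i j x y κ l n} → i * x ≡ 1ℤ + κ * n → j * y ≡ 1ℤ + l * n → i * j * (x * y) ≡ 1ℤ + (κ + l + κ * l * n) * n
  product-inverse {i} {j} {x} {y} {κ} {l} {n} h k = let a = cong (_* (j * y)) h ; b = cong ((1ℤ + κ * n) *_) k in
    (lin≡ (i ∷ j ∷ x ∷ y ∷ κ ∷ l ∷ n ∷ []) (#0 :* #1 :* (#2 :* #3)) ($1 :+ (#4 :+ #5 :+ #4 :* #5 :* #6) :* #6) (#0 :* #2 :* (#1 :* #3) == ($1 :+ #4 :* #6) :* (#1 :* #3) by a ∷ ($1 :+ #4 :* #6) :* (#1 :* #3) == ($1 :+ #4 :* #6) :* ($1 :+ #5 :* #6) by b ∷ []) [] refl)

  module Theorem (p q r : ℕ) (pp : Prime p) (pq : Prime q) (pr : Prime r) (p<q : p ℕ.< q) (q<r : q ℕ.< r) (v u : ℕ)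
    (v≥1 : 1 ℕ.≤ v) (v<p : v ℕ.< p) (hv : + p ℤDiv.∣ (+ (q ℕ.* v) - 1ℤ)) (u≥1 : 1 ℕ.≤ u) (u<p : u ℕ.< p) (hu : + p ℤDiv.∣ (+ (r ℕ.* u) - 1ℤ)) where

    private
      instance
        p≢0 : ℕ.NonZero p
        p≢0 = prime⇒nonZero pp
        q≢0 : ℕ.NonZero q
        q≢0 = prime⇒nonZero pq
        r≢0 : ℕ.NonZero r
        r≢0 = prime⇒nonZero pr
      1<p = prime>1 pp
      p≥1 = ℕ.<⇒≤ 1<p
      tv,ev = quotient≥0 {p} {q ℕ.* v} p≥1 (ℕ.*-mono-≤ (ℕ.<⇒≤ (prime>1 pq)) v≥1) hv
      tu,eu = quotient≥0 {p} {r ℕ.* u} p≥1 (ℕ.*-mono-≤ (ℕ.<⇒≤ (prime>1 pr)) u≥1) hu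
      tv tu : ℕ
      tv = proj₁ tv,ev
      tu = proj₁ tu,eu
      ev : + v * + q ≡ 1ℤ + + tv * + p
      ev = trans (ℤ.*-comm (+ v) (+ q)) (trans (sym (ℤ.pos-* q v)) (proj₂ tv,ev))
      eu : + u * + r ≡ 1ℤ + + tu * + p
      eu = trans (ℤ.*-comm (+ u) (+ r)) (trans (sym (ℤ.pos-* r u)) (proj₂ tu,eu))
      p≢q = ℕ.<⇒≢ p<q
      q≢r = ℕ.<⇒≢ q<r
      p≢r = ℕ.<⇒≢ (ℕ.<-trans p<q q<r)
      pq⁻ = inverse (primes-coprime pp pq p≢q)
      rq⁻ = inverse (primes-coprime pr pq (λ e → q≢r (sym e)))
      pr⁻ = inverse (primes-coprime pp pr p≢r)
      qr⁻ = inverse (primes-coprime pq pr q≢r)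

      kb kc : ℤ
      kb = proj₁ (proj₂ pq⁻) + proj₁ (proj₂ rq⁻) + proj₁ (proj₂ pq⁻) * proj₁ (proj₂ rq⁻) * + q
      kc = proj₁ (proj₂ pr⁻) + proj₁ (proj₂ qr⁻) + proj₁ (proj₂ pr⁻) * proj₁ (proj₂ qr⁻) * + r

    I : Inverses p q r
    I = record { ia = + v * + u ; ib = proj₁ pq⁻ * proj₁ rq⁻ ; ic = proj₁ pr⁻ * proj₁ qr⁻
      ; κa = + tv + + tu + + tv * + tu * + p ; κb = kb ; κc = kc ; ha = product-inverse {+ v} {+ u} {+ q} {+ r} {+ tv} {+ tu} {+ p} ev eu
      ; hb = product-inverse {proj₁ pq⁻} {proj₁ rq⁻} {+ p} {+ r} {proj₁ (proj₂ pq⁻)} {proj₁ (proj₂ rq⁻)} {+ q} (proj₂ (proj₂ pq⁻)) (proj₂ (proj₂ rq⁻))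
      ; hc = product-inverse {proj₁ pr⁻} {proj₁ qr⁻} {+ p} {+ q} {proj₁ (proj₂ pr⁻)} {proj₁ (proj₂ qr⁻)} {+ r} (proj₂ (proj₂ pr⁻)) (proj₂ (proj₂ qr⁻)) }

    open Coordinates I
    open Flip I

    private
      u⁻ v⁻ : ℕ
      u⁻ = p ∸ u
      v⁻ = p ∸ v
      u⁻+u : + u⁻ + + u ≡ + p
      u⁻+u = cong +_ (ℕ.m∸n+n≡m (ℕ.<⇒≤ u<p))
      v⁻+v : + v⁻ + + v ≡ + p
      v⁻+v = cong +_ (ℕ.m∸n+n≡m (ℕ.<⇒≤ v<p))
      t≤ : ∀ {s x t} → s ℕ.< p → + s * + x ≡ 1ℤ + + t * + p → t ℕ.≤ x
      t≤ {s} {x} {t} l e = case t ℕ.≤? x of λ where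
        (yes h) → h
        (no h) → ⊥-elim (let h = +≤+ (ℕ.≰⇒> h) ; l = +≤+ l ; x≥0 = +≤+ (z≤n {x}) ; P = +≤+ p≥1 ; s≥0 = +≤+ (z≤n {s}) in
          (lin⊥ (+ s ∷ + p ∷ + x ∷ + t ∷ []) ($1 :+ #0 <= #1 by l ∷ $1 :+ #2 <= #3 by h ∷ $1 <= #1 by P ∷ $0 <= #2 by x≥0 ∷ #0 :* #2 =~ $1 :+ #3 :* #1 by e ∷ []) (0 ∷ []) ((1 , 2) ∷ (0 , 3) ∷ []) refl))
      tu≤r = t≤ {u} {r} {tu} u<p eu
      tv≤q = t≤ {v} {q} {tv} v<p ev
      r-tu : + (r ∸ tu) + + tu ≡ + r
      r-tu = cong +_ (ℕ.m∸n+n≡m tu≤r)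
      q-tv : + (q ∸ tv) + + tv ≡ + q
      q-tv = cong +_ (ℕ.m∸n+n≡m tv≤q)

      plain : ∀ (s x t p Q R : ℤ) → s * x ≡ 1ℤ + t * p → R ≡ Q * x → s * R - Q ≡ t * (p * Q)
      plain s x t p Q R e f = let e = cong (_* Q) e ; f = cong (s *_) f in
        (lin≡ (s ∷ R ∷ Q ∷ t ∷ p ∷ x ∷ []) (#0 :* #1 :- #2) (#3 :* (#4 :* #2)) (#0 :* #5 :* #2 == ($1 :+ #3 :* #4) :* #2 by e ∷ #0 :* #1 == #0 :* (#2 :* #5) by f ∷ []) [] refl)
      -- For the complement `p - s` the relation `s x = 1 + t p` turns into
      -- `(p - s) x = - 1 + (x - t) p`.
      flipped : ∀ (s s⁻ x t t⁻ p Q R : ℤ) → s * x ≡ 1ℤ + t * p → R ≡ Q * x → s⁻ + s ≡ p → t⁻ + t ≡ x → s⁻ * R - - Q ≡ t⁻ * (p * Q)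
      flipped s s⁻ x t t⁻ p Q R e f a b = let e = cong (_* Q) e ; f = cong (s⁻ *_) f ; a′ = cong (λ z → z * Q * x) a ; b = cong (λ z → z * p * Q) b in
        (lin≡ (s⁻ ∷ R ∷ Q ∷ t⁻ ∷ p ∷ s ∷ x ∷ t ∷ []) (#0 :* #1 :- :- #2) (#3 :* (#4 :* #2)) (#5 :* #6 :* #2 =~ ($1 :+ #7 :* #4) :* #2 by e ∷ #0 :* #1 == #0 :* (#2 :* #6) by f ∷ (#0 :+ #5) :* #2 :* #6 == #4 :* #2 :* #6 by a′ ∷ (#3 :+ #7) :* #4 :* #2 =~ #6 :* #4 :* #2 by b ∷ []) [] refl)

      positive : ∀ {a} → a ℕ.< p → 1 ℕ.≤ p ∸ a
      positive = ℕ.m<n⇒0<n∸m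

      rq : M ≡ + r * + q
      rq = ℤ.*-comm (+ q) (+ r)
      U⁺ : + u * M - + q ≡ + tu * (+ p * + q)
      U⁺ = plain (+ u) (+ r) (+ tu) (+ p) (+ q) M eu refl
      U⁻ : + u⁻ * M - - + q ≡ + (r ∸ tu) * (+ p * + q)
      U⁻ = flipped (+ u) (+ u⁻) (+ r) (+ tu) (+ (r ∸ tu)) (+ p) (+ q) M eu refl u⁻+u r-tu
      V⁺ : + v * M - + r ≡ + tv * (+ p * + r)
      V⁺ = plain (+ v) (+ q) (+ tv) (+ p) (+ r) M ev rq
      V⁻ : + v⁻ * M - - + r ≡ + (q ∸ tv) * (+ p * + r)
      V⁻ = flipped (+ v) (+ v⁻) (+ q) (+ tv) (+ (q ∸ tv)) (+ p) (+ r) M ev rq v⁻+v q-tv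

      ia⁺⁺ : + v * + u ≡ + (u ℕ.* v) + 0ℤ * + p
      ia⁺⁺ = let a = ℤ.pos-* u v in (lin≡ (+ v ∷ + u ∷ + (u ℕ.* v) ∷ + p ∷ []) (#0 :* #1) (#2 :+ $0 :* #3) (#2 =~ #1 :* #0 by a ∷ []) [] refl)
      ia⁻⁻ : + v * + u ≡ + (u⁻ ℕ.* v⁻) + (+ u - + v⁻) * + p
      ia⁻⁻ = let a = ℤ.pos-* u⁻ v⁻ ; b = cong (_* + v⁻) u⁻+u ; c = cong (+ u *_) v⁻+v in
        (lin≡ (+ v ∷ + u ∷ + (u⁻ ℕ.* v⁻) ∷ + v⁻ ∷ + p ∷ + u⁻ ∷ []) (#0 :* #1) (#2 :+ (#1 :- #3) :* #4) (#2 =~ #5 :* #3 by a ∷ (#5 :+ #1) :* #3 =~ #4 :* #3 by b ∷ #1 :* (#3 :+ #0) == #1 :* #4 by c ∷ []) [] refl)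
      ia⁻⁺ : + v * + u ≡ - + (u⁻ ℕ.* v) + + v * + p
      ia⁻⁺ = let a = ℤ.pos-* u⁻ v ; b = cong (_* + v) u⁻+u in
        (lin≡ (+ v ∷ + u ∷ + (u⁻ ℕ.* v) ∷ + p ∷ + u⁻ ∷ []) (#0 :* #1) (:- #2 :+ #0 :* #3) (#2 == #4 :* #0 by a ∷ (#4 :+ #1) :* #0 == #3 :* #0 by b ∷ []) [] refl)
      ia⁺⁻ : + v * + u ≡ - + (u ℕ.* v⁻) + + u * + p
      ia⁺⁻ = let a = ℤ.pos-* u v⁻ ; c = cong (+ u *_) v⁻+v in
        (lin≡ (+ v ∷ + u ∷ + (u ℕ.* v⁻) ∷ + p ∷ + v⁻ ∷ []) (#0 :* #1) (:- #2 :+ #1 :* #3) (#2 == #1 :* #4 by a ∷ #1 :* (#4 :+ #0) == #1 :* #3 by c ∷ []) [] refl)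

      q≥0 : 0ℤ ≤ + q
      q≥0 = +≤+ z≤n
      r≥0 : 0ℤ ≤ + r
      r≥0 = +≤+ z≤n
      -q≤ : - + q ≤ + q
      -q≤ = (lin≤ (+ q ∷ []) (:- #0) #0 ($0 <= #0 by q≥0 ∷ []) (1 ∷ 2 ∷ []) [] refl)
      -r≤ : - + r ≤ + r
      -r≤ = (lin≤ (+ r ∷ []) (:- #0) #0 ($0 <= #0 by r≥0 ∷ []) (1 ∷ 2 ∷ []) [] refl)

    module At (n : ℤ) (n≥0 : 0ℤ ≤ n) (n<N : n < N) where
      n₀ : ℤ
      n₀ = n - + p + 1ℤ
      private
        n<′ = ℤ.i<j⇒suc[i]≤j n<N

      arms⁺⁺ : u ℕ.+ v ℕ.≤ p → Arms {I = I} u v (+ q) (+ r) n₀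
      arms⁺⁺ l = record { ez≥1 = u≥1 ; ey≥1 = v≥1 ; ez+ey≤p = l ; tz = tu ; ty = tv ; U≡ = U⁺ ; V≡ = V⁺ ; tz≤ = tu≤r ; ty≤ = tv≤q ; x≥ = -q≤ ; y≥ = -r≤ ; ia≡ = inj₁ (0ℤ , ia⁺⁺)
        ; lower = (lin≤ (+ p ∷ + q ∷ + r ∷ n ∷ []) (:- (#0 :+ #1 :+ #2)) (#3 :- #0 :+ $1) ($0 <= #3 by n≥0 ∷ $0 <= #1 by q≥0 ∷ $0 <= #2 by r≥0 ∷ []) [] [] refl) ; upper = (lin≤ (n ∷ + p ∷ N ∷ []) (#0 :- #1 :+ $1 :+ #1) #2 ($1 :+ #0 <= #2 by n<′ ∷ []) [] [] refl)
        ; upper-x = (lin≤ (n ∷ + p ∷ N ∷ + q ∷ []) (#0 :- #1 :+ $1 :+ #1) (#2 :+ #3) ($1 :+ #0 <= #2 by n<′ ∷ $0 <= #3 by q≥0 ∷ []) [] [] refl) ; upper-y = (lin≤ (n ∷ + p ∷ N ∷ + r ∷ []) (#0 :- #1 :+ $1 :+ #1) (#2 :+ #3) ($1 :+ #0 <= #2 by n<′ ∷ $0 <= #3 by r≥0 ∷ []) [] [] refl) }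
      -- The shift by both `q` and `r` is the extreme case for the field `lower`.
      arms⁻⁻ : u⁻ ℕ.+ v⁻ ℕ.≤ p → Arms {I = I} u⁻ v⁻ (- + q) (- + r) (n₀ - + r - + q)
      arms⁻⁻ l = record { ez≥1 = positive u<p ; ey≥1 = positive v<p ; ez+ey≤p = l ; tz = r ∸ tu ; ty = q ∸ tv ; U≡ = U⁻ ; V≡ = V⁻ ; tz≤ = ℕ.m∸n≤m r tu ; ty≤ = ℕ.m∸n≤m q tv ; x≥ = ≤-refl ; y≥ = ≤-refl
        ; ia≡ = inj₁ (+ u - + v⁻ , ia⁻⁻)
        ; lower = (lin≤ (+ p ∷ + q ∷ + r ∷ n ∷ []) (:- (#0 :+ #1 :+ #2)) (#3 :- #0 :+ $1 :- #2 :- #1) ($0 <= #3 by n≥0 ∷ []) [] [] refl) ; upper = (lin≤ (n ∷ + p ∷ + r ∷ + q ∷ N ∷ []) (#0 :- #1 :+ $1 :- #2 :- #3 :+ #1) #4 ($1 :+ #0 <= #4 by n<′ ∷ $0 <= #3 by q≥0 ∷ $0 <= #2 by r≥0 ∷ []) [] [] refl)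
        ; upper-x = (lin≤ (n ∷ + p ∷ + r ∷ + q ∷ N ∷ []) (#0 :- #1 :+ $1 :- #2 :- #3 :+ #1) (#4 :+ :- #3) ($1 :+ #0 <= #4 by n<′ ∷ $0 <= #2 by r≥0 ∷ []) [] [] refl) ; upper-y = (lin≤ (n ∷ + p ∷ + r ∷ + q ∷ N ∷ []) (#0 :- #1 :+ $1 :- #2 :- #3 :+ #1) (#4 :+ :- #2) ($1 :+ #0 <= #4 by n<′ ∷ $0 <= #3 by q≥0 ∷ []) [] [] refl) }
      arms⁻⁺ : u⁻ ℕ.+ v ℕ.≤ p → Arms {I = I} u⁻ v (- + q) (+ r) (n₀ - + q)
      arms⁻⁺ l = record { ez≥1 = positive u<p ; ey≥1 = v≥1 ; ez+ey≤p = l ; tz = r ∸ tu ; ty = tv ; U≡ = U⁻ ; V≡ = V⁺ ; tz≤ = ℕ.m∸n≤m r tu ; ty≤ = tv≤q ; x≥ = ≤-refl ; y≥ = -r≤ ; ia≡ = inj₂ (+ v , ia⁻⁺)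
        ; lower = (lin≤ (+ p ∷ + q ∷ + r ∷ n ∷ []) (:- (#0 :+ #1 :+ #2)) (#3 :- #0 :+ $1 :- #1) ($0 <= #3 by n≥0 ∷ $0 <= #2 by r≥0 ∷ []) [] [] refl) ; upper = (lin≤ (n ∷ + p ∷ + q ∷ N ∷ []) (#0 :- #1 :+ $1 :- #2 :+ #1) #3 ($1 :+ #0 <= #3 by n<′ ∷ $0 <= #2 by q≥0 ∷ []) [] [] refl)
        ; upper-x = (lin≤ (n ∷ + p ∷ + q ∷ N ∷ []) (#0 :- #1 :+ $1 :- #2 :+ #1) (#3 :+ :- #2) ($1 :+ #0 <= #3 by n<′ ∷ []) [] [] refl) ; upper-y = (lin≤ (n ∷ + p ∷ + q ∷ N ∷ + r ∷ []) (#0 :- #1 :+ $1 :- #2 :+ #1) (#3 :+ #4) ($1 :+ #0 <= #3 by n<′ ∷ $0 <= #2 by q≥0 ∷ $0 <= #4 by r≥0 ∷ []) [] [] refl) }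
      arms⁺⁻ : u ℕ.+ v⁻ ℕ.≤ p → Arms {I = I} u v⁻ (+ q) (- + r) (n₀ - + r)
      arms⁺⁻ l = record { ez≥1 = u≥1 ; ey≥1 = positive v<p ; ez+ey≤p = l ; tz = tu ; ty = q ∸ tv ; U≡ = U⁺ ; V≡ = V⁻ ; tz≤ = tu≤r ; ty≤ = ℕ.m∸n≤m q tv ; x≥ = -q≤ ; y≥ = ≤-refl ; ia≡ = inj₂ (+ u , ia⁺⁻)
        ; lower = (lin≤ (+ p ∷ + q ∷ + r ∷ n ∷ []) (:- (#0 :+ #1 :+ #2)) (#3 :- #0 :+ $1 :- #2) ($0 <= #3 by n≥0 ∷ $0 <= #1 by q≥0 ∷ []) [] [] refl) ; upper = (lin≤ (n ∷ + p ∷ + r ∷ N ∷ []) (#0 :- #1 :+ $1 :- #2 :+ #1) #3 ($1 :+ #0 <= #3 by n<′ ∷ $0 <= #2 by r≥0 ∷ []) [] [] refl)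
        ; upper-x = (lin≤ (n ∷ + p ∷ + r ∷ N ∷ + q ∷ []) (#0 :- #1 :+ $1 :- #2 :+ #1) (#3 :+ #4) ($1 :+ #0 <= #3 by n<′ ∷ $0 <= #4 by q≥0 ∷ $0 <= #2 by r≥0 ∷ []) [] [] refl) ; upper-y = (lin≤ (n ∷ + p ∷ + r ∷ N ∷ []) (#0 :- #1 :+ $1 :- #2 :+ #1) (#3 :+ :- #2) ($1 :+ #0 <= #3 by n<′ ∷ []) [] [] refl) }

    module Beta (β : ℕ) (β<p : β ℕ.< p) (hβ : + p ℤDiv.∣ (+ (((v ⊓ (p ∸ v)) ⊓ (u ⊓ (p ∸ u))) ℕ.* β ℕ.* q ℕ.* r) - 1ℤ)) where
      α : ℕ
      α = (v ⊓ (p ∸ v)) ⊓ (u ⊓ (p ∸ u))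
      private
        β-inverse : ∃ λ κ → + α * + β * M ≡ 1ℤ + κ * + p
        β-inverse with ∣ᵤ⇒∣ {+ p} {+ (α ℕ.* β ℕ.* q ℕ.* r) - 1ℤ} hβ
        ... | dividesₛ κ e = κ , let a = ℤ.pos-* (α ℕ.* β ℕ.* q) r ; b = cong (_* + r) (ℤ.pos-* (α ℕ.* β) q) ; c = cong (λ z → z * + q * + r) (ℤ.pos-* α β) in
          (lin≡ (+ α ∷ + β ∷ + q ∷ + r ∷ κ ∷ + p ∷ + (α ℕ.* β ℕ.* q ℕ.* r) ∷ + (α ℕ.* β ℕ.* q) ∷ + (α ℕ.* β) ∷ []) (#0 :* #1 :* (#2 :* #3)) ($1 :+ #4 :* #5) (#6 :- $1 == #4 :* #5 by e ∷ #6 =~ #7 :* #3 by a ∷ #7 :* #3 =~ #8 :* #2 :* #3 by b ∷ #8 :* #2 :* #3 =~ #0 :* #1 :* #2 :* #3 by c ∷ []) [] refl)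

        low : ∀ {a b} → a ℕ.< p → b ℕ.< p → a ⊔ b ℕ.< p
        low = ℕ.⊔-pres-<m
        split : ∀ {a b} → α ≡ a ⊓ b → + (a ℕ.* b) ≡ + α * + (a ⊔ b)
        split {a} {b} h = trans (cong +_ (sym (⊓*⊔ a b))) (trans (ℤ.pos-* (a ⊓ b) (a ⊔ b)) (cong (λ z → + z * + (a ⊔ b)) (sym h)))

      β⁺ : ∀ {a b κ} → α ≡ a ⊓ b → a ⊔ b ℕ.< p → + v * + u ≡ + (a ℕ.* b) + κ * + p → a ⊔ b ≡ β
      β⁺ {a} {b} {κ} h l e = sym (mod-unique K β<p l (trans (β-mod {+ p} {M} {+ v * + u} {+ α} {+ β} {+ (a ⊔ b)} {κ} {Inverses.κa I} {proj₁ β-inverse} 1ℤ (Inverses.ha I)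
        (trans e (cong (_+ κ * + p) (trans (split h) (sym (ℤ.*-identityˡ _))))) (proj₂ β-inverse)) (cong (λ z → z + K * + p) (ℤ.*-identityˡ (+ (a ⊔ b))))))
        where K = 1ℤ * proj₁ β-inverse * + (a ⊔ b) + + β * κ * M - + β * Inverses.κa I
      β⁻ : ∀ {a b κ} → α ≡ a ⊓ b → 1 ℕ.≤ a ⊔ b → a ⊔ b ℕ.< p → + v * + u ≡ - + (a ℕ.* b) + κ * + p → a ⊔ b ≡ p ∸ β
      β⁻ {a} {b} {κ} h l≥ l e = trans (sym (ℕ.m∸[m∸n]≡n (ℕ.<⇒≤ l))) (cong (p ∸_) (sym (mod-unique (K - 1ℤ) β<p (ℕ.∸-monoʳ-< {p} {a ⊔ b} {0} l≥ (ℕ.<⇒≤ l)) (let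
          f = β-mod {+ p} {M} {+ v * + u} {+ α} {+ β} {+ (a ⊔ b)} {κ} {Inverses.κa I} {proj₁ β-inverse} (- 1ℤ) (Inverses.ha I)
                (trans e (cong (_+ κ * + p) (trans (cong -_ (split h)) (sym (ℤ.-1*i≡-i _))))) (proj₂ β-inverse)
          g = cong +_ (ℕ.m∸n+n≡m (ℕ.<⇒≤ l)) in
        (lin≡ (+ β ∷ + (p ∸ (a ⊔ b)) ∷ K ∷ + p ∷ + (a ⊔ b) ∷ []) #0 (#1 :+ (#2 :- $1) :* #3) (#0 == :- $1 :* #4 :+ #2 :* #3 by f ∷ #1 :+ #4 =~ #3 by g ∷ []) [] refl)))))
        where K = - 1ℤ * proj₁ β-inverse * + (a ⊔ b) + + β * κ * M - + β * Inverses.κa I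

      private
        p≥2 : + 2 ≤ + p
        p≥2 = +≤+ 1<p
        q≥2 : + 2 ≤ + q
        q≥2 = +≤+ (prime>1 pq)
        r≥2 : + 2 ≤ + r
        r≥2 = +≤+ (prime>1 pr)
        edg = edge pp p<q q<r
        u⁻<p : u⁻ ℕ.< p
        u⁻<p = ℕ.∸-monoʳ-< {p} {u} {0} u≥1 (ℕ.<⇒≤ u<p)
        v⁻<p : v⁻ ℕ.< p
        v⁻<p = ℕ.∸-monoʳ-< {p} {v} {0} v≥1 (ℕ.<⇒≤ v<p)
        Upper : ℕ → ℤ → Set
        Upper w x = x ≤ + p - + w × x ≤ + 2 * + α + + w × + 3 * x ≤ + 2 * + p
        to : ∀ {a b w x y} → α ≡ a ⊓ b → a ⊔ b ≡ w → y ≡ x → y ≤ + p - + (a ⊔ b) × y ≤ + 2 * + (a ⊓ b) + + (a ⊔ b) × + 3 * y ≤ + 2 * + p → Upper w x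
        to {a} {b} {x = x} h refl refl (i , j , k) = i , subst (λ z → x ≤ + 2 * + z + + (a ⊔ b)) (sym h) j , k

      -- One of the pairs `(u , v)` and `(p - u , p - v)` has sum at most `p`. Both have the same
      -- product modulo `p`, so the larger entry is β; the two sign changes of the double shift
      -- cancel.
      upper⁺ : ∀ n → 0ℤ ≤ n → n < N → Upper β (sum {I = I} (+ q) (+ r) (n - + p + 1ℤ))
      upper⁺ n n≥0 n<N = case u ℕ.+ v ℕ.≤? p of λ where
          (yes l) → let h = near-min {p} {u} {v} l in to {u} {v} h (β⁺ {u} {v} {0ℤ} h (low u<p v<p) ia⁺⁺) refl (arms-bounds {I = I} p≥2 q≥2 r≥2 edg (arms⁺⁺ l))
          (no n) → let l = far (ℕ.≰⇒> n) ; h = trans (cong₂ _⊓_ (sym (flip-min (ℕ.<⇒≤ v<p))) (sym (flip-min (ℕ.<⇒≤ u<p)))) (near-min {p} {u⁻} {v⁻} l) in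
            to {u⁻} {v⁻} h (β⁺ {u⁻} {v⁻} {+ u - + v⁻} h (low u⁻<p v⁻<p) ia⁻⁻) both (arms-bounds {I = I} p≥2 q≥2 r≥2 edg (arms⁻⁻ l))
        where
        open At n n≥0 n<N
        far : p ℕ.< u ℕ.+ v → u⁻ ℕ.+ v⁻ ℕ.≤ p
        far l = let l = +≤+ l ; a = u⁻+u ; b = v⁻+v in ℤ.drop‿+≤+ (lin≤ (+ u⁻ ∷ + v⁻ ∷ + p ∷ + u ∷ + v ∷ []) (#0 :+ #1) #2 ($1 :+ #2 <= #3 :+ #4 by l ∷ #0 :+ #3 == #2 by a ∷ #1 :+ #4 == #2 by b ∷ []) [] [] refl)
        both : sum {I = I} (- + q) (- + r) (n₀ - + r - + q) ≡ sum {I = I} (+ q) (+ r) n₀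
        both = trans (sum-x (+ q) (- + r) (n₀ - + r)) (trans (cong -_ (sum-y (+ q) (+ r) n₀)) (ℤ.neg-involutive _))

      -- Complementing one inverse changes the sign of the sum and of the product, so the larger
      -- entry is `p - β`. Which of the two to complement is decided by the condition that the
      -- entries add up to at most `p`.
      upper⁻ : ∀ n → 0ℤ ≤ n → n < N → Upper (p ∸ β) (- sum {I = I} (+ q) (+ r) (n - + p + 1ℤ))
      upper⁻ n n≥0 n<N = case ℕ.≤-total v u of λ where
          (inj₁ v≤u) → let l = ℕ.≤-trans (ℕ.+-monoʳ-≤ u⁻ v≤u) (ℕ.≤-reflexive (ℤ.+-injective u⁻+u))
                           h = trans (cong (λ z → (v ⊓ (p ∸ v)) ⊓ z) (sym (flip-min (ℕ.<⇒≤ u<p)))) (near-min {p} {u⁻} {v} l) in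
            to {u⁻} {v} h (β⁻ {u⁻} {v} {+ v} h (ℕ.≤-trans v≥1 (ℕ.m≤n⊔m u⁻ v)) (low u⁻<p v<p) ia⁻⁺) (sum-x (+ q) (+ r) n₀) (arms-bounds {I = I} p≥2 q≥2 r≥2 edg (arms⁻⁺ l))
          (inj₂ u≤v) → let l = ℕ.≤-trans (ℕ.+-monoˡ-≤ v⁻ u≤v) (ℕ.≤-reflexive (trans (ℕ.+-comm v v⁻) (ℤ.+-injective v⁻+v)))
                           h = trans (cong (λ z → z ⊓ (u ⊓ (p ∸ u))) (sym (flip-min (ℕ.<⇒≤ v<p)))) (near-min {p} {u} {v⁻} l) in
            to {u} {v⁻} h (β⁻ {u} {v⁻} {+ u} h (ℕ.≤-trans u≥1 (ℕ.m≤m⊔n u v⁻)) (low u<p v⁻<p) ia⁺⁻) (sum-y (+ q) (+ r) n₀) (arms-bounds {I = I} p≥2 q≥2 r≥2 edg (arms⁺⁻ l))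
        where open At n n≥0 n<N

      bounds : ∀ i → Bounds p α β (a (p ℕ.* q ℕ.* r) i)
      bounds i = [ (λ e → subst (Bounds p α β) (sym e) (bounds-0 {p} {α} (ℕ.<⇒≤ β<p)))
                 , (λ (n , n≥0 , n<N , e) → subst (Bounds p α β) (sym e) (assemble (upper⁺ n n≥0 n<N) (upper⁻ n n≥0 n<N))) ]′ (a-formula pp pq pr p<q q<r I i)
        where
        assemble : ∀ {x} → Upper β x → Upper (p ∸ β) (- x) → Bounds p α β x
        assemble {x} (b₁ , b₂ , b₃) (c₁ , c₂ , c₃) = ((lin≤ (x ∷ + (2 ℕ.* α) ∷ + β ∷ + α ∷ []) #0 (#1 :+ #2) (#0 <= $2 :* #3 :+ #2 by b₂ ∷ #1 =~ $2 :* #3 by ta ∷ []) [] [] refl) , b₁ , ≤-trans b₃ (≤-reflexive (sym (twice p)))) ,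
          ((lin≤ (x ∷ + p ∷ + (2 ℕ.* α) ∷ + β ∷ + α ∷ + (p ∸ β) ∷ []) (:- #0) (#1 :+ #2 :- #3) (:- #0 <= $2 :* #4 :+ #5 by c₂ ∷ #5 :+ #3 == #1 by pb ∷ #2 =~ $2 :* #4 by ta ∷ []) [] [] refl)
           , (lin≤ (x ∷ + β ∷ + p ∷ + (p ∸ β) ∷ []) (:- #0) #1 (:- #0 <= #2 :- #3 by c₁ ∷ #3 :+ #1 =~ #2 by pb ∷ []) [] [] refl) , ≤-trans c₃ (≤-reflexive (sym (twice p))))
          where
          ta = twice α
          pb = cong +_ (ℕ.m∸n+n≡m (ℕ.<⇒≤ β<p))

theorem4p1 : (p q r : ℕ) → Prime p → Prime q → Prime r → p ℕ.< q → q ℕ.< r →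
  (qs rs : ℕ) →
  1 ℕ.≤ qs → qs ℕ.≤ p ∸ 1 → (+ p) ∣ (+ (q ℕ.* qs) - 1ℤ) →
  1 ℕ.≤ rs → rs ℕ.≤ p ∸ 1 → (+ p) ∣ (+ (r ℕ.* rs) - 1ℤ) →
  (β : ℕ) → 0 ℕ.< β → β ℕ.≤ p ∸ 1 →
  (+ p) ∣ (+ (((qs ⊓ (p ∸ qs)) ⊓ (rs ⊓ (p ∸ rs))) ℕ.* β ℕ.* q ℕ.* r) - 1ℤ) →
  (i : ℤ) →
    ((a (p ℕ.* q ℕ.* r) i ℤ.≤ + (2 ℕ.* ((qs ⊓ (p ∸ qs)) ⊓ (rs ⊓ (p ∸ rs))) ℕ.+ β))
      × (a (p ℕ.* q ℕ.* r) i ℤ.≤ + p - + β)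
      × (+ 3 ℤ.* a (p ℕ.* q ℕ.* r) i ℤ.≤ + (2 ℕ.* p)))
    × ((- a (p ℕ.* q ℕ.* r) i ℤ.≤ + (p ℕ.+ 2 ℕ.* ((qs ⊓ (p ∸ qs)) ⊓ (rs ⊓ (p ∸ rs)))) - + β)
      × (- a (p ℕ.* q ℕ.* r) i ℤ.≤ + β)
      × (+ 3 ℤ.* (- a (p ℕ.* q ℕ.* r) i) ℤ.≤ + (2 ℕ.* p)))
theorem4p1 p q r pp pq pr p<q q<r qs rs qs≥1 qs≤ hq rs≥1 rs≤ hr β _ β≤ hβ =
  Main.Theorem.Beta.bounds p q r pp pq pr p<q q<r qs rs qs≥1 (below qs≤) hq rs≥1 (below rs≤) hr β (below β≤) hβ
  where
  below : ∀ {x} → x ℕ.≤ p ∸ 1 → x ℕ.< p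
  below l = ℕ.≤-<-trans l (ℕ.∸-monoʳ-< {p} {1} {0} (s≤s z≤n) (ℕ.<⇒≤ (Semi.prime>1 pp)))
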